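{- Let $F=F(s,u,v,t_1,t_2,\dots)$ be the generating function defined in the context, and define the operators $$L_1F=\sum_{i=2}^\infty (i-1)t_i\frac{\partial F}{\partial t_{i-1}},\qquad M_1F=\sum_{i=2}^\infty\sum_{j=1}^{i-1}\Big((i-1)t_jt_{i-j}\frac{\partial F}{\partial t_{i-1}}+j(i-j)t_{i+1}\frac{\partial^2F}{\partial t_j\partial t_{i-j}}\Big),$$ $$Q_1F=\sum_{i=2}^\infty\sum_{j=1}^{i-1} j(i-j)t_{i+1}\frac{\partial F}{\partial t_j}\cdot\frac{\partial F}{\partial t_{i-j}}.$$ Then $F$ satisfies $$\frac{\partial F}{\partial s}=\big((u+v)L_1+M_1+Q_1\big)F+uvt_1,$$ and $F$ is the unique formal power series solution of this equation with $F|_{s=0}=0$. Equivalently, the partition function $Z=e^F$ is given by $$Z(s,u,v,t_1,t_2,\dots)=e^{s((u+v)L_1+M_1+uvt_1)}\,1,$$ where $1$ is the constant function $1$ and $uvt_1$ acts as a multiplication operator.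
   Context: A Belyi graph is a connected graph $\Gamma$ in which every vertex is colored white or black, every edge joins a white vertex to a black vertex, and every edge is colored blue, green or red so that each vertex is incident to exactly one edge of each color. $\Gamma$ carries the ribbon graph structure given by the counterclockwise cyclic order blue–green–red at white vertices and red–green–blue at black vertices. Automorphisms of $\Gamma$ are graph automorphisms preserving the colors of vertices and edges. The degree $d$ of $\Gamma$ is its number of green edges. The type of $\Gamma$ is the triple $(k,l;\mathbf m)$, $\mathbf m=(m_1,m_2,\dots)$, where $k$ is the number of red–green cycles of $\Gamma$, $l$ is the number of green–blue cycles, and $m_i$ is the number of red–blue cycles of length $2i$ (consisting of $i$ red and $i$ blue edges); then $\sum_i im_i=d$ and the genus $g$ of the ribbon graph satisfies $2g-2=d-(k+l+\sum_im_i)$. (Equivalently, for the corresponding Belyi pair $(C,f)$: $k=|f^{ -1}(0)|$, $l=|f^{ -1}(1)|$, $m_i$ is the number of poles of $f$ of order $i$.) Let $\mathcal B_{k,l;\mathbf m}$ be the set of isomorphism classes of Belyi graphs of type $(k,l;\mathbf m)$ and $$\mathcal N_{k,l}(\mathbf m)=\sum_{\Gamma\in\mathcal B_{k,l;\mathbf m}}\frac{1}{|\mathrm{Aut}(\Gamma)|}.$$ The generating function is the formal power series $$F(s,u,v,t_1,t_2,\dots)=\sum_{d\ge1}s^d\sum_{k,l\ge1}\ \sum_{\mathbf m:\ \sum_i im_i=d}\mathcal N_{k,l}(\mathbf m)\,u^kv^l\,t_1^{m_1}t_2^{m_2}\cdots.$$ -}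

module Defs where

open import Data.Bool.Base using (if_then_else_)
open import Data.Fin.Base as Fin using (Fin; zero; suc)
import Data.Fin.Properties as Fin
open import Data.Integer.Base using (+_)
open import Data.List.Base using
  ( List; []; _∷_; [_]; _++_; map; filter; deduplicate; length; foldr; lookup; allFin
  ; upTo; applyUpTo; cartesianProduct; cartesianProductWith )
open import Data.List.Membership.Propositional using (_∈_; find; lose)
open import Data.List.Membership.Propositional.Properties using
  ( ∈-allFin; ∈-filter⁺; ∈-filter⁻; ∈-++⁺ˡ; ∈-++⁺ʳ; ∈-map⁺; ∈-map⁻
  ; ∈-cartesianProduct⁺; ∈-cartesianProduct⁻; ∈-cartesianProductWith⁻; ∈-upTo⁻; ∈-lookup )
open import Data.List.Properties using (filter-some)
open import Data.List.Relation.Unary.All as All using (All; []; _∷_)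
open import Data.List.Relation.Unary.Any as Any using (Any; here; there)
import Data.List.Relation.Unary.Any.Properties as Any
open import Data.List.Relation.Unary.AllPairs using ([]; _∷_)
open import Data.List.Relation.Unary.Unique.Propositional using (Unique)
import Data.List.Relation.Unary.Unique.Propositional.Properties as Unique
open import Data.Maybe.Base using (Maybe; nothing; just)
import Data.Maybe.Properties as Maybe
open import Data.Nat.Base as ℕ using (ℕ; zero; suc; pred; _+_; _*_; _∸_; _≤_; _<_; z≤n; s≤s; NonZero; _!)
import Data.Nat.Properties as ℕ
open import Data.Product.Base using (∃; _×_; _,_; proj₁; proj₂)
open import Data.Product using (∃!)
import Data.Product.Properties as Product
open import Data.Rational.Base as ℚ using (ℚ; 0ℚ; 1ℚ; _/_)
import Data.Rational.Properties as ℚ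
open import Data.Sum.Base using (_⊎_; inj₁; inj₂)
import Data.Sum.Properties as Sum
import Data.Vec.Functional as Vector
open import Level using (0ℓ)
open import Function.Base using (id; _∘_)
open import Function.Definitions using (Bijective)
open import Relation.Binary.Construct.Closure.Equivalence as EqClosure using (EqClosure)
open import Relation.Binary.Construct.Closure.ReflexiveTransitive using (ε; _◅_; _◅◅_)
open import Relation.Binary.Construct.Closure.Symmetric using (fwd; bwd)
open import Relation.Binary.Core using (Rel)
open import Relation.Binary.Definitions using (Decidable; DecidableEquality)
open import Relation.Binary.PropositionalEquality
  using (_≡_; refl; sym; trans; cong; cong₂; subst; _≗_)
open import Relation.Nullary.Decidable using (Dec; yes; no; map′; _×-dec_; _⊎-dec_; _→-dec_)
open import Relation.Nullary.Negation using (contradiction)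
import Relation.Unary as Unary

-- Floyd–Warshall over a list exhausting A.

module _ {A : Set} (_≟_ : DecidableEquality A) {R : Rel A 0ℓ} (R? : Decidable R) where

  private
    Via : List A → Rel A 0ℓ
    Via []       x y = x ≡ y ⊎ R x y ⊎ R y x
    Via (z ∷ zs) x y = Via zs x y ⊎ Via zs x z × Via zs z y

    via? : ∀ zs → Decidable (Via zs)
    via? []       x y = x ≟ y ⊎-dec R? x y ⊎-dec R? y x
    via? (z ∷ zs) x y = via? zs x y ⊎-dec (via? zs x z ×-dec via? zs z y)

    via-base : ∀ zs {x y} → Via [] x y → Via zs x y
    via-base []       p = p
    via-base (_ ∷ zs) p = inj₁ (via-base zs p)

    sound : ∀ zs {x y} → Via zs x y → EqClosure R x y
    sound []       (inj₁ refl)       = ε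
    sound []       (inj₂ (inj₁ r))   = fwd r ◅ ε
    sound []       (inj₂ (inj₂ r))   = bwd r ◅ ε
    sound (_ ∷ zs) (inj₁ p)          = sound zs p
    sound (_ ∷ zs) (inj₂ (p , q))    = sound zs p ◅◅ sound zs q

    join : ∀ zs {x y w} → y ∈ zs → Via zs x y → Via zs y w → Via zs x w
    join (_ ∷ zs) (here refl) p q = inj₂ (left p , right q)
      where
      left : ∀ {x y} → Via zs x y ⊎ Via zs x y × Via zs y y → Via zs x y
      left (inj₁ p)       = p
      left (inj₂ (p , _)) = p
      right : ∀ {y w} → Via zs y w ⊎ Via zs y y × Via zs y w → Via zs y w
      right (inj₁ q)       = q
      right (inj₂ (_ , q)) = q
    join (_ ∷ zs) (there i) (inj₁ p)        (inj₁ q)         = inj₁ (join zs i p q)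
    join (_ ∷ zs) (there i) (inj₁ p)        (inj₂ (q , q′))  = inj₂ (join zs i p q , q′)
    join (_ ∷ zs) (there i) (inj₂ (p , p′)) (inj₁ q)         = inj₂ (p , join zs i p′ q)
    join (_ ∷ zs) (there i) (inj₂ (p , _))  (inj₂ (_ , q′))  = inj₂ (p , q′)

    complete : ∀ zs → (∀ z → z ∈ zs) → ∀ {x y} → EqClosure R x y → Via zs x y
    complete zs all ε            = via-base zs (inj₁ refl)
    complete zs all (fwd r ◅ rs) =
      join zs (all _) (via-base zs (inj₂ (inj₁ r))) (complete zs all rs)
    complete zs all (bwd r ◅ rs) =
      join zs (all _) (via-base zs (inj₂ (inj₂ r))) (complete zs all rs)

  eqClosure? : ∀ zs → (∀ z → z ∈ zs) → Decidable (EqClosure R)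
  eqClosure? zs all x y = map′ (sound zs) (complete zs all) (via? zs x y)

∃!? : ∀ {n} {P : Fin n → Set} → Unary.Decidable P → Dec (∃! _≡_ P)
∃!? P? = map′ (λ (x , px , u) → x , px , λ {y} → u y) (λ (x , px , u) → x , px , λ _ → u)
  (Fin.any? λ x → P? x ×-dec Fin.all? λ y → P? y →-dec (x Fin.≟ y))

bijective? : ∀ {m n} (f : Fin m → Fin n) → Dec (Bijective _≡_ _≡_ f)
bijective? f = map′
  (λ (i , o) → (λ {x} {y} → i x y) , λ y → proj₁ (o y) , λ { refl → proj₂ (o y) })
  (λ (i , o) → (λ _ _ → i) , λ y → proj₁ (o y) , proj₂ (o y) refl)
  (Fin.all? (λ x → Fin.all? λ y → (f x Fin.≟ f y) →-dec (x Fin.≟ y))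
    ×-dec Fin.all? (λ y → Fin.any? λ x → f x Fin.≟ y))

functions : ∀ {A : Set} m → List A → List (Fin m → A)
functions zero    xs = [ Vector.[] ]
functions (suc m) xs = cartesianProductWith Vector._∷_ xs (functions m xs)

functions-complete : ∀ {A : Set} m {xs : List A} (f : Fin m → A) → (∀ i → f i ∈ xs) →
                     Any (f ≗_) (functions m xs)
functions-complete zero    f _   = here λ ()
functions-complete (suc m) f f∈ = Any.cartesianProductWith⁺ Vector._∷_ extend
  (f∈ zero) (functions-complete m (f ∘ suc) (f∈ ∘ suc))
  where
  extend : ∀ {x g} → f zero ≡ x → f ∘ suc ≗ g → f ≗ x Vector.∷ g
  extend p q zero    = p
  extend p q (suc i) = q i

-- Finitely supported sequences (m₁ , m₂ , …) of natural numbers, each having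
-- exactly one representation: nothing is the zero sequence, and Exponents⁺
-- lists the entries up to the last nonzero one.

data Exponents⁺ : Set where
  [1+_] : ℕ → Exponents⁺
  _∷_   : ℕ → Exponents⁺ → Exponents⁺

infixr 5 _∷_

Exponents : Set
Exponents = Maybe Exponents⁺

infixr 5 _◂_

_◂_ : ℕ → Exponents → Exponents
zero  ◂ nothing = nothing
suc n ◂ nothing = just [1+ n ]
n     ◂ just m  = just (n ∷ m)

head : Exponents → ℕ
head nothing         = 0
head (just [1+ n ])  = suc n
head (just (n ∷ _))  = n

tail : Exponents → Exponents
tail nothing        = nothing
tail (just [1+ _ ]) = nothing
tail (just (_ ∷ m)) = just m

-- Positions count from 0: at m i is the entry m_{1+i}.

at : Exponents → ℕ → ℕ
at m zero    = head m
at m (suc i) = at (tail m) i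

adjustAt : (ℕ → ℕ) → ℕ → Exponents → Exponents
adjustAt f zero    m = f (head m) ◂ tail m
adjustAt f (suc i) m = head m ◂ adjustAt f i (tail m)

size⁺ : Exponents⁺ → ℕ
size⁺ [1+ _ ] = 1
size⁺ (_ ∷ m) = suc (size⁺ m)

size : Exponents → ℕ
size nothing  = 0
size (just m) = size⁺ m

tabulate : ℕ → (ℕ → ℕ) → Exponents
tabulate zero    f = nothing
tabulate (suc n) f = f 0 ◂ tabulate n (f ∘ suc)

weight : Exponents → ℕ
weight m = foldr _+_ 0 (applyUpTo (λ i → suc i * at m i) (size m))

_≟⁺_ : DecidableEquality Exponents⁺
[1+ a ] ≟⁺ [1+ b ] = map′ (cong [1+_]) (λ { refl → refl }) (a ℕ.≟ b)
[1+ _ ] ≟⁺ (_ ∷ _) = no λ ()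
(_ ∷ _) ≟⁺ [1+ _ ] = no λ ()
(a ∷ m) ≟⁺ (b ∷ n) =
  map′ (λ (p , q) → cong₂ _∷_ p q) (λ { refl → refl , refl }) ((a ℕ.≟ b) ×-dec (m ≟⁺ n))

at-size : ∀ m {i} → size m ≤ i → at m i ≡ 0
at-size nothing        {zero}  _       = refl
at-size nothing        {suc i} _       = at-size nothing {i} z≤n
at-size (just [1+ _ ]) {suc i} _       = at-size nothing {i} z≤n
at-size (just (_ ∷ m)) {suc i} (s≤s p) = at-size (just m) p

data EdgeColour : Set where
  blue green red : EdgeColour

colours : List EdgeColour
colours = blue ∷ green ∷ red ∷ []

∈-colours : ∀ c → c ∈ colours
∈-colours blue  = here refl
∈-colours green = there (here refl)
∈-colours red   = there (there (here refl))

_≟ᶜ_ : DecidableEquality EdgeColour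
blue  ≟ᶜ blue  = yes refl
blue  ≟ᶜ green = no λ ()
blue  ≟ᶜ red   = no λ ()
green ≟ᶜ blue  = no λ ()
green ≟ᶜ green = yes refl
green ≟ᶜ red   = no λ ()
red   ≟ᶜ blue  = no λ ()
red   ≟ᶜ green = no λ ()
red   ≟ᶜ red   = yes refl

-- Parallel edges are allowed.  The cyclic orders of the ribbon graph structure
-- are functions of the colours, so they are not part of the data.

record ColouredGraph : Set where
  field
    #white #black #edge : ℕ
    colour : Fin #edge → EdgeColour
    white  : Fin #edge → Fin #white
    black  : Fin #edge → Fin #black

  Vertex : Set
  Vertex = Fin #white ⊎ Fin #black

  vertices : List Vertex
  vertices = map inj₁ (allFin #white) ++ map inj₂ (allFin #black)

  ∈-vertices : ∀ x → x ∈ vertices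
  ∈-vertices (inj₁ w) = ∈-++⁺ˡ (∈-map⁺ inj₁ (∈-allFin w))
  ∈-vertices (inj₂ b) = ∈-++⁺ʳ (map inj₁ (allFin #white)) (∈-map⁺ inj₂ (∈-allFin b))

  _≟ᵛ_ : DecidableEquality Vertex
  _≟ᵛ_ = Sum.≡-dec Fin._≟_ Fin._≟_

  data Adjacent (cs : List EdgeColour) : Vertex → Vertex → Set where
    edge : ∀ e → colour e ∈ cs → Adjacent cs (inj₁ (white e)) (inj₂ (black e))

  _∈?_ : Decidable (_∈_ {A = EdgeColour})
  c ∈? cs = Any.any? (c ≟ᶜ_) cs

  adjacent? : ∀ cs → Decidable (Adjacent cs)
  adjacent? cs (inj₁ w) (inj₂ b) = map′
    (λ { (e , c∈ , refl , refl) → edge e c∈ })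
    (λ { (edge e c∈) → e , c∈ , refl , refl })
    (Fin.any? λ e → (colour e ∈? cs) ×-dec (white e Fin.≟ w) ×-dec (black e Fin.≟ b))
  adjacent? cs (inj₁ _) (inj₁ _) = no λ ()
  adjacent? cs (inj₂ _) (inj₁ _) = no λ ()
  adjacent? cs (inj₂ _) (inj₂ _) = no λ ()

  Linked : List EdgeColour → Rel Vertex 0ℓ
  Linked cs = EqClosure (Adjacent cs)

  linked? : ∀ cs → Decidable (Linked cs)
  linked? cs = eqClosure? _≟ᵛ_ (adjacent? cs) vertices ∈-vertices

  Connected : Set
  Connected = Vertex × (∀ x y → Linked colours x y)

  record IsBelyi : Set where
    pattern
    constructor isBelyi
    field
      white-regular : ∀ w c → ∃! _≡_ λ e → white e ≡ w × colour e ≡ c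
      black-regular : ∀ b c → ∃! _≡_ λ e → black e ≡ b × colour e ≡ c
      connected     : Connected

  private
    allColours? : ∀ {P : EdgeColour → Set} → Unary.Decidable P → Dec (∀ c → P c)
    allColours? P? = map′ (λ ps c → All.lookup ps (∈-colours c)) (λ p → All.tabulate λ {c} _ → p c)
      (All.all? P? colours)

    allVertices? : ∀ {P : Vertex → Set} → Unary.Decidable P → Dec (∀ x → P x)
    allVertices? P? = map′ (λ ps x → All.lookup ps (∈-vertices x)) (λ p → All.tabulate λ {x} _ → p x)
      (All.all? P? vertices)

    vertex? : Dec Vertex
    vertex? with vertices in eq
    ... | x ∷ _ = yes x
    ... | []    = no λ x → contradiction (subst (x ∈_) eq (∈-vertices x)) λ ()

  isBelyi? : Dec IsBelyi
  isBelyi? = map′ (λ (w , b , c) → isBelyi w b c) (λ (isBelyi w b c) → w , b , c)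
    ( (Fin.all? λ w → allColours? λ c → ∃!? λ e → (white e Fin.≟ w) ×-dec (colour e ≟ᶜ c))
      ×-dec (Fin.all? λ b → allColours? λ c → ∃!? λ e → (black e Fin.≟ b) ×-dec (colour e ≟ᶜ c))
      ×-dec vertex? ×-dec allVertices? λ x → allVertices? λ y → linked? colours x y )

  greenEdges : List (Fin #edge)
  greenEdges = filter (λ e → colour e ≟ᶜ green) (allFin #edge)

  degree : ℕ
  degree = length greenEdges

  -- In a Belyi graph the edges of two colours c, c′ form disjoint cycles
  -- covering all vertices, so the c–c′ cycles are the classes of
  -- Linked (c ∷ c′ ∷ []).  Here each is given by one of its vertices.

  cycles : EdgeColour → EdgeColour → List Vertex
  cycles c c′ = deduplicate (linked? (c ∷ c′ ∷ [])) vertices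

  cycleLength : EdgeColour → EdgeColour → Vertex → ℕ
  cycleLength c c′ x = length (filter onCycle? (allFin #edge))
    where
    onCycle? = λ e → (colour e ∈? (c ∷ c′ ∷ [])) ×-dec linked? (c ∷ c′ ∷ []) x (inj₁ (white e))

  #cyclesOfLength : EdgeColour → EdgeColour → ℕ → ℕ
  #cyclesOfLength c c′ n = length (filter (λ x → cycleLength c c′ x ℕ.≟ n) (cycles c c′))

  -- The truncation of m loses nothing: a red–blue cycle of length 2i has i red
  -- edges, and there are as many red edges as green ones.

  type : ℕ × ℕ × Exponents
  type = length (cycles red green)
       , length (cycles green blue)
       , tabulate degree (λ i → #cyclesOfLength red blue (2 * suc i))

open ColouredGraph public

record IsIsomorphism (Γ Δ : ColouredGraph)
                     (f : Fin (#white Γ) → Fin (#white Δ))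
                     (g : Fin (#black Γ) → Fin (#black Δ))
                     (h : Fin (#edge  Γ) → Fin (#edge  Δ)) : Set where
  pattern
  constructor isIso
  field
    white-bijective : Bijective _≡_ _≡_ f
    black-bijective : Bijective _≡_ _≡_ g
    edge-bijective  : Bijective _≡_ _≡_ h
    colour-preserved : ∀ e → colour Δ (h e) ≡ colour Γ e
    white-preserved  : ∀ e → white  Δ (h e) ≡ f (white Γ e)
    black-preserved  : ∀ e → black  Δ (h e) ≡ g (black Γ e)

infix 4 _≅_

_≅_ : Rel ColouredGraph 0ℓ
Γ ≅ Δ = ∃ λ f → ∃ λ g → ∃ λ h → IsIsomorphism Γ Δ f g h

module _ (Γ Δ : ColouredGraph) where

  Triple : Set
  Triple = (Fin (#white Γ) → Fin (#white Δ))
         × (Fin (#black Γ) → Fin (#black Δ))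
         × (Fin (#edge  Γ) → Fin (#edge  Δ))

  triples : List Triple
  triples = cartesianProduct (functions _ (allFin _))
           (cartesianProduct (functions _ (allFin _)) (functions _ (allFin _)))

  IsIso : Triple → Set
  IsIso (f , g , h) = IsIsomorphism Γ Δ f g h

  isIso? : Unary.Decidable IsIso
  isIso? (f , g , h) = map′
    (λ (a , b , c , d , e , i) → isIso a b c d e i)
    (λ (isIso a b c d e i) → a , b , c , d , e , i)
    ( bijective? f ×-dec bijective? g ×-dec bijective? h
      ×-dec (Fin.all? λ e → colour Δ (h e) ≟ᶜ colour Γ e)
      ×-dec (Fin.all? λ e → white Δ (h e) Fin.≟ f (white Γ e))
      ×-dec (Fin.all? λ e → black Δ (h e) Fin.≟ g (black Γ e)) )

  private
    bijective-resp : ∀ {m n} {f f′ : Fin m → Fin n} → f ≗ f′ →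
                     Bijective _≡_ _≡_ f → Bijective _≡_ _≡_ f′
    bijective-resp p (inj , sur) =
        (λ {x} {y} q → inj (trans (p x) (trans q (sym (p y)))))
      , λ y → proj₁ (sur y) , λ { refl → trans (sym (p _)) (proj₂ (sur y) refl) }

  ≅⇒∈triples : Γ ≅ Δ → Any IsIso triples
  ≅⇒∈triples (f , g , h , isIso a b c d e i) =
    Any.cartesianProduct⁺ {P = f ≗_} {Q = λ (g′ , h′) → g ≗ g′ × h ≗ h′} (enum f)
      (Any.cartesianProduct⁺ (enum g) (enum h)) |> Any.map resp
    where
    infixl 0 _|>_
    _|>_ : ∀ {A B : Set} → A → (A → B) → B
    x |> k = k x
    enum : ∀ {m n} (f : Fin m → Fin n) → Any (f ≗_) (functions m (allFin n))
    enum f = functions-complete _ f (λ _ → ∈-allFin _)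
    resp : ∀ {t} → f ≗ proj₁ t × g ≗ proj₁ (proj₂ t) × h ≗ proj₂ (proj₂ t) → IsIso t
    resp (p , q , r) = isIso (bijective-resp p a) (bijective-resp q b) (bijective-resp r c)
      (λ x → trans (cong (colour Δ) (sym (r x))) (d x))
      (λ x → trans (cong (white Δ) (sym (r x))) (trans (e x) (p _)))
      (λ x → trans (cong (black Δ) (sym (r x))) (trans (i x) (q _)))

_≅?_ : Decidable _≅_
Γ ≅? Δ = map′ (λ p → let _ , q = Any.satisfied p in _ , _ , _ , q) (≅⇒∈triples Γ Δ)
  (Any.any? (isIso? Γ Δ) (triples Γ Δ))

|Aut| : ColouredGraph → ℕ
|Aut| Γ = length (filter (isIso? Γ Γ) (triples Γ Γ))

id-bijective : ∀ {n} → Bijective _≡_ _≡_ (id {A = Fin n})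
id-bijective = id , λ y → y , id

≅-refl : ∀ Γ → Γ ≅ Γ
≅-refl Γ = id , id , id , isIso id-bijective id-bijective id-bijective
    (λ _ → refl) (λ _ → refl) (λ _ → refl)

|Aut|-nonZero : ∀ Γ → NonZero (|Aut| Γ)
|Aut|-nonZero Γ = ℕ.>-nonZero (filter-some (isIso? Γ Γ) (≅⇒∈triples Γ Γ (≅-refl Γ)))

coloured : ∀ w b n → (Fin n → EdgeColour) × (Fin n → Fin w) × (Fin n → Fin b) → ColouredGraph
coloured w b n (c , f , g) = record
  { #white = w ; #black = b ; #edge = n ; colour = c ; white = f ; black = g }

colouredGraphs : ∀ w b n → List ColouredGraph
colouredGraphs w b n = map (coloured w b n)
  (cartesianProduct (functions n colours)
    (cartesianProduct (functions n (allFin w)) (functions n (allFin b))))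

-- Each vertex has one edge of each colour, so a Belyi graph of degree d has d
-- white vertices, d black vertices and 3d edges; see belyiGraphs-complete.

belyiGraphs : ℕ → List ColouredGraph
belyiGraphs d = filter isBelyi? (colouredGraphs d d (3 * d))

lookup-injective : ∀ {A : Set} {xs : List A} → Unique xs → ∀ i j → lookup xs i ≡ lookup xs j → i ≡ j
lookup-injective (_  ∷ _)   zero    zero    _ = refl
lookup-injective (x∉ ∷ _)   zero    (suc j) p = contradiction p (All.lookup x∉ (∈-lookup j))
lookup-injective (x∉ ∷ _)   (suc i) zero    p = contradiction (sym p) (All.lookup x∉ (∈-lookup i))
lookup-injective (_  ∷ !xs) (suc i) (suc j) p = cong suc (lookup-injective !xs i j p)

module _ {n N} (end : Fin n → Fin N) (colour : Fin n → EdgeColour)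
         (regular : ∀ x c → ∃! _≡_ λ e → end e ≡ x × colour e ≡ c) where

  private
    edgeAt : Fin N → EdgeColour → Fin n
    edgeAt x c = proj₁ (regular x c)

    end-edgeAt : ∀ x c → end (edgeAt x c) ≡ x
    end-edgeAt x c = proj₁ (proj₁ (proj₂ (regular x c)))

    colour-edgeAt : ∀ x c → colour (edgeAt x c) ≡ c
    colour-edgeAt x c = proj₂ (proj₁ (proj₂ (regular x c)))

    edge-unique : ∀ {e e′} → end e ≡ end e′ → colour e ≡ colour e′ → e ≡ e′
    edge-unique p q = trans (sym (unique (p , q))) (unique (refl , refl))
      where
      unique : ∀ {e e′} → end e ≡ end e′ × colour e ≡ colour e′ → edgeAt (end e′) (colour e′) ≡ e
      unique = proj₂ (proj₂ (regular _ _))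

    code : EdgeColour → Fin 3
    code blue  = zero
    code green = suc zero
    code red   = suc (suc zero)

    decode : Fin 3 → EdgeColour
    decode zero             = blue
    decode (suc zero)       = green
    decode (suc (suc zero)) = red

    decode-code : ∀ c → decode (code c) ≡ c
    decode-code blue  = refl
    decode-code green = refl
    decode-code red   = refl

    code-decode : ∀ i → code (decode i) ≡ i
    code-decode zero             = refl
    code-decode (suc zero)       = refl
    code-decode (suc (suc zero)) = refl

  #edge≡3*#vertex : n ≡ 3 * N
  #edge≡3*#vertex = ℕ.≤-antisym (Fin.injective⇒≤ to-injective) (Fin.injective⇒≤ from-injective)
    where
    to : Fin n → Fin (3 * N)
    to e = Fin.combine (code (colour e)) (end e)
    to-injective : ∀ {e e′} → to e ≡ to e′ → e ≡ e′
    to-injective {e} {e′} p with Fin.combine-injective (code (colour e)) (end e) _ _ p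
    ... | q , r = edge-unique r
      (trans (sym (decode-code (colour e))) (trans (cong decode q) (decode-code (colour e′))))
    from : Fin (3 * N) → Fin n
    from i = edgeAt (proj₂ (Fin.remQuot N i)) (decode (proj₁ (Fin.remQuot {3} N i)))
    to-from : ∀ i → to (from i) ≡ i
    to-from i = trans
      (cong₂ Fin.combine (trans (cong code (colour-edgeAt _ _)) (code-decode _)) (end-edgeAt _ _))
      (Fin.combine-remQuot {3} N i)
    from-injective : ∀ {i j} → from i ≡ from j → i ≡ j
    from-injective {i} {j} p = trans (sym (to-from i)) (trans (cong to p) (to-from j))

  #green≡#vertex : length (filter (λ e → colour e ≟ᶜ green) (allFin n)) ≡ N
  #green≡#vertex = ℕ.≤-antisym (Fin.injective⇒≤ to-injective) (Fin.injective⇒≤ from-injective)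
    where
    greens : List (Fin n)
    greens = filter (λ e → colour e ≟ᶜ green) (allFin n)
    is-green : ∀ i → colour (lookup greens i) ≡ green
    is-green i = proj₂ (∈-filter⁻ (λ e → colour e ≟ᶜ green) {xs = allFin n} (∈-lookup {xs = greens} i))
    to : Fin (length greens) → Fin N
    to i = end (lookup greens i)
    to-injective : ∀ {i j} → to i ≡ to j → i ≡ j
    to-injective {i} {j} p =
      lookup-injective (Unique.filter⁺ (λ e → colour e ≟ᶜ green) (Unique.allFin⁺ n)) i j
        (edge-unique p (trans (is-green i) (sym (is-green j))))
    green∈ : ∀ x → edgeAt x green ∈ greens
    green∈ x = ∈-filter⁺ (λ e → colour e ≟ᶜ green) (∈-allFin _) (colour-edgeAt x green)
    from : Fin N → Fin (length greens)
    from x = Any.index (green∈ x)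
    to-from : ∀ x → to (from x) ≡ x
    to-from x = trans (cong end (sym (Any.lookup-index (green∈ x)))) (end-edgeAt x green)
    from-injective : ∀ {x y} → from x ≡ from y → x ≡ y
    from-injective {x} {y} p = trans (sym (to-from x)) (trans (cong to p) (to-from y))

isBelyi-resp : ∀ {w b n} {c c′ : Fin n → EdgeColour} {f f′ : Fin n → Fin w} {g g′ : Fin n → Fin b} →
               c ≗ c′ → f ≗ f′ → g ≗ g′ →
               IsBelyi (coloured w b n (c , f , g)) → IsBelyi (coloured w b n (c′ , f′ , g′))
isBelyi-resp {c = c} {c′} {f} {f′} {g} {g′} p q r β = isBelyi
  (λ x k → regular-resp q (IsBelyi.white-regular β x k))
  (λ x k → regular-resp r (IsBelyi.black-regular β x k))
  (proj₁ (IsBelyi.connected β) , λ x y → EqClosure.map adjacent-resp (proj₂ (IsBelyi.connected β) x y))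
  where
  regular-resp : ∀ {N} {h h′ : _ → Fin N} {x k} → h ≗ h′ →
                 ∃! _≡_ (λ e → h e ≡ x × c e ≡ k) → ∃! _≡_ (λ e → h′ e ≡ x × c′ e ≡ k)
  regular-resp t (e , (y , z) , uniq) =
      e , (trans (sym (t e)) y , trans (sym (p e)) z)
    , λ (y′ , z′) → uniq (trans (t _) y′ , trans (p _) z′)
  adjacent-resp : ∀ {x y} → Adjacent (coloured _ _ _ (c , f , g)) colours x y →
                  Adjacent (coloured _ _ _ (c′ , f′ , g′)) colours x y
  adjacent-resp (edge e _) rewrite q e | r e = edge e (∈-colours (c′ e))

belyiGraphs-complete : ∀ Γ → IsBelyi Γ → Any (Γ ≅_) (belyiGraphs (degree Γ))
belyiGraphs-complete Γ β = go (degree Γ) β (sym white≡) (sym black≡)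
  (trans (#edge≡3*#vertex (white Γ) (colour Γ) (IsBelyi.white-regular β)) (cong (3 *_) (sym white≡)))
  where
  white≡ : degree Γ ≡ #white Γ
  white≡ = #green≡#vertex (white Γ) (colour Γ) (IsBelyi.white-regular β)
  black≡ : degree Γ ≡ #black Γ
  black≡ = #green≡#vertex (black Γ) (colour Γ) (IsBelyi.black-regular β)
  go : ∀ d {w b n c f g} → IsBelyi (coloured w b n (c , f , g)) → w ≡ d → b ≡ d → n ≡ 3 * d →
       Any (coloured w b n (c , f , g) ≅_) (belyiGraphs d)
  go d {c = c} {f} {g} β refl refl refl
    with find (functions-complete _ c (λ _ → ∈-colours _))
       | find (functions-complete _ f (λ _ → ∈-allFin _))
       | find (functions-complete _ g (λ _ → ∈-allFin _))
  ... | c′ , c∈ , p | f′ , f∈ , q | g′ , g∈ , r = lose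
    (∈-filter⁺ isBelyi?
      (∈-map⁺ (coloured d d (3 * d)) (∈-cartesianProduct⁺ c∈ (∈-cartesianProduct⁺ f∈ g∈)))
      (isBelyi-resp p q r β))
    (id , id , id , isIso id-bijective id-bijective id-bijective (sym ∘ p) (sym ∘ q) (sym ∘ r))

_≟ᵗ_ : DecidableEquality (ℕ × ℕ × Exponents)
_≟ᵗ_ = Product.≡-dec ℕ._≟_ (Product.≡-dec ℕ._≟_ (Maybe.≡-dec _≟⁺_))

-- One graph from each isomorphism class of type (k , l ; m).  The degree of a
-- graph of this type is Σᵢ i mᵢ.

𝓑 : ℕ → ℕ → Exponents → List ColouredGraph
𝓑 k l m = deduplicate _≅?_ (filter (λ Γ → type Γ ≟ᵗ (k , l , m)) (belyiGraphs (weight m)))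

sumℚ : List ℚ → ℚ
sumℚ = foldr ℚ._+_ 0ℚ

𝓝 : ℕ → ℕ → Exponents → ℚ
𝓝 k l m = sumℚ (map (λ Γ → (+ 1 / |Aut| Γ) {{|Aut|-nonZero Γ}}) (𝓑 k l m))

data Variable : Set where
  s u v : Variable
  t[1+_] : ℕ → Variable

record Monomial : Set where
  constructor mono
  field
    exp-s exp-u exp-v : ℕ
    exp-t : Exponents

open Monomial public

exponent : Variable → Monomial → ℕ
exponent s        μ = exp-s μ
exponent u        μ = exp-u μ
exponent v        μ = exp-v μ
exponent t[1+ i ] μ = at (exp-t μ) i

adjust : (ℕ → ℕ) → Variable → Monomial → Monomial
adjust f s        (mono d k l m) = mono (f d) k l m
adjust f u        (mono d k l m) = mono d (f k) l m
adjust f v        (mono d k l m) = mono d k (f l) m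
adjust f t[1+ i ] (mono d k l m) = mono d k l (adjustAt f i m)

PowerSeries : Set
PowerSeries = Monomial → ℚ

infix  4 _≈_
infixl 6 _⊕_
infixl 7 _⊗_
infixr 8 _•_ _·_

_≈_ : Rel PowerSeries 0ℓ
G ≈ H = ∀ μ → G μ ≡ H μ

𝟎 𝟏 : PowerSeries
𝟎 _ = 0ℚ
𝟏 (mono zero zero zero nothing) = 1ℚ
𝟏 (mono _    _    _    _)       = 0ℚ

_⊕_ : PowerSeries → PowerSeries → PowerSeries
(G ⊕ H) μ = G μ ℚ.+ H μ

_•_ : ℚ → PowerSeries → PowerSeries
(q • G) μ = q ℚ.* G μ

fromℕ : ℕ → ℚ
fromℕ n = + n / 1

_·_ : Variable → PowerSeries → PowerSeries
(x · G) μ with exponent x μ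
... | zero  = 0ℚ
... | suc _ = G (adjust pred x μ)

∂ : Variable → PowerSeries → PowerSeries
∂ x G μ = fromℕ (suc (exponent x μ)) ℚ.* G (adjust suc x μ)

splitsℕ : ℕ → List (ℕ × ℕ)
splitsℕ n = map (λ a → a , n ∸ a) (upTo (suc n))

splits⁺ : Exponents⁺ → List (Exponents × Exponents)
splits⁺ [1+ n ] = map (λ (a , b) → (a ◂ nothing) , (b ◂ nothing)) (splitsℕ (suc n))
splits⁺ (n ∷ m) =
  cartesianProductWith (λ (a , b) (x , y) → (a ◂ x) , (b ◂ y)) (splitsℕ n) (splits⁺ m)

splitsᵗ : Exponents → List (Exponents × Exponents)
splitsᵗ nothing  = [ nothing , nothing ]
splitsᵗ (just m) = splits⁺ m

splits : Monomial → List (Monomial × Monomial)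
splits (mono d k l m) = map
  (λ ((a , a′) , (b , b′) , (c , c′) , (x , x′)) → mono a b c x , mono a′ b′ c′ x′)
  (cartesianProduct (splitsℕ d)
    (cartesianProduct (splitsℕ k) (cartesianProduct (splitsℕ l) (splitsᵗ m))))

_⊗_ : PowerSeries → PowerSeries → PowerSeries
(G ⊗ H) μ = sumℚ (map (λ (α , β) → G α ℚ.* H β) (splits μ))

infixr 9 _^_

_^_ : PowerSeries → ℕ → PowerSeries
G ^ zero  = 𝟏
G ^ suc n = G ⊗ G ^ n

-- Coefficientwise finite infinite sums.  The value of Σ∞ does not depend on
-- the choice of bound.

record Summable (G : ℕ → PowerSeries) : Set where
  constructor summable
  field
    bound    : Monomial → ℕ
    vanishes : ∀ μ n → bound μ ≤ n → G n μ ≡ 0ℚ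

open Summable public

Σ∞ : (G : ℕ → PowerSeries) → Summable G → PowerSeries
Σ∞ G σ μ = sumℚ (applyUpTo (λ n → G n μ) (bound σ μ))

Σ-antidiagonal : ℕ → (ℕ → ℕ → PowerSeries) → PowerSeries
Σ-antidiagonal n f = foldr _⊕_ 𝟎 (applyUpTo (λ a → f a (n ∸ a)) (suc n))

ZeroAt-s=0 : PowerSeries → Set
ZeroAt-s=0 G = ∀ k l m → G (mono 0 k l m) ≡ 0ℚ

·-zero : ∀ x G μ → exponent x μ ≡ 0 → (x · G) μ ≡ 0ℚ
·-zero x G μ p with exponent x μ
... | zero = refl

·-null : ∀ x G μ → G (adjust pred x μ) ≡ 0ℚ → (x · G) μ ≡ 0ℚ
·-null x G μ p with exponent x μ
... | zero  = refl
... | suc _ = p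

•-null : ∀ q G μ → G μ ≡ 0ℚ → (q • G) μ ≡ 0ℚ
•-null q G μ p = trans (cong (q ℚ.*_) p) (ℚ.*-zeroʳ q)

⊕-null : ∀ G H μ → G μ ≡ 0ℚ → H μ ≡ 0ℚ → (G ⊕ H) μ ≡ 0ℚ
⊕-null G H μ p q = cong₂ ℚ._+_ p q

antidiagonal-null : ∀ n f μ → (∀ a b → n ≤ a + b → f a b μ ≡ 0ℚ) →
                    Σ-antidiagonal n f μ ≡ 0ℚ
antidiagonal-null n f μ p =
  go (suc n) (λ a → f a (n ∸ a)) (λ a → p a (n ∸ a) (ℕ.m≤n+m∸n n a))
  where
  go : ∀ k (h : ℕ → PowerSeries) → (∀ a → h a μ ≡ 0ℚ) → foldr _⊕_ 𝟎 (applyUpTo h k) μ ≡ 0ℚ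
  go zero    h q = refl
  go (suc k) h q = cong₂ ℚ._+_ (q 0) (go k (h ∘ suc) (q ∘ suc))

head-◂ : ∀ n m → head (n ◂ m) ≡ n
head-◂ zero    nothing  = refl
head-◂ (suc _) nothing  = refl
head-◂ zero    (just _) = refl
head-◂ (suc _) (just _) = refl

tail-◂ : ∀ n m → tail (n ◂ m) ≡ m
tail-◂ zero    nothing  = refl
tail-◂ (suc _) nothing  = refl
tail-◂ zero    (just _) = refl
tail-◂ (suc _) (just _) = refl

at-pred : ∀ i m j → at m j ≡ 0 → at (adjustAt pred i m) j ≡ 0
at-pred zero    m zero    p = trans (head-◂ _ (tail m)) (cong pred p)
at-pred zero    m (suc j) p = trans (cong (λ m → at m j) (tail-◂ (pred (head m)) _)) p
at-pred (suc i) m zero    p = trans (head-◂ _ (adjustAt pred i (tail m))) p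
at-pred (suc i) m (suc j) p =
  trans (cong (λ m → at m j) (tail-◂ (head m) _)) (at-pred i (tail m) j p)

t·-null : ∀ i G μ → size (exp-t μ) ≤ i → (t[1+ i ] · G) μ ≡ 0ℚ
t·-null i G μ p = ·-zero t[1+ i ] G μ (at-size (exp-t μ) p)

tt·-null : ∀ a b G μ → size (exp-t μ) + size (exp-t μ) ≤ a + b →
           (t[1+ a ] · t[1+ b ] · G) μ ≡ 0ℚ
tt·-null a b G μ p with size (exp-t μ) ℕ.≤? a
... | yes q = t·-null a (t[1+ b ] · G) μ q
... | no ¬q = ·-null t[1+ a ] (t[1+ b ] · G) μ
  (·-zero t[1+ b ] G (adjust pred t[1+ a ] μ) (at-pred a (exp-t μ) b (at-size (exp-t μ) size≤b)))
  where
  size≤b : size (exp-t μ) ≤ b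
  size≤b = ℕ.+-cancelˡ-≤ (size (exp-t μ)) _ _
    (ℕ.≤-trans p (ℕ.+-monoˡ-≤ b (ℕ.<⇒≤ (ℕ.≰⇒> ¬q))))

s^ : ℕ → PowerSeries → PowerSeries
s^ zero    G = G
s^ (suc n) G = s · s^ n G

s^-null : ∀ n G μ → exp-s μ < n → (s^ n G) μ ≡ 0ℚ
s^-null (suc n) G (mono zero    k l m) _       = refl
s^-null (suc n) G (mono (suc d) k l m) (s≤s p) = s^-null n G (mono d k l m) p

splits-s : ∀ μ {α β} → (α , β) ∈ splits μ → exp-s α + exp-s β ≡ exp-s μ
splits-s (mono d k l m) i with ∈-map⁻ _ i
... | _ , j , refl with ∈-map⁻ _ (proj₁ (∈-cartesianProduct⁻ (splitsℕ d) _ j))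
...   | a , a∈ , refl = ℕ.m+[n∸m]≡n (ℕ.≤-pred (∈-upTo⁻ a∈))

⊗-null : ∀ G H μ → (∀ α β → exp-s α + exp-s β ≡ exp-s μ → G α ℚ.* H β ≡ 0ℚ) →
         (G ⊗ H) μ ≡ 0ℚ
⊗-null G H μ p = go (splits μ) (λ i → p _ _ (splits-s μ i))
  where
  go : ∀ αβs → (∀ {α β} → (α , β) ∈ αβs → G α ℚ.* H β ≡ 0ℚ) →
       sumℚ (map (λ (α , β) → G α ℚ.* H β) αβs) ≡ 0ℚ
  go []        q = refl
  go (_ ∷ αβs) q = cong₂ ℚ._+_ (q (here refl)) (go αβs (q ∘ there))

^-null : ∀ G → ZeroAt-s=0 G → ∀ n μ → exp-s μ < n → (G ^ n) μ ≡ 0ℚ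
^-null G G₀ (suc n) μ (s≤s p) = ⊗-null G (G ^ n) μ term
  where
  term : ∀ α β → exp-s α + exp-s β ≡ exp-s μ → G α ℚ.* (G ^ n) β ≡ 0ℚ
  term α@(mono zero    k l m) β q = trans (cong (ℚ._* (G ^ n) β) (G₀ k l m)) (ℚ.*-zeroˡ ((G ^ n) β))
  term α@(mono (suc a) _ _ _) β q =
    trans (cong (G α ℚ.*_) (^-null G G₀ n β (ℕ.≤-trans (ℕ.≤-trans (s≤s (ℕ.m≤n+m _ a)) (ℕ.≤-reflexive q)) p)))
          (ℚ.*-zeroʳ (G α))

-- The outer sum over i ≥ 2 is indexed by n = i - 2, the inner one over
-- 1 ≤ j ≤ i - 1 by a = j - 1 and b = i - j - 1, so that a + b = n.

L₁ : PowerSeries → PowerSeries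
L₁ G = Σ∞ (λ n → fromℕ (1 + n) • t[1+ 1 + n ] · ∂ t[1+ n ] G)
  (summable (size ∘ exp-t) λ μ n p →
    •-null (fromℕ (1 + n)) (t[1+ 1 + n ] · ∂ t[1+ n ] G) μ
      (t·-null (1 + n) (∂ t[1+ n ] G) μ (ℕ.m≤n⇒m≤1+n p)))

M₁ : PowerSeries → PowerSeries
M₁ G = Σ∞ (λ n → Σ-antidiagonal n (term n)) (summable bound′ λ μ n p →
  antidiagonal-null n (term n) μ λ a b q →
    ⊕-null (cut n a b) (join n a b) μ
      (•-null (fromℕ (1 + n)) (t[1+ a ] · t[1+ b ] · ∂ t[1+ n ] G) μ
        (tt·-null a b (∂ t[1+ n ] G) μ (ℕ.≤-trans p q)))
      (•-null (fromℕ ((1 + a) * (1 + b))) (t[1+ 2 + n ] · ∂ t[1+ a ] (∂ t[1+ b ] G)) μ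
        (t·-null (2 + n) (∂ t[1+ a ] (∂ t[1+ b ] G)) μ
          (ℕ.≤-trans (ℕ.m≤m+n _ _) (ℕ.≤-trans p (ℕ.m≤n+m n 2))))))
  where
  cut join term : ℕ → ℕ → ℕ → PowerSeries
  cut  n a b = fromℕ (1 + n) • t[1+ a ] · t[1+ b ] · ∂ t[1+ n ] G
  join n a b = fromℕ ((1 + a) * (1 + b)) • t[1+ 2 + n ] · ∂ t[1+ a ] (∂ t[1+ b ] G)
  term n a b = cut n a b ⊕ join n a b
  bound′ : Monomial → ℕ
  bound′ μ = size (exp-t μ) + size (exp-t μ)

Q₁ : PowerSeries → PowerSeries
Q₁ G = Σ∞ (λ n → Σ-antidiagonal n (term n)) (summable (size ∘ exp-t) λ μ n p →
  antidiagonal-null n (term n) μ λ a b _ →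
    •-null (fromℕ ((1 + a) * (1 + b))) (t[1+ 2 + n ] · (∂ t[1+ a ] G ⊗ ∂ t[1+ b ] G)) μ
      (t·-null (2 + n) (∂ t[1+ a ] G ⊗ ∂ t[1+ b ] G) μ (ℕ.≤-trans p (ℕ.m≤n+m n 2))))
  where
  term : ℕ → ℕ → ℕ → PowerSeries
  term n a b = fromℕ ((1 + a) * (1 + b)) • t[1+ 2 + n ] · (∂ t[1+ a ] G ⊗ ∂ t[1+ b ] G)

1/_! : ℕ → ℚ
1/ n ! = (+ 1 / n !) {{n ℕ.!≢0}}

exp : (G : PowerSeries) → ZeroAt-s=0 G → PowerSeries
exp G G₀ = Σ∞ (λ n → 1/ n ! • G ^ n) (summable (suc ∘ exp-s) λ μ n p →
  •-null (1/ n !) (G ^ n) μ (^-null G G₀ n μ p))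

iterate : (PowerSeries → PowerSeries) → ℕ → PowerSeries → PowerSeries
iterate A zero    G = G
iterate A (suc n) G = A (iterate A n G)

-- e^{sA} applied to G, for an operator A involving neither s nor ∂/∂s, so that
-- (sA)ⁿ = sⁿ Aⁿ.

exp-s· : (PowerSeries → PowerSeries) → PowerSeries → PowerSeries
exp-s· A G = Σ∞ (λ n → 1/ n ! • s^ n (iterate A n G)) (summable (suc ∘ exp-s) λ μ n p →
  •-null (1/ n !) (s^ n (iterate A n G)) μ (s^-null n (iterate A n G) μ p))

F : PowerSeries
F (mono d@(suc _) k@(suc _) l@(suc _) m) with weight m ℕ.≟ d
... | yes _ = 𝓝 k l m
... | no  _ = 0ℚ
F (mono _ _ _ _) = 0ℚ

F-zero : ZeroAt-s=0 F
F-zero _ _ _ = refl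

Z : PowerSeries
Z = exp F F-zero

module Submission where

-- Label the white vertices of a Belyi graph of degree d by the elements of Fin d.  Carrying
-- the labels to the black vertices along the green edges turns the graph into a pair (σ , τ)
-- of permutations generating a transitive group, whose red–green, green–blue and red–blue
-- cycles are the cycles of σ, τ and τ ∘ σ.  By orbit counting, F is the exponential
-- generating function of the transitive pairs.
--
-- Every pair of permutations of d + 1 points arises from a pair on d points by inserting the
-- new point somewhere in σ and somewhere in τ.  This multiplies τ ∘ σ by two transpositions
-- that move the new point, each of which joins two cycles or cuts one.  So the exponential
-- generating function Y of all pairs satisfies ∂Y/∂s = Λ Y, where Λ = (u + v) L₁ + M₁ + u v t₁,
-- that is, Y = exp (s Λ) 1.  Splitting off the orbit of the new point gives ∂Y/∂s = Y ∂F/∂s,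
-- hence Y = exp F.  Since the second derivatives in M₁ produce Q₁, Λ (exp F) is exp F times
-- the right-hand side of the equation for F, and exp F cancels.  Solutions are unique because
-- the equation determines the coefficient of s^(d+1) from those of lower powers of s.


open import Defs
open import Data.Bool.Base using (true; false; if_then_else_; Bool)
import Data.Bool.Properties as Bool
open import Data.Empty using (⊥)
open import Data.Fin.Base as Fin using (Fin; zero; suc; toℕ)
import Data.Fin.Properties as Fin
import Data.Integer.Base as ℤ
import Data.Integer.Properties as ℤ
open import Data.List.Base using
  ( List; []; _∷_; map; filter; length; _++_; upTo; applyUpTo; cartesianProduct
  ; cartesianProductWith; foldr; allFin; deduplicate; [_] )
open import Data.List.Membership.Propositional using (_∈_; find; lose)
open import Data.List.Membership.Propositional.Properties using
  ( ∈-upTo⁺; ∈-upTo⁻; ∈-map⁺; ∈-map⁻; ∈-filter⁺; ∈-filter⁻; ∈-cartesianProduct⁺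
  ; ∈-cartesianProduct⁻; ∈-cartesianProductWith⁺; ∈-cartesianProductWith⁻; ∈-allFin
  ; ∈-deduplicate⁻ )
open import Data.List.Properties using (map-∘; map-applyUpTo)
import Data.List.Properties as List
open import Data.List.Relation.Unary.All as All using (All; []; _∷_)
open import Data.List.Relation.Unary.AllPairs using ([]; _∷_)
open import Data.List.Relation.Unary.Any as Any using (here; there; Any)
open import Data.List.Relation.Unary.Unique.Propositional using (Unique)
import Data.List.Relation.Unary.Unique.Propositional.Properties as Unique
open import Data.Maybe.Base using (nothing; just)
import Data.Maybe.Properties as Maybe
open import Data.Nat.Base as ℕ using (ℕ; zero; suc; NonZero; _!; pred; _≤_; _<_; _⊔_; z≤n; s≤s)
import Data.Nat.Properties as ℕ
open import Data.Product using (∃!)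
open import Data.Product.Base using (_×_; _,_; proj₁; proj₂; ∃; ∃₂)
import Data.Product.Properties as Product
open import Data.Rational.Base as ℚ using (ℚ; 0ℚ; 1ℚ; _+_; _*_; _-_; -_; _/_; toℚᵘ)
import Data.Rational.Properties as ℚ
open import Data.Rational.Solver using (module +-*-Solver)
import Data.Rational.Unnormalised.Base as ℚᵘ
import Data.Rational.Unnormalised.Properties as ℚᵘ
open import Data.Sum.Base as Sum using (inj₁; inj₂; _⊎_)
import Data.Sum.Properties as Sum
open import Data.Unit.Base using (⊤; tt)
open import Data.Vec.Base as Vec using (Vec; []; _∷_; lookup)
import Data.Vec.Functional as Vector
import Data.Vec.Properties as Vec
open import Function.Base using (_∘_; id)
open import Function.Bundles using (mk⇔)
open import Function.Definitions using (Injective; Bijective)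
open import Relation.Binary.Construct.Closure.Equivalence as EqClosure using (EqClosure)
open import Relation.Binary.Construct.Closure.ReflexiveTransitive using (ε; _◅_; _◅◅_)
open import Relation.Binary.Construct.Closure.Symmetric using (fwd; bwd)
open import Relation.Binary.Core using (Rel)
open import Relation.Binary.Definitions using
  ( DecidableEquality; Tri; tri<; tri≈; tri>; Decidable; Symmetric; Transitive )
open import Relation.Binary.PropositionalEquality using
  ( _≡_; _≢_; refl; sym; trans; cong; cong₂; subst; _≗_; module ≡-Reasoning )
open import Relation.Binary.Structures using (IsEquivalence)
open import Relation.Nullary.Decidable using (Dec; yes; no; does; _×-dec_; ¬?; map′; does-⇔)
open import Relation.Nullary.Negation using (contradiction; ¬_)

-- Two insertions act on the product as transpositions on one side: `insert τ y′ ∘ insert σ x`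
-- equals `lift (τ ∘ σ) ∘ swap zero y ∘ swap zero x` when `y′ = lift σ y`, and `y′` runs over all
-- points as `y` does. The terms of Λ are the four cases of `x` and `y` being `zero` or not: the new
-- point fixed by both permutations gives u v t₁, by σ alone u L₁, by τ alone v L₁, by neither M₁.
-- The coefficients count points: a cycle of n points has n places for an insertion, and cycles of
-- lengths i and j have i j pairs of places.
--
-- The obstacle is that permutations and isomorphisms are functions, comparable only pointwise, and
-- that the representatives picked by `deduplicate` are not preserved by isomorphisms. Therefore
-- cardinalities are written as sums of indicators in ℚ and compared by double counting;
-- permutations are enumerated by codes with decidable equality; and a cycle type is characterised
-- by the number of points on cycles of each length, which involves no choice of representatives.

private
  variable
    A B C : Set
    P Q : Set
    d : ℕ

-- Naturals in ℚ, indicators and finite sums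

private
  toℚᵘ-fromℕ : ∀ n → toℚᵘ (fromℕ n) ℚᵘ.≃ ℚᵘ.mkℚᵘ (ℤ.+ n) 0
  toℚᵘ-fromℕ n = ℚ.toℚᵘ-fromℚᵘ (ℚᵘ.mkℚᵘ (ℤ.+ n) 0)

fromℕ-+ : ∀ m n → fromℕ (m ℕ.+ n) ≡ fromℕ m + fromℕ n
fromℕ-+ m n = ℚ.toℚᵘ-injective (begin
  toℚᵘ (fromℕ (m ℕ.+ n))                    ≈⟨ toℚᵘ-fromℕ (m ℕ.+ n) ⟩
  ℚᵘ.mkℚᵘ (ℤ.+ (m ℕ.+ n)) 0 ≈⟨ ℚᵘ.*≡*
      (cong (ℤ._* (ℤ.+ 1)) (sym (cong₂ ℤ._+_ (ℤ.*-identityʳ (ℤ.+ m)) (ℤ.*-identityʳ (ℤ.+ n))))) ⟩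
  ℚᵘ.mkℚᵘ (ℤ.+ m) 0 ℚᵘ.+ ℚᵘ.mkℚᵘ (ℤ.+ n) 0      ≈⟨ ℚᵘ.+-cong (toℚᵘ-fromℕ m) (toℚᵘ-fromℕ n) ⟨
  toℚᵘ (fromℕ m) ℚᵘ.+ toℚᵘ (fromℕ n)        ≈⟨ ℚ.toℚᵘ-homo-+ (fromℕ m) (fromℕ n) ⟨
  toℚᵘ (fromℕ m + fromℕ n) ∎)
  where open ℚᵘ.≃-Reasoning

fromℕ-* : ∀ m n → fromℕ (m ℕ.* n) ≡ fromℕ m * fromℕ n
fromℕ-* zero    n = sym (ℚ.*-zeroˡ (fromℕ n))
fromℕ-* (suc m) n = begin
  fromℕ (n ℕ.+ m ℕ.* n)
    ≡⟨ fromℕ-+ n (m ℕ.* n) ⟩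
  fromℕ n + fromℕ (m ℕ.* n)
    ≡⟨ cong₂ _+_ (sym (ℚ.*-identityˡ (fromℕ n))) (fromℕ-* m n) ⟩
  1ℚ * fromℕ n + fromℕ m * fromℕ n
    ≡⟨ ℚ.*-distribʳ-+ (fromℕ n) 1ℚ (fromℕ m) ⟨
  (1ℚ + fromℕ m) * fromℕ n
    ≡⟨ cong (_* fromℕ n) (fromℕ-+ 1 m) ⟨
  fromℕ (suc m) * fromℕ n ∎
  where open ≡-Reasoning

fromℕ-suc : ∀ n → fromℕ (suc n) ≡ 1ℚ + fromℕ n
fromℕ-suc = fromℕ-+ 1

fromℕ-injective : ∀ {m n} → fromℕ m ≡ fromℕ n → m ≡ n
fromℕ-injective {m} {n} p = ℤ.+-injective (begin
  ℤ.+ m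
    ≡⟨ ℤ.*-identityʳ (ℤ.+ m) ⟨
  ℤ.+ m ℤ.* ℤ.+ 1
    ≡⟨ ℚᵘ.drop-*≡* (ℚᵘ.≃-trans (ℚᵘ.≃-sym (toℚᵘ-fromℕ m))
      (ℚᵘ.≃-trans (ℚᵘ.≃-reflexive (cong toℚᵘ p)) (toℚᵘ-fromℕ n))) ⟩
  ℤ.+ n ℤ.* ℤ.+ 1
    ≡⟨ ℤ.*-identityʳ (ℤ.+ n) ⟩
  ℤ.+ n ∎)
  where open ≡-Reasoning

1/-fromℕ : ∀ n .{{_ : NonZero n}} → (ℤ.+ 1 / n) * fromℕ n ≡ 1ℚ
1/-fromℕ n@(suc n-1) = ℚ.toℚᵘ-injective (begin
  toℚᵘ ((ℤ.+ 1 / n) * fromℕ n)                  ≈⟨ ℚ.toℚᵘ-homo-* (ℤ.+ 1 / n) (fromℕ n) ⟩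
  toℚᵘ (ℤ.+ 1 / n) ℚᵘ.* toℚᵘ (fromℕ n)
      ≈⟨ ℚᵘ.*-cong (ℚ.toℚᵘ-fromℚᵘ (ℚᵘ.mkℚᵘ (ℤ.+ 1) n-1)) (toℚᵘ-fromℕ n) ⟩
  ℚᵘ.mkℚᵘ (ℤ.+ 1) n-1 ℚᵘ.* ℚᵘ.mkℚᵘ (ℤ.+ n) 0      ≈⟨ ℚᵘ.*≡* (cong ℤ.+_ (cross n-1)) ⟩
  ℚᵘ.mkℚᵘ (ℤ.+ 1) 0 ∎)
  where
  open ℚᵘ.≃-Reasoning
  cross : ∀ k → (1 ℕ.* suc k) ℕ.* 1 ≡ 1 ℕ.* (suc k ℕ.* 1)
  cross k = trans (cong (ℕ._* 1) (ℕ.*-identityˡ (suc k))) (sym (ℕ.*-identityˡ (suc k ℕ.* 1)))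

fromℕ-cancelˡ : ∀ n {p q} → fromℕ (suc n) * p ≡ fromℕ (suc n) * q → p ≡ q
fromℕ-cancelˡ n {p} {q} e = trans (sym (undo p)) (trans (cong ((ℤ.+ 1 / suc n) *_) e) (undo q))
  where
  undo : ∀ r → (ℤ.+ 1 / suc n) * (fromℕ (suc n) * r) ≡ r
  undo r = trans (sym (ℚ.*-assoc (ℤ.+ 1 / suc n) (fromℕ (suc n)) r))
    (trans (cong (_* r) (1/-fromℕ (suc n))) (ℚ.*-identityˡ r))

1/!-fromℕ : ∀ n → 1/ n ! * fromℕ (n !) ≡ 1ℚ
1/!-fromℕ n = 1/-fromℕ (n !) {{n ℕ.!≢0}}

suc*1/! : ∀ n → fromℕ (suc n) * 1/ suc n ! ≡ 1/ n !
suc*1/! n = begin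
  a * c
    ≡⟨ ℚ.*-identityˡ (a * c) ⟨
  1ℚ * (a * c)
    ≡⟨ cong (_* (a * c)) (1/!-fromℕ n) ⟨
  b * f * (a * c)
    ≡⟨ solve 4 (λ a b c f → b :* f :* (a :* c) := b :* (c :* (a :* f))) refl a b c f ⟩
  b * (c * (a * f))
    ≡⟨ cong (λ g → b * (c * g)) (fromℕ-* (suc n) (n !)) ⟨
  b * (c * fromℕ (suc n !))
    ≡⟨ cong (b *_) (1/!-fromℕ (suc n)) ⟩
  b * 1ℚ
    ≡⟨ ℚ.*-identityʳ b ⟩
  b ∎
  where
  open ≡-Reasoning
  open +-*-Solver
  a b c f : ℚ
  a = fromℕ (suc n)
  b = 1/ n !
  c = 1/ suc n !
  f = fromℕ (n !)

opaque
  -- The Iverson bracket. It is opaque so that sums of indicators are handled by the lemmas below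
  -- alone, and the decision procedures inside them are never evaluated.
  ⟦_⟧ : Dec P → ℚ
  ⟦ p? ⟧ = if does p? then 1ℚ else 0ℚ

  ⟦⟧-yes : (p? : Dec P) → P → ⟦ p? ⟧ ≡ 1ℚ
  ⟦⟧-yes (yes _) _ = refl
  ⟦⟧-yes (no ¬p) p = contradiction p ¬p

  ⟦⟧-no : (p? : Dec P) → ¬ P → ⟦ p? ⟧ ≡ 0ℚ
  ⟦⟧-no (yes p) ¬p = contradiction p ¬p
  ⟦⟧-no (no _)  _  = refl

  ⟦⟧-cong : (p? : Dec P) (q? : Dec Q) → (P → Q) → (Q → P) → ⟦ p? ⟧ ≡ ⟦ q? ⟧
  ⟦⟧-cong (yes p) q? f g = sym (⟦⟧-yes q? (f p))
  ⟦⟧-cong (no ¬p) q? f g = sym (⟦⟧-no q? (¬p ∘ g))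

  ⟦⟧-× : (p? : Dec P) (q? : Dec Q) → ⟦ p? ×-dec q? ⟧ ≡ ⟦ p? ⟧ * ⟦ q? ⟧
  ⟦⟧-× (yes _) (yes _) = refl
  ⟦⟧-× (yes _) (no _)  = refl
  ⟦⟧-× (no _)  (yes _) = refl
  ⟦⟧-× (no _)  (no _)  = refl

  ⟦⟧*-cong : (p? : Dec P) {x y : ℚ} → (P → x ≡ y) → ⟦ p? ⟧ * x ≡ ⟦ p? ⟧ * y
  ⟦⟧*-cong (yes p) f = cong (1ℚ *_) (f p)
  ⟦⟧*-cong (no _) {x} {y} f = trans (ℚ.*-zeroˡ x) (sym (ℚ.*-zeroˡ y))

⟦⟧-split : (p? : Dec P) (x : ℚ) → ⟦ p? ⟧ * x + ⟦ ¬? p? ⟧ * x ≡ x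
⟦⟧-split p?@(yes p) x = trans (cong₂ (λ a b → a * x + b * x) (⟦⟧-yes p? p)
  (⟦⟧-no (¬? p?) (λ ¬p → ¬p p)))
  (trans (cong₂ _+_ (ℚ.*-identityˡ x) (ℚ.*-zeroˡ x)) (ℚ.+-identityʳ x))
⟦⟧-split p?@(no ¬p) x = trans (cong₂ (λ a b → a * x + b * x) (⟦⟧-no p? ¬p) (⟦⟧-yes (¬? p?) ¬p))
  (trans (cong₂ _+_ (ℚ.*-zeroˡ x) (ℚ.*-identityˡ x)) (ℚ.+-identityˡ x))

Σ : List A → (A → ℚ) → ℚ
Σ xs f = sumℚ (map f xs)

Σ-cong∈ : (xs : List A) {f g : A → ℚ} → (∀ {x} → x ∈ xs → f x ≡ g x) → Σ xs f ≡ Σ xs g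
Σ-cong∈ []       e = refl
Σ-cong∈ (x ∷ xs) e = cong₂ _+_ (e (here refl)) (Σ-cong∈ xs (e ∘ there))

Σ-cong : (xs : List A) {f g : A → ℚ} → (∀ x → f x ≡ g x) → Σ xs f ≡ Σ xs g
Σ-cong xs e = Σ-cong∈ xs (λ {x} _ → e x)

Σ-zero : (xs : List A) → Σ xs (λ _ → 0ℚ) ≡ 0ℚ
Σ-zero []       = refl
Σ-zero (x ∷ xs) = trans (ℚ.+-identityˡ _) (Σ-zero xs)

Σ-null : (xs : List A) {f : A → ℚ} → (∀ {x} → x ∈ xs → f x ≡ 0ℚ) → Σ xs f ≡ 0ℚ
Σ-null xs e = trans (Σ-cong∈ xs e) (Σ-zero xs)

+-interchange : ∀ a b c d → (a + b) + (c + d) ≡ (a + c) + (b + d)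
+-interchange = solve 4 (λ a b c d → (a :+ b) :+ (c :+ d) := (a :+ c) :+ (b :+ d)) refl
  where open +-*-Solver

*-interchange : ∀ a b c d → (a * b) * (c * d) ≡ (a * c) * (b * d)
*-interchange = solve 4 (λ a b c d → (a :* b) :* (c :* d) := (a :* c) :* (b :* d)) refl
  where open +-*-Solver

x*yz≡y*xz : ∀ x y z → x * (y * z) ≡ y * (x * z)
x*yz≡y*xz = solve 3 (λ x y z → x :* (y :* z) := y :* (x :* z)) refl
  where open +-*-Solver

Σ-+ : (xs : List A) (f g : A → ℚ) → Σ xs (λ x → f x + g x) ≡ Σ xs f + Σ xs g
Σ-+ []       f g = refl
Σ-+ (x ∷ xs) f g = trans (cong ((f x + g x) +_) (Σ-+ xs f g))
  (+-interchange (f x) (g x) (Σ xs f) (Σ xs g))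

Σ-*ˡ : (xs : List A) (c : ℚ) (f : A → ℚ) → Σ xs (λ x → c * f x) ≡ c * Σ xs f
Σ-*ˡ []       c f = sym (ℚ.*-zeroʳ c)
Σ-*ˡ (x ∷ xs) c f = trans (cong (c * f x +_) (Σ-*ˡ xs c f)) (sym (ℚ.*-distribˡ-+ c (f x) (Σ xs f)))

Σ-*ʳ : (xs : List A) (c : ℚ) (f : A → ℚ) → Σ xs (λ x → f x * c) ≡ Σ xs f * c
Σ-*ʳ xs c f = trans (Σ-cong xs λ x → ℚ.*-comm (f x) c) (trans (Σ-*ˡ xs c f) (ℚ.*-comm c _))

Σ-swap : (xs : List A) (ys : List B) (f : A → B → ℚ) →
         Σ xs (λ x → Σ ys (f x)) ≡ Σ ys (λ y → Σ xs (λ x → f x y))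
Σ-swap []       ys f = sym (Σ-zero ys)
Σ-swap (x ∷ xs) ys f = trans (cong (Σ ys (f x) +_) (Σ-swap xs ys f)) (sym (Σ-+ ys (f x) _))

Σ-++ : (xs ys : List A) (f : A → ℚ) → Σ (xs ++ ys) f ≡ Σ xs f + Σ ys f
Σ-++ []       ys f = sym (ℚ.+-identityˡ _)
Σ-++ (x ∷ xs) ys f = trans (cong (f x +_) (Σ-++ xs ys f)) (sym (ℚ.+-assoc (f x) _ _))

Σ-map : (xs : List A) (g : A → B) (f : B → ℚ) → Σ (map g xs) f ≡ Σ xs (f ∘ g)
Σ-map xs g f = cong sumℚ (sym (map-∘ xs))

Σ-prodWith : (g : A → B → C) (xs : List A) (ys : List B) (f : C → ℚ) →
             Σ (cartesianProductWith g xs ys) f ≡ Σ xs (λ x → Σ ys (λ y → f (g x y)))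
Σ-prodWith g []       ys f = refl
Σ-prodWith g (x ∷ xs) ys f = trans (Σ-++ (map (g x) ys) _ f)
  (cong₂ _+_ (Σ-map ys (g x) f) (Σ-prodWith g xs ys f))

Σ-prod : (xs : List A) (ys : List B) (f : A × B → ℚ) →
         Σ (cartesianProduct xs ys) f ≡ Σ xs (λ x → Σ ys (λ y → f (x , y)))
Σ-prod = Σ-prodWith _,_

Σ-*-Σ : (xs : List A) (ys : List B) (f : A → ℚ) (g : B → ℚ) →
        Σ xs (λ x → Σ ys (λ y → f x * g y)) ≡ Σ xs f * Σ ys g
Σ-*-Σ xs ys f g = trans (Σ-cong xs λ x → Σ-*ˡ ys (f x) g) (Σ-*ʳ xs (Σ ys g) f)

Σ-filter : {P : A → Set} (P? : ∀ x → Dec (P x)) (xs : List A) (f : A → ℚ) →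
           Σ (filter P? xs) f ≡ Σ xs (λ x → ⟦ P? x ⟧ * f x)
Σ-filter P? []       f = refl
Σ-filter P? (x ∷ xs) f with P? x
... | p?@(yes p) = cong₂ _+_ (sym (trans (cong (_* f x) (⟦⟧-yes p? p)) (ℚ.*-identityˡ (f x))))
  (Σ-filter P? xs f)
... | p?@(no ¬p) = trans (Σ-filter P? xs f)
  (sym (trans (cong (_+ rest) (trans (cong (_* f x) (⟦⟧-no p? ¬p)) (ℚ.*-zeroˡ (f x))))
      (ℚ.+-identityˡ rest)))
  where rest = Σ xs (λ x → ⟦ P? x ⟧ * f x)

fromℕ-length : (xs : List A) → fromℕ (length xs) ≡ Σ xs (λ _ → 1ℚ)
fromℕ-length []       = refl
fromℕ-length (x ∷ xs) = trans (fromℕ-suc (length xs)) (cong (1ℚ +_) (fromℕ-length xs))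

fromℕ-count : {P : A → Set} (P? : ∀ x → Dec (P x)) (xs : List A) →
              fromℕ (length (filter P? xs)) ≡ Σ xs (λ x → ⟦ P? x ⟧)
fromℕ-count P? xs = trans (fromℕ-length (filter P? xs))
  (trans (Σ-filter P? xs _) (Σ-cong xs λ x → ℚ.*-identityʳ _))

Σ-point : {xs : List A} → Unique xs → ∀ {a} → a ∈ xs → {f : A → ℚ} →
          (∀ {x} → x ∈ xs → x ≢ a → f x ≡ 0ℚ) → Σ xs f ≡ f a
Σ-point (x∉ ∷ !xs) (here refl) {f} e =
  trans (cong (f _ +_) (Σ-null _ λ i → e (there i) (λ { refl → All.lookup x∉ i refl })))
        (ℚ.+-identityʳ _)
Σ-point (x∉ ∷ !xs) (there i) {f} e =
  trans (cong₂ _+_ (e (here refl) (λ { refl → All.lookup x∉ i refl })) (Σ-point !xs i (e ∘ there)))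
        (ℚ.+-identityˡ _)

Σ-indicator : {xs : List A} → Unique xs → ∀ {a} → a ∈ xs →
              {P : A → Set} (P? : ∀ x → Dec (P x)) → P a → (∀ {x} → x ∈ xs → P x → x ≡ a) →
              (f : A → ℚ) → Σ xs (λ x → ⟦ P? x ⟧ * f x) ≡ f a
Σ-indicator !xs {a} i P? pa un f = trans
  (Σ-point !xs i λ {x} j x≢a → trans (cong (_* f x) (⟦⟧-no (P? x) (x≢a ∘ un j))) (ℚ.*-zeroˡ (f x)))
  (trans (cong (_* f a) (⟦⟧-yes (P? a) pa)) (ℚ.*-identityˡ (f a)))

Σ-one : {xs : List A} → Unique xs → ∀ {a} → a ∈ xs →
        {P : A → Set} (P? : ∀ x → Dec (P x)) → P a → (∀ {x} → x ∈ xs → P x → x ≡ a) →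
        Σ xs (λ x → ⟦ P? x ⟧) ≡ 1ℚ
Σ-one {xs = xs} !xs i P? pa un = trans (Σ-cong xs λ x → sym (ℚ.*-identityʳ _))
  (Σ-indicator !xs i P? pa un (λ _ → 1ℚ))

-- Double counting of the pairs related by M.  A relation is used instead of a bijection since
-- the elements are often functions, which can be compared only pointwise.

Σ-match : (xs : List A) (ys : List B) {M : A → B → Set} (M? : ∀ x y → Dec (M x y)) →
          (∀ {x} → x ∈ xs → Σ ys (λ y → ⟦ M? x y ⟧) ≡ 1ℚ) →
          (∀ {y} → y ∈ ys → Σ xs (λ x → ⟦ M? x y ⟧) ≡ 1ℚ) →
          {f : A → ℚ} {g : B → ℚ} → (∀ {x y} → x ∈ xs → y ∈ ys → M x y → f x ≡ g y) →
          Σ xs f ≡ Σ ys g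
Σ-match xs ys M? l r {f} {g} e = begin
  Σ xs f
    ≡⟨ Σ-cong∈ xs (λ {x} i → trans (sym (ℚ.*-identityˡ (f x)))
         (trans (cong (_* f x) (sym (l i))) (sym (Σ-*ʳ ys (f x) _)))) ⟩
  Σ xs (λ x → Σ ys (λ y → ⟦ M? x y ⟧ * f x))
    ≡⟨ Σ-cong∈ xs (λ {x} i → Σ-cong∈ ys λ {y} j →
         ⟦⟧*-cong (M? x y) (e i j)) ⟩
  Σ xs (λ x → Σ ys (λ y → ⟦ M? x y ⟧ * g y))
    ≡⟨ Σ-swap xs ys _ ⟩
  Σ ys (λ y → Σ xs (λ x → ⟦ M? x y ⟧ * g y))
    ≡⟨ Σ-cong∈ ys (λ {y} j → trans (Σ-*ʳ xs (g y) _)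
         (trans (cong (_* g y) (r j)) (ℚ.*-identityˡ (g y)))) ⟩
  Σ ys g ∎
  where open ≡-Reasoning

Σ< : ℕ → (ℕ → ℚ) → ℚ
Σ< n = Σ (upTo n)

sum-applyUpTo : ∀ (f : ℕ → ℚ) n → sumℚ (applyUpTo f n) ≡ Σ< n f
sum-applyUpTo f n = cong sumℚ (sym (map-applyUpTo id f n))

Σ<-suc : ∀ n f → Σ< (suc n) f ≡ f 0 + Σ< n (f ∘ suc)
Σ<-suc n f = trans (sym (sum-applyUpTo f (suc n))) (cong (f 0 +_) (sum-applyUpTo (f ∘ suc) n))

Σ<-cong : ∀ n {f g} → (∀ {i} → i ℕ.< n → f i ≡ g i) → Σ< n f ≡ Σ< n g
Σ<-cong n e = Σ-cong∈ (upTo n) (e ∘ ∈-upTo⁻)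

Σ<-extend : ∀ {m n} f → m ℕ.≤ n → (∀ i → m ℕ.≤ i → f i ≡ 0ℚ) → Σ< n f ≡ Σ< m f
Σ<-extend {zero}  {n}     f _           e = Σ-null (upTo n) λ {i} _ → e i ℕ.z≤n
Σ<-extend {suc m} {suc n} f (ℕ.s≤s m≤n) e = trans (Σ<-suc n f)
  (trans (cong (f 0 +_) (Σ<-extend (f ∘ suc) m≤n (λ i p → e (suc i) (ℕ.s≤s p)))) (sym (Σ<-suc m f)))

Σ-same : DecidableEquality A → {xs ys : List A} → Unique xs → Unique ys →
         (∀ {x} → x ∈ xs → x ∈ ys) → (∀ {x} → x ∈ ys → x ∈ xs) →
         {f : A → ℚ} → Σ xs f ≡ Σ ys f
Σ-same _≟_ {xs} {ys} !xs !ys l r {f} = Σ-match xs ys {M = _≡_} _≟_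
  (λ {x} i → Σ-one !ys (l i) (x ≟_) refl (λ _ → sym))
  (λ {y} j → Σ-one !xs (r j) (_≟ y) refl (λ _ → id))
  (λ _ _ → cong f)

-- Exponent sequences, monomials and their factorisations

at-nothing : ∀ i → at nothing i ≡ 0
at-nothing zero    = refl
at-nothing (suc i) = at-nothing i

at-◂ : ∀ n m i → at (n ◂ m) (suc i) ≡ at m i
at-◂ n m i = cong (λ m → at m i) (tail-◂ n m)

head◂tail : ∀ m → head m ◂ tail m ≡ m
head◂tail nothing             = refl
head◂tail (just [1+ _ ])      = refl
head◂tail (just (zero ∷ _))   = refl
head◂tail (just (suc _ ∷ _))  = refl

at⁺-nonzero : ∀ m → ∃ λ i → at (just m) i ≢ 0
at⁺-nonzero [1+ _ ] = 0 , λ ()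
at⁺-nonzero (_ ∷ m) = let i , p = at⁺-nonzero m in suc i , p

-- The last entry of an `Exponents⁺` is positive, so two sequences of different lengths differ at
-- the end of the longer one.
at⁺-injective : ∀ m n → (∀ i → at (just m) i ≡ at (just n) i) → m ≡ n
at⁺-injective [1+ a ] [1+ b ] e = cong [1+_] (ℕ.suc-injective (e 0))
at⁺-injective [1+ a ] (b ∷ n) e =
  let i , p = at⁺-nonzero n in contradiction (trans (sym (e (suc i))) (at-nothing i)) p
at⁺-injective (a ∷ m) [1+ b ] e =
  let i , p = at⁺-nonzero m in contradiction (trans (e (suc i)) (at-nothing i)) p
at⁺-injective (a ∷ m) (b ∷ n) e = cong₂ _∷_ (e 0) (at⁺-injective m n (e ∘ suc))

at-injective : ∀ m n → (∀ i → at m i ≡ at n i) → m ≡ n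
at-injective nothing  nothing  e = refl
at-injective nothing  (just n) e =
  let i , p = at⁺-nonzero n in contradiction (trans (sym (e i)) (at-nothing i)) p
at-injective (just m) nothing  e =
  let i , p = at⁺-nonzero m in contradiction (trans (e i) (at-nothing i)) p
at-injective (just m) (just n) e = cong just (at⁺-injective m n e)

at-adjustAt : ∀ f i m → at (adjustAt f i m) i ≡ f (at m i)
at-adjustAt f zero    m = head-◂ _ (tail m)
at-adjustAt f (suc i) m = trans (at-◂ (head m) _ i) (at-adjustAt f i (tail m))

at-adjustAt-≢ : ∀ f i m j → j ≢ i → at (adjustAt f i m) j ≡ at m j
at-adjustAt-≢ f zero    m zero    p = contradiction refl p
at-adjustAt-≢ f zero    m (suc j) p = at-◂ (f (head m)) (tail m) j
at-adjustAt-≢ f (suc i) m zero    p = head-◂ (head m) _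
at-adjustAt-≢ f (suc i) m (suc j) p =
  trans (at-◂ (head m) _ j) (at-adjustAt-≢ f i (tail m) j (p ∘ cong suc))

infixl 7 _⊞_ _✶_

_⊞⁺_ : Exponents⁺ → Exponents⁺ → Exponents⁺
[1+ a ] ⊞⁺ [1+ b ] = [1+ a ℕ.+ suc b ]
[1+ a ] ⊞⁺ (b ∷ n) = (suc a ℕ.+ b) ∷ n
(a ∷ m) ⊞⁺ [1+ b ] = (a ℕ.+ suc b) ∷ m
(a ∷ m) ⊞⁺ (b ∷ n) = (a ℕ.+ b) ∷ (m ⊞⁺ n)

_⊞_ : Exponents → Exponents → Exponents
nothing ⊞ n       = n
just m  ⊞ nothing = just m
just m  ⊞ just n  = just (m ⊞⁺ n)

at-⊞⁺ : ∀ m n i → at (just (m ⊞⁺ n)) i ≡ at (just m) i ℕ.+ at (just n) i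
at-⊞⁺ [1+ a ] [1+ b ] zero    = refl
at-⊞⁺ [1+ a ] [1+ b ] (suc i) rewrite at-nothing i = refl
at-⊞⁺ [1+ a ] (b ∷ n) zero    = refl
at-⊞⁺ [1+ a ] (b ∷ n) (suc i) rewrite at-nothing i = refl
at-⊞⁺ (a ∷ m) [1+ b ] zero    = refl
at-⊞⁺ (a ∷ m) [1+ b ] (suc i) rewrite at-nothing i = sym (ℕ.+-identityʳ _)
at-⊞⁺ (a ∷ m) (b ∷ n) zero    = refl
at-⊞⁺ (a ∷ m) (b ∷ n) (suc i) = at-⊞⁺ m n i

at-⊞ : ∀ m n i → at (m ⊞ n) i ≡ at m i ℕ.+ at n i
at-⊞ nothing  n        i = cong (ℕ._+ at n i) (sym (at-nothing i))
at-⊞ (just m) nothing  i = sym (trans (cong (at (just m) i ℕ.+_) (at-nothing i)) (ℕ.+-identityʳ _))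
at-⊞ (just m) (just n) i = at-⊞⁺ m n i

_≟ˣ_ : DecidableEquality Variable
s ≟ˣ s = yes refl
s ≟ˣ u = no λ ()
s ≟ˣ v = no λ ()
s ≟ˣ t[1+ j ] = no λ ()
u ≟ˣ s = no λ ()
u ≟ˣ u = yes refl
u ≟ˣ v = no λ ()
u ≟ˣ t[1+ j ] = no λ ()
v ≟ˣ s = no λ ()
v ≟ˣ u = no λ ()
v ≟ˣ v = yes refl
v ≟ˣ t[1+ j ] = no λ ()
t[1+ i ] ≟ˣ s = no λ ()
t[1+ i ] ≟ˣ u = no λ ()
t[1+ i ] ≟ˣ v = no λ ()
t[1+ i ] ≟ˣ t[1+ j ] = map′ (cong t[1+_]) (λ { refl → refl }) (i ℕ.≟ j)

_≟ᵉ_ : DecidableEquality Exponents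
_≟ᵉ_ = Maybe.≡-dec _≟⁺_

opaque
  _≟ᵐ_ : DecidableEquality Monomial
  mono d k l m ≟ᵐ mono d′ k′ l′ m′ = map′ (λ { (refl , refl , refl , refl) → refl })
    (λ { refl → refl , refl , refl , refl })
    ((d ℕ.≟ d′) ×-dec (k ℕ.≟ k′) ×-dec (l ℕ.≟ l′) ×-dec (m ≟ᵉ m′))

-- Reduces every identity between monomials to identities in ℕ, one for each variable.
exponent-injective : ∀ μ ν → (∀ x → exponent x μ ≡ exponent x ν) → μ ≡ ν
exponent-injective (mono d k l m) (mono d′ k′ l′ m′) e
  with refl ← e s | refl ← e u | refl ← e v | refl ← at-injective m m′ (e ∘ t[1+_]) = refl

exponent-adjust : ∀ f x μ → exponent x (adjust f x μ) ≡ f (exponent x μ)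
exponent-adjust f s        μ = refl
exponent-adjust f u        μ = refl
exponent-adjust f v        μ = refl
exponent-adjust f t[1+ i ] μ = at-adjustAt f i (exp-t μ)

exponent-adjust-≢ : ∀ f x μ y → y ≢ x → exponent y (adjust f x μ) ≡ exponent y μ
exponent-adjust-≢ f s μ s        p = contradiction refl p
exponent-adjust-≢ f s μ u        p = refl
exponent-adjust-≢ f s μ v        p = refl
exponent-adjust-≢ f s μ t[1+ j ] p = refl
exponent-adjust-≢ f u μ s        p = refl
exponent-adjust-≢ f u μ u        p = contradiction refl p
exponent-adjust-≢ f u μ v        p = refl
exponent-adjust-≢ f u μ t[1+ j ] p = refl
exponent-adjust-≢ f v μ s        p = refl
exponent-adjust-≢ f v μ u        p = refl
exponent-adjust-≢ f v μ v        p = contradiction refl p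
exponent-adjust-≢ f v μ t[1+ j ] p = refl
exponent-adjust-≢ f t[1+ i ] μ s        p = refl
exponent-adjust-≢ f t[1+ i ] μ u        p = refl
exponent-adjust-≢ f t[1+ i ] μ v        p = refl
exponent-adjust-≢ f t[1+ i ] μ t[1+ j ] p = at-adjustAt-≢ f i (exp-t μ) j (p ∘ cong t[1+_])

_✶_ : Monomial → Monomial → Monomial
mono d k l m ✶ mono d′ k′ l′ m′ = mono (d ℕ.+ d′) (k ℕ.+ k′) (l ℕ.+ l′) (m ⊞ m′)

exponent-✶ : ∀ x μ ν → exponent x (μ ✶ ν) ≡ exponent x μ ℕ.+ exponent x ν
exponent-✶ s        μ ν = refl
exponent-✶ u        μ ν = refl
exponent-✶ v        μ ν = refl
exponent-✶ t[1+ i ] μ ν = at-⊞ (exp-t μ) (exp-t ν) i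

✶-comm : ∀ μ ν → μ ✶ ν ≡ ν ✶ μ
✶-comm μ ν = exponent-injective _ _ λ x →
  trans (exponent-✶ x μ ν) (trans (ℕ.+-comm (exponent x μ) _) (sym (exponent-✶ x ν μ)))

✶-assoc : ∀ μ ν ξ → (μ ✶ ν) ✶ ξ ≡ μ ✶ (ν ✶ ξ)
✶-assoc μ ν ξ = exponent-injective _ _ λ x → begin
  exponent x ((μ ✶ ν) ✶ ξ)
    ≡⟨ exponent-✶ x (μ ✶ ν) ξ ⟩
  exponent x (μ ✶ ν) ℕ.+ exponent x ξ
    ≡⟨ cong (ℕ._+ exponent x ξ) (exponent-✶ x μ ν) ⟩
  exponent x μ ℕ.+ exponent x ν ℕ.+ exponent x ξ
    ≡⟨ ℕ.+-assoc (exponent x μ) (exponent x ν) (exponent x ξ) ⟩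
  exponent x μ ℕ.+ (exponent x ν ℕ.+ exponent x ξ)
    ≡⟨ cong (exponent x μ ℕ.+_) (exponent-✶ x ν ξ) ⟨
  exponent x μ ℕ.+ exponent x (ν ✶ ξ)
    ≡⟨ exponent-✶ x μ (ν ✶ ξ) ⟨
  exponent x (μ ✶ (ν ✶ ξ)) ∎
  where open ≡-Reasoning

✶-cancelˡ : ∀ μ {ν ξ} → μ ✶ ν ≡ μ ✶ ξ → ν ≡ ξ
✶-cancelˡ μ {ν} {ξ} e = exponent-injective ν ξ λ x → ℕ.+-cancelˡ-≡ (exponent x μ) _ _
  (trans (sym (exponent-✶ x μ ν)) (trans (cong (exponent x) e) (exponent-✶ x μ ξ)))

one : Monomial
one = mono 0 0 0 nothing

✶-identityʳ : ∀ μ → μ ✶ one ≡ μ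
✶-identityʳ μ = ✶-comm μ one

var : Variable → Monomial
var x = adjust suc x one

exponent-one : ∀ x → exponent x one ≡ 0
exponent-one s        = refl
exponent-one u        = refl
exponent-one v        = refl
exponent-one t[1+ i ] = at-nothing i

adjust-suc : ∀ x μ → adjust suc x μ ≡ var x ✶ μ
adjust-suc x μ = exponent-injective _ _ λ y → trans (go y) (sym (exponent-✶ y (var x) μ))
  where
  go : ∀ y → exponent y (adjust suc x μ) ≡ exponent y (var x) ℕ.+ exponent y μ
  go y with y ≟ˣ x
  ... | yes refl = trans (exponent-adjust suc x μ)
    (cong (ℕ._+ exponent x μ) (sym (trans (exponent-adjust suc x one) (cong suc (exponent-one x)))))
  ... | no y≢x = trans (exponent-adjust-≢ suc x μ y y≢x)
    (cong (ℕ._+ exponent y μ) (sym (trans (exponent-adjust-≢ suc x one y y≢x) (exponent-one y))))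

adjust-pred-suc : ∀ x μ → adjust pred x (adjust suc x μ) ≡ μ
adjust-pred-suc x μ = exponent-injective _ _ go
  where
  go : ∀ y → exponent y (adjust pred x (adjust suc x μ)) ≡ exponent y μ
  go y with y ≟ˣ x
  ... | yes refl = trans (exponent-adjust pred x _) (cong pred (exponent-adjust suc x μ))
  ... | no y≢x = trans (exponent-adjust-≢ pred x _ y y≢x) (exponent-adjust-≢ suc x μ y y≢x)

adjust-suc-pred : ∀ x μ → exponent x μ ≢ 0 → adjust suc x (adjust pred x μ) ≡ μ
adjust-suc-pred x μ p = exponent-injective _ _ go
  where
  suc-pred : ∀ n → n ≢ 0 → suc (pred n) ≡ n
  suc-pred zero    q = contradiction refl q
  suc-pred (suc n) q = refl
  go : ∀ y → exponent y (adjust suc x (adjust pred x μ)) ≡ exponent y μ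
  go y with y ≟ˣ x
  ... | yes refl = trans (exponent-adjust suc x _)
    (trans (cong suc (exponent-adjust pred x μ)) (suc-pred _ p))
  ... | no y≢x = trans (exponent-adjust-≢ suc x _ y y≢x) (exponent-adjust-≢ pred x μ y y≢x)

exponent-adjust-suc : ∀ x μ → exponent x (adjust suc x μ) ≢ 0
exponent-adjust-suc x μ e with () ← trans (sym e) (exponent-adjust suc x μ)

∈-splitsℕ⁺ : ∀ {n a b} → a ℕ.+ b ≡ n → (a , b) ∈ splitsℕ n
∈-splitsℕ⁺ {n} {a} {b} refl = subst (λ c → (a , c) ∈ splitsℕ n) (ℕ.m+n∸m≡n a b)
  (∈-map⁺ _ (∈-upTo⁺ (ℕ.s≤s (ℕ.m≤m+n a b))))

∈-splitsℕ⁻ : ∀ {n a b} → (a , b) ∈ splitsℕ n → a ℕ.+ b ≡ n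
∈-splitsℕ⁻ i with _ , a∈ , refl ← ∈-map⁻ _ i = ℕ.m+[n∸m]≡n (ℕ.≤-pred (∈-upTo⁻ a∈))

splitsℕ-unique : ∀ n → Unique (splitsℕ n)
splitsℕ-unique n = Unique.map⁺ (cong proj₁) (Unique.upTo⁺ (suc n))

∈-splits⁺⁺ : ∀ m {x y} → (∀ i → at x i ℕ.+ at y i ≡ at (just m) i) → (x , y) ∈ splits⁺ m
∈-splits⁺⁺ [1+ n ] {x} {y} e =
  subst (_∈ splits⁺ [1+ n ]) (cong₂ _,_ (trans (cong (head x ◂_) (sym x′≡0)) (head◂tail x))
                                        (trans (cong (head y ◂_) (sym y′≡0)) (head◂tail y)))
    (∈-map⁺ _ (∈-splitsℕ⁺ (e 0)))
  where
  x′≡0 : tail x ≡ nothing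
  x′≡0 = at-injective _ _ λ i → trans (ℕ.m+n≡0⇒m≡0 _ (trans (e (suc i)) (at-nothing i)))
      (sym (at-nothing i))
  y′≡0 : tail y ≡ nothing
  y′≡0 = at-injective _ _ λ i → trans
      (ℕ.m+n≡0⇒n≡0 (at x (suc i)) (trans (e (suc i)) (at-nothing i))) (sym (at-nothing i))
∈-splits⁺⁺ (n ∷ m) {x} {y} e =
  subst (_∈ splits⁺ (n ∷ m)) (cong₂ _,_ (head◂tail x) (head◂tail y))
    (∈-cartesianProductWith⁺ (λ (a , b) (x , y) → (a ◂ x) , (b ◂ y)) (∈-splitsℕ⁺ (e 0))
        (∈-splits⁺⁺ m (e ∘ suc)))

∈-splits⁺⁻ : ∀ m {x y} → (x , y) ∈ splits⁺ m → ∀ i → at x i ℕ.+ at y i ≡ at (just m) i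
∈-splits⁺⁻ [1+ n ] p i with (a , b) , q , refl ← ∈-map⁻ _ p = go i
  where
  go : ∀ i → at (a ◂ nothing) i ℕ.+ at (b ◂ nothing) i ≡ at (just [1+ n ]) i
  go zero    = trans (cong₂ ℕ._+_ (head-◂ a nothing) (head-◂ b nothing)) (∈-splitsℕ⁻ q)
  go (suc i) = trans (cong₂ ℕ._+_ (at-◂ a nothing i) (at-◂ b nothing i))
    (trans (cong (ℕ._+ at nothing i) (at-nothing i)) refl)
∈-splits⁺⁻ (n ∷ m) p i
  with (a , b) , (x , y) , q , r , refl ← ∈-cartesianProductWith⁻
      (λ (a , b) (x , y) → (a ◂ x) , (b ◂ y)) (splitsℕ n) (splits⁺ m) p = go i
  where
  go : ∀ i → at (a ◂ x) i ℕ.+ at (b ◂ y) i ≡ at (just (n ∷ m)) i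
  go zero    = trans (cong₂ ℕ._+_ (head-◂ a x) (head-◂ b y)) (∈-splitsℕ⁻ q)
  go (suc i) = trans (cong₂ ℕ._+_ (at-◂ a x i) (at-◂ b y i)) (∈-splits⁺⁻ m r i)

∈-splitsᵗ⁺ : ∀ m {x y} → x ⊞ y ≡ m → (x , y) ∈ splitsᵗ m
∈-splitsᵗ⁺ nothing  {nothing} {nothing} e = here refl
∈-splitsᵗ⁺ nothing  {just _}  {nothing} ()
∈-splitsᵗ⁺ nothing  {just _}  {just _}  ()
∈-splitsᵗ⁺ nothing  {nothing} {just _}  ()
∈-splitsᵗ⁺ (just m) {x} {y} e = ∈-splits⁺⁺ m λ i → trans (sym (at-⊞ x y i)) (cong (λ m → at m i) e)

∈-splitsᵗ⁻ : ∀ m {x y} → (x , y) ∈ splitsᵗ m → x ⊞ y ≡ m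
∈-splitsᵗ⁻ nothing  (here refl)   = refl
∈-splitsᵗ⁻ (just m) {x} {y} p = at-injective _ _ λ i → trans (at-⊞ x y i) (∈-splits⁺⁻ m p i)

◂-injective : ∀ {a b x y} → a ◂ x ≡ b ◂ y → a ≡ b × x ≡ y
◂-injective {a} {b} {x} {y} e =
    trans (sym (head-◂ a x)) (trans (cong head e) (head-◂ b y))
  , trans (sym (tail-◂ a x)) (trans (cong tail e) (tail-◂ b y))

splits⁺-unique : ∀ m → Unique (splits⁺ m)
splits⁺-unique [1+ n ] = Unique.map⁺
  (λ e → cong₂ _,_ (proj₁ (◂-injective (cong proj₁ e))) (proj₁ (◂-injective (cong proj₂ e))))
  (splitsℕ-unique (suc n))
splits⁺-unique (n ∷ m) = Unique.cartesianProductWith⁺ _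
  (λ e → cong₂ _,_ (proj₁ (◂-injective (cong proj₁ e))) (proj₁ (◂-injective (cong proj₂ e)))
       , cong₂ _,_ (proj₂ (◂-injective (cong proj₁ e))) (proj₂ (◂-injective (cong proj₂ e))))
  (splitsℕ-unique n) (splits⁺-unique m)

splitsᵗ-unique : ∀ m → Unique (splitsᵗ m)
splitsᵗ-unique nothing  = [] ∷ []
splitsᵗ-unique (just m) = splits⁺-unique m

∈-splits⁺ : ∀ μ {α β} → α ✶ β ≡ μ → (α , β) ∈ splits μ
∈-splits⁺ (mono d k l m) {mono a b c x} {mono a′ b′ c′ x′} refl =
  ∈-map⁺ (λ ((a , a′) , (b , b′) , (c , c′) , (x , x′)) → mono a b c x , mono a′ b′ c′ x′)
    (∈-cartesianProduct⁺ (∈-splitsℕ⁺ {d} {a} refl) (∈-cartesianProduct⁺ (∈-splitsℕ⁺ {k} {b} refl)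
      (∈-cartesianProduct⁺ (∈-splitsℕ⁺ {l} {c} refl) (∈-splitsᵗ⁺ m {x} {x′} refl))))

∈-splits⁻ : ∀ μ {α β} → (α , β) ∈ splits μ → α ✶ β ≡ μ
∈-splits⁻ (mono d k l m) i
  with _ , j , refl ← ∈-map⁻ _ i
  with p , j ← ∈-cartesianProduct⁻ (splitsℕ d) _ j
  with q , j ← ∈-cartesianProduct⁻ (splitsℕ k) _ j
  with r , j ← ∈-cartesianProduct⁻ (splitsℕ l) _ j
  with refl ← ∈-splitsℕ⁻ {d} p | refl ← ∈-splitsℕ⁻ {k} q | refl ← ∈-splitsℕ⁻ {l} r | refl ←
      ∈-splitsᵗ⁻ m j = refl

splits-unique : ∀ μ → Unique (splits μ)
splits-unique (mono d k l m) = Unique.map⁺ (λ { refl → refl })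
  (Unique.cartesianProduct⁺ (splitsℕ-unique d) (Unique.cartesianProduct⁺ (splitsℕ-unique k)
    (Unique.cartesianProduct⁺ (splitsℕ-unique l) (splitsᵗ-unique m))))

divisors : Monomial → List Monomial
divisors μ = map proj₁ (splits μ)

∈-divisors⁺ : ∀ μ {α} β → α ✶ β ≡ μ → α ∈ divisors μ
∈-divisors⁺ μ β e = ∈-map⁺ proj₁ (∈-splits⁺ μ e)

∈-divisors⁻ : ∀ μ {α} → α ∈ divisors μ → ∃ λ β → α ✶ β ≡ μ
∈-divisors⁻ μ i with (α , β) , j , refl ← ∈-map⁻ proj₁ {xs = splits μ} i = β , ∈-splits⁻ μ j

divisors-unique : ∀ μ → Unique (divisors μ)
divisors-unique μ = go (splits μ) (splits-unique μ) (∈-splits⁻ μ)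
  where
  open import Data.List.Relation.Unary.All.Properties as All using ()
  import Data.List.Relation.Unary.All as All
  go : ∀ xs → Unique xs → (∀ {α β} → (α , β) ∈ xs → α ✶ β ≡ μ) → Unique (map proj₁ xs)
  go []             _         e = []
  go ((α , β) ∷ xs) (x∉ ∷ !xs) e =
    All.map⁺ (All.tabulate λ { {α′ , β′} i refl → All.lookup x∉ i
      (cong (α ,_) (✶-cancelˡ α (trans (e (here refl)) (sym (e (there i)))))) })
    ∷ go xs !xs (e ∘ there)

-- On the left the index set depends on `ρ`; on the right only the indicator does. This allows a sum
-- over `ρ` to be exchanged with the sum over its factorisations, which associativity of `⊗`
-- requires.
Σ-splits : ∀ μ ρ → ρ ∈ divisors μ → (f : Monomial × Monomial → ℚ) →
           Σ (splits ρ) f ≡ Σ (divisors μ) λ α → Σ (divisors μ) λ β → ⟦ (α ✶ β) ≟ᵐ ρ ⟧ * f (α , β)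
Σ-splits μ ρ i f = begin
  Σ (splits ρ) f
    ≡⟨ Σ-same (Product.≡-dec _≟ᵐ_ _≟ᵐ_) (splits-unique ρ)
         (Unique.filter⁺ P? (Unique.cartesianProduct⁺ (divisors-unique μ) (divisors-unique μ)))
         (λ j → ∈-filter⁺ P? (∈-cartesianProduct⁺ (left (∈-splits⁻ ρ j)) (right (∈-splits⁻ ρ j)))
             (∈-splits⁻ ρ j))
         (λ j → ∈-splits⁺ ρ (proj₂ (∈-filter⁻ P? {xs = cartesianProduct D D} j))) ⟩
  Σ (filter P? (cartesianProduct D D)) f
    ≡⟨ Σ-filter P? (cartesianProduct D D) f ⟩
  Σ (cartesianProduct D D) (λ p → ⟦ P? p ⟧ * f p)
    ≡⟨ Σ-prod D D _ ⟩
  Σ D (λ α → Σ D (λ β → ⟦ P? (α , β) ⟧ * f (α , β))) ∎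
  where
  open ≡-Reasoning
  D = divisors μ
  P? : ∀ ((α , β) : Monomial × Monomial) → Dec (α ✶ β ≡ ρ)
  P? (α , β) = (α ✶ β) ≟ᵐ ρ
  left : ∀ {α β} → α ✶ β ≡ ρ → α ∈ D
  left {α} {β} e = let γ , e′ = ∈-divisors⁻ μ i in
    ∈-divisors⁺ μ (β ✶ γ) (trans (sym (✶-assoc α β γ)) (trans (cong (_✶ γ) e) e′))
  right : ∀ {α β} → α ✶ β ≡ ρ → β ∈ D
  right {α} {β} e = left {β} {α} (trans (✶-comm β α) e)

-- Power series

≈-refl : ∀ {G} → G ≈ G
≈-refl μ = refl

≈-sym : ∀ {G H} → G ≈ H → H ≈ G
≈-sym e μ = sym (e μ)

≈-trans : ∀ {G H K} → G ≈ H → H ≈ K → G ≈ K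
≈-trans e f μ = trans (e μ) (f μ)

⊗-cong : ∀ {G G′ H H′} → G ≈ G′ → H ≈ H′ → G ⊗ H ≈ G′ ⊗ H′
⊗-cong e f μ = Σ-cong (splits μ) λ (α , β) → cong₂ _*_ (e α) (f β)

self∈divisors : ∀ μ → μ ∈ divisors μ
self∈divisors μ = ∈-divisors⁺ μ one (✶-identityʳ μ)

⊗-divisors : ∀ G H μ ρ → ρ ∈ divisors μ →
  (G ⊗ H) ρ ≡ Σ (divisors μ) λ α → Σ (divisors μ) λ β → ⟦ (α ✶ β) ≟ᵐ ρ ⟧ * (G α * H β)
⊗-divisors G H μ ρ i = Σ-splits μ ρ i _

⊗-comm : ∀ G H → G ⊗ H ≈ H ⊗ G
⊗-comm G H μ = begin
  (G ⊗ H) μ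
    ≡⟨ ⊗-divisors G H μ μ (self∈divisors μ) ⟩
  Σ D (λ α → Σ D λ β → ⟦ (α ✶ β) ≟ᵐ μ ⟧ * (G α * H β))
    ≡⟨ Σ-swap D D _ ⟩
  Σ D (λ β → Σ D λ α → ⟦ (α ✶ β) ≟ᵐ μ ⟧ * (G α * H β))
    ≡⟨ (Σ-cong D λ β → Σ-cong D λ α → cong₂ _*_
         (⟦⟧-cong ((α ✶ β) ≟ᵐ μ) ((β ✶ α) ≟ᵐ μ) (trans (✶-comm β α)) (trans (✶-comm α β)))
             (ℚ.*-comm (G α) (H β))) ⟩
  Σ D (λ β → Σ D λ α → ⟦ (β ✶ α) ≟ᵐ μ ⟧ * (H β * G α))
    ≡⟨ ⊗-divisors H G μ μ (self∈divisors μ) ⟨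
  (H ⊗ G) μ ∎
  where
  open ≡-Reasoning
  D = divisors μ

private
  ⊗-assoc-expand : ∀ G H K μ → let D = divisors μ in
    ((G ⊗ H) ⊗ K) μ ≡ Σ D λ γ → Σ D λ α → Σ D λ β → ⟦ ((α ✶ β) ✶ γ) ≟ᵐ μ ⟧ * ((G α * H β) * K γ)
  ⊗-assoc-expand G H K μ = begin
    ((G ⊗ H) ⊗ K) μ
      ≡⟨ ⊗-divisors (G ⊗ H) K μ μ (self∈divisors μ) ⟩
    Σ D (λ ρ → Σ D λ γ → ⟦ (ρ ✶ γ) ≟ᵐ μ ⟧ * ((G ⊗ H) ρ * K γ))
      ≡⟨ (Σ-cong∈ D λ {ρ} i → Σ-cong D λ γ → expand ρ i γ) ⟩
    Σ D (λ ρ → Σ D λ γ → Σ D λ α → Σ D λ β → w ρ γ α β * ((G α * H β) * K γ))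
      ≡⟨ Σ-swap D D _ ⟩
    Σ D (λ γ → Σ D λ ρ → Σ D λ α → Σ D λ β → w ρ γ α β * ((G α * H β) * K γ))
      ≡⟨ (Σ-cong D λ γ → trans (Σ-swap D D _) (Σ-cong D λ α → trans (Σ-swap D D _) (Σ-cong D λ β →
            trans (Σ-*ʳ D ((G α * H β) * K γ) _) (cong (_* ((G α * H β) * K γ)) (collapse γ α β)))))
                ⟩
    Σ D (λ γ → Σ D λ α → Σ D λ β → ⟦ ((α ✶ β) ✶ γ) ≟ᵐ μ ⟧ * ((G α * H β) * K γ)) ∎
    where
    open ≡-Reasoning
    D = divisors μ
    w : Monomial → Monomial → Monomial → Monomial → ℚ
    w ρ γ α β = ⟦ (α ✶ β) ≟ᵐ ρ ⟧ * ⟦ (ρ ✶ γ) ≟ᵐ μ ⟧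
    regroup : ∀ a b c d → a * ((b * c) * d) ≡ (b * a) * (c * d)
    regroup = solve 4 (λ a b c d → a :* ((b :* c) :* d) := (b :* a) :* (c :* d)) refl
      where open +-*-Solver
    expand : ∀ ρ → ρ ∈ D → ∀ γ → ⟦ (ρ ✶ γ) ≟ᵐ μ ⟧ * ((G ⊗ H) ρ * K γ) ≡
             Σ D λ α → Σ D λ β → w ρ γ α β * ((G α * H β) * K γ)
    expand ρ i γ = begin
      a * ((G ⊗ H) ρ * K γ)
        ≡⟨ cong (λ z → a * (z * K γ)) (⊗-divisors G H μ ρ i) ⟩
      a * (Σ D (λ α → Σ D λ β → ⟦ (α ✶ β) ≟ᵐ ρ ⟧ * (G α * H β)) * K γ)
        ≡⟨ cong (a *_) (Σ-*ʳ D (K γ) _) ⟨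
      a * Σ D (λ α → Σ D (λ β → ⟦ (α ✶ β) ≟ᵐ ρ ⟧ * (G α * H β)) * K γ)
        ≡⟨ Σ-*ˡ D a _ ⟨
      Σ D (λ α → a * (Σ D (λ β → ⟦ (α ✶ β) ≟ᵐ ρ ⟧ * (G α * H β)) * K γ))
        ≡⟨ (Σ-cong D λ α → trans (cong (a *_) (sym (Σ-*ʳ D (K γ) _))) (trans (sym (Σ-*ˡ D a _))
             (Σ-cong D λ β → regroup a ⟦ (α ✶ β) ≟ᵐ ρ ⟧ (G α * H β) (K γ)))) ⟩
      Σ D (λ α → Σ D λ β → w ρ γ α β * ((G α * H β) * K γ)) ∎
      where a = ⟦ (ρ ✶ γ) ≟ᵐ μ ⟧
    -- Only `ρ = α ✶ β` can contribute. If `(α ✶ β) ✶ γ` is `μ`, this `ρ` is among the divisors of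
    -- `μ`; otherwise every term vanishes, whether `α ✶ β` is a divisor or not.
    collapse : ∀ γ α β → Σ D (λ ρ → w ρ γ α β) ≡ ⟦ ((α ✶ β) ✶ γ) ≟ᵐ μ ⟧
    collapse γ α β = split (((α ✶ β) ✶ γ) ≟ᵐ μ)
      where
      split : Dec ((α ✶ β) ✶ γ ≡ μ) → Σ D (λ ρ → w ρ γ α β) ≡ ⟦ ((α ✶ β) ✶ γ) ≟ᵐ μ ⟧
      split (yes e) = trans (Σ-indicator (divisors-unique μ) (∈-divisors⁺ μ γ e) ((α ✶ β) ≟ᵐ_) refl
                          (λ _ → sym) (λ ρ → ⟦ (ρ ✶ γ) ≟ᵐ μ ⟧))
                        refl
      split (no ¬e) = trans (Σ-null D λ {ρ} _ → null ρ) (sym (⟦⟧-no (((α ✶ β) ✶ γ) ≟ᵐ μ) ¬e))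
        where
        null : ∀ ρ → w ρ γ α β ≡ 0ℚ
        null ρ = trans
          (⟦⟧*-cong ((α ✶ β) ≟ᵐ ρ) (λ { refl → ⟦⟧-no (((α ✶ β) ✶ γ) ≟ᵐ μ) ¬e }))
          (ℚ.*-zeroʳ ⟦ (α ✶ β) ≟ᵐ ρ ⟧)

-- The triple sum of `⊗-assoc-expand` is invariant under cyclic rotation of the three factors, so
-- the left side equals `(H ⊗ K) ⊗ G`, and commutativity does the rest.
⊗-assoc : ∀ G H K → (G ⊗ H) ⊗ K ≈ G ⊗ (H ⊗ K)
⊗-assoc G H K μ = begin
  ((G ⊗ H) ⊗ K) μ
    ≡⟨ ⊗-assoc-expand G H K μ ⟩
  Σ D (λ γ → Σ D λ α → Σ D λ β → ⟦ ((α ✶ β) ✶ γ) ≟ᵐ μ ⟧ * ((G α * H β) * K γ))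
    ≡⟨ Σ-swap D D _ ⟩
  Σ D (λ α → Σ D λ γ → Σ D λ β → ⟦ ((α ✶ β) ✶ γ) ≟ᵐ μ ⟧ * ((G α * H β) * K γ))
    ≡⟨ (Σ-cong D λ α → Σ-swap D D _) ⟩
  Σ D (λ α → Σ D λ β → Σ D λ γ → ⟦ ((α ✶ β) ✶ γ) ≟ᵐ μ ⟧ * ((G α * H β) * K γ))
    ≡⟨ (Σ-cong D λ α → Σ-cong D λ β → Σ-cong D λ γ → cong₂ _*_
         (⟦⟧-cong (((α ✶ β) ✶ γ) ≟ᵐ μ) (((β ✶ γ) ✶ α) ≟ᵐ μ)
           (trans (rotate α β γ)) (trans (sym (rotate α β γ))))
         (trans (ℚ.*-assoc (G α) (H β) (K γ)) (ℚ.*-comm (G α) _))) ⟩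
  Σ D (λ α → Σ D λ β → Σ D λ γ → ⟦ ((β ✶ γ) ✶ α) ≟ᵐ μ ⟧ * ((H β * K γ) * G α))
    ≡⟨ ⊗-assoc-expand H K G μ ⟨
  ((H ⊗ K) ⊗ G) μ
    ≡⟨ ⊗-comm (H ⊗ K) G μ ⟩
  (G ⊗ (H ⊗ K)) μ ∎
  where
  open ≡-Reasoning
  D = divisors μ
  rotate : ∀ α β γ → (β ✶ γ) ✶ α ≡ (α ✶ β) ✶ γ
  rotate α β γ = trans (✶-comm (β ✶ γ) α) (sym (✶-assoc α β γ))

-- The monomial `ν` as a power series. Multiplication by a variable is a product with such a series
-- (`·≈δ⊗`), so its compatibility with `⊗` comes from associativity and commutativity.
δ : Monomial → PowerSeries
δ ν μ = ⟦ ν ≟ᵐ μ ⟧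

δ⊗-at : ∀ ν G μ → (δ ν ⊗ G) (ν ✶ μ) ≡ G μ
δ⊗-at ν G μ = trans (Σ-indicator (splits-unique (ν ✶ μ)) (∈-splits⁺ (ν ✶ μ) refl)
  (λ p → ν ≟ᵐ proj₁ p) refl
  (λ { i refl → cong (ν ,_) (✶-cancelˡ ν (∈-splits⁻ (ν ✶ μ) i)) }) (G ∘ proj₂)) refl

δ⊗-null : ∀ ν G μ → (∀ ξ → ν ✶ ξ ≢ μ) → (δ ν ⊗ G) μ ≡ 0ℚ
δ⊗-null ν G μ n = Σ-null (splits μ) λ {(α , β)} i →
  trans (cong (_* G β) (⟦⟧-no (ν ≟ᵐ α) (λ { refl → n β (∈-splits⁻ μ i) }))) (ℚ.*-zeroˡ (G β))

·-at : ∀ x G μ → (x · G) (adjust suc x μ) ≡ G μ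
·-at x G μ = go (exponent-adjust-suc x μ)
  where
  go : exponent x (adjust suc x μ) ≢ 0 → (x · G) (adjust suc x μ) ≡ G μ
  go p with exponent x (adjust suc x μ)
  ... | zero  = contradiction refl p
  ... | suc _ = cong G (adjust-pred-suc x μ)

-- A view replacing the case distinction in `·`: in the first case the coefficient of `x · G` is one
-- of `G`, in the second it is zero.
data Divisible (x : Variable) : Monomial → Set where
  multiple : ∀ μ → Divisible x (adjust suc x μ)
  coprime  : ∀ {μ} → exponent x μ ≡ 0 → Divisible x μ

divisible : ∀ x μ → Divisible x μ
divisible x μ with exponent x μ ℕ.≟ 0
... | yes p = coprime p
... | no ¬p = subst (Divisible x) (adjust-suc-pred x μ ¬p) (multiple (adjust pred x μ))

·≈δ⊗ : ∀ x G → x · G ≈ δ (var x) ⊗ G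
·≈δ⊗ x G μ with divisible x μ
... | multiple ν = trans (·-at x G ν)
  (sym (trans (cong (δ (var x) ⊗ G) (adjust-suc x ν)) (δ⊗-at (var x) G ν)))
... | coprime p  = trans (·-zero x G μ p) (sym (δ⊗-null (var x) G μ λ ξ e →
  exponent-adjust-suc x ξ (trans (cong (exponent x) (trans (adjust-suc x ξ) e)) p)))

𝟏≈δ : 𝟏 ≈ δ one
𝟏≈δ μ@(mono zero zero zero nothing)  = sym (⟦⟧-yes (one ≟ᵐ μ) refl)
𝟏≈δ μ@(mono zero zero zero (just _)) = sym (⟦⟧-no (one ≟ᵐ μ) λ ())
𝟏≈δ μ@(mono zero zero (suc _) _)     = sym (⟦⟧-no (one ≟ᵐ μ) λ ())
𝟏≈δ μ@(mono zero (suc _) _ _)        = sym (⟦⟧-no (one ≟ᵐ μ) λ ())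
𝟏≈δ μ@(mono (suc _) _ _ _)           = sym (⟦⟧-no (one ≟ᵐ μ) λ ())

⊗-identityˡ : ∀ G → 𝟏 ⊗ G ≈ G
⊗-identityˡ G μ = trans (⊗-cong 𝟏≈δ (≈-refl {G}) μ) (δ⊗-at one G μ)

·-cong : ∀ x {G H} → G ≈ H → x · G ≈ x · H
·-cong x e μ with exponent x μ
... | zero  = refl
... | suc _ = e _

·-⊗ˡ : ∀ x G H → (x · G) ⊗ H ≈ x · (G ⊗ H)
·-⊗ˡ x G H = ≈-trans (⊗-cong (·≈δ⊗ x G) (≈-refl {H}))
  (≈-trans (⊗-assoc (δ (var x)) G H) (≈-sym (·≈δ⊗ x (G ⊗ H))))

·-⊗ʳ : ∀ x G H → G ⊗ (x · H) ≈ x · (G ⊗ H)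
·-⊗ʳ x G H = ≈-trans (⊗-comm G (x · H)) (≈-trans (·-⊗ˡ x H G) (·-cong x (⊗-comm H G)))

·-injective : ∀ x {G H} → x · G ≈ x · H → G ≈ H
·-injective x {G} {H} e μ = trans (sym (·-at x G μ)) (trans (e (adjust suc x μ)) (·-at x H μ))

·-⊕ : ∀ x G H → x · (G ⊕ H) ≈ x · G ⊕ x · H
·-⊕ x G H μ with exponent x μ
... | zero  = refl
... | suc _ = refl

·-• : ∀ x q G → x · q • G ≈ q • x · G
·-• x q G μ with exponent x μ
... | zero  = sym (ℚ.*-zeroʳ q)
... | suc _ = refl

⊗-distribˡ : ∀ G H K → G ⊗ (H ⊕ K) ≈ G ⊗ H ⊕ G ⊗ K
⊗-distribˡ G H K μ = trans (Σ-cong (splits μ) λ (α , β) → ℚ.*-distribˡ-+ (G α) (H β) (K β))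
  (Σ-+ (splits μ) _ _)

⊗-distribʳ : ∀ G H K → (H ⊕ K) ⊗ G ≈ H ⊗ G ⊕ K ⊗ G
⊗-distribʳ G H K μ = trans (Σ-cong (splits μ) λ (α , β) → ℚ.*-distribʳ-+ (G β) (H α) (K α))
  (Σ-+ (splits μ) _ _)

⊗-•ʳ : ∀ q G H → G ⊗ (q • H) ≈ q • (G ⊗ H)
⊗-•ʳ q G H μ = trans (Σ-cong (splits μ) λ (α , β) → x*yz≡y*xz (G α) q (H β)) (Σ-*ˡ (splits μ) q _)

⊗-•ˡ : ∀ q G H → (q • G) ⊗ H ≈ q • (G ⊗ H)
⊗-•ˡ q G H μ = trans (Σ-cong (splits μ) λ (α , β) → ℚ.*-assoc q (G α) (H β)) (Σ-*ˡ (splits μ) q _)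

·∂ : ∀ x G μ → (x · ∂ x G) μ ≡ fromℕ (exponent x μ) * G μ
·∂ x G μ with divisible x μ
... | multiple ν = trans (·-at x (∂ x G) ν)
  (cong (λ n → fromℕ n * G (adjust suc x ν)) (sym (exponent-adjust suc x ν)))
... | coprime p  = trans (·-zero x (∂ x G) μ p)
  (sym (trans (cong (λ n → fromℕ n * G μ) p) (ℚ.*-zeroˡ (G μ))))

-- The Leibniz rule holds because the Euler operator x · ∂ x is additive on exponents.

∂-⊗ : ∀ x G H → ∂ x (G ⊗ H) ≈ ∂ x G ⊗ H ⊕ G ⊗ ∂ x H
∂-⊗ x G H = ·-injective x (≈-trans euler (≈-sym (≈-trans (·-⊕ x (∂ x G ⊗ H) (G ⊗ ∂ x H))
    (λ μ → cong₂ _+_ (sym (·-⊗ˡ x (∂ x G) H μ)) (sym (·-⊗ʳ x G (∂ x H) μ))))))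
  where
  euler : x · ∂ x (G ⊗ H) ≈ (x · ∂ x G) ⊗ H ⊕ G ⊗ (x · ∂ x H)
  euler μ = begin
    (x · ∂ x (G ⊗ H)) μ
      ≡⟨ ·∂ x (G ⊗ H) μ ⟩
    fromℕ (exponent x μ) * (G ⊗ H) μ
      ≡⟨ Σ-*ˡ (splits μ) (fromℕ (exponent x μ)) _ ⟨
    Σ (splits μ) (λ (α , β) → fromℕ (exponent x μ) * (G α * H β))
      ≡⟨ (Σ-cong∈ (splits μ) λ {(α , β)} i → term α β (∈-splits⁻ μ i)) ⟩
    Σ (splits μ) (λ (α , β) → (x · ∂ x G) α * H β + G α * (x · ∂ x H) β)
      ≡⟨ Σ-+ (splits μ) _ _ ⟩
    ((x · ∂ x G) ⊗ H ⊕ G ⊗ (x · ∂ x H)) μ ∎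
    where
    open ≡-Reasoning
    expand : ∀ a b c d → (a + b) * (c * d) ≡ (a * c) * d + c * (b * d)
    expand = solve 4 (λ a b c d → (a :+ b) :* (c :* d) := (a :* c) :* d :+ c :* (b :* d)) refl
      where open +-*-Solver
    term : ∀ α β → α ✶ β ≡ μ → fromℕ (exponent x μ) * (G α * H β) ≡ (x · ∂ x G) α * H β + G α *
        (x · ∂ x H) β
    term α β refl = begin
      fromℕ (exponent x (α ✶ β)) * (G α * H β)
        ≡⟨ cong (_* (G α * H β)) (trans (cong fromℕ (exponent-✶ x α β))
            (fromℕ-+ (exponent x α) (exponent x β))) ⟩
      (fromℕ (exponent x α) + fromℕ (exponent x β)) * (G α * H β)
        ≡⟨ expand (fromℕ (exponent x α)) (fromℕ (exponent x β)) (G α) (H β) ⟩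
      fromℕ (exponent x α) * G α * H β + G α * (fromℕ (exponent x β) * H β)
        ≡⟨ cong₂ _+_ (cong (_* H β) (·∂ x G α)) (cong (G α *_) (·∂ x H β)) ⟨
      (x · ∂ x G) α * H β + G α * (x · ∂ x H) β ∎

-- A coefficientwise finite sum, with the bound on the number of terms left open; in
-- contrast to Σ∞ it can be combined without matching bounds.

record IsSum (h : ℕ → PowerSeries) (H : PowerSeries) : Set where
  constructor isSum
  field
    support : Monomial → ℕ
    partial : ∀ μ {N} → support μ ≤ N → H μ ≡ Σ< N (λ n → h n μ)

open IsSum

isSum-truncated : ∀ {h H} (b : Monomial → ℕ) →
                  (∀ μ → H μ ≡ sumℚ (applyUpTo (λ n → h n μ) (b μ))) →
                  (∀ μ n → b μ ≤ n → h n μ ≡ 0ℚ) → IsSum h H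
isSum-truncated {h} b e z = isSum b λ μ {N} p →
  trans (e μ) (trans (sum-applyUpTo (λ n → h n μ) (b μ)) (sym (Σ<-extend (λ n → h n μ) p (z μ))))

-- The coefficients `μ` and `ν` may differ and a factor `q` is allowed, because slices at different
-- powers of `s` are compared in this way later on.
isSum-at : ∀ {h h′ H H′} → IsSum h H → IsSum h′ H′ → ∀ q μ ν →
           (∀ n → h n μ ≡ q * h′ n ν) → H μ ≡ q * H′ ν
isSum-at {h} {h′} {H} {H′} σ τ q μ ν e = begin
  H μ
    ≡⟨ partial σ μ (ℕ.m≤m⊔n (support σ μ) (support τ ν)) ⟩
  Σ< N (λ n → h n μ)
    ≡⟨ Σ-cong (upTo N) e ⟩
  Σ< N (λ n → q * h′ n ν)
    ≡⟨ Σ-*ˡ (upTo N) q _ ⟩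
  q * Σ< N (λ n → h′ n ν)
    ≡⟨ cong (q *_) (partial τ ν (ℕ.m≤n⊔m (support σ μ) (support τ ν))) ⟨
  q * H′ ν ∎
  where
  open ≡-Reasoning
  N = support σ μ ⊔ support τ ν

isSum-unique : ∀ {h h′ H H′} → IsSum h H → IsSum h′ H′ → (∀ n → h n ≈ h′ n) → H ≈ H′
isSum-unique {H′ = H′} σ τ e μ =
  trans (isSum-at σ τ 1ℚ μ μ (λ n → trans (e n μ) (sym (ℚ.*-identityˡ _)))) (ℚ.*-identityˡ (H′ μ))

isSum-⊕ : ∀ {h h′ H H′} → IsSum h H → IsSum h′ H′ → IsSum (λ n → h n ⊕ h′ n) (H ⊕ H′)
isSum-⊕ {h} {h′} σ τ = isSum (λ μ → support σ μ ⊔ support τ μ) λ μ {N} p → trans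
  (cong₂ _+_ (partial σ μ (ℕ.≤-trans (ℕ.m≤m⊔n _ _) p)) (partial τ μ (ℕ.≤-trans (ℕ.m≤n⊔m _ _) p)))
  (sym (Σ-+ (upTo N) (λ n → h n μ) (λ n → h′ n μ)))

isSum-∂ : ∀ x {h H} → IsSum h H → IsSum (∂ x ∘ h) (∂ x H)
isSum-∂ x {h} σ = isSum (λ μ → support σ (adjust suc x μ)) λ μ {N} p → trans
  (cong (fromℕ (suc (exponent x μ)) *_) (partial σ (adjust suc x μ) p))
  (sym (Σ-*ˡ (upTo N) (fromℕ (suc (exponent x μ))) (λ n → h n (adjust suc x μ))))

isSum-shift : ∀ {h H} → h 0 ≈ 𝟎 → IsSum h H → IsSum (h ∘ suc) H
isSum-shift {h} z σ = isSum (support σ) λ μ {N} p → trans (partial σ μ (ℕ.m≤n⇒m≤1+n p))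
  (trans (Σ<-suc N (λ n → h n μ)) (trans (cong (_+ Σ< N (λ n → h (suc n) μ)) (z μ))
      (ℚ.+-identityˡ _)))

maximum : ∀ {A : Set} → List A → (A → ℕ) → ℕ
maximum []       f = 0
maximum (x ∷ xs) f = f x ⊔ maximum xs f

≤-maximum : ∀ {A : Set} {xs : List A} {x} f → x ∈ xs → f x ≤ maximum xs f
≤-maximum f (here refl) = ℕ.m≤m⊔n _ _
≤-maximum f (there i)   = ℕ.≤-trans (≤-maximum f i) (ℕ.m≤n⊔m _ _)

-- A monomial has finitely many factorisations, so the largest bound needed at a second factor
-- serves for all of them.
isSum-⊗ : ∀ G {h H} → IsSum h H → IsSum (λ n → G ⊗ h n) (G ⊗ H)
isSum-⊗ G {h} σ = isSum (λ μ → maximum (splits μ) (support σ ∘ proj₂)) λ μ {N} p → trans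
  (Σ-cong∈ (splits μ) λ {(α , β)} i → trans
    (cong (G α *_) (partial σ β (ℕ.≤-trans (≤-maximum (support σ ∘ proj₂) i) p)))
    (sym (Σ-*ˡ (upTo N) (G α) (λ n → h n β))))
  (Σ-swap (splits μ) (upTo N) _)

isSum-cong : ∀ {h h′ H} → (∀ n → h n ≈ h′ n) → IsSum h H → IsSum h′ H
isSum-cong e σ = isSum (support σ) λ μ {N} p → trans (partial σ μ p) (Σ-cong (upTo N) λ n → e n μ)

⊕-cong : ∀ {G G′ H H′} → G ≈ G′ → H ≈ H′ → G ⊕ H ≈ G′ ⊕ H′
⊕-cong e f μ = cong₂ _+_ (e μ) (f μ)

•-cong : ∀ q {G H} → G ≈ H → q • G ≈ q • H
•-cong q e μ = cong (q *_) (e μ)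

∂-cong : ∀ x {G H} → G ≈ H → ∂ x G ≈ ∂ x H
∂-cong x e μ = cong (fromℕ (suc (exponent x μ)) *_) (e (adjust suc x μ))

∂-• : ∀ x q G → ∂ x (q • G) ≈ q • ∂ x G
∂-• x q G μ = x*yz≡y*xz (fromℕ (suc (exponent x μ))) q (G (adjust suc x μ))

∂-𝟏 : ∀ x → ∂ x 𝟏 ≈ 𝟎
∂-𝟏 x μ = trans (cong (fromℕ (suc (exponent x μ)) *_)
  (trans (𝟏≈δ (adjust suc x μ)) (⟦⟧-no (one ≟ᵐ adjust suc x μ) λ e →
    exponent-adjust-suc x μ (trans (cong (exponent x) (sym e)) (exponent-one x)))))
  (ℚ.*-zeroʳ (fromℕ (suc (exponent x μ))))

∂-^ : ∀ x G n → ∂ x (G ^ suc n) ≈ fromℕ (suc n) • (G ^ n ⊗ ∂ x G)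
∂-^ x G zero μ = begin
  ∂ x (G ⊗ 𝟏) μ
    ≡⟨ ∂-cong x (≈-trans (⊗-comm G 𝟏) (⊗-identityˡ G)) μ ⟩
  ∂ x G μ
    ≡⟨ ⊗-identityˡ (∂ x G) μ ⟨
  (𝟏 ⊗ ∂ x G) μ
    ≡⟨ ℚ.*-identityˡ _ ⟨
  1ℚ * (𝟏 ⊗ ∂ x G) μ ∎
  where open ≡-Reasoning
∂-^ x G (suc n) μ = begin
  ∂ x (G ⊗ G ^ suc n) μ
    ≡⟨ ∂-⊗ x G (G ^ suc n) μ ⟩
  (∂ x G ⊗ G ^ suc n) μ + (G ⊗ ∂ x (G ^ suc n)) μ
    ≡⟨ cong₂ _+_ (⊗-comm (∂ x G) (G ^ suc n) μ)
         (trans (⊗-cong (≈-refl {G}) (∂-^ x G n) μ)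
           (trans (⊗-•ʳ (fromℕ (suc n)) G (G ^ n ⊗ ∂ x G) μ)
                  (cong (fromℕ (suc n) *_) (sym (⊗-assoc G (G ^ n) (∂ x G) μ))))) ⟩
  X + fromℕ (suc n) * X
    ≡⟨ cong (_+ fromℕ (suc n) * X) (ℚ.*-identityˡ X) ⟨
  1ℚ * X + fromℕ (suc n) * X
    ≡⟨ ℚ.*-distribʳ-+ X 1ℚ (fromℕ (suc n)) ⟨
  (1ℚ + fromℕ (suc n)) * X
    ≡⟨ cong (_* X) (fromℕ-suc (suc n)) ⟨
  fromℕ (suc (suc n)) * X ∎
  where
  open ≡-Reasoning
  X : ℚ
  X = (G ^ suc n ⊗ ∂ x G) μ

-- Termwise, the derivative of G^(n+1)/(n+1)! is (Gⁿ/n!) ∂G. The constant term has derivative zero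
-- and drops out, which accounts for the shift of the index.
∂-exp : ∀ x G G₀ → ∂ x (exp G G₀) ≈ exp G G₀ ⊗ ∂ x G
∂-exp x G G₀ = isSum-unique
  (isSum-shift (≈-trans (∂-• x (1/ 0 !) 𝟏)
      (λ μ → trans (cong (1/ 0 ! *_) (∂-𝟏 x μ)) (ℚ.*-zeroʳ (1/ 0 !)))) (isSum-∂ x sum))
  (isSum-cong (λ n → ⊗-comm (∂ x G) (1/ n ! • G ^ n)) (subst-comm (isSum-⊗ (∂ x G) sum)))
  step
  where
  sum : IsSum (λ n → 1/ n ! • G ^ n) (exp G G₀)
  sum = isSum-truncated (suc ∘ exp-s) (λ _ → refl) λ μ n p →
    •-null (1/ n !) (G ^ n) μ (^-null G G₀ n μ p)
  subst-comm : ∀ {h} → IsSum h (∂ x G ⊗ exp G G₀) → IsSum h (exp G G₀ ⊗ ∂ x G)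
  subst-comm σ = isSum (support σ) λ μ p → trans (⊗-comm (exp G G₀) (∂ x G) μ) (partial σ μ p)
  step : ∀ n → ∂ x (1/ suc n ! • G ^ suc n) ≈ (1/ n ! • G ^ n) ⊗ ∂ x G
  step n μ = begin
    ∂ x (1/ suc n ! • G ^ suc n) μ
      ≡⟨ ∂-• x (1/ suc n !) (G ^ suc n) μ ⟩
    1/ suc n ! * ∂ x (G ^ suc n) μ
      ≡⟨ cong (1/ suc n ! *_) (∂-^ x G n μ) ⟩
    1/ suc n ! * (fromℕ (suc n) * X)
      ≡⟨ ℚ.*-assoc (1/ suc n !) (fromℕ (suc n)) X ⟨
    1/ suc n ! * fromℕ (suc n) * X
      ≡⟨ cong (_* X) (trans (ℚ.*-comm (1/ suc n !) _) (suc*1/! n)) ⟩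
    1/ n ! * X
      ≡⟨ ⊗-•ˡ (1/ n !) (G ^ n) (∂ x G) μ ⟨
    ((1/ n ! • G ^ n) ⊗ ∂ x G) μ ∎
    where
    open ≡-Reasoning
    X : ℚ
    X = (G ^ n ⊗ ∂ x G) μ

-- The operators applied to an exponential

antidiagonal : ℕ → (ℕ → ℕ → ℚ) → ℚ
antidiagonal n f = Σ< (suc n) (λ a → f a (n ℕ.∸ a))

Σ-antidiagonal-at : ∀ n f μ → Σ-antidiagonal n f μ ≡ antidiagonal n (λ a b → f a b μ)
Σ-antidiagonal-at n f μ = trans (go (suc n) (λ a → f a (n ℕ.∸ a)))
  (sum-applyUpTo (λ a → f a (n ℕ.∸ a) μ) (suc n))
  where
  go : ∀ k (h : ℕ → PowerSeries) → foldr _⊕_ 𝟎 (applyUpTo h k) μ ≡ sumℚ (applyUpTo (λ a → h a μ) k)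
  go zero    h = refl
  go (suc k) h = cong (h 0 μ +_) (go k (h ∘ suc))

Σ-antidiagonal-cong : ∀ n {f g} → (∀ a b → f a b ≈ g a b) → Σ-antidiagonal n f ≈ Σ-antidiagonal n g
Σ-antidiagonal-cong n {f} {g} e μ = trans (Σ-antidiagonal-at n f μ)
  (trans (Σ-cong (upTo (suc n)) λ a → e a (n ℕ.∸ a) μ) (sym (Σ-antidiagonal-at n g μ)))

⊗-antidiagonal : ∀ G n f → G ⊗ Σ-antidiagonal n f ≈ Σ-antidiagonal n (λ a b → G ⊗ f a b)
⊗-antidiagonal G n f μ = begin
  (G ⊗ Σ-antidiagonal n f) μ
    ≡⟨ (Σ-cong (splits μ) λ (α , β) → trans (cong (G α *_) (Σ-antidiagonal-at n f β))
        (sym (Σ-*ˡ (upTo (suc n)) (G α) _))) ⟩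
  Σ (splits μ) (λ (α , β) → Σ< (suc n) (λ a → G α * f a (n ℕ.∸ a) β))
    ≡⟨ Σ-swap (splits μ) (upTo (suc n)) _ ⟩
  antidiagonal n (λ a b → (G ⊗ f a b) μ)
    ≡⟨ Σ-antidiagonal-at n (λ a b → G ⊗ f a b) μ ⟨
  Σ-antidiagonal n (λ a b → G ⊗ f a b) μ ∎
  where open ≡-Reasoning

Σ-antidiagonal-⊕ : ∀ n f g → Σ-antidiagonal n f ⊕ Σ-antidiagonal n g ≈ Σ-antidiagonal n
  (λ a b → f a b ⊕ g a b)
Σ-antidiagonal-⊕ n f g μ = trans
  (cong₂ _+_ (Σ-antidiagonal-at n f μ) (Σ-antidiagonal-at n g μ))
  (trans (sym (Σ-+ (upTo (suc n)) (λ a → f a (n ℕ.∸ a) μ) (λ a → g a (n ℕ.∸ a) μ)))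
    (sym (Σ-antidiagonal-at n (λ a b → f a b ⊕ g a b) μ)))

-- The summands of `L₁`, `M₁` and `Q₁`. With n = a + b, `extend` makes a cycle of n + 1 points
-- longer by one, `cut` turns it and a new point into cycles of a + 1 and b + 1 points, and `join`
-- turns cycles of a + 1 and b + 1 points and a new point into one of n + 3 points. `quad` is what
-- the second derivative of an exponential adds to `join`.
extend cut join quad : ℕ → ℕ → ℕ → PowerSeries → PowerSeries
extend n _ _ G = fromℕ (1 ℕ.+ n) • t[1+ 1 ℕ.+ n ] · ∂ t[1+ n ] G
cut    n a b G = fromℕ (1 ℕ.+ n) • t[1+ a ] · t[1+ b ] · ∂ t[1+ n ] G
join   n a b G = fromℕ ((1 ℕ.+ a) ℕ.* (1 ℕ.+ b)) • t[1+ 2 ℕ.+ n ] · ∂ t[1+ a ] (∂ t[1+ b ] G)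
quad   n a b G = fromℕ ((1 ℕ.+ a) ℕ.* (1 ℕ.+ b)) • t[1+ 2 ℕ.+ n ] · (∂ t[1+ a ] G ⊗ ∂ t[1+ b ] G)

isSum-L₁ : ∀ G → IsSum (λ n → extend n 0 0 G) (L₁ G)
isSum-L₁ G = isSum-truncated (size ∘ exp-t) (λ _ → refl) λ μ n p →
  •-null (fromℕ (1 ℕ.+ n)) (t[1+ 1 ℕ.+ n ] · ∂ t[1+ n ] G) μ
      (t·-null (1 ℕ.+ n) (∂ t[1+ n ] G) μ (ℕ.m≤n⇒m≤1+n p))

isSum-M₁ : ∀ G → IsSum (λ n → Σ-antidiagonal n (λ a b → cut n a b G ⊕ join n a b G)) (M₁ G)
isSum-M₁ G = isSum-truncated (λ μ → size (exp-t μ) ℕ.+ size (exp-t μ)) (λ _ → refl) λ μ n p →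
  antidiagonal-null n (λ a b → cut n a b G ⊕ join n a b G) μ λ a b q →
    ⊕-null (cut n a b G) (join n a b G) μ
      (•-null (fromℕ (1 ℕ.+ n)) (t[1+ a ] · t[1+ b ] · ∂ t[1+ n ] G) μ
        (tt·-null a b (∂ t[1+ n ] G) μ (ℕ.≤-trans p q)))
      (•-null (fromℕ ((1 ℕ.+ a) ℕ.* (1 ℕ.+ b))) (t[1+ 2 ℕ.+ n ] · ∂ t[1+ a ] (∂ t[1+ b ] G)) μ
        (t·-null (2 ℕ.+ n) (∂ t[1+ a ] (∂ t[1+ b ] G)) μ
          (ℕ.≤-trans (ℕ.m≤m+n _ _) (ℕ.≤-trans p (ℕ.m≤n+m n 2)))))

isSum-Q₁ : ∀ G → IsSum (λ n → Σ-antidiagonal n (λ a b → quad n a b G)) (Q₁ G)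
isSum-Q₁ G = isSum-truncated (size ∘ exp-t) (λ _ → refl) λ μ n p →
  antidiagonal-null n (λ a b → quad n a b G) μ λ a b _ →
    •-null (fromℕ ((1 ℕ.+ a) ℕ.* (1 ℕ.+ b))) (t[1+ 2 ℕ.+ n ] · (∂ t[1+ a ] G ⊗ ∂ t[1+ b ] G)) μ
      (t·-null (2 ℕ.+ n) (∂ t[1+ a ] G ⊗ ∂ t[1+ b ] G) μ (ℕ.≤-trans p (ℕ.m≤n+m n 2)))

•·-⊗ : ∀ q x G H → q • x · (G ⊗ H) ≈ G ⊗ (q • x · H)
•·-⊗ q x G H = ≈-trans (•-cong q (≈-sym (·-⊗ʳ x G H))) (≈-sym (⊗-•ʳ q G (x · H)))

module _ (G : PowerSeries) (G₀ : ZeroAt-s=0 G) where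

  private
    E : PowerSeries
    E = exp G G₀

  L₁-exp : L₁ E ≈ E ⊗ L₁ G
  L₁-exp = isSum-unique (isSum-L₁ E) (isSum-⊗ E (isSum-L₁ G)) λ n →
    ≈-trans (•-cong (fromℕ (1 ℕ.+ n)) (·-cong t[1+ 1 ℕ.+ n ] (∂-exp t[1+ n ] G G₀)))
      (•·-⊗ (fromℕ (1 ℕ.+ n)) t[1+ 1 ℕ.+ n ] E (∂ t[1+ n ] G))

  private
    cut-exp : ∀ n a b → cut n a b E ≈ E ⊗ cut n a b G
    cut-exp n a b = ≈-trans (•-cong (fromℕ (1 ℕ.+ n)) (·-cong t[1+ a ]
        (≈-trans (·-cong t[1+ b ] (∂-exp t[1+ n ] G G₀)) (≈-sym (·-⊗ʳ t[1+ b ] E (∂ t[1+ n ] G))))))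
      (•·-⊗ (fromℕ (1 ℕ.+ n)) t[1+ a ] E (t[1+ b ] · ∂ t[1+ n ] G))

    ∂∂-exp : ∀ x y → ∂ x (∂ y E) ≈ E ⊗ (∂ x (∂ y G) ⊕ ∂ x G ⊗ ∂ y G)
    ∂∂-exp x y μ = begin
      ∂ x (∂ y E) μ
        ≡⟨ ∂-cong x (∂-exp y G G₀) μ ⟩
      ∂ x (E ⊗ ∂ y G) μ
        ≡⟨ ∂-⊗ x E (∂ y G) μ ⟩
      (∂ x E ⊗ ∂ y G) μ + (E ⊗ ∂ x (∂ y G)) μ
        ≡⟨ cong (_+ (E ⊗ ∂ x (∂ y G)) μ)
             (trans (⊗-cong (∂-exp x G G₀) (≈-refl {∂ y G}) μ) (⊗-assoc E (∂ x G) (∂ y G) μ)) ⟩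
      (E ⊗ (∂ x G ⊗ ∂ y G)) μ + (E ⊗ ∂ x (∂ y G)) μ
        ≡⟨ ℚ.+-comm _ ((E ⊗ ∂ x (∂ y G)) μ) ⟩
      (E ⊗ ∂ x (∂ y G)) μ + (E ⊗ (∂ x G ⊗ ∂ y G)) μ
        ≡⟨ ⊗-distribˡ E (∂ x (∂ y G)) (∂ x G ⊗ ∂ y G) μ ⟨
      (E ⊗ (∂ x (∂ y G) ⊕ ∂ x G ⊗ ∂ y G)) μ ∎
      where open ≡-Reasoning

    join-exp : ∀ n a b → join n a b E ≈ E ⊗ (join n a b G ⊕ quad n a b G)
    join-exp n a b = ≈-trans (•-cong q (·-cong x (∂∂-exp t[1+ a ] t[1+ b ])))
      (≈-trans (•·-⊗ q x E (J′ ⊕ K)) (⊗-cong (≈-refl {E}) (≈-trans (•-cong q (·-⊕ x J′ K))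
        (λ μ → ℚ.*-distribˡ-+ q ((x · J′) μ) ((x · K) μ)))))
      where
      q = fromℕ ((1 ℕ.+ a) ℕ.* (1 ℕ.+ b))
      x = t[1+ 2 ℕ.+ n ]
      J′ = ∂ t[1+ a ] (∂ t[1+ b ] G)
      K = ∂ t[1+ a ] G ⊗ ∂ t[1+ b ] G

  M₁-exp : M₁ E ≈ E ⊗ (M₁ G ⊕ Q₁ G)
  M₁-exp = isSum-unique (isSum-M₁ E) (isSum-⊗ E (isSum-⊕ (isSum-M₁ G) (isSum-Q₁ G))) λ n →
    ≈-trans (Σ-antidiagonal-cong n (term n))
      (≈-trans (≈-sym (⊗-antidiagonal E n (f+g n)))
          (⊗-cong (≈-refl {E}) (≈-sym (Σ-antidiagonal-⊕ n (f n) (g n)))))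
    where
    f g f+g : ℕ → ℕ → ℕ → PowerSeries
    f n a b = cut n a b G ⊕ join n a b G
    g n a b = quad n a b G
    f+g n a b = f n a b ⊕ g n a b
    term : ∀ n a b → cut n a b E ⊕ join n a b E ≈ E ⊗ f+g n a b
    term n a b = ≈-trans (⊕-cong (cut-exp n a b) (join-exp n a b))
      (≈-trans (≈-sym (⊗-distribˡ E (cut n a b G) (join n a b G ⊕ quad n a b G)))
        (⊗-cong (≈-refl {E}) λ μ → sym (ℚ.+-assoc (cut n a b G μ) (join n a b G μ)
            (quad n a b G μ))))

-- Cancellation, slices in s and uniqueness of solutions

exp-at-s=0 : ∀ G G₀ k l m → exp G G₀ (mono 0 k l m) ≡ 𝟏 (mono 0 k l m)
exp-at-s=0 G G₀ k l m = trans (ℚ.+-identityʳ _) (ℚ.*-identityˡ _)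

-- Write E = 𝟏 + R. Since R has no terms without `s`, a coefficient of R ⊗ W at sᵈ involves W at
-- powers below d only, where W and W′ agree by induction; subtracting it leaves W itself.
⊗-cancelˡ : ∀ E {W W′} → (∀ k l m → E (mono 0 k l m) ≡ 𝟏 (mono 0 k l m)) → E ⊗ W ≈ E ⊗ W′ → W ≈ W′
⊗-cancelˡ E {W} {W′} E₀ e μ = go (exp-s μ) μ ℕ.≤-refl
  where
  R : PowerSeries
  R μ = E μ - 𝟏 μ
  R₀ : ∀ k l m → R (mono 0 k l m) ≡ 0ℚ
  R₀ k l m = trans (cong (_- 𝟏 (mono 0 k l m)) (E₀ k l m)) (ℚ.+-inverseʳ (𝟏 (mono 0 k l m)))
  p≡q+[p-q] : ∀ p q → p ≡ q + (p - q)
  p≡q+[p-q] = solve 2 (λ p q → p := q :+ (p :- q)) refl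
    where open +-*-Solver
  E⊗ : ∀ V μ → (E ⊗ V) μ ≡ V μ + (R ⊗ V) μ
  E⊗ V μ = trans (⊗-cong {H = V} (λ ν → p≡q+[p-q] (E ν) (𝟏 ν)) (≈-refl {V}) μ)
    (trans (⊗-distribʳ V 𝟏 R μ) (cong (_+ (R ⊗ V) μ) (⊗-identityˡ V μ)))
  go : ∀ d μ → exp-s μ ≤ d → W μ ≡ W′ μ
  R⊗ : ∀ d μ → exp-s μ ≤ d → ∀ α β → α ✶ β ≡ μ → R α * W β ≡ R α * W′ β
  go d μ p = ∙-cancelʳ ((R ⊗ W) μ) (W μ) (W′ μ) (begin
    W μ + (R ⊗ W) μ
      ≡⟨ E⊗ W μ ⟨
    (E ⊗ W) μ
      ≡⟨ e μ ⟩
    (E ⊗ W′) μ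
      ≡⟨ E⊗ W′ μ ⟩
    W′ μ + (R ⊗ W′) μ
      ≡⟨ cong (W′ μ +_) (Σ-cong∈ (splits μ) λ {(α , β)} i → R⊗ d μ p α β (∈-splits⁻ μ i)) ⟨
    W′ μ + (R ⊗ W) μ ∎)
    where
    open ≡-Reasoning
    open import Algebra.Properties.Group ℚ.+-0-group using (∙-cancelʳ)
  R⊗ d       μ p α@(mono zero k l m)        β refl = trans (cong (_* W β) (R₀ k l m))
    (trans (ℚ.*-zeroˡ (W β)) (sym (trans (cong (_* W′ β) (R₀ k l m)) (ℚ.*-zeroˡ (W′ β)))))
  R⊗ (suc d) μ (s≤s p) α@(mono (suc a) k l m) β refl =
    cong (R α *_) (go d β (ℕ.≤-trans (ℕ.m≤n+m (exp-s β) a) p))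

-- The operators not involving s act on each coefficient of sᵈ separately.

record Slice (d d′ : ℕ) (q : ℚ) (G H : PowerSeries) : Set where
  constructor slice
  field
    at-slice : ∀ k l m → G (mono d k l m) ≡ q * H (mono d′ k l m)

open Slice public

module _ {d d′ : ℕ} {q : ℚ} where

  ·ᵘ-slice : ∀ {G H} → Slice d d′ q G H → Slice d d′ q (u · G) (u · H)
  ·ᵘ-slice {G} {H} σ = slice λ { zero l m → sym (ℚ.*-zeroʳ q) ; (suc k) l m → at-slice σ k l m }

  ·ᵛ-slice : ∀ {G H} → Slice d d′ q G H → Slice d d′ q (v · G) (v · H)
  ·ᵛ-slice {G} {H} σ = slice λ { k zero m → sym (ℚ.*-zeroʳ q) ; k (suc l) m → at-slice σ k l m }

  ·ᵗ-slice : ∀ i {G H} → Slice d d′ q G H → Slice d d′ q (t[1+ i ] · G) (t[1+ i ] · H)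
  ·ᵗ-slice i {G} {H} σ = slice go
    where
    go : ∀ k l m → (t[1+ i ] · G) (mono d k l m) ≡ q * (t[1+ i ] · H) (mono d′ k l m)
    go k l m with at m i
    ... | zero  = sym (ℚ.*-zeroʳ q)
    ... | suc _ = at-slice σ k l (adjustAt pred i m)

  ∂ᵗ-slice : ∀ i {G H} → Slice d d′ q G H → Slice d d′ q (∂ t[1+ i ] G) (∂ t[1+ i ] H)
  ∂ᵗ-slice i {G} {H} σ = slice λ k l m → trans
    (cong (fromℕ (suc (at m i)) *_) (at-slice σ k l (adjustAt suc i m)))
    (x*yz≡y*xz (fromℕ (suc (at m i))) q _)

  •-slice : ∀ r {G H} → Slice d d′ q G H → Slice d d′ q (r • G) (r • H)
  •-slice r {G} {H} σ = slice λ k l m → trans (cong (r *_) (at-slice σ k l m)) (x*yz≡y*xz r q _)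

  ⊕-slice : ∀ {G G′ H H′} → Slice d d′ q G H → Slice d d′ q G′ H′ → Slice d d′ q (G ⊕ G′) (H ⊕ H′)
  ⊕-slice {H = H} {H′} σ τ = slice λ k l m →
    trans (cong₂ _+_ (at-slice σ k l m) (at-slice τ k l m)) (sym (ℚ.*-distribˡ-+ q (H _) (H′ _)))

  Σ-slice : ∀ n f g → (∀ a b → Slice d d′ q (f a b) (g a b)) → Slice d d′ q (Σ-antidiagonal n f)
      (Σ-antidiagonal n g)
  Σ-slice n f g σ = slice λ k l m → trans (Σ-antidiagonal-at n f _)
    (trans (Σ-cong (upTo (suc n)) λ a → at-slice (σ a (n ℕ.∸ a)) k l m)
      (trans (Σ-*ˡ (upTo (suc n)) q _) (cong (q *_) (sym (Σ-antidiagonal-at n g _)))))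

  isSum-slice : ∀ {h h′ G H} → IsSum h G → IsSum h′ H → (∀ n → Slice d d′ q (h n) (h′ n)) →
      Slice d d′ q G H
  isSum-slice σ τ e = slice λ k l m → isSum-at σ τ q _ _ λ n → at-slice (e n) k l m

  L₁-slice : ∀ {G H} → Slice d d′ q G H → Slice d d′ q (L₁ G) (L₁ H)
  L₁-slice {G} {H} σ = isSum-slice (isSum-L₁ G) (isSum-L₁ H) λ n →
    •-slice (fromℕ (1 ℕ.+ n)) (·ᵗ-slice (1 ℕ.+ n) (∂ᵗ-slice n σ))

  M₁-slice : ∀ {G H} → Slice d d′ q G H → Slice d d′ q (M₁ G) (M₁ H)
  M₁-slice {G} {H} σ = isSum-slice (isSum-M₁ G) (isSum-M₁ H) λ n → Σ-slice n
    (λ a b → cut n a b G ⊕ join n a b G) (λ a b → cut n a b H ⊕ join n a b H) λ a b → ⊕-slice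
    (•-slice (fromℕ (1 ℕ.+ n)) (·ᵗ-slice a (·ᵗ-slice b (∂ᵗ-slice n σ))))
    (•-slice (fromℕ ((1 ℕ.+ a) ℕ.* (1 ℕ.+ b))) (·ᵗ-slice (2 ℕ.+ n) (∂ᵗ-slice a (∂ᵗ-slice b σ))))

Λ Φ : PowerSeries → PowerSeries
Λ G = u · L₁ G ⊕ v · L₁ G ⊕ M₁ G ⊕ u · v · t[1+ 0 ] · G
Φ G = u · L₁ G ⊕ v · L₁ G ⊕ M₁ G ⊕ Q₁ G ⊕ u · v · t[1+ 0 ] · 𝟏

-- Used with q = 1 for dependence on a single power of `s`, with q = 1/d! to pass to exponential
-- generating functions, and with q = 0 to show that a slice vanishes.
Λ-slice : ∀ {d d′ q G H} → Slice d d′ q G H → Slice d d′ q (Λ G) (Λ H)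
Λ-slice σ = ⊕-slice (⊕-slice (⊕-slice (·ᵘ-slice (L₁-slice σ)) (·ᵛ-slice (L₁-slice σ))) (M₁-slice σ))
  (·ᵘ-slice (·ᵛ-slice (·ᵗ-slice 0 σ)))

-- Products mix the powers of `s`, so `Q₁` cannot be treated one slice at a time. However, a product
-- up to sᵈ depends on its factors up to sᵈ only.
Agree : ℕ → PowerSeries → PowerSeries → Set
Agree d G H = ∀ {e} → e ≤ d → Slice e e 1ℚ G H

agree : ∀ {d G H} → (∀ μ → exp-s μ ≤ d → G μ ≡ H μ) → Agree d G H
agree {H = H} e p = slice λ k l m → trans (e _ p) (sym (ℚ.*-identityˡ (H _)))

agree⁻ : ∀ {d G H} → Agree d G H → ∀ μ → exp-s μ ≤ d → G μ ≡ H μ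
agree⁻ {H = H} σ (mono e k l m) p = trans (at-slice (σ p) k l m) (ℚ.*-identityˡ (H _))

⊗-agree : ∀ {d G G′ H H′} → Agree d G H → Agree d G′ H′ → Agree d (G ⊗ G′) (H ⊗ H′)
⊗-agree {d} σ τ = agree λ μ p → Σ-cong∈ (splits μ) λ {(α , β)} i →
  let q = ℕ.≤-trans (ℕ.≤-reflexive (cong exp-s (∈-splits⁻ μ i))) p in
  cong₂ _*_ (agree⁻ σ α (ℕ.≤-trans (ℕ.m≤m+n _ _) q))
      (agree⁻ τ β (ℕ.≤-trans (ℕ.m≤n+m _ (exp-s α)) q))

Φ-agree : ∀ {d G H} → Agree d G H → Agree d (Φ G) (Φ H)
Φ-agree {d} {G} {H} σ p = ⊕-slice (⊕-slice (⊕-slice (⊕-slice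
    (·ᵘ-slice (L₁-slice (σ p))) (·ᵛ-slice (L₁-slice (σ p)))) (M₁-slice (σ p)))
    (isSum-slice (isSum-Q₁ G) (isSum-Q₁ H) λ n → Σ-slice n (λ a b → quad n a b G)
        (λ a b → quad n a b H) λ a b →
      •-slice (fromℕ ((1 ℕ.+ a) ℕ.* (1 ℕ.+ b)))
          (·ᵗ-slice (2 ℕ.+ n) (⊗-agree (λ q → ∂ᵗ-slice a (σ q)) (λ q → ∂ᵗ-slice b (σ q)) p))))
  (slice λ k l m → sym (ℚ.*-identityˡ _))

Λ-agree : ∀ {d G H} → Agree d G H → Agree d (Λ G) (Λ H)
Λ-agree σ p = Λ-slice (σ p)

-- Stated for an arbitrary right-hand side because it serves twice: with `Φ` for the uniqueness of
-- `F`, and with the linear map `_⊗ ∂ s F` to recognise the generating function of all pairs as `Z`.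
ode-unique : (Ψ : PowerSeries → PowerSeries) → (∀ {d G H} → Agree d G H → Agree d (Ψ G) (Ψ H)) →
             ∀ {G H} → (∀ k l m → G (mono 0 k l m) ≡ H (mono 0 k l m)) →
             ∂ s G ≈ Ψ G → ∂ s H ≈ Ψ H → G ≈ H
ode-unique Ψ Ψ-agree {G} {H} e₀ eG eH μ = go (exp-s μ) μ ℕ.≤-refl
  where
  go : ∀ d μ → exp-s μ ≤ d → G μ ≡ H μ
  go d       (mono zero k l m)    p       = e₀ k l m
  go (suc d) (mono (suc e) k l m) (s≤s p) = fromℕ-cancelˡ e
    (trans (eG (mono e k l m)) (trans (agree⁻ (Ψ-agree {d} (agree (go d))) (mono e k l m) p)
        (sym (eH (mono e k l m)))))

Λ-cong : ∀ {G H} → G ≈ H → Λ G ≈ Λ H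
Λ-cong {G} {H} e μ = agree⁻ (Λ-agree {exp-s μ} {G} {H} (agree λ ν _ → e ν)) μ ℕ.≤-refl

Λ-exp : ∀ G G₀ → Λ (exp G G₀) ≈ exp G G₀ ⊗ Φ G
Λ-exp G G₀ = ≈-trans (⊕-cong (⊕-cong (⊕-cong (lin u) (lin v)) (M₁-exp G G₀)) const)
    (≈-sym (≈-trans (⊗-distribˡ E (a ⊕ b ⊕ M₁ G ⊕ Q₁ G) c) (⊕-cong
      (≈-trans (⊗-cong (≈-refl {E}) λ μ → ℚ.+-assoc ((a ⊕ b) μ) (M₁ G μ) (Q₁ G μ))
        (≈-trans (⊗-distribˡ E (a ⊕ b) (M₁ G ⊕ Q₁ G))
            (⊕-cong (⊗-distribˡ E a b) (≈-refl {E ⊗ (M₁ G ⊕ Q₁ G)})))) (≈-refl {E ⊗ c}))))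
  where
  E a b c : PowerSeries
  E = exp G G₀
  a = u · L₁ G
  b = v · L₁ G
  c = u · v · t[1+ 0 ] · 𝟏
  lin : ∀ x → x · L₁ E ≈ E ⊗ (x · L₁ G)
  lin x = ≈-trans (·-cong x (L₁-exp G G₀)) (≈-sym (·-⊗ʳ x E (L₁ G)))
  const : u · v · t[1+ 0 ] · E ≈ E ⊗ (u · v · t[1+ 0 ] · 𝟏)
  const = ≈-trans (·-cong u (≈-trans (·-cong v (≈-trans (·-cong t[1+ 0 ]
      (≈-trans (≈-sym (⊗-identityˡ E)) (⊗-comm 𝟏 E))) (≈-sym (·-⊗ʳ t[1+ 0 ] E 𝟏))))
      (≈-sym (·-⊗ʳ v E (t[1+ 0 ] · 𝟏))))) (≈-sym (·-⊗ʳ u E (v · t[1+ 0 ] · 𝟏)))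

-- Exponential generating functions in s

Ê : (ℕ → PowerSeries) → PowerSeries
Ê X (mono d k l m) = 1/ d ! * X d (mono 0 k l m)

Ê-cong : ∀ {X X′} → (∀ d → X d ≈ X′ d) → Ê X ≈ Ê X′
Ê-cong e (mono d k l m) = cong (1/ d ! *_) (e d (mono 0 k l m))

∂s-Ê : ∀ X → ∂ s (Ê X) ≈ Ê (X ∘ suc)
∂s-Ê X (mono d k l m) = trans (sym (ℚ.*-assoc (fromℕ (suc d)) (1/ suc d !) _))
  (cong (_* X (suc d) (mono 0 k l m)) (suc*1/! d))

-- The binomial convolution, defined by the Leibniz rule instead of binomial coefficients. Each step
-- of the recursion decides to which factor one label goes.
_⊛_ : (ℕ → PowerSeries) → (ℕ → PowerSeries) → ℕ → PowerSeries
(X ⊛ Y) zero    = X 0 ⊗ Y 0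
(X ⊛ Y) (suc d) = ((X ∘ suc) ⊛ Y) d ⊕ (X ⊛ (Y ∘ suc)) d

-- By `∂s-Ê` both sides obey the same Leibniz rule under `∂ s`. Induction on the power of `s`, for
-- all X and Y at once, therefore leaves only the coefficient of s⁰ to compare.
Ê-⊛ : ∀ X Y → Ê (X ⊛ Y) ≈ Ê X ⊗ Ê Y
Ê-⊛ X Y μ = go (exp-s μ) X Y _ _ _
  where
  go : ∀ d X Y k l m → Ê (X ⊛ Y) (mono d k l m) ≡ (Ê X ⊗ Ê Y) (mono d k l m)
  go zero X Y k l m = trans (ℚ.*-identityˡ ((X 0 ⊗ Y 0) μ₀))
      (Σ-cong∈ (splits μ₀) λ {(α , β)} i → term α β (∈-splits⁻ μ₀ i))
    where
    μ₀ = mono 0 k l m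
    term : ∀ α β → α ✶ β ≡ μ₀ → X 0 α * Y 0 β ≡ Ê X α * Ê Y β
    term α@(mono zero _ _ _) β@(mono zero _ _ _) refl = cong₂ _*_ (sym (ℚ.*-identityˡ (X 0 α)))
        (sym (ℚ.*-identityˡ (Y 0 β)))
  go (suc d) X Y k l m = fromℕ-cancelˡ d (begin
    ∂ s (Ê (X ⊛ Y)) ν
      ≡⟨ ∂s-Ê (X ⊛ Y) ν ⟩
    1/ d ! * (((X ∘ suc) ⊛ Y) d (mono 0 k l m) + (X ⊛ (Y ∘ suc)) d (mono 0 k l m))
      ≡⟨ ℚ.*-distribˡ-+ (1/ d !) (((X ∘ suc) ⊛ Y) d (mono 0 k l m)) _ ⟩
    Ê ((X ∘ suc) ⊛ Y) ν + Ê (X ⊛ (Y ∘ suc)) ν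
      ≡⟨ cong₂ _+_ (go d (X ∘ suc) Y k l m) (go d X (Y ∘ suc) k l m) ⟩
    (Ê (X ∘ suc) ⊗ Ê Y) ν + (Ê X ⊗ Ê (Y ∘ suc)) ν
      ≡⟨ cong₂ _+_ (⊗-cong (∂s-Ê X) (≈-refl {Ê Y}) ν) (⊗-cong (≈-refl {Ê X}) (∂s-Ê Y) ν) ⟨
    (∂ s (Ê X) ⊗ Ê Y) ν + (Ê X ⊗ ∂ s (Ê Y)) ν
      ≡⟨ ∂-⊗ s (Ê X) (Ê Y) ν ⟨
    ∂ s (Ê X ⊗ Ê Y) ν ∎)
    where
    open ≡-Reasoning
    ν = mono d k l m

module _ (X : ℕ → PowerSeries) (X-zero : X 0 ≈ 𝟏) (X-suc : ∀ d → X (suc d) ≈ Λ (X d)) where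

  Ê-ode : ∂ s (Ê X) ≈ Λ (Ê X)
  Ê-ode μ@(mono d k l m) = trans (∂s-Ê X μ) (trans (cong (1/ d ! *_) (X-suc d (mono 0 k l m)))
    (sym (at-slice (Λ-slice {q = 1/ d !} {G = Ê X} {H = X d} (slice λ _ _ _ → refl)) k l m)))

  private
    iterate≈ : ∀ d → X d ≈ iterate Λ d 𝟏
    iterate≈ zero    = X-zero
    iterate≈ (suc d) = ≈-trans (X-suc d) (Λ-cong (iterate≈ d))

    -- Vanishing at s^(e+1) is expressed as being 0 times the slice at s⁰ of another series, a form
    -- that `Λ-slice` preserves.
    s-free : ∀ n e → Slice (suc e) 0 0ℚ (iterate Λ n 𝟏) 𝟏
    s-free zero    e = slice λ k l m → sym (ℚ.*-zeroˡ (𝟏 (mono 0 k l m)))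
    s-free (suc n) e = slice λ k l m → trans (at-slice (Λ-slice (s-free n e)) k l m)
      (trans (ℚ.*-zeroˡ (Λ 𝟏 (mono 0 k l m))) (sym (ℚ.*-zeroˡ (𝟏 (mono 0 k l m)))))

    s^-at : ∀ n d k l m G → (s^ n G) (mono (n ℕ.+ d) k l m) ≡ G (mono d k l m)
    s^-at zero    d k l m G = refl
    s^-at (suc n) d k l m G = s^-at n d k l m G

    s^-above : ∀ n e k l m → (s^ n (iterate Λ n 𝟏)) (mono (n ℕ.+ suc e) k l m) ≡ 0ℚ
    s^-above n e k l m = trans (s^-at n (suc e) k l m (iterate Λ n 𝟏))
      (trans (at-slice (s-free n e) k l m) (ℚ.*-zeroˡ (𝟏 (mono 0 k l m))))

    s^-iterate : ∀ n d k l m → n ≢ d → (s^ n (iterate Λ n 𝟏)) (mono d k l m) ≡ 0ℚ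
    s^-iterate n d k l m n≢d = go (ℕ.<-cmp n d)
      where
      go : Tri (n < d) (n ≡ d) (d < n) → (s^ n (iterate Λ n 𝟏)) (mono d k l m) ≡ 0ℚ
      go (tri≈ _ n≡d _) = contradiction n≡d n≢d
      go (tri> _ _ d<n) = s^-null n (iterate Λ n 𝟏) (mono d k l m) d<n
      go (tri< n<d _ _) = let e , n+e≡d = ℕ.m≤n⇒∃[o]m+o≡n n<d in
        subst (λ d → (s^ n (iterate Λ n 𝟏)) (mono d k l m) ≡ 0ℚ) (trans (ℕ.+-suc n e) n+e≡d)
            (s^-above n e k l m)

  -- The iterates of Λ on 𝟏 are free of `s`, so the n-th term of the exponential contributes to sⁿ
  -- alone, and at sᵈ only n = d is left.
  Ê≈exp-s· : Ê X ≈ exp-s· Λ 𝟏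
  Ê≈exp-s· μ@(mono d k l m) = sym (begin
    exp-s· Λ 𝟏 μ
      ≡⟨ sum-applyUpTo (λ n → 1/ n ! * (s^ n (iterate Λ n 𝟏)) μ) (suc d) ⟩
    Σ< (suc d) (λ n → 1/ n ! * (s^ n (iterate Λ n 𝟏)) μ)
      ≡⟨ Σ-point (Unique.upTo⁺ (suc d)) (∈-upTo⁺ (ℕ.n<1+n d))
           (λ {n} _ n≢d → trans (cong (1/ n ! *_) (s^-iterate n d k l m n≢d)) (ℚ.*-zeroʳ (1/ n !)))
               ⟩
    1/ d ! * (s^ d (iterate Λ d 𝟏)) μ
      ≡⟨ cong (λ e → 1/ d ! * (s^ d (iterate Λ d 𝟏)) (mono e k l m)) (ℕ.+-identityʳ d) ⟨
    1/ d ! * (s^ d (iterate Λ d 𝟏)) (mono (d ℕ.+ 0) k l m)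
      ≡⟨ cong (1/ d ! *_) (s^-at d 0 k l m (iterate Λ d 𝟏)) ⟩
    1/ d ! * iterate Λ d 𝟏 (mono 0 k l m)
      ≡⟨ cong (1/ d ! *_) (iterate≈ d (mono 0 k l m)) ⟨
    Ê X μ ∎)
    where open ≡-Reasoning

-- Cycles and cycle types of permutations

iter : (A → A) → ℕ → A → A
iter f zero    x = x
iter f (suc n) x = f (iter f n x)

iter-+ : ∀ (f : A → A) m n x → iter f (m ℕ.+ n) x ≡ iter f m (iter f n x)
iter-+ f zero    n x = refl
iter-+ f (suc m) n x = cong f (iter-+ f m n x)

iter-comm : ∀ (f : A → A) m n x → iter f m (iter f n x) ≡ iter f n (iter f m x)
iter-comm f m n x = trans (sym (iter-+ f m n x))
  (trans (cong (λ k → iter f k x) (ℕ.+-comm m n)) (iter-+ f n m x))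

iter-injective : ∀ {f : A → A} → Injective _≡_ _≡_ f → ∀ n → Injective _≡_ _≡_ (iter f n)
iter-injective inj zero    e = e
iter-injective inj (suc n) e = iter-injective inj n (inj e)

iter-cancel : ∀ {f : A → A} → Injective _≡_ _≡_ f → ∀ {i j} x → i < j → iter f i x ≡ iter f j x →
              ∃ λ k → suc k ≤ j × suc k ℕ.+ i ≡ j × iter f (suc k) x ≡ x
iter-cancel {f = f} inj {i} x i<j e with k , refl ← ℕ.m≤n⇒∃[o]m+o≡n i<j =
    k , s≤s (ℕ.m≤n+m k i) , cong suc (ℕ.+-comm k i)
  , iter-injective inj i (trans (sym (trans (cong (λ k → iter f k x) (sym (ℕ.+-suc i k)))
      (iter-+ f i (suc k) x))) (sym e))

least : {P : ℕ → Set} (P? : ∀ n → Dec (P n)) → ∀ n → P n → ∃ λ p → p ≤ n × P p ×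
  (∀ i → i < p → ¬ P i)
least P? zero    pn = zero , z≤n , pn , λ _ ()
least P? (suc n) pn with P? 0
... | yes p₀ = zero , z≤n , p₀ , λ _ ()
... | no ¬p₀ with p , p≤n , pp , min ← least (P? ∘ suc) n pn =
  suc p , s≤s p≤n , pp , λ { zero _ → ¬p₀ ; (suc i) (s≤s i<p) → min i i<p }

-- The cycle through x has p + 1 elements.

record IsPer (f : A → A) (x : A) (p : ℕ) : Set where
  constructor isPer
  field
    returns : iter f (suc p) x ≡ x
    minimal : ∀ i → i < p → iter f (suc i) x ≢ x

open IsPer

isPer-unique : ∀ {f : A → A} {x p q} → IsPer f x p → IsPer f x q → p ≡ q
isPer-unique {p = p} {q} P Q with ℕ.<-cmp p q
... | tri< p<q _ _ = contradiction (returns P) (minimal Q p p<q)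
... | tri≈ _ p≡q _ = p≡q
... | tri> _ _ q<p = contradiction (returns Q) (minimal P q q<p)

isPer-map : ∀ {B : Set} {f : A → A} {h : B → B} (e : A → B) → Injective _≡_ _≡_ e →
            (∀ x → h (e x) ≡ e (f x)) → ∀ {x p} → IsPer f x p → IsPer h (e x) p
isPer-map {f = f} {h} e e-inj comm {x} {p} P = isPer
  (trans (iter-map (suc p) x) (cong e (returns P)))
  (λ i i<p q → minimal P i i<p (e-inj (trans (sym (iter-map (suc i) x)) q)))
  where
  iter-map : ∀ n x → iter h n (e x) ≡ e (iter f n x)
  iter-map zero    x = refl
  iter-map (suc n) x = trans (cong h (iter-map n x)) (comm (iter f n x))

isPer-cong : ∀ {f g : A → A} → f ≗ g → ∀ {x p} → IsPer f x p → IsPer g x p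
isPer-cong e = isPer-map id id (λ x → sym (e x))

module _ {d} (f : Fin d → Fin d) (inj : Injective _≡_ _≡_ f) where

  private
    -- Two of the d + 1 points x, f x, ..., fᵈ x coincide. Injectivity cancels the shorter iterate,
    -- and the least return time is taken. The result is one less than the length of the cycle, in
    -- accordance with the indices of `t[1+_]` and `at`.
    period : ∀ x → ∃ λ p → p < d × iter f (suc p) x ≡ x × (∀ i → i < p → iter f (suc i) x ≢ x)
    period x with i , j , i<j , e ← Fin.pigeonhole (ℕ.n<1+n d) (λ i → iter f (toℕ i) x)
             with k , k<j , _ , e′ ← iter-cancel inj x i<j e
             with p , p≤k , r , m ← least (λ n → iter f (suc n) x Fin.≟ x) k e′ =
      p , ℕ.≤-trans (s≤s p≤k) (ℕ.≤-trans k<j (ℕ.≤-pred (Fin.toℕ<n j))) , r , m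

  opaque
    per : Fin d → ℕ
    per x = proj₁ (period x)

    per<d : ∀ x → per x < d
    per<d x = proj₁ (proj₂ (period x))

    per-isPer : ∀ x → IsPer f x (per x)
    per-isPer x = let _ , _ , r , m = period x in isPer r m

  per-unique : ∀ {x p} → IsPer f x p → per x ≡ p
  per-unique = isPer-unique (per-isPer _)

Same : (A → A) → Rel A _
Same f x y = ∃ λ n → iter f n x ≡ y

module _ {d} {f : Fin d → Fin d} (inj : Injective _≡_ _≡_ f) where

  private
    ℓ : Fin d → ℕ
    ℓ x = suc (per f inj x)

  same-reduce : ∀ n x → ∃ λ i → i < ℓ x × iter f i x ≡ iter f n x
  same-reduce zero    x = 0 , s≤s z≤n , refl
  same-reduce (suc n) x with i , i<ℓ , e ← same-reduce n x with suc i ℕ.<? ℓ x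
  ... | yes p = suc i , p , cong f e
  ... | no ¬p = 0 , s≤s z≤n , trans (sym (returns (per-isPer f inj x)))
    (trans (cong (λ n → iter f n x) (ℕ.≤-antisym (ℕ.≮⇒≥ ¬p) i<ℓ)) (cong f e))

  opaque
    same? : Decidable (Same f)
    same? x y = map′ (λ (i , e) → toℕ i , e)
      (λ { (n , refl) → let i , p , e = same-reduce n x in
        Fin.fromℕ< p , trans (cong (λ i → iter f i x) (Fin.toℕ-fromℕ< p)) e })
      (Fin.any? λ (i : Fin (ℓ x)) → iter f (toℕ i) x Fin.≟ y)

  same-sym : Symmetric (Same f)
  same-sym {x} (n , refl) with i , i<ℓ , e ← same-reduce n x with k , i+k≡ℓ ← ℕ.m≤n⇒∃[o]m+o≡n
      (ℕ.<⇒≤ i<ℓ) =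
    k , trans (cong (iter f k) (sym e)) (trans (sym (iter-+ f k i x))
      (trans (cong (λ n → iter f n x) (trans (ℕ.+-comm k i) i+k≡ℓ)) (returns (per-isPer f inj x))))

  iter-injective-< : ∀ x {i j} → i < ℓ x → j < ℓ x → iter f i x ≡ iter f j x → i ≡ j
  iter-injective-< x {i} {j} p q e with ℕ.<-cmp i j
  ... | tri≈ _ i≡j _ = i≡j
  ... | tri< i<j _ _ with k , k<j , _ , e′ ← iter-cancel inj x i<j e =
    contradiction e′ (minimal (per-isPer f inj x) k (ℕ.≤-trans k<j (ℕ.≤-pred q)))
  ... | tri> _ _ j<i with k , k<i , _ , e′ ← iter-cancel inj x j<i (sym e) =
    contradiction e′ (minimal (per-isPer f inj x) k (ℕ.≤-trans k<i (ℕ.≤-pred p)))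

  per-same : ∀ {x y} → Same f x y → per f inj x ≡ per f inj y
  per-same {x} (n , refl) = sym (per-unique f inj (isPer
    (trans (iter-comm f (ℓ x) n x) (cong (iter f n) (returns Pₓ)))
    (λ i i<p e → minimal Pₓ i i<p (iter-injective inj n (trans (iter-comm f n (suc i) x) e)))))
    where Pₓ = per-isPer f inj x

  Σ-same-class : ∀ x (g : Fin d → ℚ) →
                 Σ (allFin d) (λ y → ⟦ same? x y ⟧ * g y) ≡ Σ< (ℓ x) (λ i → g (iter f i x))
  Σ-same-class x g = begin
    Σ (allFin d) (λ y → ⟦ same? x y ⟧ * g y)
      ≡⟨ (Σ-cong (allFin d) λ y → trans (cong (_* g y) (indicator y))
          (sym (Σ-*ʳ (upTo (ℓ x)) (g y) (λ i → ⟦ iter f i x Fin.≟ y ⟧)))) ⟩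
    Σ (allFin d) (λ y → Σ< (ℓ x) λ i → ⟦ iter f i x Fin.≟ y ⟧ * g y)
      ≡⟨ Σ-swap (allFin d) (upTo (ℓ x)) _ ⟩
    Σ< (ℓ x) (λ i → Σ (allFin d) λ y → ⟦ iter f i x Fin.≟ y ⟧ * g y)
      ≡⟨ (Σ-cong (upTo (ℓ x)) λ i → Σ-indicator (Unique.allFin⁺ d) (∈-allFin (iter f i x))
          (iter f i x Fin.≟_) refl (λ _ → sym) g) ⟩
    Σ< (ℓ x) (λ i → g (iter f i x)) ∎
    where
    open ≡-Reasoning
    indicator : ∀ y → ⟦ same? x y ⟧ ≡ Σ< (ℓ x) (λ i → ⟦ iter f i x Fin.≟ y ⟧)
    indicator y = go (same? x y)
      where
      go : Dec (Same f x y) → ⟦ same? x y ⟧ ≡ Σ< (ℓ x) (λ i → ⟦ iter f i x Fin.≟ y ⟧)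
      go (yes (n , e)) = let i , i<ℓ , e′ = same-reduce n x in
        trans (⟦⟧-yes (same? x y) (n , e))
            (sym (Σ-one (Unique.upTo⁺ (ℓ x)) (∈-upTo⁺ i<ℓ) (λ i → iter f i x Fin.≟ y)
          (trans e′ e) λ j∈ e″ → iter-injective-< x (∈-upTo⁻ j∈) i<ℓ (trans e″ (sym (trans e′ e)))))
      go (no ¬s) = trans (⟦⟧-no (same? x y) ¬s)
        (sym (Σ-null (upTo (ℓ x)) λ {i} _ → ⟦⟧-no (iter f i x Fin.≟ y) (λ e → ¬s (i , e))))

  Σ-same-one : ∀ x → Σ (allFin d) (λ y → ⟦ same? x y ⟧) ≡ fromℕ (ℓ x)
  Σ-same-one x = begin
    Σ (allFin d) (λ y → ⟦ same? x y ⟧)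
      ≡⟨ (Σ-cong (allFin d) λ y → ℚ.*-identityʳ ⟦ same? x y ⟧) ⟨
    Σ (allFin d) (λ y → ⟦ same? x y ⟧ * 1ℚ)
      ≡⟨ Σ-same-class x (λ _ → 1ℚ) ⟩
    Σ< (ℓ x) (λ _ → 1ℚ)
      ≡⟨ fromℕ-length (upTo (ℓ x)) ⟨
    fromℕ (length (upTo (ℓ x)))
      ≡⟨ cong fromℕ (length-upTo (ℓ x)) ⟩
    fromℕ (ℓ x) ∎
    where
    open ≡-Reasoning
    open import Data.List.Properties using (length-upTo)

same-trans : ∀ {f : A → A} → Transitive (Same f)
same-trans {f = f} {x} (m , refl) (n , refl) = n ℕ.+ m , iter-+ f n m x

-- Each class keeps exactly one representative. Inserting this 1 turns sums over elements into sums
-- over representatives; it is used for the cycles of a permutation, the cycles of a graph and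
-- isomorphism classes of graphs.
Σ-deduplicate : {R : Rel A _} (R? : Decidable R) → Symmetric R → Transitive R →
                ∀ {xs x} → Any (λ y → R y x) xs → Σ (deduplicate R? xs) (λ r → ⟦ R? r x ⟧) ≡ 1ℚ
Σ-deduplicate {R = R} R? R-sym R-trans {y ∷ xs} {x} p = trans
  (cong (⟦ R? y x ⟧ +_) (Σ-filter (¬? ∘ R? y) (deduplicate R? xs) (λ r → ⟦ R? r x ⟧)))
  (go (R? y x))
  where
  rest : ℚ
  rest = Σ (deduplicate R? xs) (λ r → ⟦ ¬? (R? y r) ⟧ * ⟦ R? r x ⟧)
  go : Dec (R y x) → ⟦ R? y x ⟧ + rest ≡ 1ℚ
  go (yes yx) = trans (cong₂ _+_ (⟦⟧-yes (R? y x) yx) (Σ-null (deduplicate R? xs) λ {r} _ → null r))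
      (ℚ.+-identityʳ 1ℚ)
    where
    null : ∀ r → ⟦ ¬? (R? y r) ⟧ * ⟦ R? r x ⟧ ≡ 0ℚ
    null r = trans (⟦⟧*-cong (¬? (R? y r))
        (λ ¬yr → ⟦⟧-no (R? r x) (λ rx → ¬yr (R-trans yx (R-sym rx)))))
      (ℚ.*-zeroʳ ⟦ ¬? (R? y r) ⟧)
  go (no ¬yx) = trans (cong₂ _+_ (⟦⟧-no (R? y x) ¬yx)
      (trans (Σ-cong (deduplicate R? xs) keep) (Σ-deduplicate R? R-sym R-trans (tail-any p))))
          (ℚ.+-identityˡ 1ℚ)
    where
    keep : ∀ r → ⟦ ¬? (R? y r) ⟧ * ⟦ R? r x ⟧ ≡ ⟦ R? r x ⟧
    keep r = trans (ℚ.*-comm ⟦ ¬? (R? y r) ⟧ _) (trans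
      (⟦⟧*-cong (R? r x) (λ rx → ⟦⟧-yes (¬? (R? y r)) (λ yr → ¬yx (R-trans yr rx))))
      (ℚ.*-identityʳ ⟦ R? r x ⟧))
    tail-any : ∀ {xs} → Any (λ y → R y x) (y ∷ xs) → Any (λ y → R y x) xs
    tail-any (here yx) = contradiction yx ¬yx
    tail-any (there q) = q

at-tabulate : ∀ n f {i} → i < n → at (tabulate n f) i ≡ f i
at-tabulate (suc n) f {zero}  _       = head-◂ (f 0) (tabulate n (f ∘ suc))
at-tabulate (suc n) f {suc i} (s≤s p) = trans (at-◂ (f 0) (tabulate n (f ∘ suc)) i)
  (at-tabulate n (f ∘ suc) p)

at-tabulate-≥ : ∀ n f {i} → n ≤ i → at (tabulate n f) i ≡ 0
at-tabulate-≥ zero    f {i}     _       = at-nothing i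
at-tabulate-≥ (suc n) f {suc i} (s≤s p) = trans (at-◂ (f 0) (tabulate n (f ∘ suc)) i)
  (at-tabulate-≥ n (f ∘ suc) p)

total⁺ : Exponents⁺ → ℕ
total⁺ [1+ n ] = suc n
total⁺ (n ∷ m) = n ℕ.+ total⁺ m

total : Exponents → ℕ
total nothing  = 0
total (just m) = total⁺ m

total-⊞⁺ : ∀ m n → total⁺ (m ⊞⁺ n) ≡ total⁺ m ℕ.+ total⁺ n
total-⊞⁺ [1+ a ] [1+ b ] = refl
total-⊞⁺ [1+ a ] (b ∷ n) = cong suc (ℕ.+-assoc a b (total⁺ n))
total-⊞⁺ (a ∷ m) [1+ b ] = trans (ℕ.+-assoc a (suc b) (total⁺ m))
  (trans (cong (a ℕ.+_) (ℕ.+-comm (suc b) (total⁺ m))) (sym (ℕ.+-assoc a (total⁺ m) (suc b))))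
total-⊞⁺ (a ∷ m) (b ∷ n) = trans (cong (a ℕ.+ b ℕ.+_) (total-⊞⁺ m n))
  (interchange a b (total⁺ m) (total⁺ n))
  where
  open import Algebra.Properties.CommutativeSemigroup ℕ.+-commutativeSemigroup using (interchange)

total-⊞ : ∀ m n → total (m ⊞ n) ≡ total m ℕ.+ total n
total-⊞ nothing  n        = refl
total-⊞ (just m) nothing  = sym (ℕ.+-identityʳ (total⁺ m))
total-⊞ (just m) (just n) = total-⊞⁺ m n

total-◂ : ∀ n m → total (n ◂ m) ≡ n ℕ.+ total m
total-◂ zero    nothing  = refl
total-◂ (suc n) nothing  = cong suc (sym (ℕ.+-identityʳ n))
total-◂ zero    (just m) = refl
total-◂ (suc n) (just m) = refl

fromℕ-total-tabulate : ∀ n (f : ℕ → ℕ) → fromℕ (total (tabulate n f)) ≡ Σ< n (fromℕ ∘ f)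
fromℕ-total-tabulate zero    f = refl
fromℕ-total-tabulate (suc n) f = begin
  fromℕ (total (f 0 ◂ tabulate n (f ∘ suc)))
    ≡⟨ cong fromℕ (total-◂ (f 0) (tabulate n (f ∘ suc))) ⟩
  fromℕ (f 0 ℕ.+ total (tabulate n (f ∘ suc)))
    ≡⟨ fromℕ-+ (f 0) _ ⟩
  fromℕ (f 0) + fromℕ (total (tabulate n (f ∘ suc)))
    ≡⟨ cong (fromℕ (f 0) +_) (fromℕ-total-tabulate n (f ∘ suc)) ⟩
  fromℕ (f 0) + Σ< n (fromℕ ∘ f ∘ suc)
    ≡⟨ Σ<-suc n (fromℕ ∘ f) ⟨
  Σ< (suc n) (fromℕ ∘ f) ∎
  where open ≡-Reasoning

-- Both sides count the points on cycles of length i + 1. This determines `m` by division in ℚ,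
-- needs no representatives, and is additive when the set of points is split into invariant parts.
CycleType : (f : Fin d → Fin d) → Injective _≡_ _≡_ f → Exponents → Set
CycleType {d} f inj m = ∀ i → fromℕ (suc i) * fromℕ (at m i) ≡ Σ (allFin d)
  (λ x → ⟦ per f inj x ℕ.≟ i ⟧)

cycleType-unique : ∀ {f : Fin d → Fin d} {inj : Injective _≡_ _≡_ f} {m n} → CycleType f inj m →
  CycleType f inj n → m ≡ n
cycleType-unique {m = m} {n} C D = at-injective m n λ i →
  fromℕ-injective (fromℕ-cancelˡ i (trans (C i) (sym (D i))))

module _ {d} (f : Fin d → Fin d) (inj : Injective _≡_ _≡_ f) where

  private
    reps : List (Fin d)
    reps = deduplicate (same? inj) (allFin d)

  private
    reps-count : ∀ i → fromℕ (suc i) * Σ reps (λ r → ⟦ per f inj r ℕ.≟ i ⟧) ≡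
                       Σ (allFin d) (λ x → ⟦ per f inj x ℕ.≟ i ⟧)
    reps-count i = sym (begin
      Σ (allFin d) (λ x → ⟦ per f inj x ℕ.≟ i ⟧)
        ≡⟨ (Σ-cong (allFin d) λ x → trans (sym (ℚ.*-identityˡ ⟦ per f inj x ℕ.≟ i ⟧))
            (trans (cong (_* ⟦ per f inj x ℕ.≟ i ⟧)
             (sym (Σ-deduplicate (same? inj) (same-sym inj) (same-trans {f = f}) {allFin d} {x}
                 (Any.map (λ { refl → 0 , refl }) (∈-allFin x)))))
             (sym (Σ-*ʳ reps ⟦ per f inj x ℕ.≟ i ⟧ _)))) ⟩
      Σ (allFin d) (λ x → Σ reps λ r → ⟦ same? inj r x ⟧ * ⟦ per f inj x ℕ.≟ i ⟧)
        ≡⟨ Σ-swap (allFin d) reps _ ⟩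
      Σ reps (λ r → Σ (allFin d) λ x → ⟦ same? inj r x ⟧ * ⟦ per f inj x ℕ.≟ i ⟧)
        ≡⟨ (Σ-cong reps λ r → Σ-cong (allFin d) λ x → ⟦⟧*-cong (same? inj r x) λ s →
             cong (λ p → ⟦ p ℕ.≟ i ⟧) (sym (per-same inj s))) ⟩
      Σ reps (λ r → Σ (allFin d) λ x → ⟦ same? inj r x ⟧ * ⟦ per f inj r ℕ.≟ i ⟧)
        ≡⟨ (Σ-cong reps λ r → trans (Σ-*ʳ (allFin d) ⟦ per f inj r ℕ.≟ i ⟧ _)
            (trans (cong (_* ⟦ per f inj r ℕ.≟ i ⟧) (Σ-same-one inj r))
             (trans (ℚ.*-comm (fromℕ (suc (per f inj r))) _)
                 (trans (⟦⟧*-cong (per f inj r ℕ.≟ i) λ { refl → refl })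
                 (ℚ.*-comm _ (fromℕ (suc i))))))) ⟩
      Σ reps (λ r → fromℕ (suc i) * ⟦ per f inj r ℕ.≟ i ⟧)
        ≡⟨ Σ-*ˡ reps (fromℕ (suc i)) _ ⟩
      fromℕ (suc i) * Σ reps (λ r → ⟦ per f inj r ℕ.≟ i ⟧) ∎)
      where open ≡-Reasoning

  opaque
    cycleType : Exponents
    cycleType = tabulate d (λ i → length (filter (λ r → per f inj r ℕ.≟ i) reps))

    cycleType-isCycleType : CycleType f inj cycleType
    cycleType-isCycleType i with i ℕ.<? d
    ... | yes i<d = trans (cong (λ n → fromℕ (suc i) * fromℕ n) (at-tabulate d _ i<d))
      (trans (cong (fromℕ (suc i) *_) (fromℕ-count (λ r → per f inj r ℕ.≟ i) reps)) (reps-count i))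
    ... | no i≮d = trans (cong (λ n → fromℕ (suc i) * fromℕ n) (at-tabulate-≥ d _ (ℕ.≮⇒≥ i≮d)))
      (trans (ℚ.*-zeroʳ (fromℕ (suc i))) (sym (Σ-null (allFin d) λ {x} _ →
        ⟦⟧-no (per f inj x ℕ.≟ i) λ { refl → i≮d (per<d f inj x) })))

tᵉ : ℕ → Exponents
tᵉ i = adjustAt suc i nothing

fromℕ-at-tᵉ : ∀ p i → fromℕ (at (tᵉ p) i) ≡ ⟦ p ℕ.≟ i ⟧
fromℕ-at-tᵉ p i = go (p ℕ.≟ i)
  where
  go : Dec (p ≡ i) → fromℕ (at (tᵉ p) i) ≡ ⟦ p ℕ.≟ i ⟧
  go (yes refl) = trans (cong fromℕ (trans (at-adjustAt suc p nothing) (cong suc (at-nothing p))))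
      (sym (⟦⟧-yes (p ℕ.≟ p) refl))
  go (no p≢i) = trans (cong fromℕ (trans (at-adjustAt-≢ suc p nothing i (p≢i ∘ sym))
      (at-nothing i))) (sym (⟦⟧-no (p ℕ.≟ i) p≢i))

⊞-assoc : ∀ a b c → (a ⊞ b) ⊞ c ≡ a ⊞ (b ⊞ c)
⊞-assoc a b c = cong exp-t (✶-assoc (mono 0 0 0 a) (mono 0 0 0 b) (mono 0 0 0 c))

⊞-comm : ∀ a b → a ⊞ b ≡ b ⊞ a
⊞-comm a b = cong exp-t (✶-comm (mono 0 0 0 a) (mono 0 0 0 b))

⊞-cancelˡ : ∀ a {b c} → a ⊞ b ≡ a ⊞ c → b ≡ c
⊞-cancelˡ a e = cong exp-t (✶-cancelˡ (mono 0 0 0 a) (cong (mono 0 0 0) e))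

⊞-cancelʳ : ∀ a {b c} → b ⊞ a ≡ c ⊞ a → b ≡ c
⊞-cancelʳ a {b} {c} e = ⊞-cancelˡ a (trans (⊞-comm a b) (trans e (⊞-comm c a)))

⊞-swapʳ : ∀ a b c → (a ⊞ b) ⊞ c ≡ (a ⊞ c) ⊞ b
⊞-swapʳ a b c = trans (⊞-assoc a b c) (trans (cong (a ⊞_) (⊞-comm b c)) (sym (⊞-assoc a c b)))

total-tᵉ : ∀ i → total (tᵉ i) ≡ 1
total-tᵉ zero    = refl
total-tᵉ (suc i) = trans (total-◂ 0 (adjustAt suc i nothing)) (total-tᵉ i)

adjustAt-suc : ∀ i m → adjustAt suc i m ≡ tᵉ i ⊞ m
adjustAt-suc i m = cong exp-t (adjust-suc t[1+ i ] (mono 0 0 0 m))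

factor : ∀ r m → at m r ≢ 0 → ∃ λ m₀ → m ≡ m₀ ⊞ tᵉ r
factor r m n = adjustAt pred r m , (begin
  m
    ≡⟨ cong exp-t (adjust-suc-pred t[1+ r ] (mono 0 0 0 m) n) ⟨
  adjustAt suc r (adjustAt pred r m)
    ≡⟨ adjustAt-suc r (adjustAt pred r m) ⟩
  tᵉ r ⊞ adjustAt pred r m
    ≡⟨ ⊞-comm (tᵉ r) _ ⟩
  adjustAt pred r m ⊞ tᵉ r ∎)
  where open ≡-Reasoning

-- Transpositions: joining and cutting cycles

swap : Fin d → Fin d → Fin d → Fin d
swap a b x with x Fin.≟ a | x Fin.≟ b
... | yes _ | _     = b
... | no _  | yes _ = a
... | no _  | no _  = x

swap-ˡ : ∀ (a b : Fin d) → swap a b a ≡ b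
swap-ˡ a b with a Fin.≟ a | a Fin.≟ b
... | yes _  | _ = refl
... | no a≢a | _ = contradiction refl a≢a

swap-ʳ : ∀ (a b : Fin d) → swap a b b ≡ a
swap-ʳ a b with b Fin.≟ a | b Fin.≟ b
... | yes b≡a | _      = b≡a
... | no _    | yes _  = refl
... | no _    | no b≢b = contradiction refl b≢b

swap-≢ : ∀ (a b : Fin d) {x} → x ≢ a → x ≢ b → swap a b x ≡ x
swap-≢ a b {x} p q with x Fin.≟ a | x Fin.≟ b
... | yes x≡a | _       = contradiction x≡a p
... | no _    | yes x≡b = contradiction x≡b q
... | no _    | no _    = refl

swap-involutive : ∀ (a b x : Fin d) → swap a b (swap a b x) ≡ x
swap-involutive a b x with x Fin.≟ a | x Fin.≟ b
... | yes refl | _        = swap-ʳ a b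
... | no _     | yes refl = swap-ˡ a b
... | no p     | no q     = swap-≢ a b p q

swap-injective : ∀ (a b : Fin d) → Injective _≡_ _≡_ (swap a b)
swap-injective a b {x} {y} e =
  trans (sym (swap-involutive a b x)) (trans (cong (swap a b) e) (swap-involutive a b y))

swap-self : ∀ (a x : Fin d) → swap a a x ≡ x
swap-self a x with x Fin.≟ a
... | yes refl = refl
... | no _     = refl

swap-natural : ∀ {c} (e : Fin c → Fin d) → Injective _≡_ _≡_ e → ∀ a b x → swap (e a) (e b) (e x)
  ≡ e (swap a b x)
swap-natural e inj a b x with x Fin.≟ a | x Fin.≟ b
... | yes refl | _        = swap-ˡ (e a) (e b)
... | no _     | yes refl = swap-ʳ (e a) (e b)
... | no p     | no q     = swap-≢ (e a) (e b) (p ∘ inj) (q ∘ inj)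

-- The relation between f and g = f ∘ (a b), stated pointwise. In this form it is symmetric in a and
-- b and also in f and g, so that cutting by g can be read as joining by f.
record Switched (f g : Fin d → Fin d) (a b : Fin d) : Set where
  constructor switched
  field
    atˡ   : g a ≡ f b
    atʳ   : g b ≡ f a
    other : ∀ {x} → x ≢ a → x ≢ b → g x ≡ f x

switched-swap : ∀ (f : Fin d → Fin d) a b → Switched f (f ∘ swap a b) a b
switched-swap f a b = switched (cong f (swap-ˡ a b)) (cong f (swap-ʳ a b))
  (λ p q → cong f (swap-≢ a b p q))

switched-sym : ∀ {f g : Fin d → Fin d} {a b} → Switched f g a b → Switched f g b a
switched-sym (switched p q r) = switched q p (λ x y → r y x)

switched-inverse : ∀ {f g : Fin d → Fin d} {a b} → Switched f g a b → Switched g f a b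
switched-inverse (switched p q r) = switched (sym q) (sym p) (λ x y → sym (r x y))

-- The first step of g leads from a to f b. Afterwards g follows f until b is reached, since the
-- path stays on the cycle of b, which does not contain a.
walk : ∀ {f g : Fin d → Fin d} {a b} (inj : Injective _≡_ _≡_ f) → Switched f g a b → ¬ Same f a b →
       ∀ i → i ≤ per f inj b → iter g (suc i) a ≡ iter f (suc i) b
walk             inj S ns zero    _ = Switched.atˡ S
walk {g = g} {a} {b} inj S ns (suc i) p = trans (cong g (walk inj S ns i (ℕ.<⇒≤ p)))
  (Switched.other S (λ e → ns (same-sym inj (suc i , e))) (IsPer.minimal (per-isPer _ inj b) i p))

module Join {d} {f g : Fin d → Fin d} {a b : Fin d}
            (inj : Injective _≡_ _≡_ f) (inj′ : Injective _≡_ _≡_ g)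
            (S : Switched f g a b) (ns : ¬ Same f a b) where

  private
    ns′ : ¬ Same f b a
    ns′ = ns ∘ same-sym inj
    p q : ℕ
    p = per f inj a
    q = per f inj b
    a⇝b : iter g (suc q) a ≡ b
    a⇝b = trans (walk inj S ns q ℕ.≤-refl) (IsPer.returns (per-isPer f inj b))
    b⇝a : iter g (suc p) b ≡ a
    b⇝a = trans (walk inj (switched-sym S) ns′ p ℕ.≤-refl) (IsPer.returns (per-isPer f inj a))

  same-ab : Same g a b
  same-ab = suc q , a⇝b

  private
    isPer-a : IsPer g a (p ℕ.+ suc q)
    isPer-a = isPer
      (trans (iter-+ g (suc p) (suc q) a) (trans (cong (iter g (suc p)) a⇝b) b⇝a)) no-return
      where
      -- For i ≤ q the point reached lies on the f-cycle of b, hence is not a. Later points lie on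
      -- the f-cycle of a, where the minimality of p excludes an early return.
      no-return : ∀ i → i < p ℕ.+ suc q → iter g (suc i) a ≢ a
      no-return i i<p+q e with i ℕ.≤? q
      ... | yes i≤q = ns′ (suc i , trans (sym (walk inj S ns i i≤q)) e)
      ... | no i≰q with j , refl ← ℕ.m≤n⇒∃[o]m+o≡n (ℕ.≰⇒> i≰q) =
        IsPer.minimal (per-isPer f inj a) j j<p
          (trans (sym (walk inj (switched-sym S) ns′ j (ℕ.<⇒≤ j<p)))
            (trans (cong (iter g (suc j)) (sym a⇝b))
              (trans (sym (iter-+ g (suc j) (suc q) a))
                  (trans (cong (λ n → iter g n a) (cong suc (ℕ.+-comm j (suc q)))) e))))
        where
        j<p : j < p
        j<p = ℕ.+-cancelˡ-< (suc q) j p (ℕ.<-≤-trans i<p+q (ℕ.≤-reflexive (ℕ.+-comm p (suc q))))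

  per-a : per g inj′ a ≡ p ℕ.+ suc q
  per-a = per-unique g inj′ isPer-a

  private
    same-a : ∀ {z} → Same f a z → Same g a z
    same-a {z} (n , e) with same-reduce inj n a
    ... | zero  , _ , e′ = 0 , trans e′ e
    ... | suc i , s≤s i<p , e′ = same-trans {f = g} same-ab
      (suc i , trans (walk inj (switched-sym S) ns′ i (ℕ.<⇒≤ i<p)) (trans e′ e))

    same-b : ∀ {z} → Same f b z → Same g a z
    same-b {z} (n , e) with same-reduce inj n b
    ... | zero  , _ , e′ = same-trans {f = g} same-ab (0 , trans e′ e)
    ... | suc i , s≤s i<q , e′ = suc i , trans (walk inj S ns i (ℕ.<⇒≤ i<q)) (trans e′ e)

    iter-other : ∀ {z} → ¬ Same f a z → ¬ Same f b z → ∀ n → iter g n z ≡ iter f n z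
    iter-other na nb zero    = refl
    iter-other na nb (suc n) = trans (cong g (iter-other na nb n))
      (Switched.other S (λ e → na (same-sym inj (n , e))) (λ e → nb (same-sym inj (n , e))))

  per-other : ∀ {z} → ¬ Same f a z → ¬ Same f b z → per g inj′ z ≡ per f inj z
  per-other {z} na nb = per-unique g inj′ (isPer
    (trans (iter-other na nb (suc (per f inj z))) (IsPer.returns P₀))
    (λ i i<p e → IsPer.minimal P₀ i i<p (trans (sym (iter-other na nb (suc i))) e)))
    where P₀ = per-isPer f inj z

  same-a⁻ : ∀ {z} → ¬ Same f a z → ¬ Same f b z → ¬ Same g a z
  same-a⁻ {z} na nb az with n , e ← same-sym inj′ az =
    na (same-sym inj (n , trans (sym (iter-other na nb n)) e))

  private
    pointwise : ∀ i z → ⟦ per g inj′ z ℕ.≟ i ⟧ +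
        (⟦ same? inj a z ⟧ * ⟦ p ℕ.≟ i ⟧ + ⟦ same? inj b z ⟧ * ⟦ q ℕ.≟ i ⟧) ≡
                        ⟦ per f inj z ℕ.≟ i ⟧ + (⟦ same? inj a z ⟧ + ⟦ same? inj b z ⟧) * ⟦ p ℕ.+
                            suc q ℕ.≟ i ⟧
    pointwise i z = go (same? inj a z) (same? inj b z)
      where
      open +-*-Solver using (solve; _:=_; con; _:+_; _:*_)
      lhs rhs : ℚ → ℚ → ℕ → ℕ → ℚ
      lhs A B n m = ⟦ n ℕ.≟ i ⟧ + (A * ⟦ p ℕ.≟ i ⟧ + B * ⟦ q ℕ.≟ i ⟧)
      rhs A B n m = ⟦ m ℕ.≟ i ⟧ + (A + B) * ⟦ p ℕ.+ suc q ℕ.≟ i ⟧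
      to : ∀ {A B n m} → ⟦ same? inj a z ⟧ ≡ A → ⟦ same? inj b z ⟧ ≡ B → per g inj′ z ≡ n →
          per f inj z ≡ m →
           lhs A B n m ≡ rhs A B n m →
           lhs ⟦ same? inj a z ⟧ ⟦ same? inj b z ⟧ (per g inj′ z) (per f inj z) ≡
           rhs ⟦ same? inj a z ⟧ ⟦ same? inj b z ⟧ (per g inj′ z) (per f inj z)
      to refl refl refl refl e = e
      go : Dec (Same f a z) → Dec (Same f b z) →
           lhs ⟦ same? inj a z ⟧ ⟦ same? inj b z ⟧ (per g inj′ z) (per f inj z) ≡
           rhs ⟦ same? inj a z ⟧ ⟦ same? inj b z ⟧ (per g inj′ z) (per f inj z)
      go (yes az) (yes bz) = contradiction (same-trans {f = f} az (same-sym inj bz)) ns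
      go (yes az) (no ¬bz) = to (⟦⟧-yes (same? inj a z) az) (⟦⟧-no (same? inj b z) ¬bz)
        (trans (sym (per-same inj′ (same-a az))) per-a) (sym (per-same inj az))
        (solve 3 (λ x y z → z :+ (con 1ℚ :* x :+ con 0ℚ :* y) := x :+ (con 1ℚ :+ con 0ℚ) :* z) refl
          ⟦ p ℕ.≟ i ⟧ ⟦ q ℕ.≟ i ⟧ ⟦ p ℕ.+ suc q ℕ.≟ i ⟧)
      go (no ¬az) (yes bz) = to (⟦⟧-no (same? inj a z) ¬az) (⟦⟧-yes (same? inj b z) bz)
        (trans (sym (per-same inj′ (same-b bz))) per-a) (sym (per-same inj bz))
        (solve 3 (λ x y z → z :+ (con 0ℚ :* x :+ con 1ℚ :* y) := y :+ (con 0ℚ :+ con 1ℚ) :* z) refl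
          ⟦ p ℕ.≟ i ⟧ ⟦ q ℕ.≟ i ⟧ ⟦ p ℕ.+ suc q ℕ.≟ i ⟧)
      go (no ¬az) (no ¬bz) = to (⟦⟧-no (same? inj a z) ¬az) (⟦⟧-no (same? inj b z) ¬bz)
        (per-other ¬az ¬bz) refl
        (solve 4 (λ x y z w → w :+ (con 0ℚ :* x :+ con 0ℚ :* y) := w :+ (con 0ℚ :+ con 0ℚ) :* z)
            refl
          ⟦ p ℕ.≟ i ⟧ ⟦ q ℕ.≟ i ⟧ ⟦ p ℕ.+ suc q ℕ.≟ i ⟧ ⟦ per f inj z ℕ.≟ i ⟧)

  -- A subtraction-free way to say that two cycles are replaced by one. After multiplication by i +
  -- 1 it is the identity `pointwise` summed over all points: on either of the joined cycles the
  -- period of a point changes to p + q + 1, elsewhere nothing changes.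
  cycleType-join : ∀ {m m′} → CycleType f inj m → CycleType g inj′ m′ →
                   (m′ ⊞ tᵉ p) ⊞ tᵉ q ≡ m ⊞ tᵉ (p ℕ.+ suc q)
  cycleType-join {m} {m′} C C′ = at-injective _ _ λ i → fromℕ-injective (fromℕ-cancelˡ i (begin
    n i * fromℕ (at ((m′ ⊞ tᵉ p) ⊞ tᵉ q) i)
      ≡⟨ cong (n i *_) (at³ m′ i) ⟩
    n i * (fromℕ (at m′ i) + (⟦ p ℕ.≟ i ⟧ + ⟦ q ℕ.≟ i ⟧))
      ≡⟨ distrib (n i) (fromℕ (at m′ i)) ⟦ p ℕ.≟ i ⟧ ⟦ q ℕ.≟ i ⟧ ⟩
    n i * fromℕ (at m′ i) + (n i * ⟦ p ℕ.≟ i ⟧ + n i * ⟦ q ℕ.≟ i ⟧)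
      ≡⟨ cong₂ _+_ (C′ i) (cong₂ _+_ (class a i p refl) (class b i q refl)) ⟩
    Σ V (λ z → ⟦ per g inj′ z ℕ.≟ i ⟧) +
        (Σ V (λ z → inA z * ⟦ p ℕ.≟ i ⟧) + Σ V (λ z → inB z * ⟦ q ℕ.≟ i ⟧))
      ≡⟨ cong (Σ V (λ z → ⟦ per g inj′ z ℕ.≟ i ⟧) +_)
          (Σ-+ V (λ z → inA z * ⟦ p ℕ.≟ i ⟧) (λ z → inB z * ⟦ q ℕ.≟ i ⟧)) ⟨
    Σ V (λ z → ⟦ per g inj′ z ℕ.≟ i ⟧) + Σ V (λ z → inA z * ⟦ p ℕ.≟ i ⟧ + inB z * ⟦ q ℕ.≟ i ⟧)
      ≡⟨ Σ-+ V (λ z → ⟦ per g inj′ z ℕ.≟ i ⟧) (λ z → inA z * ⟦ p ℕ.≟ i ⟧ + inB z * ⟦ q ℕ.≟ i ⟧) ⟨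
    Σ V (λ z → ⟦ per g inj′ z ℕ.≟ i ⟧ + (inA z * ⟦ p ℕ.≟ i ⟧ + inB z * ⟦ q ℕ.≟ i ⟧))
      ≡⟨ Σ-cong V (pointwise i) ⟩
    Σ V (λ z → ⟦ per f inj z ℕ.≟ i ⟧ + (inA z + inB z) * r i)
      ≡⟨ Σ-+ V (λ z → ⟦ per f inj z ℕ.≟ i ⟧) (λ z → (inA z + inB z) * r i) ⟩
    Σ V (λ z → ⟦ per f inj z ℕ.≟ i ⟧) + Σ V (λ z → (inA z + inB z) * r i)
      ≡⟨ cong (Σ V (λ z → ⟦ per f inj z ℕ.≟ i ⟧) +_)
          (trans (Σ-*ʳ V (r i) (λ z → inA z + inB z)) (cong (_* r i)
           (trans (Σ-+ V inA inB) (trans (cong₂ _+_ (Σ-same-one inj a) (Σ-same-one inj b))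
               (sym (fromℕ-+ (suc p) (suc q))))))) ⟩
    Σ V (λ z → ⟦ per f inj z ℕ.≟ i ⟧) + fromℕ (suc (p ℕ.+ suc q)) * r i
      ≡⟨ cong₂ _+_ (C i) (index (p ℕ.+ suc q) i) ⟨
    n i * fromℕ (at m i) + n i * r i
      ≡⟨ ℚ.*-distribˡ-+ (n i) (fromℕ (at m i)) (r i) ⟨
    n i * (fromℕ (at m i) + r i)
      ≡⟨ cong (n i *_) (trans (cong fromℕ (at-⊞ m (tᵉ (p ℕ.+ suc q)) i)) (trans (fromℕ-+ (at m i) _)
           (cong (fromℕ (at m i) +_) (fromℕ-at-tᵉ (p ℕ.+ suc q) i)))) ⟨
    n i * fromℕ (at (m ⊞ tᵉ (p ℕ.+ suc q)) i) ∎))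
    where
    open ≡-Reasoning
    V = allFin d
    n r : ℕ → ℚ
    n i = fromℕ (suc i)
    r i = ⟦ p ℕ.+ suc q ℕ.≟ i ⟧
    inA inB : Fin d → ℚ
    inA z = ⟦ same? inj a z ⟧
    inB z = ⟦ same? inj b z ⟧
    distrib : ∀ a b c d → a * (b + (c + d)) ≡ a * b + (a * c + a * d)
    distrib = solve 4 (λ a b c d → a :* (b :+ (c :+ d)) := a :* b :+ (a :* c :+ a :* d)) refl
      where open +-*-Solver using (solve; _:=_; _:+_; _:*_)
    index : ∀ c i → n i * ⟦ c ℕ.≟ i ⟧ ≡ n c * ⟦ c ℕ.≟ i ⟧
    index c i = trans (ℚ.*-comm (n i) _)
        (trans (⟦⟧*-cong (c ℕ.≟ i) λ { refl → refl }) (ℚ.*-comm _ (n c)))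
    class : ∀ c i k → per f inj c ≡ k → n i * ⟦ k ℕ.≟ i ⟧ ≡ Σ V
        (λ z → ⟦ same? inj c z ⟧ * ⟦ k ℕ.≟ i ⟧)
    class c i k refl = trans (index k i)
      (trans (cong (_* ⟦ k ℕ.≟ i ⟧) (sym (Σ-same-one inj c)))
          (sym (Σ-*ʳ V ⟦ k ℕ.≟ i ⟧ (λ z → ⟦ same? inj c z ⟧))))
    at³ : ∀ m i → fromℕ (at ((m ⊞ tᵉ p) ⊞ tᵉ q) i) ≡ fromℕ (at m i) + (⟦ p ℕ.≟ i ⟧ + ⟦ q ℕ.≟ i ⟧)
    at³ m i = begin
      fromℕ (at ((m ⊞ tᵉ p) ⊞ tᵉ q) i)
        ≡⟨ cong fromℕ (trans (at-⊞ (m ⊞ tᵉ p) (tᵉ q) i) (cong (ℕ._+ at (tᵉ q) i) (at-⊞ m (tᵉ p) i)))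
            ⟩
      fromℕ (at m i ℕ.+ at (tᵉ p) i ℕ.+ at (tᵉ q) i)
        ≡⟨ trans (fromℕ-+ (at m i ℕ.+ at (tᵉ p) i) _)
            (cong (_+ fromℕ (at (tᵉ q) i)) (fromℕ-+ (at m i) _)) ⟩
      (fromℕ (at m i) + fromℕ (at (tᵉ p) i)) + fromℕ (at (tᵉ q) i)
        ≡⟨ cong₂ (λ x y → (fromℕ (at m i) + x) + y) (fromℕ-at-tᵉ p i) (fromℕ-at-tᵉ q i) ⟩
      (fromℕ (at m i) + ⟦ p ℕ.≟ i ⟧) + ⟦ q ℕ.≟ i ⟧
        ≡⟨ ℚ.+-assoc (fromℕ (at m i)) ⟦ p ℕ.≟ i ⟧ ⟦ q ℕ.≟ i ⟧ ⟩
      fromℕ (at m i) + (⟦ p ℕ.≟ i ⟧ + ⟦ q ℕ.≟ i ⟧) ∎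

-- g cuts the cycle of a under f in two; the part through b has j + 1 elements.

module Cut {d} {f g : Fin d → Fin d} {a b : Fin d}
           (inj : Injective _≡_ _≡_ f) (inj′ : Injective _≡_ _≡_ g)
           (S : Switched f g a b) {j : ℕ} (j<p : j < per f inj a) (a⇝b : iter f (suc j) a ≡ b) where

  private
    walk-b : ∀ i → i ≤ j → iter g (suc i) b ≡ iter f (suc i) a
    walk-b zero    _   = Switched.atʳ S
    walk-b (suc i) i<j = trans (cong g (walk-b i (ℕ.<⇒≤ i<j))) (Switched.other S
      (λ e → IsPer.minimal (per-isPer f inj a) i (ℕ.<-trans i<j j<p) e)
      (λ e → ℕ.<⇒≢ (s≤s i<j) (iter-injective-< inj a (s≤s (ℕ.<-trans i<j j<p)) (s≤s j<p)
          (trans e (sym a⇝b)))))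

  per-b : per g inj′ b ≡ j
  per-b = per-unique g inj′ (isPer (trans (walk-b j ℕ.≤-refl) a⇝b) λ i i<j e →
    ℕ.<⇒≢ (s≤s i<j) (iter-injective-< inj a (s≤s (ℕ.<-trans i<j j<p)) (s≤s j<p)
      (trans (sym (walk-b i (ℕ.<⇒≤ i<j))) (trans e (sym a⇝b)))))

  apart : ¬ Same g a b
  apart ab with n , e ← same-sym inj′ ab with same-reduce inj′ n b
  ... | zero  , _ , e′ = IsPer.minimal (per-isPer f inj a) j j<p (trans a⇝b (trans e′ e))
  ... | suc i , s≤s i<ℓ , e′ = IsPer.minimal (per-isPer f inj a) i (ℕ.<-trans i<j j<p)
    (trans (sym (walk-b i (ℕ.<⇒≤ i<j))) (trans e′ e))
    where
    i<j : i < j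
    i<j = ℕ.<-≤-trans i<ℓ (ℕ.≤-reflexive per-b)

  private
    -- Undoing the cut is a join, with the roles of f and g exchanged.
    module J = Join {f = g} {g = f} inj′ inj (switched-inverse S) apart

  per-sum : per f inj a ≡ per g inj′ a ℕ.+ suc j
  per-sum = trans J.per-a (cong (λ j → per g inj′ a ℕ.+ suc j) per-b)

  cycleType-cut : ∀ {m m′} → CycleType f inj m → CycleType g inj′ m′ →
                  (m ⊞ tᵉ (per g inj′ a)) ⊞ tᵉ j ≡ m′ ⊞ tᵉ (per f inj a)
  cycleType-cut {m} {m′} C C′ = trans (cong (λ j → (m ⊞ tᵉ (per g inj′ a)) ⊞ tᵉ j) (sym per-b))
    (trans (J.cycleType-join C′ C) (cong (λ r → m′ ⊞ tᵉ r) (sym J.per-a)))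

lift : (Fin d → Fin d) → Fin (suc d) → Fin (suc d)
lift f zero    = zero
lift f (suc x) = suc (f x)

lift-injective : ∀ {f : Fin d → Fin d} → Injective _≡_ _≡_ f → Injective _≡_ _≡_ (lift f)
lift-injective inj {zero}  {zero}  e = refl
lift-injective inj {suc x} {suc y} e = cong suc (inj (Fin.suc-injective e))

Σ-allFin-suc : (g : Fin (suc d) → ℚ) → Σ (allFin (suc d)) g ≡ g zero + Σ (allFin d) (g ∘ suc)
Σ-allFin-suc {d} g = cong (g zero +_)
  (trans (cong (λ xs → Σ xs g) (sym (List.map-tabulate id suc))) (Σ-map (allFin d) suc g))

module _ {d} {f : Fin d → Fin d} (inj : Injective _≡_ _≡_ f) where

  per-lift-zero : per (lift f) (lift-injective inj) zero ≡ 0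
  per-lift-zero = per-unique (lift f) (lift-injective inj) (isPer refl λ _ ())

  per-lift-suc : ∀ x → per (lift f) (lift-injective inj) (suc x) ≡ per f inj x
  per-lift-suc x = per-unique (lift f) (lift-injective inj)
    (isPer-map suc Fin.suc-injective (λ _ → refl) (per-isPer f inj x))

  iter-lift : ∀ n x → iter (lift f) n (suc x) ≡ suc (iter f n x)
  iter-lift zero    x = refl
  iter-lift (suc n) x = cong (lift f) (iter-lift n x)

  same-lift : ∀ {x y} → Same (lift f) (suc x) (suc y) → Same f x y
  same-lift {x} (n , e) = n , Fin.suc-injective (trans (sym (iter-lift n x)) e)

  apart-lift : ∀ x → ¬ Same (lift f) zero (suc x)
  apart-lift x (n , e) = contradiction (trans (sym (iter-zero n)) e) λ ()
    where
    iter-zero : ∀ n → iter (lift f) n zero ≡ zero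
    iter-zero zero    = refl
    iter-zero (suc n) = cong (lift f) (iter-zero n)

  cycleType-lift : ∀ {m} → CycleType f inj m → CycleType (lift f) (lift-injective inj) (m ⊞ tᵉ 0)
  cycleType-lift {m} C i = begin
    fromℕ (suc i) * fromℕ (at (m ⊞ tᵉ 0) i)
      ≡⟨ cong (fromℕ (suc i) *_) (trans (cong fromℕ (at-⊞ m (tᵉ 0) i))
          (trans (fromℕ-+ (at m i) _) (cong (fromℕ (at m i) +_) (fromℕ-at-tᵉ 0 i)))) ⟩
    fromℕ (suc i) * (fromℕ (at m i) + ⟦ 0 ℕ.≟ i ⟧)
      ≡⟨ ℚ.*-distribˡ-+ (fromℕ (suc i)) (fromℕ (at m i)) ⟦ 0 ℕ.≟ i ⟧ ⟩
    fromℕ (suc i) * fromℕ (at m i) + fromℕ (suc i) * ⟦ 0 ℕ.≟ i ⟧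
      ≡⟨ cong₂ _+_ (C i) (trans (ℚ.*-comm (fromℕ (suc i)) _)
          (trans (⟦⟧*-cong (0 ℕ.≟ i) λ { refl → refl }) (ℚ.*-identityʳ _))) ⟩
    Σ (allFin d) (λ x → ⟦ per f inj x ℕ.≟ i ⟧) + ⟦ 0 ℕ.≟ i ⟧
      ≡⟨ ℚ.+-comm (Σ (allFin d) (λ x → ⟦ per f inj x ℕ.≟ i ⟧)) _ ⟩
    ⟦ 0 ℕ.≟ i ⟧ + Σ (allFin d) (λ x → ⟦ per f inj x ℕ.≟ i ⟧)
      ≡⟨ cong₂ _+_ (cong (λ p → ⟦ p ℕ.≟ i ⟧) per-lift-zero)
          (Σ-cong (allFin d) λ x → cong (λ p → ⟦ p ℕ.≟ i ⟧) (per-lift-suc x)) ⟨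
    ⟦ per (lift f) (lift-injective inj) zero ℕ.≟ i ⟧ + Σ (allFin d)
        (λ x → ⟦ per (lift f) (lift-injective inj) (suc x) ℕ.≟ i ⟧)
      ≡⟨ Σ-allFin-suc (λ x → ⟦ per (lift f) (lift-injective inj) x ℕ.≟ i ⟧) ⟨
    Σ (allFin (suc d)) (λ x → ⟦ per (lift f) (lift-injective inj) x ℕ.≟ i ⟧) ∎
    where open ≡-Reasoning

cycleType-unique′ : ∀ {f : Fin d → Fin d} {inj : Injective _≡_ _≡_ f} {m} → CycleType f inj m →
  cycleType f inj ≡ m
cycleType-unique′ {f = f} {inj} C = cycleType-unique {f = f} {λ {x} {y} → inj {x} {y}}
  (cycleType-isCycleType f inj) C

cycleType-cong : ∀ {f g : Fin d → Fin d} (inj : Injective _≡_ _≡_ f) (inj′ : Injective _≡_ _≡_ g) →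
  f ≗ g →
                 cycleType f inj ≡ cycleType g inj′
cycleType-cong {d} {f} {g} inj inj′ e = cycleType-unique {f = f} {λ {x} {y} → inj {x} {y}}
  (cycleType-isCycleType f inj) λ i →
  trans (cycleType-isCycleType g inj′ i) (Σ-cong (allFin d) λ x →
    cong (λ p → ⟦ p ℕ.≟ i ⟧) (per-unique g inj′ (isPer-cong e (per-isPer f inj x))))

-- Exponents form a free commutative monoid. As `tᵉ p` and `tᵉ r` are different generators, the
-- factor `tᵉ p` on the left can only come from `n`, and after cancelling it `m` must contain
-- `tᵉ r`.
exchange : ∀ {m n p r} → m ⊞ tᵉ p ≡ n ⊞ tᵉ r → p ≢ r → ∃ λ m₀ → n ≡ m₀ ⊞ tᵉ p × m ≡ m₀ ⊞ tᵉ r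
exchange {m} {n} {p} {r} e p≢r = let m₀ , n≡ = factor p n n-has in
  m₀ , n≡ , ⊞-cancelʳ (tᵉ p) (trans e (trans (cong (_⊞ tᵉ r) n≡) (⊞-swapʳ m₀ (tᵉ p) (tᵉ r))))
  where
  n-has : at n p ≢ 0
  n-has z = ℕ.1+n≢0 (begin
    suc (at m p)
      ≡⟨ ℕ.+-comm 1 (at m p) ⟩
    at m p ℕ.+ 1
      ≡⟨ cong (at m p ℕ.+_) (trans (at-adjustAt suc p nothing) (cong suc (at-nothing p))) ⟨
    at m p ℕ.+ at (tᵉ p) p
      ≡⟨ at-⊞ m (tᵉ p) p ⟨
    at (m ⊞ tᵉ p) p
      ≡⟨ cong (λ m → at m p) e ⟩
    at (n ⊞ tᵉ r) p
      ≡⟨ at-⊞ n (tᵉ r) p ⟩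
    at n p ℕ.+ at (tᵉ r) p
      ≡⟨ cong₂ ℕ._+_ z (trans (at-adjustAt-≢ suc r nothing p p≢r) (at-nothing p)) ⟩
    0 ∎)
    where open ≡-Reasoning

-- `f₁` places the new point `zero` between a and f a, by joining the fixed point `zero` of `lift f`
-- to the cycle of a. The second transposition in `f₂` again moves `zero`: it cuts the enlarged
-- cycle if b lies on the cycle of a, and joins it to the cycle of b otherwise.
module Insert {d} (f : Fin d → Fin d) (inj : Injective _≡_ _≡_ f) (a : Fin d) where

  f₁ : Fin (suc d) → Fin (suc d)
  f₁ = lift f ∘ swap zero (suc a)

  f₁-injective : Injective _≡_ _≡_ f₁
  f₁-injective = swap-injective zero (suc a) ∘ lift-injective inj

  private
    p : ℕ
    p = per f inj a
    m m₁ : Exponents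
    m = cycleType f inj
    m₁ = cycleType f₁ f₁-injective
    S = switched-swap (lift f) zero (suc a)
    module J = Join (lift-injective inj) f₁-injective S (apart-lift inj a)

    per-zero : per f₁ f₁-injective zero ≡ suc p
    per-zero = trans J.per-a (cong₂ (λ x y → x ℕ.+ suc y) (per-lift-zero inj) (per-lift-suc inj a))

  extended : ∃ λ m₀ → m ≡ m₀ ⊞ tᵉ p × m₁ ≡ m₀ ⊞ tᵉ (suc p)
  extended = exchange {m₁} {m} {p} {suc p} (⊞-cancelʳ (tᵉ 0) (begin
    (m₁ ⊞ tᵉ p) ⊞ tᵉ 0
      ≡⟨ ⊞-swapʳ m₁ (tᵉ p) (tᵉ 0) ⟩
    (m₁ ⊞ tᵉ 0) ⊞ tᵉ p
      ≡⟨ cong₂ (λ x y → (m₁ ⊞ tᵉ x) ⊞ tᵉ y) (per-lift-zero inj) (per-lift-suc inj a) ⟨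
    (m₁ ⊞ tᵉ (per (lift f) (lift-injective inj) zero)) ⊞ tᵉ
        (per (lift f) (lift-injective inj) (suc a))
      ≡⟨ J.cycleType-join {m ⊞ tᵉ 0} {m₁} (cycleType-lift inj {m} (cycleType-isCycleType f inj))
          (cycleType-isCycleType f₁ f₁-injective) ⟩
    (m ⊞ tᵉ 0) ⊞ tᵉ (per (lift f) (lift-injective inj) zero ℕ.+ suc
        (per (lift f) (lift-injective inj) (suc a)))
      ≡⟨ cong₂ (λ x y → (m ⊞ tᵉ 0) ⊞ tᵉ (x ℕ.+ suc y)) (per-lift-zero inj) (per-lift-suc inj a) ⟩
    (m ⊞ tᵉ 0) ⊞ tᵉ (suc p)
      ≡⟨ ⊞-swapʳ m (tᵉ 0) (tᵉ (suc p)) ⟩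
    (m ⊞ tᵉ (suc p)) ⊞ tᵉ 0 ∎))
    (λ e → ℕ.1+n≢n (sym e))
    where open ≡-Reasoning

  total-extended : total m₁ ≡ total m
  total-extended = let m₀ , e , e₁ = extended in begin
    total m₁
      ≡⟨ cong total e₁ ⟩
    total (m₀ ⊞ tᵉ (suc p))
      ≡⟨ total-⊞ m₀ (tᵉ (suc p)) ⟩
    total m₀ ℕ.+ total (tᵉ (suc p))
      ≡⟨ cong (total m₀ ℕ.+_) (trans (total-tᵉ (suc p)) (sym (total-tᵉ p))) ⟩
    total m₀ ℕ.+ total (tᵉ p)
      ≡⟨ total-⊞ m₀ (tᵉ p) ⟨
    total (m₀ ⊞ tᵉ p)
      ≡⟨ cong total e ⟨
    total m ∎
    where open ≡-Reasoning

  module _ (b : Fin d) where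

    f₂ : Fin (suc d) → Fin (suc d)
    f₂ = f₁ ∘ swap zero (suc b)

    f₂-injective : Injective _≡_ _≡_ f₂
    f₂-injective = swap-injective zero (suc b) ∘ f₁-injective

    private
      q : ℕ
      q = per f inj b
      m₂ : Exponents
      m₂ = cycleType f₂ f₂-injective
      S₂ = switched-swap f₁ zero (suc b)

    -- Two joins in succession, first of `zero` with the cycle of a and then of the result with the
    -- cycle of b. Together they contain (p + 1) + (q + 1) + 1 points, whence the index 2 + (p + q).
    joined : ¬ Same f a b → ∃ λ m₀ → m ≡ (m₀ ⊞ tᵉ q) ⊞ tᵉ p × m₂ ≡ m₀ ⊞ tᵉ (2 ℕ.+ (p ℕ.+ q))
    joined na = n , trans e (cong (_⊞ tᵉ p) e₀) , trans e₂
        (cong (λ r → n ⊞ tᵉ (suc r)) (ℕ.+-suc p q))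
      where
      m₀ = proj₁ extended
      e = proj₁ (proj₂ extended)
      e₁ = proj₂ (proj₂ extended)
      apart : ¬ Same f₁ zero (suc b)
      apart = J.same-a⁻ (apart-lift inj b) (na ∘ same-lift inj)
      module K = Join f₁-injective f₂-injective S₂ apart
      per-b : per f₁ f₁-injective (suc b) ≡ q
      per-b = trans (J.per-other (apart-lift inj b) (na ∘ same-lift inj)) (per-lift-suc inj b)
      relation : m₂ ⊞ tᵉ q ≡ m₀ ⊞ tᵉ (suc p ℕ.+ suc q)
      relation = ⊞-cancelʳ (tᵉ (suc p)) (begin
        (m₂ ⊞ tᵉ q) ⊞ tᵉ (suc p)
          ≡⟨ ⊞-swapʳ m₂ (tᵉ q) (tᵉ (suc p)) ⟩
        (m₂ ⊞ tᵉ (suc p)) ⊞ tᵉ q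
          ≡⟨ cong₂ (λ x y → (m₂ ⊞ tᵉ x) ⊞ tᵉ y) per-zero per-b ⟨
        (m₂ ⊞ tᵉ (per f₁ f₁-injective zero)) ⊞ tᵉ (per f₁ f₁-injective (suc b))
          ≡⟨ K.cycleType-join {m₁} {m₂} (cycleType-isCycleType f₁ f₁-injective)
              (cycleType-isCycleType f₂ f₂-injective) ⟩
        m₁ ⊞ tᵉ (per f₁ f₁-injective zero ℕ.+ suc (per f₁ f₁-injective (suc b)))
          ≡⟨ cong₂ (λ x y → m₁ ⊞ tᵉ (x ℕ.+ suc y)) per-zero per-b ⟩
        m₁ ⊞ tᵉ (suc p ℕ.+ suc q)
          ≡⟨ cong (_⊞ tᵉ (suc p ℕ.+ suc q)) e₁ ⟩
        (m₀ ⊞ tᵉ (suc p)) ⊞ tᵉ (suc p ℕ.+ suc q)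
          ≡⟨ ⊞-swapʳ m₀ (tᵉ (suc p)) (tᵉ (suc p ℕ.+ suc q)) ⟩
        (m₀ ⊞ tᵉ (suc p ℕ.+ suc q)) ⊞ tᵉ (suc p) ∎)
        where open ≡-Reasoning
      exchanged = exchange {m₂} {m₀} {q} {suc p ℕ.+ suc q} relation
          (ℕ.<⇒≢ (ℕ.m≤n+m (suc q) (suc p)))
      n = proj₁ exchanged
      e₀ = proj₁ (proj₂ exchanged)
      e₂ = proj₂ (proj₂ exchanged)

    module _ (j : ℕ) (j≤p : j ≤ p) (a⇝b : iter f (suc j) a ≡ b) where

      private
        a⇝b₁ : iter f₁ (suc j) zero ≡ suc b
        a⇝b₁ = trans (walk (lift-injective inj) S (apart-lift inj a) j
            (ℕ.≤-trans j≤p (ℕ.≤-reflexive (sym (per-lift-suc inj a)))))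
          (trans (iter-lift inj (suc j) a) (cong suc a⇝b))
        j<per : j < per f₁ f₁-injective zero
        j<per = ℕ.<-≤-trans (s≤s j≤p) (ℕ.≤-reflexive (sym per-zero))
        module K = Cut f₁-injective f₂-injective S₂ {j} j<per a⇝b₁
        per-zero₂ : per f₂ f₂-injective zero ≡ p ℕ.∸ j
        per-zero₂ = sym (trans (cong (ℕ._∸ j)
            (ℕ.suc-injective (trans (sym per-zero)
            (trans K.per-sum (ℕ.+-suc (per f₂ f₂-injective zero) j)))))
          (ℕ.m+n∸n≡m (per f₂ f₂-injective zero) j))

      -- The enlarged cycle has p + 2 points; the part through b has j + 1 of them and the part
      -- through `zero` the remaining p - j + 1. The extreme case j = p is b = a, where `zero`
      -- becomes a fixed point.
      separated : ∃ λ m₀ → m ≡ m₀ ⊞ tᵉ p × m₂ ≡ (m₀ ⊞ tᵉ (p ℕ.∸ j)) ⊞ tᵉ j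
      separated = m₀ , e , sym (⊞-cancelʳ (tᵉ (suc p)) (begin
        ((m₀ ⊞ tᵉ (p ℕ.∸ j)) ⊞ tᵉ j) ⊞ tᵉ (suc p)
          ≡⟨ trans (⊞-swapʳ (m₀ ⊞ tᵉ (p ℕ.∸ j)) (tᵉ j) (tᵉ (suc p)))
              (cong (_⊞ tᵉ j) (⊞-swapʳ m₀ (tᵉ (p ℕ.∸ j)) (tᵉ (suc p)))) ⟩
        ((m₀ ⊞ tᵉ (suc p)) ⊞ tᵉ (p ℕ.∸ j)) ⊞ tᵉ j
          ≡⟨ cong₂ (λ x y → (x ⊞ tᵉ y) ⊞ tᵉ j) e₁ per-zero₂ ⟨
        (m₁ ⊞ tᵉ (per f₂ f₂-injective zero)) ⊞ tᵉ j
          ≡⟨ K.cycleType-cut {m₁} {m₂} (cycleType-isCycleType f₁ f₁-injective)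
              (cycleType-isCycleType f₂ f₂-injective) ⟩
        m₂ ⊞ tᵉ (per f₁ f₁-injective zero)
          ≡⟨ cong (λ x → m₂ ⊞ tᵉ x) per-zero ⟩
        m₂ ⊞ tᵉ (suc p) ∎))
        where
        open ≡-Reasoning
        m₀ = proj₁ extended
        e = proj₁ (proj₂ extended)
        e₁ = proj₂ (proj₂ extended)

-- Insertions as differential operators on monomials

Σ-per : ∀ {f : Fin d → Fin d} (inj : Injective _≡_ _≡_ f) (g : ℕ → ℚ) {N} → d ≤ N →
        Σ (allFin d) (g ∘ per f inj) ≡ Σ< N
            (λ n → fromℕ (suc n) * (fromℕ (at (cycleType f inj) n) * g n))
Σ-per {d} {f} inj g {N} d≤N = begin
  Σ (allFin d) (g ∘ per f inj)
    ≡⟨ (Σ-cong (allFin d) λ x → Σ-indicator (Unique.upTo⁺ N)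
        (∈-upTo⁺ (ℕ.<-≤-trans (per<d f inj x) d≤N)) (per f inj x ℕ.≟_) refl (λ _ → sym) g) ⟨
  Σ (allFin d) (λ x → Σ< N λ n → ⟦ per f inj x ℕ.≟ n ⟧ * g n)
    ≡⟨ Σ-swap (allFin d) (upTo N) (λ x n → ⟦ per f inj x ℕ.≟ n ⟧ * g n) ⟩
  Σ< N (λ n → Σ (allFin d) λ x → ⟦ per f inj x ℕ.≟ n ⟧ * g n)
    ≡⟨ (Σ-cong (upTo N) λ n → trans (Σ-*ʳ (allFin d) (g n) (λ x → ⟦ per f inj x ℕ.≟ n ⟧))
         (trans (cong (_* g n) (sym (cycleType-isCycleType f inj n)))
             (ℚ.*-assoc (fromℕ (suc n)) _ (g n)))) ⟩
  Σ< N (λ n → fromℕ (suc n) * (fromℕ (at (cycleType f inj) n) * g n)) ∎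
  where open ≡-Reasoning

-- Division by x, discarding the terms not divisible by x.

δ/ : Variable → PowerSeries → PowerSeries
δ/ x G μ = G (adjust suc x μ)

∂-δ : ∀ x ν μ → ∂ x (δ ν) μ ≡ fromℕ (exponent x ν) * δ/ x (δ ν) μ
∂-δ x ν μ = begin
  fromℕ (suc (exponent x μ)) * ⟦ ν ≟ᵐ adjust suc x μ ⟧
    ≡⟨ ℚ.*-comm (fromℕ (suc (exponent x μ))) _ ⟩
  ⟦ ν ≟ᵐ adjust suc x μ ⟧ * fromℕ (suc (exponent x μ))
    ≡⟨ ⟦⟧*-cong (ν ≟ᵐ adjust suc x μ) (λ { refl → cong fromℕ (sym (exponent-adjust suc x μ)) }) ⟩
  ⟦ ν ≟ᵐ adjust suc x μ ⟧ * fromℕ (exponent x ν)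
    ≡⟨ ℚ.*-comm ⟦ ν ≟ᵐ adjust suc x μ ⟧ _ ⟩
  fromℕ (exponent x ν) * ⟦ ν ≟ᵐ adjust suc x μ ⟧ ∎
  where open ≡-Reasoning

δ/-adjust : ∀ x ν → δ/ x (δ (adjust suc x ν)) ≈ δ ν
δ/-adjust x ν μ = ⟦⟧-cong (adjust suc x ν ≟ᵐ adjust suc x μ) (ν ≟ᵐ μ)
  (λ e → trans (sym (adjust-pred-suc x ν)) (trans (cong (adjust pred x) e) (adjust-pred-suc x μ)))
      (cong (adjust suc x))

·-δ : ∀ x ν → x · δ ν ≈ δ (adjust suc x ν)
·-δ x ν μ with divisible x μ
... | multiple μ′ = trans (·-at x (δ ν) μ′) (sym (δ/-adjust x ν μ′))
... | coprime p   = trans (·-zero x (δ ν) μ p)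
  (sym (⟦⟧-no (adjust suc x ν ≟ᵐ μ) (λ e → exponent-adjust-suc x ν
      (trans (cong (exponent x) e) p))))

mono-⊞-tᵉ : ∀ {k l} m i → mono 0 k l (m ⊞ tᵉ i) ≡ adjust suc t[1+ i ] (mono 0 k l m)
mono-⊞-tᵉ {k} {l} m i = cong (mono 0 k l) (trans (⊞-comm m (tᵉ i)) (sym (adjustAt-suc i m)))

·-Σ : ∀ {A : Set} x (xs : List A) (G : A → PowerSeries) μ →
      (x · (λ μ → Σ xs (λ c → G c μ))) μ ≡ Σ xs (λ c → (x · G c) μ)
·-Σ x xs G μ with exponent x μ
... | zero  = sym (Σ-zero xs)
... | suc _ = refl

module CutAndJoin {d} (f : Fin d → Fin d) (inj : Injective _≡_ _≡_ f) (k l : ℕ) where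

  open Insert f inj

  private
    m : Exponents
    m = cycleType f inj
    ν : Monomial
    ν = mono 0 k l m
    ℓ : Fin d → ℕ
    ℓ = per f inj
    V : List (Fin d)
    V = allFin d

  -- Grouping the points a by the length n + 1 of their cycle gives the factor n + 1, which is the
  -- coefficient in `L₁`, times the number of such cycles, which is the exponent that ∂/∂t brings
  -- down.
  Σ-extended : (λ μ → Σ V (λ a → δ (mono 0 k l (cycleType (f₁ a) (f₁-injective a))) μ)) ≈ L₁ (δ ν)
  Σ-extended = isSum-unique (isSum (λ _ → d) λ μ d≤N → trans (Σ-cong V λ a → term a μ)
      (Σ-per inj (g μ) d≤N))
    (isSum-L₁ (δ ν)) λ n μ → cong (fromℕ (suc n) *_) (sym (trans
      (·-cong t[1+ suc n ] (∂-δ t[1+ n ] ν) μ)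
          (·-• t[1+ suc n ] (fromℕ (at m n)) (δ/ t[1+ n ] (δ ν)) μ)))
    where
    g : Monomial → ℕ → ℚ
    g μ n = (t[1+ suc n ] · δ/ t[1+ n ] (δ ν)) μ
    term : ∀ a → δ (mono 0 k l (cycleType (f₁ a) (f₁-injective a))) ≈ t[1+ suc
        (ℓ a) ] · δ/ t[1+ ℓ a ] (δ ν)
    term a μ = let m₀ , e , e₁ = extended a in begin
      δ (mono 0 k l (cycleType (f₁ a) (f₁-injective a))) μ
        ≡⟨ cong (λ ξ → δ ξ μ) (trans (cong (mono 0 k l) e₁) (mono-⊞-tᵉ m₀ (suc (ℓ a)))) ⟩
      δ (adjust suc t[1+ suc (ℓ a) ] (mono 0 k l m₀)) μ
        ≡⟨ ·-δ t[1+ suc (ℓ a) ] (mono 0 k l m₀) μ ⟨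
      (t[1+ suc (ℓ a) ] · δ (mono 0 k l m₀)) μ
        ≡⟨ ·-cong t[1+ suc (ℓ a) ] (δ/-adjust t[1+ ℓ a ] (mono 0 k l m₀)) μ ⟨
      (t[1+ suc (ℓ a) ] · δ/ t[1+ ℓ a ] (δ (adjust suc t[1+ ℓ a ] (mono 0 k l m₀)))) μ
        ≡⟨ cong (λ ξ → (t[1+ suc (ℓ a) ] · δ/ t[1+ ℓ a ] (δ ξ)) μ)
            (trans (cong (mono 0 k l) e) (mono-⊞-tᵉ m₀ (ℓ a))) ⟨
      (t[1+ suc (ℓ a) ] · δ/ t[1+ ℓ a ] (δ ν)) μ ∎
      where open ≡-Reasoning

  private
    δ₂ : Fin d → Fin d → PowerSeries
    δ₂ a b = δ (mono 0 k l (cycleType (f₂ a b) (f₂-injective a b)))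

    cutSeries : ℕ → ℕ → ℕ → PowerSeries
    cutSeries n i j = t[1+ i ] · t[1+ j ] · δ/ t[1+ n ] (δ ν)

    joinSeries : ℕ → ℕ → PowerSeries
    joinSeries i j = t[1+ 2 ℕ.+ (i ℕ.+ j) ] · δ/ t[1+ i ] (δ/ t[1+ j ] (δ ν))

  δ₂-cut : ∀ a b j → j ≤ ℓ a → iter f (suc j) a ≡ b → δ₂ a b ≈ cutSeries (ℓ a) j (ℓ a ℕ.∸ j)
  δ₂-cut a b j j≤p a⇝b μ = let m₀ , e , e₂ = separated a b j j≤p a⇝b; p = ℓ a; i = p ℕ.∸ j
                               ν₀ = mono 0 k l m₀ in begin
    δ₂ a b μ
      ≡⟨ cong (λ ξ → δ ξ μ) (trans (cong (mono 0 k l) e₂)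
           (trans (mono-⊞-tᵉ (m₀ ⊞ tᵉ i) j) (cong (adjust suc t[1+ j ]) (mono-⊞-tᵉ m₀ i)))) ⟩
    δ (adjust suc t[1+ j ] (adjust suc t[1+ i ] ν₀)) μ
      ≡⟨ ·-δ t[1+ j ] (adjust suc t[1+ i ] ν₀) μ ⟨
    (t[1+ j ] · δ (adjust suc t[1+ i ] ν₀)) μ
      ≡⟨ ·-cong t[1+ j ] (≈-trans (≈-sym (·-δ t[1+ i ] ν₀))
          (·-cong t[1+ i ] (≈-sym (δ/-adjust t[1+ p ] ν₀)))) μ ⟩
    (t[1+ j ] · t[1+ i ] · δ/ t[1+ p ] (δ (adjust suc t[1+ p ] ν₀))) μ
      ≡⟨ cong (λ ξ → (t[1+ j ] · t[1+ i ] · δ/ t[1+ p ] (δ ξ)) μ)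
          (trans (cong (mono 0 k l) e) (mono-⊞-tᵉ m₀ p)) ⟨
    cutSeries p j i μ ∎
    where open ≡-Reasoning

  δ₂-join : ∀ a b → ¬ Same f a b → δ₂ a b ≈ joinSeries (ℓ a) (ℓ b)
  δ₂-join a b na μ = let m₀ , e , e₂ = joined a b na; p = ℓ a; q = ℓ b; r = 2 ℕ.+ (p ℕ.+ q)
                         ν₀ = mono 0 k l m₀ in begin
    δ₂ a b μ
      ≡⟨ cong (λ ξ → δ ξ μ) (trans (cong (mono 0 k l) e₂) (mono-⊞-tᵉ m₀ r)) ⟩
    δ (adjust suc t[1+ r ] ν₀) μ
      ≡⟨ ·-δ t[1+ r ] ν₀ μ ⟨
    (t[1+ r ] · δ ν₀) μ
      ≡⟨ ·-cong t[1+ r ] (≈-trans (≈-sym (δ/-adjust t[1+ p ] ν₀))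
           (λ μ → sym (δ/-adjust t[1+ q ] (adjust suc t[1+ p ] ν₀) (adjust suc t[1+ p ] μ)))) μ ⟩
    (t[1+ r ] · δ/ t[1+ p ] (δ/ t[1+ q ] (δ (adjust suc t[1+ q ] (adjust suc t[1+ p ] ν₀))))) μ
      ≡⟨ cong (λ ξ → (t[1+ r ] · δ/ t[1+ p ] (δ/ t[1+ q ] (δ ξ))) μ)
           (trans (cong (mono 0 k l) (trans e (⊞-swapʳ m₀ (tᵉ q) (tᵉ p))))
             (trans (mono-⊞-tᵉ (m₀ ⊞ tᵉ p) q) (cong (adjust suc t[1+ q ]) (mono-⊞-tᵉ m₀ p)))) ⟨
    joinSeries p q μ ∎
    where open ≡-Reasoning

  private
    Σ-cut : ∀ a μ → Σ V (λ b → ⟦ same? inj a b ⟧ * δ₂ a b μ) ≡ antidiagonal (ℓ a)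
        (λ i j → cutSeries (ℓ a) i j μ)
    Σ-cut a μ = begin
      Σ V (λ b → ⟦ same? inj a b ⟧ * δ₂ a b μ)
        -- Walking around the cycle from f a rather than from a gives b as f^(j+1) a with 0 ≤ j ≤
        -- `ℓ a`, the parametrisation used in `δ₂-cut`.
        ≡⟨ (Σ-cong V λ b → cong (_* δ₂ a b μ) (⟦⟧-cong (same? inj a b) (same? inj (f a) b)
             (same-trans {f = f} (same-sym inj a⇝fa)) (same-trans {f = f} a⇝fa))) ⟩
      Σ V (λ b → ⟦ same? inj (f a) b ⟧ * δ₂ a b μ)
        ≡⟨ Σ-same-class inj (f a) (λ b → δ₂ a b μ) ⟩
      Σ< (suc (ℓ (f a))) (λ j → δ₂ a (iter f j (f a)) μ)
        ≡⟨ cong (λ p → Σ< (suc p) (λ j → δ₂ a (iter f j (f a)) μ)) (per-same inj a⇝fa) ⟨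
      Σ< (suc (ℓ a)) (λ j → δ₂ a (iter f j (f a)) μ)
        ≡⟨ (Σ<-cong (suc (ℓ a)) λ {j} j≤p → δ₂-cut a (iter f j (f a)) j (ℕ.≤-pred j≤p)
            (iter-comm f 1 j a) μ) ⟩
      antidiagonal (ℓ a) (λ i j → cutSeries (ℓ a) i j μ) ∎
      where
      open ≡-Reasoning
      a⇝fa : Same f a (f a)
      a⇝fa = 1 , refl

    cutSum joinSum : PowerSeries
    cutSum μ = Σ V (λ a → Σ V λ b → ⟦ same? inj a b ⟧ * δ₂ a b μ)
    joinSum μ = Σ V (λ a → Σ V λ b → ⟦ ¬? (same? inj a b) ⟧ * δ₂ a b μ)

    cut-δ : ∀ n i j μ → fromℕ (suc n) * (fromℕ (at m n) * cutSeries n i j μ) ≡ cut n i j (δ ν) μ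
    cut-δ n i j μ = cong (fromℕ (suc n) *_) (sym (begin
      (t[1+ i ] · t[1+ j ] · ∂ t[1+ n ] (δ ν)) μ
        ≡⟨ ·-cong t[1+ i ] (≈-trans (·-cong t[1+ j ] (∂-δ t[1+ n ] ν))
            (·-• t[1+ j ] (fromℕ (at m n)) (δ/ t[1+ n ] (δ ν)))) μ ⟩
      (t[1+ i ] · fromℕ (at m n) • t[1+ j ] · δ/ t[1+ n ] (δ ν)) μ
        ≡⟨ ·-• t[1+ i ] (fromℕ (at m n)) (t[1+ j ] · δ/ t[1+ n ] (δ ν)) μ ⟩
      fromℕ (at m n) * cutSeries n i j μ ∎))
      where open ≡-Reasoning

    isSum-cut : IsSum (λ n → Σ-antidiagonal n (λ i j → cut n i j (δ ν))) cutSum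
    isSum-cut = isSum (λ _ → d) λ μ {N} d≤N → begin
      cutSum μ
        ≡⟨ (Σ-cong V λ a → Σ-cut a μ) ⟩
      Σ V (λ a → antidiagonal (ℓ a) (λ i j → cutSeries (ℓ a) i j μ))
        ≡⟨ Σ-per inj (λ n → antidiagonal n (λ i j → cutSeries n i j μ)) d≤N ⟩
      Σ< N (λ n → fromℕ (suc n) * (fromℕ (at m n) * antidiagonal n (λ i j → cutSeries n i j μ)))
        ≡⟨ (Σ-cong (upTo N) λ n → trans (cong (fromℕ (suc n) *_)
            (sym (Σ-*ˡ (upTo (suc n)) (fromℕ (at m n)) (λ i → cutSeries n i (n ℕ.∸ i) μ))))
             (trans (sym (Σ-*ˡ (upTo (suc n)) (fromℕ (suc n))
                 (λ i → fromℕ (at m n) * cutSeries n i (n ℕ.∸ i) μ)))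
               (trans (Σ-cong (upTo (suc n)) λ i → cut-δ n i (n ℕ.∸ i) μ)
                 (sym (Σ-antidiagonal-at n (λ i j → cut n i j (δ ν)) μ))))) ⟩
      Σ< N (λ n → Σ-antidiagonal n (λ i j → cut n i j (δ ν)) μ) ∎
      where open ≡-Reasoning

    -- Expands a single value into the sum over n and i + j = n in which `M₁` is written; only n = x
    -- + y and i = x contribute. Afterwards the sums over points can be moved inside.
    antidiagonal-one : ∀ {x y N} → x ℕ.+ y < N → (h : ℕ → ℕ → ℚ) →
                       Σ< N (λ n → antidiagonal n (λ i j → (⟦ x ℕ.≟ i ⟧ * ⟦ y ℕ.≟ j ⟧) * h i j))
                           ≡ h x y
    antidiagonal-one {x} {y} {N} x+y<N h = begin
      Σ< N (λ n → antidiagonal n (g n))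
        ≡⟨ Σ-point (Unique.upTo⁺ N) (∈-upTo⁺ x+y<N) (λ {n} _ n≢ → Σ-null (upTo (suc n)) λ {i} i∈ →
             off i (n ℕ.∸ i) λ { (refl , e) → n≢
                 (trans (sym (ℕ.m+[n∸m]≡n (ℕ.≤-pred (∈-upTo⁻ i∈)))) (cong (x ℕ.+_) (sym e))) }) ⟩
      antidiagonal (x ℕ.+ y) (g (x ℕ.+ y))
        ≡⟨ Σ-point (Unique.upTo⁺ (suc (x ℕ.+ y))) (∈-upTo⁺ (s≤s (ℕ.m≤m+n x y)))
            (λ {i} _ i≢x → off i _ λ { (refl , _) → i≢x refl }) ⟩
      (⟦ x ℕ.≟ x ⟧ * ⟦ y ℕ.≟ x ℕ.+ y ℕ.∸ x ⟧) * h x (x ℕ.+ y ℕ.∸ x)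
        ≡⟨ cong (λ j → (⟦ x ℕ.≟ x ⟧ * ⟦ y ℕ.≟ j ⟧) * h x j) (ℕ.m+n∸m≡n x y) ⟩
      (⟦ x ℕ.≟ x ⟧ * ⟦ y ℕ.≟ y ⟧) * h x y
        ≡⟨ cong (_* h x y) (trans (cong₂ _*_ (⟦⟧-yes (x ℕ.≟ x) refl) (⟦⟧-yes (y ℕ.≟ y) refl))
            (ℚ.*-identityˡ 1ℚ)) ⟩
      1ℚ * h x y
        ≡⟨ ℚ.*-identityˡ (h x y) ⟩
      h x y ∎
      where
      open ≡-Reasoning
      g : ℕ → ℕ → ℕ → ℚ
      g n i j = (⟦ x ℕ.≟ i ⟧ * ⟦ y ℕ.≟ j ⟧) * h i j
      off : ∀ i j → ¬ (x ≡ i × y ≡ j) → (⟦ x ℕ.≟ i ⟧ * ⟦ y ℕ.≟ j ⟧) * h i j ≡ 0ℚ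
      off i j n = trans (cong (_* h i j)
          (trans (⟦⟧*-cong (x ℕ.≟ i) (λ p → ⟦⟧-no (y ℕ.≟ j) (λ q → n (p , q))))
          (ℚ.*-zeroʳ ⟦ x ℕ.≟ i ⟧)))
        (ℚ.*-zeroˡ (h i j))

    -- The factor produced by two derivatives of a monomial: the product of the two exponents, or
    -- the falling factorial m (m - 1) if i = j.
    c : ℕ → ℕ → ℚ
    c i j = fromℕ (at m j) * (fromℕ (at m i) - ⟦ j ℕ.≟ i ⟧)

    sub-move : ∀ {x y z : ℚ} → x + y ≡ z → y ≡ z - x
    sub-move {x} {y} refl = solve 2 (λ x y → y := (x :+ y) :- x) refl x y
      where open +-*-Solver using (solve; _:=_; _:+_; _:-_)

    ∂∂-δ : ∀ i j → ∂ t[1+ i ] (∂ t[1+ j ] (δ ν)) ≈ c i j • δ/ t[1+ i ] (δ/ t[1+ j ] (δ ν))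
    ∂∂-δ i j μ = begin
      fromℕ (suc (at (exp-t μ) i)) * ∂ t[1+ j ] (δ ν) (adjust suc t[1+ i ] μ)
        ≡⟨ cong (fromℕ (suc (at (exp-t μ) i)) *_) (∂-δ t[1+ j ] ν (adjust suc t[1+ i ] μ)) ⟩
      fromℕ (suc (at (exp-t μ) i)) * (fromℕ (at m j) * ⟦ ν ≟ᵐ ξ ⟧)
        ≡⟨ x*yz≡y*xz (fromℕ (suc (at (exp-t μ) i))) (fromℕ (at m j)) ⟦ ν ≟ᵐ ξ ⟧ ⟩
      fromℕ (at m j) * (fromℕ (suc (at (exp-t μ) i)) * ⟦ ν ≟ᵐ ξ ⟧)
        ≡⟨ cong (fromℕ (at m j) *_) (trans (ℚ.*-comm (fromℕ (suc (at (exp-t μ) i))) _)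
             (trans (⟦⟧*-cong (ν ≟ᵐ ξ) matching) (ℚ.*-comm ⟦ ν ≟ᵐ ξ ⟧ _))) ⟩
      fromℕ (at m j) * ((fromℕ (at m i) - ⟦ j ℕ.≟ i ⟧) * ⟦ ν ≟ᵐ ξ ⟧)
        ≡⟨ ℚ.*-assoc (fromℕ (at m j)) _ ⟦ ν ≟ᵐ ξ ⟧ ⟨
      c i j * ⟦ ν ≟ᵐ ξ ⟧ ∎
      where
      open ≡-Reasoning
      ξ : Monomial
      ξ = adjust suc t[1+ j ] (adjust suc t[1+ i ] μ)
      matching : ν ≡ ξ → fromℕ (suc (at (exp-t μ) i)) ≡ fromℕ (at m i) - ⟦ j ℕ.≟ i ⟧
      matching e = sub-move (begin
        ⟦ j ℕ.≟ i ⟧ + fromℕ (suc (at (exp-t μ) i))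
          ≡⟨ cong₂ _+_ (fromℕ-at-tᵉ j i) (cong fromℕ (at-adjustAt suc i (exp-t μ))) ⟨
        fromℕ (at (tᵉ j) i) + fromℕ (at (adjustAt suc i (exp-t μ)) i)
          ≡⟨ fromℕ-+ (at (tᵉ j) i) _ ⟨
        fromℕ (at (tᵉ j) i ℕ.+ at (adjustAt suc i (exp-t μ)) i)
          ≡⟨ cong fromℕ (trans (sym (at-⊞ (tᵉ j) (adjustAt suc i (exp-t μ)) i))
              (cong (λ m → at m i) (sym (trans (cong exp-t e)
              (adjustAt-suc j (adjustAt suc i (exp-t μ))))))) ⟩
        fromℕ (at m i) ∎)

    index : ∀ p j → fromℕ (suc p) * ⟦ p ℕ.≟ j ⟧ ≡ fromℕ (suc j) * ⟦ p ℕ.≟ j ⟧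
    index p j = trans (ℚ.*-comm (fromℕ (suc p)) _)
        (trans (⟦⟧*-cong (p ℕ.≟ j) λ { refl → refl }) (ℚ.*-comm _ (fromℕ (suc j))))

    -- From all points on cycles of length j + 1, those on the cycle of a are removed; there are j +
    -- 1 of them if that cycle has this length, and none otherwise.
    pairs-at : ∀ a j → Σ V (λ b → ⟦ ¬? (same? inj a b) ⟧ * ⟦ ℓ b ℕ.≟ j ⟧) ≡ fromℕ (suc j) *
        (fromℕ (at m j) - ⟦ ℓ a ℕ.≟ j ⟧)
    pairs-at a j = trans (sub-move (begin
        Σ V (λ b → ⟦ same? inj a b ⟧ * ⟦ ℓ b ℕ.≟ j ⟧) + Σ V
            (λ b → ⟦ ¬? (same? inj a b) ⟧ * ⟦ ℓ b ℕ.≟ j ⟧)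
          ≡⟨ Σ-+ V (λ b → ⟦ same? inj a b ⟧ * ⟦ ℓ b ℕ.≟ j ⟧)
              (λ b → ⟦ ¬? (same? inj a b) ⟧ * ⟦ ℓ b ℕ.≟ j ⟧) ⟨
        Σ V (λ b → ⟦ same? inj a b ⟧ * ⟦ ℓ b ℕ.≟ j ⟧ + ⟦ ¬? (same? inj a b) ⟧ * ⟦ ℓ b ℕ.≟ j ⟧)
          ≡⟨ (Σ-cong V λ b → ⟦⟧-split (same? inj a b) ⟦ ℓ b ℕ.≟ j ⟧) ⟩
        Σ V (λ b → ⟦ ℓ b ℕ.≟ j ⟧)
          ≡⟨ cycleType-isCycleType f inj j ⟨
        fromℕ (suc j) * fromℕ (at m j) ∎))
      (trans (cong (λ z → fromℕ (suc j) * fromℕ (at m j) - z) same-count)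
          (factor-out (fromℕ (suc j)) (fromℕ (at m j)) ⟦ ℓ a ℕ.≟ j ⟧))
      where
      open ≡-Reasoning
      factor-out : ∀ x y z → x * y - x * z ≡ x * (y - z)
      factor-out = solve 3 (λ x y z → x :* y :- x :* z := x :* (y :- z)) refl
        where open +-*-Solver using (solve; _:=_; _:*_; _:-_)
      same-count : Σ V (λ b → ⟦ same? inj a b ⟧ * ⟦ ℓ b ℕ.≟ j ⟧) ≡ fromℕ (suc j) * ⟦ ℓ a ℕ.≟ j ⟧
      same-count = begin
        Σ V (λ b → ⟦ same? inj a b ⟧ * ⟦ ℓ b ℕ.≟ j ⟧)
          ≡⟨ (Σ-cong V λ b → ⟦⟧*-cong (same? inj a b) λ ab → cong (λ p → ⟦ p ℕ.≟ j ⟧)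
              (sym (per-same inj ab))) ⟩
        Σ V (λ b → ⟦ same? inj a b ⟧ * ⟦ ℓ a ℕ.≟ j ⟧)
          ≡⟨ Σ-*ʳ V ⟦ ℓ a ℕ.≟ j ⟧ (λ b → ⟦ same? inj a b ⟧) ⟩
        Σ V (λ b → ⟦ same? inj a b ⟧) * ⟦ ℓ a ℕ.≟ j ⟧
          ≡⟨ cong (_* ⟦ ℓ a ℕ.≟ j ⟧) (Σ-same-one inj a) ⟩
        fromℕ (suc (ℓ a)) * ⟦ ℓ a ℕ.≟ j ⟧
          ≡⟨ index (ℓ a) j ⟩
        fromℕ (suc j) * ⟦ ℓ a ℕ.≟ j ⟧ ∎

    -- Ordered pairs of points on different cycles of lengths i + 1 and j + 1. Their number is the
    -- coefficient with which `join` acts on the monomial; excluding pairs on one cycle matches the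
    -- falling factorial in `c`.
    pairs-count : ∀ i j → Σ V (λ a → Σ V λ b → ⟦ ¬? (same? inj a b) ⟧ *
        (⟦ ℓ a ℕ.≟ i ⟧ * ⟦ ℓ b ℕ.≟ j ⟧)) ≡
                          fromℕ ((1 ℕ.+ i) ℕ.* (1 ℕ.+ j)) * c i j
    pairs-count i j = begin
      Σ V (λ a → Σ V λ b → ⟦ ¬? (same? inj a b) ⟧ * (⟦ ℓ a ℕ.≟ i ⟧ * ⟦ ℓ b ℕ.≟ j ⟧))
        ≡⟨ (Σ-cong V λ a → trans (Σ-cong V λ b → x*yz≡y*xz ⟦ ¬?
            (same? inj a b) ⟧ ⟦ ℓ a ℕ.≟ i ⟧ ⟦ ℓ b ℕ.≟ j ⟧)
             (trans (Σ-*ˡ V ⟦ ℓ a ℕ.≟ i ⟧ (λ b → ⟦ ¬? (same? inj a b) ⟧ * ⟦ ℓ b ℕ.≟ j ⟧))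
                 (cong (⟦ ℓ a ℕ.≟ i ⟧ *_) (pairs-at a j)))) ⟩
      Σ V (λ a → ⟦ ℓ a ℕ.≟ i ⟧ * (nⱼ * (mⱼ - ⟦ ℓ a ℕ.≟ j ⟧)))
        ≡⟨ (Σ-cong V λ a → ⟦⟧*-cong (ℓ a ℕ.≟ i) λ e → cong (λ p → nⱼ * (mⱼ - ⟦ p ℕ.≟ j ⟧)) e) ⟩
      Σ V (λ a → ⟦ ℓ a ℕ.≟ i ⟧ * (nⱼ * (mⱼ - ⟦ i ℕ.≟ j ⟧)))
        ≡⟨ Σ-*ʳ V (nⱼ * (mⱼ - ⟦ i ℕ.≟ j ⟧)) (λ a → ⟦ ℓ a ℕ.≟ i ⟧) ⟩
      Σ V (λ a → ⟦ ℓ a ℕ.≟ i ⟧) * (nⱼ * (mⱼ - ⟦ i ℕ.≟ j ⟧))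
        ≡⟨ cong (_* (nⱼ * (mⱼ - ⟦ i ℕ.≟ j ⟧))) (cycleType-isCycleType f inj i) ⟨
      (nᵢ * mᵢ) * (nⱼ * (mⱼ - ⟦ i ℕ.≟ j ⟧))
        ≡⟨ *-interchange nᵢ mᵢ nⱼ (mⱼ - ⟦ i ℕ.≟ j ⟧) ⟩
      (nᵢ * nⱼ) * (mᵢ * (mⱼ - ⟦ i ℕ.≟ j ⟧))
        ≡⟨ cong₂ _*_ (sym (fromℕ-* (1 ℕ.+ i) (1 ℕ.+ j))) (symmetric (i ℕ.≟ j)) ⟩
      fromℕ ((1 ℕ.+ i) ℕ.* (1 ℕ.+ j)) * c i j ∎
      where
      open ≡-Reasoning
      nᵢ nⱼ mᵢ mⱼ : ℚ
      nᵢ = fromℕ (suc i)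
      nⱼ = fromℕ (suc j)
      mᵢ = fromℕ (at m i)
      mⱼ = fromℕ (at m j)
      symmetric : Dec (i ≡ j) → mᵢ * (mⱼ - ⟦ i ℕ.≟ j ⟧) ≡ c i j
      symmetric (yes refl) = refl
      symmetric (no i≢j) = trans (cong (λ z → mᵢ * (mⱼ - z)) (⟦⟧-no (i ℕ.≟ j) i≢j))
        (trans (comm-zero mᵢ mⱼ) (cong (λ z → mⱼ * (mᵢ - z)) (sym (⟦⟧-no (j ℕ.≟ i) (i≢j ∘ sym)))))
        where
        comm-zero : ∀ x y → x * (y - 0ℚ) ≡ y * (x - 0ℚ)
        comm-zero x y = trans (cong (x *_) (ℚ.+-identityʳ y))
            (trans (ℚ.*-comm x y) (cong (y *_) (sym (ℚ.+-identityʳ x))))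

    join-δ : ∀ n i j → i ℕ.+ j ≡ n → ∀ μ →
        (fromℕ ((1 ℕ.+ i) ℕ.* (1 ℕ.+ j)) * c i j) * joinSeries i j μ ≡ join n i j (δ ν) μ
    join-δ n i j refl μ = trans (ℚ.*-assoc (fromℕ ((1 ℕ.+ i) ℕ.* (1 ℕ.+ j))) (c i j)
        (joinSeries i j μ))
      (cong (fromℕ ((1 ℕ.+ i) ℕ.* (1 ℕ.+ j)) *_) (sym (trans (·-cong t[1+ 2 ℕ.+ n ] (∂∂-δ i j) μ)
        (·-• t[1+ 2 ℕ.+ n ] (c i j) (δ/ t[1+ i ] (δ/ t[1+ j ] (δ ν))) μ))))

    isSum-join : IsSum (λ n → Σ-antidiagonal n (λ i j → join n i j (δ ν))) joinSum
    -- Both periods are below d, so every index n = `ℓ a` + `ℓ b` is below d + d.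
    isSum-join = isSum (λ _ → d ℕ.+ d) λ μ {N} 2d≤N → begin
      joinSum μ
        ≡⟨ (Σ-cong V λ a → Σ-cong V λ b → trans
             (⟦⟧*-cong (¬? (same? inj a b)) (λ na → δ₂-join a b na μ))
             (cong (w a b *_) (sym (antidiagonal-one {ℓ a} {ℓ b} {N}
                 (ℕ.<-≤-trans (ℕ.+-mono-< (per<d f inj a) (per<d f inj b)) 2d≤N)
                 (λ i j → joinSeries i j μ))))) ⟩
      Σ V (λ a → Σ V λ b → w a b * Σ< N (λ n → antidiagonal n (t a b μ)))
        ≡⟨ (Σ-cong V λ a → Σ-cong V λ b → trans
            (sym (Σ-*ˡ (upTo N) (w a b) (λ n → antidiagonal n (t a b μ))))
             (Σ-cong (upTo N) λ n → sym (Σ-*ˡ (upTo (suc n)) (w a b) (λ i → t a b μ i (n ℕ.∸ i)))))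
                 ⟩
      Σ V (λ a → Σ V λ b → Σ< N λ n → antidiagonal n λ i j → w a b * t a b μ i j)
        ≡⟨ (Σ-cong V λ a → Σ-swap V (upTo N) (λ b n → antidiagonal n λ i j → w a b * t a b μ i j)) ⟩
      Σ V (λ a → Σ< N λ n → Σ V λ b → antidiagonal n λ i j → w a b * t a b μ i j)
        ≡⟨ Σ-swap V (upTo N) (λ a n → Σ V λ b → antidiagonal n λ i j → w a b * t a b μ i j) ⟩
      Σ< N (λ n → Σ V λ a → Σ V λ b → antidiagonal n λ i j → w a b * t a b μ i j)
        ≡⟨ (Σ-cong (upTo N) λ n → trans (Σ-cong V λ a → Σ-swap V (upTo (suc n))
            (λ b i → w a b * t a b μ i (n ℕ.∸ i)))
             (Σ-swap V (upTo (suc n)) (λ a i → Σ V λ b → w a b * t a b μ i (n ℕ.∸ i)))) ⟩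
      Σ< N (λ n → antidiagonal n λ i j → Σ V λ a → Σ V λ b → w a b * t a b μ i j)
        ≡⟨ (Σ-cong (upTo N) λ n → trans (Σ<-cong (suc n) λ {i} i≤n → collect n i (n ℕ.∸ i)
            (ℕ.m+[n∸m]≡n (ℕ.≤-pred i≤n)) μ)
             (sym (Σ-antidiagonal-at n (λ i j → join n i j (δ ν)) μ))) ⟩
      Σ< N (λ n → Σ-antidiagonal n (λ i j → join n i j (δ ν)) μ) ∎
      where
      open ≡-Reasoning
      w : Fin d → Fin d → ℚ
      w a b = ⟦ ¬? (same? inj a b) ⟧
      t : Fin d → Fin d → Monomial → ℕ → ℕ → ℚ
      t a b μ i j = (⟦ ℓ a ℕ.≟ i ⟧ * ⟦ ℓ b ℕ.≟ j ⟧) * joinSeries i j μ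
      collect : ∀ n i j → i ℕ.+ j ≡ n → ∀ μ → Σ V (λ a → Σ V λ b → w a b * t a b μ i j) ≡ join n i j
          (δ ν) μ
      collect n i j e μ = begin
        Σ V (λ a → Σ V λ b → w a b * t a b μ i j)
          ≡⟨ (Σ-cong V λ a → trans (Σ-cong V λ b → sym
              (ℚ.*-assoc (w a b) (⟦ ℓ a ℕ.≟ i ⟧ * ⟦ ℓ b ℕ.≟ j ⟧) (joinSeries i j μ)))
               (Σ-*ʳ V (joinSeries i j μ) (λ b → w a b * (⟦ ℓ a ℕ.≟ i ⟧ * ⟦ ℓ b ℕ.≟ j ⟧)))) ⟩
        Σ V (λ a → Σ V (λ b → w a b * (⟦ ℓ a ℕ.≟ i ⟧ * ⟦ ℓ b ℕ.≟ j ⟧)) * joinSeries i j μ)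
          ≡⟨ Σ-*ʳ V (joinSeries i j μ) (λ a → Σ V (λ b → w a b * (⟦ ℓ a ℕ.≟ i ⟧ * ⟦ ℓ b ℕ.≟ j ⟧))) ⟩
        Σ V (λ a → Σ V (λ b → w a b * (⟦ ℓ a ℕ.≟ i ⟧ * ⟦ ℓ b ℕ.≟ j ⟧))) * joinSeries i j μ
          ≡⟨ cong (_* joinSeries i j μ) (pairs-count i j) ⟩
        (fromℕ ((1 ℕ.+ i) ℕ.* (1 ℕ.+ j)) * c i j) * joinSeries i j μ
          ≡⟨ join-δ n i j e μ ⟩
        join n i j (δ ν) μ ∎

  Σ-cut-and-join : (λ μ → Σ V (λ a → Σ V λ b → δ
      (mono 0 k l (cycleType (f₂ a b) (f₂-injective a b))) μ)) ≈ M₁ (δ ν)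
  Σ-cut-and-join = ≈-trans
    (λ μ → trans (Σ-cong V λ a → trans (Σ-cong V λ b → sym (⟦⟧-split (same? inj a b) (δ₂ a b μ)))
        (Σ-+ V (λ b → ⟦ same? inj a b ⟧ * δ₂ a b μ) (λ b → ⟦ ¬? (same? inj a b) ⟧ * δ₂ a b μ)))
      (Σ-+ V (λ a → Σ V λ b → ⟦ same? inj a b ⟧ * δ₂ a b μ)
          (λ a → Σ V λ b → ⟦ ¬? (same? inj a b) ⟧ * δ₂ a b μ)))
    (isSum-unique (isSum-⊕ isSum-cut isSum-join) (isSum-M₁ (δ ν)) λ n →
      Σ-antidiagonal-⊕ n (λ i j → cut n i j (δ ν)) (λ i j → join n i j (δ ν)))

-- Linearity of Λ

∂-⊕ : ∀ x G H → ∂ x (G ⊕ H) ≈ ∂ x G ⊕ ∂ x H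
∂-⊕ x G H μ = ℚ.*-distribˡ-+ (fromℕ (suc (exponent x μ))) (G (adjust suc x μ)) (H (adjust suc x μ))

•-⊕ : ∀ q G H → q • (G ⊕ H) ≈ q • G ⊕ q • H
•-⊕ q G H μ = ℚ.*-distribˡ-+ q (G μ) (H μ)

L₁-⊕ : ∀ G H → L₁ (G ⊕ H) ≈ L₁ G ⊕ L₁ H
L₁-⊕ G H = isSum-unique (isSum-L₁ (G ⊕ H)) (isSum-⊕ (isSum-L₁ G) (isSum-L₁ H)) λ n →
  let q = fromℕ (1 ℕ.+ n); x = t[1+ 1 ℕ.+ n ]; y = t[1+ n ] in
  ≈-trans (•-cong q (≈-trans (·-cong x (∂-⊕ y G H)) (·-⊕ x (∂ y G) (∂ y H))))
      (•-⊕ q (x · ∂ y G) (x · ∂ y H))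

M₁-⊕ : ∀ G H → M₁ (G ⊕ H) ≈ M₁ G ⊕ M₁ H
M₁-⊕ G H = isSum-unique (isSum-M₁ (G ⊕ H)) (isSum-⊕ (isSum-M₁ G) (isSum-M₁ H)) λ n →
  ≈-trans (Σ-antidiagonal-cong n (term n))
    (≈-sym (Σ-antidiagonal-⊕ n (λ a b → cut n a b G ⊕ join n a b G)
        (λ a b → cut n a b H ⊕ join n a b H)))
  where
  cut-⊕ : ∀ n a b → cut n a b (G ⊕ H) ≈ cut n a b G ⊕ cut n a b H
  cut-⊕ n a b = let q = fromℕ (1 ℕ.+ n); x = t[1+ a ]; y = t[1+ b ]; z = t[1+ n ] in
    ≈-trans (•-cong q (≈-trans (·-cong x (≈-trans (·-cong y (∂-⊕ z G H)) (·-⊕ y (∂ z G) (∂ z H))))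
        (·-⊕ x (y · ∂ z G) (y · ∂ z H))))
      (•-⊕ q (x · y · ∂ z G) (x · y · ∂ z H))
  join-⊕ : ∀ n a b → join n a b (G ⊕ H) ≈ join n a b G ⊕ join n a b H
  join-⊕ n a b = let q = fromℕ ((1 ℕ.+ a) ℕ.* (1 ℕ.+ b))
                     x = t[1+ a ]; y = t[1+ b ]; z = t[1+ 2 ℕ.+ n ] in
    ≈-trans (•-cong q (≈-trans (·-cong z (≈-trans (∂-cong x (∂-⊕ y G H)) (∂-⊕ x (∂ y G) (∂ y H))))
        (·-⊕ z (∂ x (∂ y G)) (∂ x (∂ y H)))))
      (•-⊕ q (z · ∂ x (∂ y G)) (z · ∂ x (∂ y H)))
  term : ∀ n a b → cut n a b (G ⊕ H) ⊕ join n a b (G ⊕ H) ≈ (cut n a b G ⊕ join n a b G) ⊕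
      (cut n a b H ⊕ join n a b H)
  term n a b μ = trans (cong₂ _+_ (cut-⊕ n a b μ) (join-⊕ n a b μ))
    (+-interchange (cut n a b G μ) (cut n a b H μ) (join n a b G μ) (join n a b H μ))

Λ-⊕ : ∀ G H → Λ (G ⊕ H) ≈ Λ G ⊕ Λ H
Λ-⊕ G H μ = trans
  (cong₂ _+_ (cong₂ _+_ (cong₂ _+_ (lin u) (lin v)) (M₁-⊕ G H μ))
    (trans (·-cong u (≈-trans (·-cong v (·-⊕ t[1+ 0 ] G H)) (·-⊕ v (t[1+ 0 ] · G) (t[1+ 0 ] · H)))
        μ)
      (·-⊕ u (v · t[1+ 0 ] · G) (v · t[1+ 0 ] · H) μ)))
  (regroup ((u · L₁ G) μ) ((u · L₁ H) μ) ((v · L₁ G) μ) ((v · L₁ H) μ) (M₁ G μ) (M₁ H μ)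
      ((u · v · t[1+ 0 ] · G) μ) ((u · v · t[1+ 0 ] · H) μ))
  where
  lin : ∀ x → (x · L₁ (G ⊕ H)) μ ≡ (x · L₁ G) μ + (x · L₁ H) μ
  lin x = trans (·-cong x (L₁-⊕ G H) μ) (·-⊕ x (L₁ G) (L₁ H) μ)
  regroup : ∀ a a′ b b′ c c′ e e′ → (a + a′) + (b + b′) + (c + c′) + (e + e′) ≡ (a + b + c + e) +
      (a′ + b′ + c′ + e′)
  regroup = solve 8 (λ a a′ b b′ c c′ e e′ → (a :+ a′) :+ (b :+ b′) :+ (c :+ c′) :+ (e :+ e′) :=
    (a :+ b :+ c :+ e) :+ (a′ :+ b′ :+ c′ :+ e′)) refl
    where open +-*-Solver using (solve; _:=_; _:+_)

Λ-Σ : ∀ {A : Set} (xs : List A) (G : A → PowerSeries) →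
      Λ (λ μ → Σ xs (λ c → G c μ)) ≈ λ μ → Σ xs (λ c → Λ (G c) μ)
Λ-Σ []       G (mono d k l m) = trans
  -- Λ 𝟎 is zero because 𝟎 is 0 times itself.
  (at-slice (Λ-slice {d} {d} {0ℚ} {𝟎} {𝟎} (slice λ k l m → sym (ℚ.*-zeroˡ 0ℚ))) k l m)
      (ℚ.*-zeroˡ (Λ 𝟎 (mono d k l m)))
Λ-Σ (x ∷ xs) G μ = trans (Λ-⊕ (G x) (λ μ → Σ xs (λ c → G c μ)) μ) (cong (Λ (G x) μ +_) (Λ-Σ xs G μ))

-- Codes of permutations and the recursion for all pairs

injective⇒surjective : ∀ {f : Fin d → Fin d} → Injective _≡_ _≡_ f → ∀ y → ∃ λ x → f x ≡ y
injective⇒surjective {f = f} inj y = iter f (per f inj y) y , IsPer.returns (per-isPer f inj y)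

Σ-reindex : ∀ {f : Fin d → Fin d} → Injective _≡_ _≡_ f → (g : Fin d → ℚ) → Σ (allFin d) g ≡ Σ
  (allFin d) (g ∘ f)
Σ-reindex {d} {f} inj g = Σ-match (allFin d) (allFin d) (λ y x → f x Fin.≟ y)
  (λ {y} _ → let x , fx≡y = injective⇒surjective inj y in
    Σ-one (Unique.allFin⁺ d) (∈-allFin x) (λ x → f x Fin.≟ y) fx≡y λ _ e → inj (trans e (sym fx≡y)))
  (λ {x} _ → Σ-one (Unique.allFin⁺ d) (∈-allFin (f x)) (f x Fin.≟_) refl λ _ → sym)
  {g} {g ∘ f} λ { _ _ refl → refl }

-- A permutation of Fin (d + 1) is a permutation of the nonzero elements followed by
-- the insertion of zero: the transposition of zero with its preimage.

Perm : ℕ → Set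
Perm zero    = ⊤
Perm (suc d) = Fin (suc d) × Perm d

insert : (Fin d → Fin d) → Fin (suc d) → Fin (suc d) → Fin (suc d)
insert f x = lift f ∘ swap zero x

insert-injective : ∀ {f : Fin d → Fin d} → Injective _≡_ _≡_ f → ∀ x → Injective _≡_ _≡_
  (insert f x)
insert-injective inj x = swap-injective zero x ∘ lift-injective inj

decode : Perm d → Fin d → Fin d
decode {suc d} (x , c) = insert (decode c) x

decode-injective : (c : Perm d) → Injective _≡_ _≡_ (decode c)
decode-injective {suc d} (x , c) = insert-injective (decode-injective c) x

perms : ∀ d → List (Perm d)
perms zero    = [ tt ]
perms (suc d) = cartesianProduct (allFin (suc d)) (perms d)

perms-unique : ∀ d → Unique (perms d)
perms-unique zero    = [] ∷ []
perms-unique (suc d) = Unique.cartesianProduct⁺ (Unique.allFin⁺ (suc d)) (perms-unique d)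

∈-perms : (c : Perm d) → c ∈ perms d
∈-perms {zero}  tt      = here refl
∈-perms {suc d} (x , c) = ∈-cartesianProduct⁺ (∈-allFin x) (∈-perms c)

-- The monomial uᵏ vˡ tᵐ of the dessin with white-to-black maps σ, id and black-to-white map τ.

weightOf : (σ τ : Fin d → Fin d) → Injective _≡_ _≡_ σ → Injective _≡_ _≡_ τ → Monomial
weightOf σ τ σ-inj τ-inj = mono 0 (total (cycleType σ σ-inj)) (total (cycleType τ τ-inj))
  (cycleType (τ ∘ σ) (λ e → σ-inj (τ-inj e)))

monomial : Perm d × Perm d → Monomial
monomial (σ , τ) = weightOf (decode σ) (decode τ) (decode-injective σ) (decode-injective τ)

pairs : ∀ d → List (Perm d × Perm d)
pairs d = cartesianProduct (perms d) (perms d)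

-- The polynomial of all pairs of permutations of d points. The power of `s` is not recorded in
-- `monomial` but supplied by `Ê`.
𝕎 : ℕ → PowerSeries
𝕎 d μ = Σ (pairs d) (λ c → δ (monomial c) μ)

module InsertPair {d} (σ τ : Fin d → Fin d)
                  (σ-inj : Injective _≡_ _≡_ σ) (τ-inj : Injective _≡_ _≡_ τ) where

  private
    π : Fin d → Fin d
    π = τ ∘ σ
    π-inj : Injective _≡_ _≡_ π
    π-inj e = σ-inj (τ-inj e)
    k l : ℕ
    k = total (cycleType σ σ-inj)
    l = total (cycleType τ τ-inj)
    m : Exponents
    m = cycleType π π-inj
    ν : Monomial
    ν = weightOf σ τ σ-inj τ-inj
    module I = Insert π π-inj

    count : ℕ → Fin (suc d) → ℕ
    count n zero    = suc n
    count n (suc _) = n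

    lift-cycleType : ∀ {f : Fin d → Fin d} (inj : Injective _≡_ _≡_ f) {g}
        (inj′ : Injective _≡_ _≡_ g) → g ≗ lift f →
                     cycleType g inj′ ≡ cycleType f inj ⊞ tᵉ 0
    lift-cycleType {f} inj {g} inj′ e = trans (cycleType-cong inj′ (lift-injective inj) e)
      (cycleType-unique′ {f = lift f} {λ {x} {y} → lift-injective inj {x} {y}}
          (cycleType-lift inj {cycleType f inj} (cycleType-isCycleType f inj)))

    insert-zero : ∀ (f : Fin d → Fin d) x → insert f zero x ≡ lift f x
    insert-zero f x = cong (lift f) (swap-self zero x)

    total-insert : ∀ {f : Fin d → Fin d} (inj : Injective _≡_ _≡_ f) x →
                   total (cycleType (insert f x) (insert-injective inj x)) ≡ count
                       (total (cycleType f inj)) x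
    total-insert {f} inj zero = trans (cong total
        (lift-cycleType inj (insert-injective inj zero) (insert-zero f)))
      (trans (total-⊞ (cycleType f inj) (tᵉ 0)) (ℕ.+-comm (total (cycleType f inj)) 1))
    total-insert {f} inj (suc a) = Insert.total-extended f inj a

    -- Moving the second transposition through `lift σ` conjugates it, turning the position
    -- `lift σ y` into y. Both transpositions then stand to the right of `lift π`, as in `f₂`.
    product : ∀ x y → insert τ (lift σ y) ∘ insert σ x ≗ lift π ∘ swap zero y ∘ swap zero x
    product x y z = trans (cong (lift τ)
        (swap-natural (lift σ) (lift-injective σ-inj) zero y (swap zero x z)))
      (lift-∘ (swap zero y (swap zero x z)))
      where
      lift-∘ : ∀ z → lift τ (lift σ z) ≡ lift π z
      lift-∘ zero    = refl
      lift-∘ (suc z) = refl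

    product-injective : ∀ x y → Injective _≡_ _≡_ (insert τ (lift σ y) ∘ insert σ x)
    product-injective x y e = insert-injective σ-inj x (insert-injective τ-inj (lift σ y) e)

    -- In `product` the transposition coming from τ stands next to `lift π`, so b is the first
    -- argument of `I.f₂` and a the second.
    type′ : Fin (suc d) → Fin (suc d) → Exponents
    type′ zero    zero    = m ⊞ tᵉ 0
    type′ zero    (suc b) = cycleType (I.f₁ b) (I.f₁-injective b)
    type′ (suc a) zero    = cycleType (I.f₁ a) (I.f₁-injective a)
    type′ (suc a) (suc b) = cycleType (I.f₂ b a) (I.f₂-injective b a)

    cycleType-product : ∀ x y → cycleType (insert τ (lift σ y) ∘ insert σ x) (product-injective x y)
        ≡ type′ x y
    cycleType-product zero zero = lift-cycleType π-inj (product-injective zero zero)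
      (λ z → trans (product zero zero z)
          (cong (lift π) (trans (swap-self zero (swap zero zero z)) (swap-self zero z))))
    cycleType-product zero (suc b) = cycleType-cong (product-injective zero (suc b))
        (I.f₁-injective b)
      (λ z → trans (product zero (suc b) z)
          (cong (λ w → lift π (swap zero (suc b) w)) (swap-self zero z)))
    cycleType-product (suc a) zero = cycleType-cong (product-injective (suc a) zero)
        (I.f₁-injective a)
      (λ z → trans (product (suc a) zero z) (cong (lift π) (swap-self zero (swap zero (suc a) z))))
    cycleType-product (suc a) (suc b) = cycleType-cong (product-injective (suc a) (suc b))
        (I.f₂-injective b a) (product (suc a) (suc b))

    inserted : Fin (suc d) → Fin (suc d) → Monomial
    inserted x y = weightOf (insert σ x) (insert τ y) (insert-injective σ-inj x)
        (insert-injective τ-inj y)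

    inserted-lift : ∀ x y → inserted x (lift σ y) ≡ mono 0 (count k x) (count l y) (type′ x y)
    inserted-lift x y = trans
      (cong₂ (λ a b → mono 0 a b (cycleType (insert τ (lift σ y) ∘ insert σ x)
          (product-injective x y)))
        (total-insert σ-inj x) (trans (total-insert τ-inj (lift σ y)) (count-lift y)))
      (cong (mono 0 (count k x) (count l y)) (cycleType-product x y))
      where
      count-lift : ∀ y → count l (lift σ y) ≡ count l y
      count-lift zero    = refl
      count-lift (suc y) = refl

    extension : ∀ k l → PowerSeries
    extension k l μ = Σ (allFin d) (λ a → δ (mono 0 k l (cycleType (I.f₁ a) (I.f₁-injective a))) μ)

    ·-extension : ∀ x k l k′ l′ → (∀ m → adjust suc x (mono 0 k l m) ≡ mono 0 k′ l′ m) →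
        extension k′ l′ ≈ x · L₁ (δ (mono 0 k l m))
    ·-extension x k l k′ l′ e μ = begin
      Σ (allFin d) (λ a → δ (mono 0 k′ l′ (cycleType (I.f₁ a) (I.f₁-injective a))) μ)
        ≡⟨ (Σ-cong (allFin d) λ a → trans
            (·-δ x (mono 0 k l (cycleType (I.f₁ a) (I.f₁-injective a))) μ)
            (cong (λ ξ → δ ξ μ) (e (cycleType (I.f₁ a) (I.f₁-injective a))))) ⟨
      Σ (allFin d) (λ a → (x · δ (mono 0 k l (cycleType (I.f₁ a) (I.f₁-injective a)))) μ)
        ≡⟨ ·-Σ x (allFin d) (λ a → δ (mono 0 k l (cycleType (I.f₁ a) (I.f₁-injective a)))) μ ⟨
      (x · extension k l) μ
        ≡⟨ ·-cong x (CutAndJoin.Σ-extended π π-inj k l) μ ⟩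
      (x · L₁ (δ (mono 0 k l m))) μ ∎
      where open ≡-Reasoning

  -- Four cases. If x is `zero`, the new point is a fixed point of σ and contributes a factor u;
  -- otherwise it lengthens a cycle of σ. The same holds for y, τ and v. The product undergoes no
  -- insertion, one or two, which gives t₁, `L₁` or `M₁` respectively.
  Σ-inserted : (λ μ → Σ (allFin (suc d)) (λ x → Σ (allFin (suc d)) λ y → δ (inserted x y) μ)) ≈ Λ
      (δ ν)
  Σ-inserted μ = begin
    Σ V⁺ (λ x → Σ V⁺ λ y → δ (inserted x y) μ)
      -- The position in τ is reparametrised by the bijection `lift σ`, in order to apply `product`.
      ≡⟨ (Σ-cong V⁺ λ x → trans (Σ-reindex (lift-injective σ-inj) (λ y → δ (inserted x y) μ))
           (Σ-cong V⁺ λ y → cong (λ ξ → δ ξ μ) (inserted-lift x y))) ⟩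
    Σ V⁺ (λ x → Σ V⁺ λ y → D x y)
      ≡⟨ Σ-allFin-suc (λ x → Σ V⁺ λ y → D x y) ⟩
    Σ V⁺ (D zero) + Σ V (λ a → Σ V⁺ (D (suc a)))
      ≡⟨ cong₂ _+_ (Σ-allFin-suc (D zero)) (trans (Σ-cong V λ a → Σ-allFin-suc (D (suc a)))
           (Σ-+ V (λ a → D (suc a) zero) (λ a → Σ V λ b → D (suc a) (suc b)))) ⟩
    (D zero zero + Σ V (λ b → D zero (suc b))) +
        (Σ V (λ a → D (suc a) zero) + Σ V (λ a → Σ V λ b → D (suc a) (suc b)))
      ≡⟨ cong₂ _+_ (cong₂ _+_ fixed (·-extension u k l (suc k) l (λ _ → refl) μ))
           (cong₂ _+_ (·-extension v k l k (suc l) (λ _ → refl) μ)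
             (trans (Σ-swap V V (λ a b → D (suc a) (suc b)))
                 (CutAndJoin.Σ-cut-and-join π π-inj k l μ))) ⟩
    ((u · v · t[1+ 0 ] · δ ν) μ + (u · L₁ (δ ν)) μ) + ((v · L₁ (δ ν)) μ + M₁ (δ ν) μ)
      ≡⟨ regroup ((u · v · t[1+ 0 ] · δ ν) μ) ((u · L₁ (δ ν)) μ) ((v · L₁ (δ ν)) μ) (M₁ (δ ν) μ) ⟩
    Λ (δ ν) μ ∎
    where
    open ≡-Reasoning
    V = allFin d
    V⁺ = allFin (suc d)
    D : Fin (suc d) → Fin (suc d) → ℚ
    D x y = δ (mono 0 (count k x) (count l y) (type′ x y)) μ
    fixed : D zero zero ≡ (u · v · t[1+ 0 ] · δ ν) μ
    fixed = sym (trans (·-cong u (≈-trans (·-cong v (·-δ t[1+ 0 ] ν))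
        (·-δ v (adjust suc t[1+ 0 ] ν))) μ)
      (trans (·-δ u (adjust suc v (adjust suc t[1+ 0 ] ν)) μ)
        (cong (λ m → δ (mono 0 (suc k) (suc l) m) μ) (trans (adjustAt-suc 0 m) (⊞-comm (tᵉ 0) m)))))
    regroup : ∀ a b c e → (a + b) + (c + e) ≡ b + c + e + a
    regroup = solve 4 (λ a b c e → (a :+ b) :+ (c :+ e) := b :+ c :+ e :+ a) refl
      where open +-*-Solver using (solve; _:=_; _:+_)

𝕎-zero : 𝕎 0 ≈ 𝟏
𝕎-zero μ = trans (ℚ.+-identityʳ _) (trans
  (cong (λ ξ → δ ξ μ) (cong₂ (λ a b → mono 0 (total a) (total a) b) empty empty)) (sym (𝟏≈δ μ)))
  where
  empty : ∀ {f : Fin 0 → Fin 0} {inj : Injective _≡_ _≡_ f} → cycleType f inj ≡ nothing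
  empty {f} {inj} = cycleType-unique′ {f = f} {λ {x} {y} → inj {x} {y}} λ i →
    trans (cong (λ n → fromℕ (suc i) * fromℕ n) (at-nothing i)) (ℚ.*-zeroʳ (fromℕ (suc i)))

𝕎-suc : ∀ d → 𝕎 (suc d) ≈ Λ (𝕎 d)
𝕎-suc d μ = begin
  Σ (pairs (suc d)) (λ c → δ (monomial c) μ)
    ≡⟨ trans (Σ-prod (perms (suc d)) (perms (suc d)) (λ c → δ (monomial c) μ))
         (trans (Σ-prod V⁺ (perms d) (λ σ⁺ → Σ (perms (suc d)) λ τ⁺ → D σ⁺ τ⁺))
           (Σ-cong V⁺ λ x → Σ-cong (perms d) λ σ → Σ-prod V⁺ (perms d) (D (x , σ)))) ⟩
  Σ V⁺ (λ x → Σ (perms d) λ σ → Σ V⁺ λ y → Σ (perms d) λ τ → D (x , σ) (y , τ))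
    ≡⟨ trans (Σ-swap V⁺ (perms d) (λ x σ → Σ V⁺ λ y → Σ (perms d) λ τ → D (x , σ) (y , τ)))
         (Σ-cong (perms d) λ σ → trans (Σ-cong V⁺ λ x → Σ-swap V⁺ (perms d)
             (λ y τ → D (x , σ) (y , τ)))
           (Σ-swap V⁺ (perms d) (λ x τ → Σ V⁺ λ y → D (x , σ) (y , τ)))) ⟩
  Σ (perms d) (λ σ → Σ (perms d) λ τ → Σ V⁺ λ x → Σ V⁺ λ y → D (x , σ) (y , τ))
    ≡⟨ (Σ-cong (perms d) λ σ → Σ-cong (perms d) λ τ →
         InsertPair.Σ-inserted (decode σ) (decode τ) (decode-injective σ) (decode-injective τ) μ) ⟩
  Σ (perms d) (λ σ → Σ (perms d) λ τ → Λ (δ (monomial (σ , τ))) μ)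
    ≡⟨ Σ-prod (perms d) (perms d) (λ c → Λ (δ (monomial c)) μ) ⟨
  Σ (pairs d) (λ c → Λ (δ (monomial c)) μ)
    ≡⟨ Λ-Σ (pairs d) (λ c → δ (monomial c)) μ ⟨
  Λ (𝕎 d) μ ∎
  where
  open ≡-Reasoning
  V⁺ = allFin (suc d)
  D : Perm (suc d) → Perm (suc d) → ℚ
  D σ τ = δ (monomial (σ , τ)) μ

-- The first component of a code is the preimage of `zero`. Once these agree, undoing the common
-- transposition leaves the lifts of the remaining permutations.
decode-unique : (c c′ : Perm d) → decode c ≗ decode c′ → c ≡ c′
decode-unique {zero}  tt      tt        e = refl
decode-unique {suc d} (x , c) (x′ , c′) e
  with refl ← decode-injective (x′ , c′) {x} {x′}
      (trans (sym (e x)) (trans (cong (lift (decode c)) (swap-ʳ zero x))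
                (sym (cong (lift (decode c′)) (swap-ʳ zero x′))))) =
  cong (x ,_) (decode-unique c c′ λ y → Fin.suc-injective
      (trans (sym (undo c y)) (trans (e (swap zero x (suc y))) (undo c′ y))))
  where
  undo : ∀ c y → insert (decode c) x (swap zero x (suc y)) ≡ suc (decode c y)
  undo c y = cong (lift (decode c)) (swap-involutive zero x (suc y))

encode : (f : Fin d → Fin d) → Injective _≡_ _≡_ f → ∃ λ (c : Perm d) → decode c ≗ f
encode {zero}  f inj = tt , λ ()
encode {suc d} f inj = (x , proj₁ code) , λ z → trans (agree-lift (swap zero x z))
  (cong f (swap-involutive zero x z))
  where
  -- After the transposition of `zero` with its preimage, the permutation `h` fixes `zero` and so
  -- restricts to the other points.
  preimage = injective⇒surjective inj zero
  x = proj₁ preimage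
  h : Fin (suc d) → Fin (suc d)
  h = f ∘ swap zero x
  h-inj : Injective _≡_ _≡_ h
  h-inj = swap-injective zero x ∘ inj
  h-zero : h zero ≡ zero
  h-zero = trans (cong f (swap-ˡ zero x)) (proj₂ preimage)
  lower : ∀ z → z ≢ zero → ∃ λ y → suc y ≡ z
  lower zero    n = contradiction refl n
  lower (suc y) _ = y , refl
  lowered : ∀ y → ∃ λ y′ → suc y′ ≡ h (suc y)
  lowered y = lower (h (suc y)) λ e → Fin.0≢1+n (sym (h-inj (trans e (sym h-zero))))
  g : Fin d → Fin d
  g = proj₁ ∘ lowered
  g-inj : Injective _≡_ _≡_ g
  g-inj {y} {y′} e = Fin.suc-injective
      (h-inj (trans (sym (proj₂ (lowered y))) (trans (cong suc e) (proj₂ (lowered y′)))))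
  code = encode g g-inj
  agree-lift : ∀ z → lift (decode (proj₁ code)) z ≡ h z
  agree-lift zero    = sym h-zero
  agree-lift (suc y) = trans (cong suc (proj₂ code y)) (proj₂ (lowered y))

-- Splitting off the orbit of the new point

pairs-unique : ∀ d → Unique (pairs d)
pairs-unique d = Unique.cartesianProduct⁺ (perms-unique d) (perms-unique d)

∈-pairs : (c : Perm d × Perm d) → c ∈ pairs d
∈-pairs (σ , τ) = ∈-cartesianProduct⁺ (∈-perms σ) (∈-perms τ)

-- A subset T identifies Fin n with the sum of its complement, Fin (#out T), and Fin (#in T).

#out #in : ∀ {n} → Vec Bool n → ℕ
#out []          = 0
#out (false ∷ T) = suc (#out T)
#out (true  ∷ T) = #out T
#in []          = 0
#in (false ∷ T) = #in T
#in (true  ∷ T) = suc (#in T)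

glue : ∀ {n} (T : Vec Bool n) → Fin (#out T) ⊎ Fin (#in T) → Fin n
glue (false ∷ T) (inj₁ zero)    = zero
glue (false ∷ T) (inj₁ (suc i)) = suc (glue T (inj₁ i))
glue (false ∷ T) (inj₂ j)       = suc (glue T (inj₂ j))
glue (true  ∷ T) (inj₁ i)       = suc (glue T (inj₁ i))
glue (true  ∷ T) (inj₂ zero)    = zero
glue (true  ∷ T) (inj₂ (suc j)) = suc (glue T (inj₂ j))

split : ∀ {n} (T : Vec Bool n) → Fin n → Fin (#out T) ⊎ Fin (#in T)
split (false ∷ T) zero    = inj₁ zero
split (false ∷ T) (suc x) = Sum.map suc id (split T x)
split (true  ∷ T) zero    = inj₂ zero
split (true  ∷ T) (suc x) = Sum.map id suc (split T x)

split-glue : ∀ {n} (T : Vec Bool n) x → split T (glue T x) ≡ x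
split-glue (false ∷ T) (inj₁ zero)    = refl
split-glue (false ∷ T) (inj₁ (suc i)) = cong (Sum.map suc id) (split-glue T (inj₁ i))
split-glue (false ∷ T) (inj₂ j)       = cong (Sum.map suc id) (split-glue T (inj₂ j))
split-glue (true  ∷ T) (inj₁ i)       = cong (Sum.map id suc) (split-glue T (inj₁ i))
split-glue (true  ∷ T) (inj₂ zero)    = refl
split-glue (true  ∷ T) (inj₂ (suc j)) = cong (Sum.map id suc) (split-glue T (inj₂ j))

glue-split : ∀ {n} (T : Vec Bool n) x → glue T (split T x) ≡ x
glue-split (false ∷ T) zero    = refl
glue-split (true  ∷ T) zero    = refl
glue-split (false ∷ T) (suc x) = trans (glue-suc (split T x)) (cong suc (glue-split T x))
  where
  glue-suc : ∀ y → glue (false ∷ T) (Sum.map suc id y) ≡ suc (glue T y)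
  glue-suc (inj₁ i) = refl
  glue-suc (inj₂ j) = refl
glue-split (true ∷ T) (suc x) = trans (glue-suc (split T x)) (cong suc (glue-split T x))
  where
  glue-suc : ∀ y → glue (true ∷ T) (Sum.map id suc y) ≡ suc (glue T y)
  glue-suc (inj₁ i) = refl
  glue-suc (inj₂ j) = refl

glue-injective : ∀ {n} (T : Vec Bool n) → Injective _≡_ _≡_ (glue T)
glue-injective T {x} {y} e = trans (sym (split-glue T x))
  (trans (cong (split T) e) (split-glue T y))

lookup-out : ∀ {n} (T : Vec Bool n) i → lookup T (glue T (inj₁ i)) ≡ false
lookup-out (false ∷ T) zero    = refl
lookup-out (false ∷ T) (suc i) = lookup-out T i
lookup-out (true  ∷ T) i       = lookup-out T i

lookup-in : ∀ {n} (T : Vec Bool n) j → lookup T (glue T (inj₂ j)) ≡ true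
lookup-in (false ∷ T) j       = lookup-in T j
lookup-in (true  ∷ T) zero    = refl
lookup-in (true  ∷ T) (suc j) = lookup-in T j

Σ-glue : ∀ {n} (T : Vec Bool n) (g : Fin n → ℚ) →
         Σ (allFin n) g ≡ Σ (allFin (#out T)) (g ∘ glue T ∘ inj₁) + Σ (allFin (#in T))
             (g ∘ glue T ∘ inj₂)
Σ-glue []          g = refl
Σ-glue {suc n} (false ∷ T) g = begin
  Σ (allFin (suc n)) g
    ≡⟨ Σ-allFin-suc g ⟩
  g zero + Σ (allFin n) (g ∘ suc)
    ≡⟨ cong (g zero +_) (Σ-glue T (g ∘ suc)) ⟩
  g zero + (Σ (allFin (#out T)) (g ∘ suc ∘ glue T ∘ inj₁) + Σ (allFin (#in T))
      (g ∘ suc ∘ glue T ∘ inj₂))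
    ≡⟨ ℚ.+-assoc (g zero) _ _ ⟨
  (g zero + Σ (allFin (#out T)) (g ∘ suc ∘ glue T ∘ inj₁)) + Σ (allFin (#in T))
      (g ∘ suc ∘ glue T ∘ inj₂)
    ≡⟨ cong (_+ Σ (allFin (#in T)) (g ∘ suc ∘ glue T ∘ inj₂))
        (Σ-allFin-suc (g ∘ glue (false ∷ T) ∘ inj₁)) ⟨
  Σ (allFin (suc (#out T))) (g ∘ glue (false ∷ T) ∘ inj₁) + Σ (allFin (#in T))
      (g ∘ glue (false ∷ T) ∘ inj₂) ∎
  where open ≡-Reasoning
Σ-glue {suc n} (true ∷ T) g = begin
  Σ (allFin (suc n)) g
    ≡⟨ Σ-allFin-suc g ⟩
  g zero + Σ (allFin n) (g ∘ suc)
    ≡⟨ cong (g zero +_) (Σ-glue T (g ∘ suc)) ⟩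
  g zero + (Σ₁ + Σ₂)
    ≡⟨ cong (g zero +_) (ℚ.+-comm Σ₁ Σ₂) ⟩
  g zero + (Σ₂ + Σ₁)
    ≡⟨ ℚ.+-assoc (g zero) Σ₂ Σ₁ ⟨
  (g zero + Σ₂) + Σ₁
    ≡⟨ ℚ.+-comm (g zero + Σ₂) Σ₁ ⟩
  Σ₁ + (g zero + Σ₂)
    ≡⟨ cong (Σ₁ +_) (Σ-allFin-suc (g ∘ glue (true ∷ T) ∘ inj₂)) ⟨
  Σ₁ + Σ (allFin (suc (#in T))) (g ∘ glue (true ∷ T) ∘ inj₂) ∎
  where
  open ≡-Reasoning
  Σ₁ Σ₂ : ℚ
  Σ₁ = Σ (allFin (#out T)) (g ∘ suc ∘ glue T ∘ inj₁)
  Σ₂ = Σ (allFin (#in T)) (g ∘ suc ∘ glue T ∘ inj₂)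

module _ {n} (T : Vec Bool n) where

  merge : (Fin (#out T) → Fin (#out T)) → (Fin (#in T) → Fin (#in T)) → Fin n → Fin n
  merge f g = glue T ∘ Sum.map f g ∘ split T

  merge-glue : ∀ f g x → merge f g (glue T x) ≡ glue T (Sum.map f g x)
  merge-glue f g x = cong (glue T ∘ Sum.map f g) (split-glue T x)

  merge-cong : ∀ {f f′ g g′} → f ≗ f′ → g ≗ g′ → merge f g ≗ merge f′ g′
  merge-cong p q x = cong (glue T) (sum-cong (split T x))
    where
    sum-cong : ∀ y → Sum.map _ _ y ≡ Sum.map _ _ y
    sum-cong (inj₁ i) = cong inj₁ (p i)
    sum-cong (inj₂ j) = cong inj₂ (q j)

  merge-∘ : ∀ f f′ g g′ → merge f g ∘ merge f′ g′ ≗ merge (f ∘ f′) (g ∘ g′)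
  merge-∘ f f′ g g′ x = trans (merge-glue f g (Sum.map f′ g′ (split T x)))
      (cong (glue T) (sum-∘ (split T x)))
    where
    sum-∘ : ∀ y → Sum.map f g (Sum.map f′ g′ y) ≡ Sum.map (f ∘ f′) (g ∘ g′) y
    sum-∘ (inj₁ i) = refl
    sum-∘ (inj₂ j) = refl

  merge-uniqueˡ : ∀ {f f′ g g′} → merge f g ≗ merge f′ g′ → f ≗ f′
  merge-uniqueˡ {f} {f′} {g} {g′} e i = Sum.inj₁-injective (glue-injective T
    (trans (sym (merge-glue f g (inj₁ i)))
        (trans (e (glue T (inj₁ i))) (merge-glue f′ g′ (inj₁ i)))))

  merge-uniqueʳ : ∀ {f f′ g g′} → merge f g ≗ merge f′ g′ → g ≗ g′
  merge-uniqueʳ {f} {f′} {g} {g′} e j = Sum.inj₂-injective (glue-injective T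
    (trans (sym (merge-glue f g (inj₂ j)))
        (trans (e (glue T (inj₂ j))) (merge-glue f′ g′ (inj₂ j)))))

  lookup-merge : ∀ f g x → lookup T (merge f g x) ≡ lookup T x
  lookup-merge f g x = trans (go (split T x)) (cong (lookup T) (glue-split T x))
    where
    go : ∀ y → lookup T (glue T (Sum.map f g y)) ≡ lookup T (glue T y)
    go (inj₁ i) = trans (lookup-out T (f i)) (sym (lookup-out T i))
    go (inj₂ j) = trans (lookup-in T (g j)) (sym (lookup-in T j))

  module _ {f : Fin (#out T) → Fin (#out T)} {g : Fin (#in T) → Fin (#in T)}
           (f-inj : Injective _≡_ _≡_ f) (g-inj : Injective _≡_ _≡_ g) where

    merge-injective : Injective _≡_ _≡_ (merge f g)
    merge-injective {x} {y} e = trans (sym (glue-split T x))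
        (trans (cong (glue T) (map-injective (split T x) (split T y) (glue-injective T e)))
        (glue-split T y))
      where
      map-injective : ∀ x y → Sum.map f g x ≡ Sum.map f g y → x ≡ y
      map-injective (inj₁ i) (inj₁ j) e = cong inj₁ (f-inj (Sum.inj₁-injective e))
      map-injective (inj₂ i) (inj₂ j) e = cong inj₂ (g-inj (Sum.inj₂-injective e))

    cycleType-merge : cycleType (merge f g) merge-injective ≡ cycleType f f-inj ⊞ cycleType g g-inj
    cycleType-merge = cycleType-unique′ {f = merge f g} {λ {x} {y} → merge-injective {x} {y}} λ i →
        begin
      fromℕ (suc i) * fromℕ (at (cycleType f f-inj ⊞ cycleType g g-inj) i)
        ≡⟨ cong (fromℕ (suc i) *_) (trans
            (cong fromℕ (at-⊞ (cycleType f f-inj) (cycleType g g-inj) i))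
            (fromℕ-+ (at (cycleType f f-inj) i) _)) ⟩
      fromℕ (suc i) * (fromℕ (at (cycleType f f-inj) i) + fromℕ (at (cycleType g g-inj) i))
        ≡⟨ ℚ.*-distribˡ-+ (fromℕ (suc i)) (fromℕ (at (cycleType f f-inj) i)) _ ⟩
      fromℕ (suc i) * fromℕ (at (cycleType f f-inj) i) + fromℕ (suc i) * fromℕ
          (at (cycleType g g-inj) i)
        ≡⟨ cong₂ _+_ (cycleType-isCycleType f f-inj i) (cycleType-isCycleType g g-inj i) ⟩
      Σ (allFin (#out T)) (λ x → ⟦ per f f-inj x ℕ.≟ i ⟧) + Σ (allFin (#in T))
          (λ x → ⟦ per g g-inj x ℕ.≟ i ⟧)
        ≡⟨ cong₂ _+_ (Σ-cong (allFin (#out T)) λ x → cong (λ p → ⟦ p ℕ.≟ i ⟧) (per-out x))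
                     (Σ-cong (allFin (#in T)) λ x → cong (λ p → ⟦ p ℕ.≟ i ⟧) (per-in x)) ⟨
      Σ (allFin (#out T)) (λ x → ⟦ per (merge f g) merge-injective (glue T (inj₁ x)) ℕ.≟ i ⟧) +
      Σ (allFin (#in T)) (λ x → ⟦ per (merge f g) merge-injective (glue T (inj₂ x)) ℕ.≟ i ⟧)
        ≡⟨ Σ-glue T (λ x → ⟦ per (merge f g) merge-injective x ℕ.≟ i ⟧) ⟨
      Σ (allFin n) (λ x → ⟦ per (merge f g) merge-injective x ℕ.≟ i ⟧) ∎
      where
      open ≡-Reasoning
      per-out : ∀ x → per (merge f g) merge-injective (glue T (inj₁ x)) ≡ per f f-inj x
      per-out x = per-unique (merge f g) merge-injective
        (isPer-map (glue T ∘ inj₁) (Sum.inj₁-injective ∘ glue-injective T)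
            (λ x → merge-glue f g (inj₁ x)) (per-isPer f f-inj x))
      per-in : ∀ x → per (merge f g) merge-injective (glue T (inj₂ x)) ≡ per g g-inj x
      per-in x = per-unique (merge f g) merge-injective
        (isPer-map (glue T ∘ inj₂) (Sum.inj₂-injective ∘ glue-injective T)
            (λ x → merge-glue f g (inj₂ x)) (per-isPer g g-inj x))

  restrict : (h : Fin n → Fin n) → Injective _≡_ _≡_ h → (∀ x → lookup T (h x) ≡ lookup T x) →
             ∃₂ λ f g → Injective _≡_ _≡_ f × Injective _≡_ _≡_ g × merge f g ≗ h
  restrict h h-inj inv = f , g , f-inj , g-inj , merge≗
    where
    out : ∀ i → ∃ λ i′ → glue T (inj₁ i′) ≡ h (glue T (inj₁ i))
    out i = go (split T (h (glue T (inj₁ i)))) (glue-split T (h (glue T (inj₁ i))))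
      where
      go : ∀ y → glue T y ≡ h (glue T (inj₁ i)) → ∃ λ i′ → glue T (inj₁ i′) ≡ h (glue T (inj₁ i))
      go (inj₁ i′) e = i′ , e
      go (inj₂ j) e = contradiction (trans (sym (lookup-in T j))
          (trans (cong (lookup T) e) (trans (inv (glue T (inj₁ i))) (lookup-out T i)))) λ ()
    inn : ∀ j → ∃ λ j′ → glue T (inj₂ j′) ≡ h (glue T (inj₂ j))
    inn j = go (split T (h (glue T (inj₂ j)))) (glue-split T (h (glue T (inj₂ j))))
      where
      go : ∀ y → glue T y ≡ h (glue T (inj₂ j)) → ∃ λ j′ → glue T (inj₂ j′) ≡ h (glue T (inj₂ j))
      go (inj₂ j′) e = j′ , e
      go (inj₁ i) e = contradiction (trans (sym (lookup-out T i))
          (trans (cong (lookup T) e) (trans (inv (glue T (inj₂ j))) (lookup-in T j)))) λ ()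
    f = proj₁ ∘ out
    g = proj₁ ∘ inn
    f-inj : Injective _≡_ _≡_ f
    f-inj {x} {y} e = Sum.inj₁-injective (glue-injective T (h-inj
      (trans (sym (proj₂ (out x))) (trans (cong (glue T ∘ inj₁) e) (proj₂ (out y))))))
    g-inj : Injective _≡_ _≡_ g
    g-inj {x} {y} e = Sum.inj₂-injective (glue-injective T (h-inj
      (trans (sym (proj₂ (inn x))) (trans (cong (glue T ∘ inj₂) e) (proj₂ (inn y))))))
    merge≗ : merge f g ≗ h
    merge≗ x = trans (go (split T x)) (cong h (glue-split T x))
      where
      go : ∀ y → glue T (Sum.map f g y) ≡ h (glue T y)
      go (inj₁ i) = proj₂ (out i)
      go (inj₂ j) = proj₂ (inn j)

data Step (σ τ : Fin d → Fin d) : Fin d → Fin d → Set where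
  σ-step : ∀ x → Step σ τ x (σ x)
  τ-step : ∀ x → Step σ τ x (τ x)

step? : (σ τ : Fin d → Fin d) → Decidable (Step σ τ)
step? σ τ x y with σ x Fin.≟ y | τ x Fin.≟ y
... | yes refl | _        = yes (σ-step x)
... | no _     | yes refl = yes (τ-step x)
... | no p     | no q     = no λ { (σ-step _) → p refl ; (τ-step _) → q refl }

Orbit : (σ τ : Fin d → Fin d) → Fin d → Fin d → Set
Orbit σ τ = EqClosure (Step σ τ)

opaque
  orbit? : (σ τ : Fin d → Fin d) → Decidable (Orbit σ τ)
  orbit? {d} σ τ = eqClosure? Fin._≟_ (step? σ τ) (allFin d) ∈-allFin

-- The pair on the empty set is excluded: a Belyi graph has a vertex, and F has no constant term.
IsTransitive : (σ τ : Fin d → Fin d) → Set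
IsTransitive {zero}  σ τ = ⊥
IsTransitive {suc d} σ τ = ∀ x → Orbit σ τ zero x

transitive? : (σ τ : Fin d → Fin d) → Dec (IsTransitive σ τ)
transitive? {zero}  σ τ = no λ ()
transitive? {suc d} σ τ = Fin.all? (orbit? σ τ zero)

transitivePair? : (c : Perm d × Perm d) → Dec (IsTransitive (decode (proj₁ c)) (decode (proj₂ c)))
transitivePair? (σ , τ) = transitive? (decode σ) (decode τ)

ℂ : ℕ → PowerSeries
ℂ d μ = Σ (pairs d) (λ c → ⟦ transitivePair? c ⟧ * δ (monomial c) μ)

lookup-orbit : ∀ (T : Vec Bool d) {σ τ} → (∀ x → lookup T (σ x) ≡ lookup T x) →
  (∀ x → lookup T (τ x) ≡ lookup T x) →
               ∀ {x y} → Orbit σ τ x y → lookup T x ≡ lookup T y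
lookup-orbit T p q ε                     = refl
lookup-orbit T p q (fwd (σ-step x) ◅ xs) = trans (sym (p x)) (lookup-orbit T p q xs)
lookup-orbit T p q (fwd (τ-step x) ◅ xs) = trans (sym (q x)) (lookup-orbit T p q xs)
lookup-orbit T p q (bwd (σ-step x) ◅ xs) = trans (p x) (lookup-orbit T p q xs)
lookup-orbit T p q (bwd (τ-step x) ◅ xs) = trans (q x) (lookup-orbit T p q xs)

orbit-cong : ∀ {σ σ′ τ τ′ : Fin d → Fin d} → σ ≗ σ′ → τ ≗ τ′ → ∀ {x y} → Orbit σ τ x y →
  Orbit σ′ τ′ x y
orbit-cong {σ = σ} {σ′} {τ} {τ′} p q = EqClosure.map step
  where
  step : ∀ {x y} → Step σ τ x y → Step σ′ τ′ x y
  step (σ-step x) = subst (Step σ′ τ′ x) (sym (p x)) (σ-step x)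
  step (τ-step x) = subst (Step σ′ τ′ x) (sym (q x)) (τ-step x)

module _ {n} (T : Vec Bool n) (σ₁ τ₁ : Fin (#out T) → Fin (#out T))
         (σ₂ τ₂ : Fin (#in T) → Fin (#in T)) where

  orbit-merge⁺ : ∀ {x y} → Orbit σ₂ τ₂ x y → Orbit (merge T σ₁ σ₂) (merge T τ₁ τ₂) (glue T (inj₂ x))
      (glue T (inj₂ y))
  orbit-merge⁺ = EqClosure.gmap (glue T ∘ inj₂) step
    where
    step : ∀ {x y} → Step σ₂ τ₂ x y → Step (merge T σ₁ σ₂) (merge T τ₁ τ₂) (glue T (inj₂ x))
        (glue T (inj₂ y))
    step (σ-step x) = subst (Step _ _ (glue T (inj₂ x))) (merge-glue T σ₁ σ₂ (inj₂ x))
        (σ-step (glue T (inj₂ x)))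
    step (τ-step x) = subst (Step _ _ (glue T (inj₂ x))) (merge-glue T τ₁ τ₂ (inj₂ x))
        (τ-step (glue T (inj₂ x)))

  -- A path starting in the part marked by `T` never leaves it, in either direction, so it projects
  -- to that part step by step. The induction is over paths with arbitrary endpoints, whose
  -- positions are given by `split`.
  orbit-merge⁻ : ∀ {x y} → Orbit (merge T σ₁ σ₂) (merge T τ₁ τ₂) (glue T (inj₂ x))
      (glue T (inj₂ y)) → Orbit σ₂ τ₂ x y
  orbit-merge⁻ {x} {y} o = go o (split-glue T (inj₂ x)) (split-glue T (inj₂ y))
    where
    go : ∀ {z w i j} → Orbit (merge T σ₁ σ₂) (merge T τ₁ τ₂) z w → split T z ≡ inj₂ i → split T w
        ≡ inj₂ j → Orbit σ₂ τ₂ i j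
    forward : ∀ h₁ h₂ {z i} → split T z ≡ inj₂ i → split T (merge T h₁ h₂ z) ≡ inj₂ (h₂ i)
    forward h₁ h₂ {z} e = trans (split-glue T (Sum.map h₁ h₂ (split T z))) (cong (Sum.map h₁ h₂) e)
    backward : ∀ h₁ h₂ z {i} → split T (merge T h₁ h₂ z) ≡ inj₂ i → ∃ λ j → split T z
        ≡ inj₂ j × h₂ j ≡ i
    backward h₁ h₂ z e = cases (split T z) refl
      where
      cases : ∀ y → split T z ≡ y → ∃ λ j → split T z ≡ inj₂ j × h₂ j ≡ _
      cases (inj₁ i) e′ = contradiction
          (trans (sym (cong (Sum.map h₁ h₂) e′))
          (trans (sym (split-glue T (Sum.map h₁ h₂ (split T z)))) e)) λ ()
      cases (inj₂ j) e′ = j , e′ , Sum.inj₂-injective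
          (trans (sym (cong (Sum.map h₁ h₂) e′))
          (trans (sym (split-glue T (Sum.map h₁ h₂ (split T z)))) e))
    go ε p q = subst (Orbit σ₂ τ₂ _) (Sum.inj₂-injective (trans (sym p) q)) ε
    go (fwd (σ-step z) ◅ o) p q = fwd (σ-step _) ◅ go o (forward σ₁ σ₂ p) q
    go (fwd (τ-step z) ◅ o) p q = fwd (τ-step _) ◅ go o (forward τ₁ τ₂ p) q
    go (bwd (σ-step z) ◅ o) p q with j , e , refl ← backward σ₁ σ₂ z p = bwd (σ-step j) ◅ go o e q
    go (bwd (τ-step z) ◅ o) p q with j , e , refl ← backward τ₁ τ₂ z p = bwd (τ-step j) ◅ go o e q

subsets : ∀ n → List (Vec Bool n)
subsets zero    = [] ∷ []
subsets (suc n) = cartesianProductWith _∷_ (false ∷ true ∷ []) (subsets n)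

subsets-unique : ∀ n → Unique (subsets n)
subsets-unique zero    = [] ∷ []
subsets-unique (suc n) = Unique.cartesianProductWith⁺ _∷_ (λ e → Vec.∷-injective e)
  (((λ ()) ∷ []) ∷ [] ∷ []) (subsets-unique n)

∈-subsets : ∀ {n} (S : Vec Bool n) → S ∈ subsets n
∈-subsets []          = here refl
∈-subsets (false ∷ S) = ∈-cartesianProductWith⁺ _∷_ {xs = false ∷ true ∷ []} (here refl)
  (∈-subsets S)
∈-subsets (true ∷ S) = ∈-cartesianProductWith⁺ _∷_ {xs = false ∷ true ∷ []} (there (here refl))
  (∈-subsets S)

-- The first bit of a subset records which of the two summands is chosen in the recursion for `⊛`.
⊛-subsets : ∀ X Y d μ → (X ⊛ Y) d μ ≡ Σ (subsets d) (λ S → (X (#out S) ⊗ Y (#in S)) μ)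
⊛-subsets X Y zero    μ = sym (ℚ.+-identityʳ ((X 0 ⊗ Y 0) μ))
⊛-subsets X Y (suc d) μ = begin
  ((X ∘ suc) ⊛ Y) d μ + (X ⊛ (Y ∘ suc)) d μ
    ≡⟨ cong₂ _+_ (⊛-subsets (X ∘ suc) Y d μ) (⊛-subsets X (Y ∘ suc) d μ) ⟩
  Σ (subsets d) (f ∘ (false ∷_)) + Σ (subsets d) (f ∘ (true ∷_))
    ≡⟨ cong (Σ (subsets d) (f ∘ (false ∷_)) +_) (ℚ.+-identityʳ (Σ (subsets d) (f ∘ (true ∷_)))) ⟨
  Σ (subsets d) (f ∘ (false ∷_)) + (Σ (subsets d) (f ∘ (true ∷_)) + 0ℚ)
    ≡⟨ Σ-prodWith _∷_ (false ∷ true ∷ []) (subsets d) f ⟨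
  Σ (subsets (suc d)) f ∎
  where
  open ≡-Reasoning
  f : Vec Bool (suc d) → ℚ
  f S = (X (#out S) ⊗ Y (#in S)) μ

δ-⊗ : ∀ ν ξ → δ ν ⊗ δ ξ ≈ δ (ν ✶ ξ)
δ-⊗ ν ξ μ with (ν ✶ ξ) ≟ᵐ μ
... | yes refl = trans (δ⊗-at ν (δ ξ) ξ)
  (trans (⟦⟧-yes (ξ ≟ᵐ ξ) refl) (sym (⟦⟧-yes (yes refl) refl)))
... | no ¬e    = trans (Σ-null (splits μ) λ {(α , β)} i →
    trans (⟦⟧*-cong (ν ≟ᵐ α) λ { refl → ⟦⟧-no (ξ ≟ᵐ β) λ { refl → ¬e (∈-splits⁻ μ i) } })
        (ℚ.*-zeroʳ ⟦ ν ≟ᵐ α ⟧))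
  (sym (⟦⟧-no (no ¬e) ¬e))

⊗-Σˡ : ∀ {A : Set} (xs : List A) (G : A → PowerSeries) H μ →
       ((λ μ → Σ xs (λ c → G c μ)) ⊗ H) μ ≡ Σ xs (λ c → (G c ⊗ H) μ)
⊗-Σˡ xs G H μ = trans (Σ-cong (splits μ) λ (α , β) → sym (Σ-*ʳ xs (H β) (λ c → G c α)))
  (Σ-swap (splits μ) xs (λ (α , β) c → G c α * H β))

⊗-Σʳ : ∀ {A : Set} G (xs : List A) (H : A → PowerSeries) μ →
       (G ⊗ (λ μ → Σ xs (λ c → H c μ))) μ ≡ Σ xs (λ c → (G ⊗ H c) μ)
⊗-Σʳ G xs H μ = trans (Σ-cong (splits μ) λ (α , β) → sym (Σ-*ˡ xs (G α) (λ c → H c β)))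
  (Σ-swap (splits μ) xs (λ (α , β) c → G α * H c β))

𝕎⊗ℂ : ∀ p q μ → (𝕎 p ⊗ ℂ q) μ ≡
      Σ (pairs p) (λ c₁ → Σ (pairs q) λ c₂ → ⟦ transitivePair? c₂ ⟧ * δ
          (monomial c₁ ✶ monomial c₂) μ)
𝕎⊗ℂ p q μ = trans (⊗-Σˡ (pairs p) (δ ∘ monomial) (ℂ q) μ) (Σ-cong (pairs p) λ c₁ →
  trans (⊗-Σʳ (δ (monomial c₁)) (pairs q) (λ c₂ → ⟦ transitivePair? c₂ ⟧ • δ (monomial c₂)) μ)
    (Σ-cong (pairs q) λ c₂ → trans (⊗-•ʳ ⟦ transitivePair? c₂ ⟧ (δ (monomial c₁))
        (δ (monomial c₂)) μ)
      (cong (⟦ transitivePair? c₂ ⟧ *_) (δ-⊗ (monomial c₁) (monomial c₂) μ))))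

private
  cong₃ : ∀ {A B C D : Set} (f : A → B → C → D) {a a′ b b′ c c′} →
          a ≡ a′ → b ≡ b′ → c ≡ c′ → f a b c ≡ f a′ b′ c′
  cong₃ f refl refl refl = refl

weightOf-cong : ∀ {σ σ′ τ τ′ : Fin d → Fin d} (a : Injective _≡_ _≡_ σ) (a′ : Injective _≡_ _≡_ σ′)
                (b : Injective _≡_ _≡_ τ) (b′ : Injective _≡_ _≡_ τ′) → σ ≗ σ′ → τ ≗ τ′ →
                weightOf σ τ a b ≡ weightOf σ′ τ′ a′ b′
weightOf-cong {σ = σ} {σ′} {τ} {τ′} a a′ b b′ p q = cong₃ (λ x y z → mono 0 (total x) (total y) z)
  (cycleType-cong a a′ p) (cycleType-cong b b′ q)
  (cycleType-cong {f = τ ∘ σ} {τ′ ∘ σ′} (λ e → a (b e)) (λ e → a′ (b′ e))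
      (λ x → trans (q (σ x)) (cong τ′ (p x))))

weightOf-merge : ∀ {n} (T : Vec Bool n) {σ₁ τ₁ σ₂ τ₂}
  (a₁ : Injective _≡_ _≡_ σ₁) (b₁ : Injective _≡_ _≡_ τ₁) (a₂ : Injective _≡_ _≡_ σ₂)
      (b₂ : Injective _≡_ _≡_ τ₂) →
  weightOf (merge T σ₁ σ₂) (merge T τ₁ τ₂) (merge-injective T a₁ a₂) (merge-injective T b₁ b₂) ≡
  weightOf σ₁ τ₁ a₁ b₁ ✶ weightOf σ₂ τ₂ a₂ b₂
weightOf-merge T {σ₁} {τ₁} {σ₂} {τ₂} a₁ b₁ a₂ b₂ = cong₃ (mono 0)
  (trans (cong total (cycleType-merge T a₁ a₂)) (total-⊞ (cycleType σ₁ a₁) (cycleType σ₂ a₂)))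
  (trans (cong total (cycleType-merge T b₁ b₂)) (total-⊞ (cycleType τ₁ b₁) (cycleType τ₂ b₂)))
  (trans (cycleType-cong {f = merge T τ₁ τ₂ ∘ merge T σ₁ σ₂} {merge T (τ₁ ∘ σ₁) (τ₂ ∘ σ₂)}
            (λ e → merge-injective T a₁ a₂ (merge-injective T b₁ b₂ e))
            (merge-injective T (λ e → a₁ (b₁ e)) (λ e → a₂ (b₂ e))) (merge-∘ T τ₁ σ₁ τ₂ σ₂))
    (cycleType-merge T (λ e → a₁ (b₁ e)) (λ e → a₂ (b₂ e))))

module _ (d : ℕ) where

  private
    -- `S` stands for the orbit of `zero` without `zero` itself. The orbit is `true ∷ S`, hence the
    -- transitive pair acts on one point more than `S` has; this is the shift in `ℂ ∘ suc`.
    Glued : Perm (suc d) × Perm (suc d) → (S : Vec Bool d) →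
            Perm (#out S) × Perm (#out S) → Perm (suc (#in S)) × Perm (suc (#in S)) → Set
    Glued (σ , τ) S (σ₁ , τ₁) (σ₂ , τ₂) =
      decode σ ≗ merge (true ∷ S) (decode σ₁) (decode σ₂) × decode τ ≗ merge (true ∷ S) (decode τ₁)
          (decode τ₂)

    glued? : ∀ c S c₁ c₂ → Dec (Glued c S c₁ c₂)
    glued? c S c₁ c₂ = Fin.all? (λ _ → _ Fin.≟ _) ×-dec Fin.all? (λ _ → _ Fin.≟ _)

    glue-pairs : ∀ S c₁ c₂ → ∃ λ c → Glued c S c₁ c₂
    glue-pairs S (σ₁ , τ₁) (σ₂ , τ₂) = (proj₁ σ , proj₁ τ) , proj₂ σ , proj₂ τ
      where
      σ = encode (merge (true ∷ S) (decode σ₁) (decode σ₂))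
          (merge-injective (true ∷ S) (decode-injective σ₁) (decode-injective σ₂))
      τ = encode (merge (true ∷ S) (decode τ₁) (decode τ₂))
          (merge-injective (true ∷ S) (decode-injective τ₁) (decode-injective τ₂))

    monomial-glued : ∀ c S c₁ c₂ → Glued c S c₁ c₂ → monomial c ≡ monomial c₁ ✶ monomial c₂
    monomial-glued (σ , τ) S (σ₁ , τ₁) (σ₂ , τ₂) (p , q) = trans
      (weightOf-cong (decode-injective σ)
          (merge-injective (true ∷ S) (decode-injective σ₁) (decode-injective σ₂))
        (decode-injective τ) (merge-injective (true ∷ S) (decode-injective τ₁)
            (decode-injective τ₂)) p q)
      (weightOf-merge (true ∷ S) (decode-injective σ₁) (decode-injective τ₁) (decode-injective σ₂)
          (decode-injective τ₂))

    glued-one : ∀ S c₁ c₂ → Σ (pairs (suc d)) (λ c → ⟦ glued? c S c₁ c₂ ⟧) ≡ 1ℚ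
    glued-one S c₁ c₂ = let c , p , q = glue-pairs S c₁ c₂ in
      Σ-one (pairs-unique (suc d)) (∈-pairs c) (λ c → glued? c S c₁ c₂) (p , q)
        λ {c′} _ (p′ , q′) → cong₂ _,_ (decode-unique (proj₁ c′) (proj₁ c) λ x → trans (p′ x)
            (sym (p x)))
                                       (decode-unique (proj₂ c′) (proj₂ c) λ x → trans (q′ x)
                                           (sym (q x)))

    module Component (c : Perm (suc d) × Perm (suc d)) where
      σ τ : Fin (suc d) → Fin (suc d)
      σ = decode (proj₁ c)
      τ = decode (proj₂ c)

      S₀ : Vec Bool d
      S₀ = Vec.tabulate (λ x → does (orbit? σ τ zero (suc x)))

      T₀ : Vec Bool (suc d)
      T₀ = true ∷ S₀

      lookup-T₀ : ∀ x → lookup T₀ x ≡ does (orbit? σ τ zero x)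
      lookup-T₀ zero    = does-⇔ (mk⇔ id id) (yes ε) (orbit? σ τ zero zero)
      lookup-T₀ (suc x) = Vec.lookup∘tabulate _ x

      invariant : ∀ {x y} → Step σ τ x y → lookup T₀ y ≡ lookup T₀ x
      invariant {x} {y} xy = trans (lookup-T₀ y) (trans
        (does-⇔ (mk⇔ (λ o → o ◅◅ bwd xy ◅ ε) (λ o → o ◅◅ fwd xy ◅ ε)) (orbit? σ τ zero y)
            (orbit? σ τ zero x)) (sym (lookup-T₀ x)))

      restrict-σ = restrict T₀ σ (decode-injective (proj₁ c)) (λ x → invariant (σ-step x))
      restrict-τ = restrict T₀ τ (decode-injective (proj₂ c)) (λ x → invariant (τ-step x))

      σ₁ = proj₁ restrict-σ
      σ₂ = proj₁ (proj₂ restrict-σ)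
      τ₁ = proj₁ restrict-τ
      τ₂ = proj₁ (proj₂ restrict-τ)
      code-σ₁ = encode σ₁ (proj₁ (proj₂ (proj₂ restrict-σ)))
      code-σ₂ = encode σ₂ (proj₁ (proj₂ (proj₂ (proj₂ restrict-σ))))
      code-τ₁ = encode τ₁ (proj₁ (proj₂ (proj₂ restrict-τ)))
      code-τ₂ = encode τ₂ (proj₁ (proj₂ (proj₂ (proj₂ restrict-τ))))

      c₁⁰ : Perm (#out S₀) × Perm (#out S₀)
      c₁⁰ = proj₁ code-σ₁ , proj₁ code-τ₁

      c₂⁰ : Perm (suc (#in S₀)) × Perm (suc (#in S₀))
      c₂⁰ = proj₁ code-σ₂ , proj₁ code-τ₂

      merge-σ : merge T₀ σ₁ σ₂ ≗ σ
      merge-σ = proj₂ (proj₂ (proj₂ (proj₂ restrict-σ)))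

      merge-τ : merge T₀ τ₁ τ₂ ≗ τ
      merge-τ = proj₂ (proj₂ (proj₂ (proj₂ restrict-τ)))

      glued₀ : Glued c S₀ c₁⁰ c₂⁰
      glued₀ = (λ x → trans (sym (merge-σ x))
          (sym (merge-cong T₀ (proj₂ code-σ₁) (proj₂ code-σ₂) x)))
             , (λ x → trans (sym (merge-τ x))
                 (sym (merge-cong T₀ (proj₂ code-τ₁) (proj₂ code-τ₂) x)))

      transitive₀ : IsTransitive (decode (proj₁ c₂⁰)) (decode (proj₂ c₂⁰))
      transitive₀ j = orbit-cong (λ x → sym (proj₂ code-σ₂ x)) (λ x → sym (proj₂ code-τ₂ x))
        (orbit-merge⁻ T₀ σ₁ τ₁ σ₂ τ₂ {zero} {j}
            (orbit-cong (λ x → sym (merge-σ x)) (λ x → sym (merge-τ x))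
            (reach (glue T₀ (inj₂ j)) (lookup-in T₀ j))))
        where
        reach : ∀ x → lookup T₀ x ≡ true → Orbit σ τ zero x
        reach x e with orbit? σ τ zero x | trans (sym (lookup-T₀ x)) e
        ... | yes o | _  = o
        ... | no _  | ()

      -- As `true ∷ S` is invariant and contains `zero`, it contains the orbit of `zero`. As the
      -- pair on it is transitive, it is contained in that orbit.
      subset-unique : ∀ S c₁ c₂ → IsTransitive (decode (proj₁ c₂)) (decode (proj₂ c₂)) →
          Glued c S c₁ c₂ → S ≡ S₀
      subset-unique S c₁ c₂ trans₂ (p , q) = trans (sym (Vec.tabulate∘lookup S))
          (Vec.tabulate-cong λ x → go x)
        where
        T = true ∷ S
        f₁ = decode (proj₁ c₁)
        g₁ = decode (proj₂ c₁)
        f₂ = decode (proj₁ c₂)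
        g₂ = decode (proj₂ c₂)
        inv : ∀ {h₁ h₂ h} → h ≗ merge T h₁ h₂ → ∀ x → lookup T (h x) ≡ lookup T x
        inv {h₁} {h₂} e x = trans (cong (lookup T) (e x)) (lookup-merge T h₁ h₂ x)
        reach : ∀ z → lookup T z ≡ true → Orbit σ τ zero z
        reach z e = cases (split T z) (glue-split T z)
          where
          cases : ∀ y → glue T y ≡ z → Orbit σ τ zero z
          cases (inj₁ i) e′ = contradiction
              (trans (sym (lookup-out T i)) (trans (cong (lookup T) e′) e)) λ ()
          cases (inj₂ j) e′ = subst (Orbit σ τ zero) e′
              (orbit-cong (λ x → sym (p x)) (λ x → sym (q x))
            (orbit-merge⁺ T f₁ g₁ f₂ g₂ (trans₂ j)))
        go : ∀ x → lookup S x ≡ does (orbit? σ τ zero (suc x))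
        go x with orbit? σ τ zero (suc x)
        ... | yes o = sym (lookup-orbit T (inv p) (inv q) o)
        ... | no ¬o = Bool.¬-not λ e → ¬o (reach (suc x) e)

      pairs-unique₀ : ∀ c₁ c₂ → Glued c S₀ c₁ c₂ → c₁ ≡ c₁⁰ × c₂ ≡ c₂⁰
      pairs-unique₀ c₁ c₂ (p , q) =
          cong₂ _,_ (decode-unique (proj₁ c₁) (proj₁ c₁⁰) (merge-uniqueˡ T₀ pσ))
              (decode-unique (proj₂ c₁) (proj₂ c₁⁰) (merge-uniqueˡ T₀ pτ))
        , cong₂ _,_ (decode-unique (proj₁ c₂) (proj₁ c₂⁰) (merge-uniqueʳ T₀ pσ))
            (decode-unique (proj₂ c₂) (proj₂ c₂⁰) (merge-uniqueʳ T₀ pτ))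
        where
        pσ : merge T₀ (decode (proj₁ c₁)) (decode (proj₁ c₂)) ≗ merge T₀ (decode (proj₁ c₁⁰))
            (decode (proj₁ c₂⁰))
        pσ x = trans (sym (p x)) (proj₁ glued₀ x)
        pτ : merge T₀ (decode (proj₂ c₁)) (decode (proj₂ c₂)) ≗ merge T₀ (decode (proj₂ c₁⁰))
            (decode (proj₂ c₂⁰))
        pτ x = trans (sym (q x)) (proj₂ glued₀ x)

    -- The indicator of (S, c₁, c₂) being the decomposition of c. Its sum over decompositions is 1
    -- for every c; its sum over c is 1 for every triple whose second pair is transitive.
    weight₂ : ∀ c S c₁ c₂ → ℚ
    weight₂ c S c₁ c₂ = ⟦ transitivePair? c₂ ⟧ * ⟦ glued? c S c₁ c₂ ⟧

    decomposition-one : ∀ c → Σ (subsets d)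
        (λ S → Σ (pairs (#out S)) λ c₁ → Σ (pairs (suc (#in S))) λ c₂ → weight₂ c S c₁ c₂) ≡ 1ℚ
    decomposition-one c = begin
      Σ (subsets d) (λ S → Σ (pairs (#out S)) λ c₁ → Σ (pairs (suc (#in S))) λ c₂ →
          weight₂ c S c₁ c₂)
        ≡⟨ Σ-point (subsets-unique d) (∈-subsets S₀)
            (λ {S} _ S≢ → Σ-null (pairs (#out S)) λ {c₁} _ → Σ-null (pairs (suc (#in S))) λ {c₂} _ →
             trans (⟦⟧*-cong (transitivePair? c₂)
                 (λ t → ⟦⟧-no (glued? c S c₁ c₂) (S≢ ∘ subset-unique S c₁ c₂ t)))
                 (ℚ.*-zeroʳ ⟦ transitivePair? c₂ ⟧)) ⟩
      Σ (pairs (#out S₀)) (λ c₁ → Σ (pairs (suc (#in S₀))) λ c₂ → weight₂ c S₀ c₁ c₂)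
        ≡⟨ Σ-point (pairs-unique (#out S₀)) (∈-pairs c₁⁰)
            (λ {c₁} _ c₁≢ → Σ-null (pairs (suc (#in S₀))) λ {c₂} _ →
             not-glued c₁ c₂ (c₁≢ ∘ proj₁ ∘ pairs-unique₀ c₁ c₂)) ⟩
      Σ (pairs (suc (#in S₀))) (λ c₂ → weight₂ c S₀ c₁⁰ c₂)
        ≡⟨ Σ-point (pairs-unique (suc (#in S₀))) (∈-pairs c₂⁰)
            (λ {c₂} _ c₂≢ → not-glued c₁⁰ c₂ (c₂≢ ∘ proj₂ ∘ pairs-unique₀ c₁⁰ c₂)) ⟩
      weight₂ c S₀ c₁⁰ c₂⁰
        ≡⟨ trans (cong₂ _*_ (⟦⟧-yes (transitivePair? c₂⁰) transitive₀)
            (⟦⟧-yes (glued? c S₀ c₁⁰ c₂⁰) glued₀)) (ℚ.*-identityˡ 1ℚ) ⟩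
      1ℚ ∎
      where
      open ≡-Reasoning
      open Component c
      not-glued : ∀ c₁ c₂ → ¬ Glued c S₀ c₁ c₂ → weight₂ c S₀ c₁ c₂ ≡ 0ℚ
      not-glued c₁ c₂ n = trans (cong (⟦ transitivePair? c₂ ⟧ *_) (⟦⟧-no (glued? c S₀ c₁ c₂) n))
          (ℚ.*-zeroʳ ⟦ transitivePair? c₂ ⟧)

    Σ₃ : (f : ∀ S → Perm (#out S) × Perm (#out S) → Perm (suc (#in S)) × Perm (suc (#in S)) → ℚ) → ℚ
    Σ₃ f = Σ (subsets d) (λ S → Σ (pairs (#out S)) λ c₁ → Σ (pairs (suc (#in S))) λ c₂ → f S c₁ c₂)

    Σ₃-cong : ∀ {f g} → (∀ S c₁ c₂ → f S c₁ c₂ ≡ g S c₁ c₂) → Σ₃ f ≡ Σ₃ g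
    Σ₃-cong e = Σ-cong (subsets d) λ S → Σ-cong (pairs (#out S)) λ c₁ → Σ-cong
        (pairs (suc (#in S))) λ c₂ → e S c₁ c₂

    Σ₃-*ʳ : ∀ f x → Σ₃ (λ S c₁ c₂ → f S c₁ c₂ * x) ≡ Σ₃ f * x
    Σ₃-*ʳ f x = trans (Σ-cong (subsets d) λ S → trans
        (Σ-cong (pairs (#out S)) λ c₁ → Σ-*ʳ (pairs (suc (#in S))) x (f S c₁))
        (Σ-*ʳ (pairs (#out S)) x (λ c₁ → Σ (pairs (suc (#in S))) (f S c₁))))
      (Σ-*ʳ (subsets d) x (λ S → Σ (pairs (#out S)) λ c₁ → Σ (pairs (suc (#in S))) (f S c₁)))

    Σ₃-swap : ∀ {A : Set} (xs : List A)
        (f : A → ∀ S → Perm (#out S) × Perm (#out S) → Perm (suc (#in S)) × Perm (suc (#in S)) → ℚ)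
        →
              Σ xs (λ x → Σ₃ (f x)) ≡ Σ₃ (λ S c₁ c₂ → Σ xs λ x → f x S c₁ c₂)
    Σ₃-swap xs f = trans (Σ-swap xs (subsets d)
        (λ x S → Σ (pairs (#out S)) λ c₁ → Σ (pairs (suc (#in S))) λ c₂ → f x S c₁ c₂))
      (Σ-cong (subsets d) λ S → trans (Σ-swap xs (pairs (#out S))
          (λ x c₁ → Σ (pairs (suc (#in S))) λ c₂ → f x S c₁ c₂))
        (Σ-cong (pairs (#out S)) λ c₁ → Σ-swap xs (pairs (suc (#in S))) (λ x c₂ → f x S c₁ c₂)))

  -- Double counting with `weight₂`. The monomial of a pair is the product of the monomials of its
  -- parts, since cycle types of invariant parts add up.
  𝕎-components : 𝕎 (suc d) ≈ (𝕎 ⊛ (ℂ ∘ suc)) d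
  𝕎-components μ = begin
    Σ cs (λ c → δ (monomial c) μ)
      ≡⟨ (Σ-cong cs λ c → trans (sym (ℚ.*-identityˡ (δ (monomial c) μ)))
          (trans (cong (_* δ (monomial c) μ) (sym (decomposition-one c)))
           (sym (Σ₃-*ʳ (weight₂ c) (δ (monomial c) μ))))) ⟩
    Σ cs (λ c → Σ₃ λ S c₁ c₂ → weight₂ c S c₁ c₂ * δ (monomial c) μ)
      ≡⟨ Σ₃-swap cs (λ c S c₁ c₂ → weight₂ c S c₁ c₂ * δ (monomial c) μ) ⟩
    Σ₃ (λ S c₁ c₂ → Σ cs λ c → weight₂ c S c₁ c₂ * δ (monomial c) μ)
      ≡⟨ Σ₃-cong collect ⟩
    Σ₃ (λ S c₁ c₂ → ⟦ transitivePair? c₂ ⟧ * δ (monomial c₁ ✶ monomial c₂) μ)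
      ≡⟨ (Σ-cong (subsets d) λ S → 𝕎⊗ℂ (#out S) (suc (#in S)) μ) ⟨
    Σ (subsets d) (λ S → (𝕎 (#out S) ⊗ ℂ (suc (#in S))) μ)
      ≡⟨ ⊛-subsets 𝕎 (ℂ ∘ suc) d μ ⟨
    (𝕎 ⊛ (ℂ ∘ suc)) d μ ∎
    where
    open ≡-Reasoning
    cs = pairs (suc d)
    collect : ∀ S c₁ c₂ → Σ cs (λ c → weight₂ c S c₁ c₂ * δ (monomial c) μ)
        ≡ ⟦ transitivePair? c₂ ⟧ * δ (monomial c₁ ✶ monomial c₂) μ
    collect S c₁ c₂ = begin
      Σ cs (λ c → (t * ⟦ glued? c S c₁ c₂ ⟧) * δ (monomial c) μ)
        ≡⟨ (Σ-cong cs λ c → trans (ℚ.*-assoc t ⟦ glued? c S c₁ c₂ ⟧ (δ (monomial c) μ)) (cong (t *_)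
             (⟦⟧*-cong (glued? c S c₁ c₂) λ g → cong (λ ξ → δ ξ μ) (monomial-glued c S c₁ c₂ g)))) ⟩
      Σ cs (λ c → t * (⟦ glued? c S c₁ c₂ ⟧ * D))
        ≡⟨ trans (Σ-*ˡ cs t (λ c → ⟦ glued? c S c₁ c₂ ⟧ * D))
            (cong (t *_) (Σ-*ʳ cs D (λ c → ⟦ glued? c S c₁ c₂ ⟧))) ⟩
      t * (Σ cs (λ c → ⟦ glued? c S c₁ c₂ ⟧) * D)
        ≡⟨ cong (λ x → t * (x * D)) (glued-one S c₁ c₂) ⟩
      t * (1ℚ * D)
        ≡⟨ cong (t *_) (ℚ.*-identityˡ D) ⟩
      t * D ∎
      where
      t D : ℚ
      t = ⟦ transitivePair? c₂ ⟧
      D = δ (monomial c₁ ✶ monomial c₂) μ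

∂s-Ê𝕎 : ∂ s (Ê 𝕎) ≈ Ê 𝕎 ⊗ ∂ s (Ê ℂ)
∂s-Ê𝕎 = ≈-trans (∂s-Ê 𝕎) (≈-trans (Ê-cong 𝕎-components)
  (≈-trans (Ê-⊛ 𝕎 (ℂ ∘ suc)) (⊗-cong (≈-refl {Ê 𝕎}) (≈-sym (∂s-Ê ℂ)))))

-- Isomorphisms of coloured graphs and invariance of the type

module _ {m n} {f : Fin m → Fin n} (bij : Bijective _≡_ _≡_ f) where

  inverse : Fin n → Fin m
  inverse y = proj₁ (proj₂ bij y)

  inverseʳ : ∀ y → f (inverse y) ≡ y
  inverseʳ y = proj₂ (proj₂ bij y) refl

  inverseˡ : ∀ x → inverse (f x) ≡ x
  inverseˡ x = proj₁ bij (inverseʳ (f x))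

  inverse-bijective : Bijective _≡_ _≡_ inverse
  inverse-bijective = (λ {x} {y} e → trans (sym (inverseʳ x)) (trans (cong f e) (inverseʳ y)))
                    , λ x → f x , λ { refl → inverseˡ x }

  Σ-bijection : (g : Fin n → ℚ) → Σ (allFin m) (g ∘ f) ≡ Σ (allFin n) g
  Σ-bijection g = Σ-match (allFin m) (allFin n) {M = λ x y → f x ≡ y} (λ x y → f x Fin.≟ y)
    (λ {x} _ → Σ-one (Unique.allFin⁺ n) (∈-allFin (f x)) (f x Fin.≟_) refl λ _ → sym)
    (λ {y} _ → Σ-one (Unique.allFin⁺ m) (∈-allFin (inverse y)) (λ x → f x Fin.≟ y) (inverseʳ y)
      λ {x} _ e → trans (sym (inverseˡ x)) (cong inverse e))
    {g ∘ f} {g} λ { _ _ refl → refl }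

bijective-∘ : ∀ {l m n} {f : Fin m → Fin n} {g : Fin l → Fin m} →
              Bijective _≡_ _≡_ f → Bijective _≡_ _≡_ g → Bijective _≡_ _≡_ (f ∘ g)
bijective-∘ {f = f} {g} f-bij g-bij = (λ e → proj₁ g-bij (proj₁ f-bij e))
  , λ y → inverse g-bij (inverse f-bij y)
        , λ { refl → trans (cong f (inverseʳ g-bij (inverse f-bij y))) (inverseʳ f-bij y) }

injective⇒bijective : ∀ {d} {f : Fin d → Fin d} → Injective _≡_ _≡_ f → Bijective _≡_ _≡_ f
injective⇒bijective inj = inj , λ y → let x , e = injective⇒surjective inj y in x , λ { refl → e }

bijective-cong : ∀ {m n} {f g : Fin m → Fin n} → f ≗ g → Bijective _≡_ _≡_ f → Bijective _≡_ _≡_ g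
bijective-cong p (inj , sur) = (λ {x} {y} q → inj (trans (p x) (trans q (sym (p y)))))
                             , λ y → proj₁ (sur y) , λ
                                 { refl → trans (sym (p _)) (proj₂ (sur y) refl) }

≅-sym : ∀ {Γ Δ} → Γ ≅ Δ → Δ ≅ Γ
≅-sym {Γ} {Δ} (f , g , h , isIso a b c p q r) =
  inverse a , inverse b , inverse c , isIso (inverse-bijective a) (inverse-bijective b)
      (inverse-bijective c)
    (λ e → trans (sym (p (inverse c e))) (cong (colour Δ) (inverseʳ c e)))
    (λ e → trans (sym (inverseˡ a (white Γ (inverse c e))))
        (cong (inverse a) (trans (sym (q (inverse c e))) (cong (white Δ) (inverseʳ c e)))))
    (λ e → trans (sym (inverseˡ b (black Γ (inverse c e))))
        (cong (inverse b) (trans (sym (r (inverse c e))) (cong (black Δ) (inverseʳ c e)))))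

isIso-∘ : ∀ {Γ Δ Θ f g h f′ g′ h′} → IsIsomorphism Δ Θ f′ g′ h′ → IsIsomorphism Γ Δ f g h →
          IsIsomorphism Γ Θ (f′ ∘ f) (g′ ∘ g) (h′ ∘ h)
isIso-∘ {f = f} {g} {h} {f′} {g′} (isIso a′ b′ c′ p′ q′ r′) (isIso a b c p q r) = isIso
  (bijective-∘ a′ a) (bijective-∘ b′ b) (bijective-∘ c′ c)
  (λ e → trans (p′ (h e)) (p e))
  (λ e → trans (q′ (h e)) (cong f′ (q e)))
  (λ e → trans (r′ (h e)) (cong g′ (r e)))

isIso-cong : ∀ {Γ Δ f g h f′ g′ h′} → f ≗ f′ → g ≗ g′ → h ≗ h′ → IsIsomorphism Γ Δ f g h →
  IsIsomorphism Γ Δ f′ g′ h′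
isIso-cong {Γ} {Δ} F≗ G≗ H≗ (isIso a b c p q r) = isIso
  (bijective-cong F≗ a) (bijective-cong G≗ b) (bijective-cong H≗ c)
  (λ e → trans (cong (colour Δ) (sym (H≗ e))) (p e))
  (λ e → trans (cong (white Δ) (sym (H≗ e))) (trans (q e) (F≗ _)))
  (λ e → trans (cong (black Δ) (sym (H≗ e))) (trans (r e) (G≗ _)))

≅-trans : ∀ {Γ Δ Θ} → Γ ≅ Δ → Δ ≅ Θ → Γ ≅ Θ
≅-trans {Γ} {Δ} {Θ} (f , g , h , i) (f′ , g′ , h′ , i′) =
  f′ ∘ f , g′ ∘ g , h′ ∘ h , isIso-∘ {Γ} {Δ} {Θ} i′ i

module _ (Γ : ColouredGraph) where

  linked-sym : ∀ cs {x y} → Linked Γ cs x y → Linked Γ cs y x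
  linked-sym cs = EqClosure.symmetric (Adjacent Γ cs)

  linked-trans : ∀ cs {x y z} → Linked Γ cs x y → Linked Γ cs y z → Linked Γ cs x z
  linked-trans cs = EqClosure.transitive (Adjacent Γ cs)


  cycles-one : ∀ c c′ x → Σ (cycles Γ c c′) (λ r → ⟦ linked? Γ (c ∷ c′ ∷ []) r x ⟧) ≡ 1ℚ
  cycles-one c c′ x = Σ-deduplicate (linked? Γ (c ∷ c′ ∷ [])) (linked-sym (c ∷ c′ ∷ []))
      (linked-trans (c ∷ c′ ∷ []))
    {vertices Γ} {x} (Any.map (λ { refl → EqClosure.reflexive (Adjacent Γ (c ∷ c′ ∷ [])) })
        (∈-vertices Γ x))

  fromℕ-cycleLength : ∀ c c′ x → fromℕ (cycleLength Γ c c′ x) ≡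
    Σ (allFin (#edge Γ)) (λ e → ⟦ _∈?_ Γ (colour Γ e) (c ∷ c′ ∷ []) ⟧ * ⟦ linked? Γ (c ∷ c′ ∷ []) x
        (inj₁ (white Γ e)) ⟧)
  fromℕ-cycleLength c c′ x = trans
    (fromℕ-count (λ e → _∈?_ Γ (colour Γ e) (c ∷ c′ ∷ []) ×-dec linked? Γ (c ∷ c′ ∷ []) x
        (inj₁ (white Γ e))) (allFin (#edge Γ)))
    (Σ-cong (allFin (#edge Γ)) λ e → ⟦⟧-× (_∈?_ Γ (colour Γ e) (c ∷ c′ ∷ []))
        (linked? Γ (c ∷ c′ ∷ []) x (inj₁ (white Γ e))))

  cycleLength-linked : ∀ c c′ {x y} → Linked Γ (c ∷ c′ ∷ []) x y → cycleLength Γ c c′ x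
      ≡ cycleLength Γ c c′ y
  cycleLength-linked c c′ {x} {y} xy = fromℕ-injective (trans (fromℕ-cycleLength c c′ x)
    (trans (Σ-cong (allFin (#edge Γ)) λ e → cong (⟦ _∈?_ Γ (colour Γ e) (c ∷ c′ ∷ []) ⟧ *_)
      (⟦⟧-cong (linked? Γ (c ∷ c′ ∷ []) x (inj₁ (white Γ e)))
          (linked? Γ (c ∷ c′ ∷ []) y (inj₁ (white Γ e)))
        (linked-trans (c ∷ c′ ∷ []) (linked-sym (c ∷ c′ ∷ []) xy)) (linked-trans (c ∷ c′ ∷ []) xy)))
      (sym (fromℕ-cycleLength c c′ y))))

  fromℕ-#cyclesOfLength : ∀ c c′ n → fromℕ (#cyclesOfLength Γ c c′ n) ≡ Σ (cycles Γ c c′)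
      (λ r → ⟦ cycleLength Γ c c′ r ℕ.≟ n ⟧)
  fromℕ-#cyclesOfLength c c′ n = fromℕ-count (λ r → cycleLength Γ c c′ r ℕ.≟ n) (cycles Γ c c′)

module _ {Γ Δ : ColouredGraph} {f g h} (iso : IsIsomorphism Γ Δ f g h) where

  private
    open IsIsomorphism iso

    φ : Vertex Γ → Vertex Δ
    φ = Sum.map f g

    linked-φ⁺ : ∀ cs {x y} → Linked Γ cs x y → Linked Δ cs (φ x) (φ y)
    linked-φ⁺ cs = EqClosure.gmap φ step
      where
      step : ∀ {x y} → Adjacent Γ cs x y → Adjacent Δ cs (φ x) (φ y)
      step (edge e c∈) = subst (λ w → Adjacent Δ cs (inj₁ w) (inj₂ (g (black Γ e))))
          (white-preserved e)
        (subst (λ b → Adjacent Δ cs (inj₁ (white Δ (h e))) (inj₂ b)) (black-preserved e)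
          (edge (h e) (subst (_∈ cs) (sym (colour-preserved e)) c∈)))

    φ⁻¹ : Vertex Δ → Vertex Γ
    φ⁻¹ = Sum.map (inverse white-bijective) (inverse black-bijective)

    φ-φ⁻¹ : ∀ y → φ (φ⁻¹ y) ≡ y
    φ-φ⁻¹ (inj₁ w) = cong inj₁ (inverseʳ white-bijective w)
    φ-φ⁻¹ (inj₂ b) = cong inj₂ (inverseʳ black-bijective b)

    φ⁻¹-φ : ∀ x → φ⁻¹ (φ x) ≡ x
    φ⁻¹-φ (inj₁ w) = cong inj₁ (inverseˡ white-bijective w)
    φ⁻¹-φ (inj₂ b) = cong inj₂ (inverseˡ black-bijective b)

    linked-φ⁻ : ∀ cs {x y} → Linked Δ cs (φ x) (φ y) → Linked Γ cs x y
    linked-φ⁻ cs {x} {y} o = subst (λ x → Linked Γ cs x y) (φ⁻¹-φ x)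
        (subst (Linked Γ cs (φ⁻¹ (φ x))) (φ⁻¹-φ y) (EqClosure.gmap φ⁻¹ step o))
      where
      step : ∀ {x y} → Adjacent Δ cs x y → Adjacent Γ cs (φ⁻¹ x) (φ⁻¹ y)
      step (edge e c∈) = subst (λ w → Adjacent Γ cs (inj₁ w)
          (inj₂ (inverse black-bijective (black Δ e)))) white≡
        (subst (λ b → Adjacent Γ cs (inj₁ (white Γ e′)) (inj₂ b)) black≡
          (edge e′ (subst (_∈ cs) (trans (cong (colour Δ) (sym (inverseʳ edge-bijective e)))
              (colour-preserved e′)) c∈)))
        where
        e′ = inverse edge-bijective e
        white≡ : white Γ e′ ≡ inverse white-bijective (white Δ e)
        white≡ = trans (sym (inverseˡ white-bijective (white Γ e′))) (cong (inverse white-bijective)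
          (trans (sym (white-preserved e′)) (cong (white Δ) (inverseʳ edge-bijective e))))
        black≡ : black Γ e′ ≡ inverse black-bijective (black Δ e)
        black≡ = trans (sym (inverseˡ black-bijective (black Γ e′))) (cong (inverse black-bijective)
          (trans (sym (black-preserved e′)) (cong (black Δ) (inverseʳ edge-bijective e))))

    Σ-edges : (k : Fin (#edge Δ) → ℚ) → Σ (allFin (#edge Γ)) (k ∘ h) ≡ Σ (allFin (#edge Δ)) k
    Σ-edges = Σ-bijection edge-bijective

    cycleLength-φ : ∀ c c′ x → cycleLength Γ c c′ x ≡ cycleLength Δ c c′ (φ x)
    cycleLength-φ c c′ x = fromℕ-injective (begin
      fromℕ (cycleLength Γ c c′ x)
        ≡⟨ fromℕ-cycleLength Γ c c′ x ⟩
      Σ (allFin (#edge Γ)) (λ e → ⟦ _∈?_ Γ (colour Γ e) cs ⟧ * ⟦ linked? Γ cs x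
          (inj₁ (white Γ e)) ⟧)
        ≡⟨ (Σ-cong (allFin (#edge Γ)) λ e → cong₂ _*_
             (⟦⟧-cong (_∈?_ Γ (colour Γ e) cs) (_∈?_ Δ (colour Δ (h e)) cs)
                 (subst (_∈ cs) (sym (colour-preserved e))) (subst (_∈ cs) (colour-preserved e)))
             (⟦⟧-cong (linked? Γ cs x (inj₁ (white Γ e)))
                 (linked? Δ cs (φ x) (inj₁ (white Δ (h e))))
               (λ o → subst (λ w → Linked Δ cs (φ x) (inj₁ w)) (sym (white-preserved e))
                   (linked-φ⁺ cs o))
               (λ o → linked-φ⁻ cs (subst (λ w → Linked Δ cs (φ x) (inj₁ w))
                   (white-preserved e) o)))) ⟩
      Σ (allFin (#edge Γ)) (λ e → ⟦ _∈?_ Δ (colour Δ (h e)) cs ⟧ * ⟦ linked? Δ cs (φ x)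
          (inj₁ (white Δ (h e))) ⟧)
        ≡⟨ Σ-edges (λ e → ⟦ _∈?_ Δ (colour Δ e) cs ⟧ * ⟦ linked? Δ cs (φ x) (inj₁ (white Δ e)) ⟧) ⟩
      Σ (allFin (#edge Δ)) (λ e → ⟦ _∈?_ Δ (colour Δ e) cs ⟧ * ⟦ linked? Δ cs (φ x)
          (inj₁ (white Δ e)) ⟧)
        ≡⟨ fromℕ-cycleLength Δ c c′ (φ x) ⟨
      fromℕ (cycleLength Δ c c′ (φ x)) ∎)
      where
      open ≡-Reasoning
      cs = c ∷ c′ ∷ []

    -- The representatives chosen in the two graphs need not correspond under `φ`. They are matched
    -- when they lie on corresponding cycles, which pairs each of them with exactly one on the other
    -- side.
    Σ-cycles : ∀ c c′ (k : Vertex Γ → ℚ) (k′ : Vertex Δ → ℚ) →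
               (∀ {r r′} → Linked Δ (c ∷ c′ ∷ []) r′ (φ r) → k r ≡ k′ r′) → Σ (cycles Γ c c′) k ≡ Σ
                   (cycles Δ c c′) k′
    Σ-cycles c c′ k k′ e = Σ-match (cycles Γ c c′) (cycles Δ c c′) {λ r r′ → Linked Δ cs r′ (φ r)}
        (λ r r′ → linked? Δ cs r′ (φ r))
      (λ {r} _ → cycles-one Δ c c′ (φ r))
      (λ {r′} _ → trans (Σ-cong (cycles Γ c c′) λ r → ⟦⟧-cong (linked? Δ cs r′ (φ r))
          (linked? Γ cs r (φ⁻¹ r′))
          (λ o → linked-sym Γ cs (linked-φ⁻ cs
              (subst (λ z → Linked Δ cs z (φ r)) (sym (φ-φ⁻¹ r′)) o)))
          (λ o → subst (λ z → Linked Δ cs z (φ r)) (φ-φ⁻¹ r′) (linked-φ⁺ cs (linked-sym Γ cs o))))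
        (cycles-one Γ c c′ (φ⁻¹ r′)))
      {k} {k′} (λ _ _ → e)
      where cs = c ∷ c′ ∷ []

    #cycles-iso : ∀ c c′ → length (cycles Γ c c′) ≡ length (cycles Δ c c′)
    #cycles-iso c c′ = fromℕ-injective (trans (fromℕ-length (cycles Γ c c′))
      (trans (Σ-cycles c c′ (λ _ → 1ℚ) (λ _ → 1ℚ) (λ _ → refl))
          (sym (fromℕ-length (cycles Δ c c′)))))

    #cyclesOfLength-iso : ∀ c c′ n → #cyclesOfLength Γ c c′ n ≡ #cyclesOfLength Δ c c′ n
    #cyclesOfLength-iso c c′ n = fromℕ-injective (trans (fromℕ-#cyclesOfLength Γ c c′ n)
      (trans (Σ-cycles c c′ (λ r → ⟦ cycleLength Γ c c′ r ℕ.≟ n ⟧)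
          (λ r → ⟦ cycleLength Δ c c′ r ℕ.≟ n ⟧)
          (λ {r} {r′} o → cong (λ l → ⟦ l ℕ.≟ n ⟧)
              (trans (cycleLength-φ c c′ r) (sym (cycleLength-linked Δ c c′ o)))))
        (sym (fromℕ-#cyclesOfLength Δ c c′ n))))

  degree-iso : degree Γ ≡ degree Δ
  degree-iso = fromℕ-injective (trans (fromℕ-count (λ e → colour Γ e ≟ᶜ green) (allFin (#edge Γ)))
    (trans (Σ-cong (allFin (#edge Γ)) λ e → cong (λ c → ⟦ c ≟ᶜ green ⟧) (sym (colour-preserved e)))
      (trans (Σ-edges (λ e → ⟦ colour Δ e ≟ᶜ green ⟧))
          (sym (fromℕ-count (λ e → colour Δ e ≟ᶜ green) (allFin (#edge Δ)))))))

  type-iso : type Γ ≡ type Δ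
  type-iso = cong₂ _,_ (#cycles-iso red green) (cong₂ _,_ (#cycles-iso green blue)
    (trans (tabulate-cong (degree Γ) λ i → #cyclesOfLength-iso red blue (2 ℕ.* suc i))
      (cong (λ d → tabulate d (λ i → #cyclesOfLength Δ red blue (2 ℕ.* suc i))) degree-iso)))
    where
    tabulate-cong : ∀ n {a b : ℕ → ℕ} → (∀ i → a i ≡ b i) → tabulate n a ≡ tabulate n b
    tabulate-cong zero    e = refl
    tabulate-cong (suc n) e = cong₂ _◂_ (e 0) (tabulate-cong n (e ∘ suc))

  connected-iso : Connected Δ → Connected Γ
  connected-iso (x , all) = φ⁻¹ x , λ y z → linked-φ⁻ colours (all (φ y) (φ z))

-- The graph of a pair of permutations

private
  code : EdgeColour → Fin 3
  code blue  = zero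
  code green = suc zero
  code red   = suc (suc zero)

  uncode : Fin 3 → EdgeColour
  uncode zero             = blue
  uncode (suc zero)       = green
  uncode (suc (suc zero)) = red

  uncode-code : ∀ c → uncode (code c) ≡ c
  uncode-code blue  = refl
  uncode-code green = refl
  uncode-code red   = refl

  code-uncode : ∀ i → code (uncode i) ≡ i
  code-uncode zero             = refl
  code-uncode (suc zero)       = refl
  code-uncode (suc (suc zero)) = refl

module _ {d : ℕ} where

  edgeOf : EdgeColour → Fin d → Fin (3 ℕ.* d)
  edgeOf c i = Fin.combine (code c) i

  colourOf : Fin (3 ℕ.* d) → EdgeColour
  colourOf e = uncode (proj₁ (Fin.remQuot {3} d e))

  indexOf : Fin (3 ℕ.* d) → Fin d
  indexOf e = proj₂ (Fin.remQuot {3} d e)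

  colourOf-edgeOf : ∀ c i → colourOf (edgeOf c i) ≡ c
  colourOf-edgeOf c i = trans (cong (uncode ∘ proj₁) (Fin.remQuot-combine (code c) i))
      (uncode-code c)

  indexOf-edgeOf : ∀ c i → indexOf (edgeOf c i) ≡ i
  indexOf-edgeOf c i = cong proj₂ (Fin.remQuot-combine (code c) i)

  edgeOf-colourOf : ∀ e → edgeOf (colourOf e) (indexOf e) ≡ e
  edgeOf-colourOf e = trans (cong (λ c → Fin.combine c (indexOf e))
      (code-uncode (proj₁ (Fin.remQuot {3} d e)))) (Fin.combine-remQuot {3} d e)

-- The dessin of a pair of permutations, with one green edge i — i, one red edge i — σ i
-- and one blue edge τ i — i for each i (white end first).

module _ {d : ℕ} (σ τ : Fin d → Fin d) where

  whiteEnd blackEnd : EdgeColour → Fin d → Fin d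
  whiteEnd blue  i = τ i
  whiteEnd green i = i
  whiteEnd red   i = i
  blackEnd blue  i = i
  blackEnd green i = i
  blackEnd red   i = σ i

  graph : ColouredGraph
  graph = coloured d d (3 ℕ.* d)
    (colourOf {d} , (λ e → whiteEnd (colourOf {d} e) (indexOf {d} e)) ,
        (λ e → blackEnd (colourOf {d} e) (indexOf {d} e)))

  white-edgeOf : ∀ c i → white graph (edgeOf c i) ≡ whiteEnd c i
  white-edgeOf c i = cong₂ whiteEnd {colourOf {d} (edgeOf c i)} {c} {indexOf {d} (edgeOf c i)} {i}
      (colourOf-edgeOf c i) (indexOf-edgeOf c i)

  black-edgeOf : ∀ c i → black graph (edgeOf c i) ≡ blackEnd c i
  black-edgeOf c i = cong₂ blackEnd {colourOf {d} (edgeOf c i)} {c} {indexOf {d} (edgeOf c i)} {i}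
      (colourOf-edgeOf c i) (indexOf-edgeOf c i)

  adjacent : ∀ {cs} c i → c ∈ cs → Adjacent graph cs (inj₁ (whiteEnd c i)) (inj₂ (blackEnd c i))
  adjacent {cs} c i c∈ = subst (λ w → Adjacent graph cs (inj₁ w) (inj₂ (blackEnd c i)))
      (white-edgeOf c i)
    (subst (λ b → Adjacent graph cs (inj₁ (white graph (edgeOf c i))) (inj₂ b)) (black-edgeOf c i)
      (edge (edgeOf c i) (subst (_∈ cs) (sym (colourOf-edgeOf c i)) c∈)))

  -- Linkage is the equivalence generated by the edges, so an invariant of it needs checking only
  -- for the edges of each colour. The map `p` sends black vertices to points along edges of a
  -- suitable colour.
  linked-fold : ∀ {cs} {_∼_ : Fin d → Fin d → Set} → IsEquivalence _∼_ →
      (p : Vertex graph → Fin d) →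
                (∀ c i → c ∈ cs → p (inj₁ (whiteEnd c i)) ∼ p (inj₂ (blackEnd c i))) →
                ∀ {x y} → Linked graph cs x y → p x ∼ p y
  linked-fold eq p step = EqClosure.gfold eq p
      λ { (edge e c∈) → step (colourOf {d} e) (indexOf {d} e) c∈ }

  whiteEnd-injective : Injective _≡_ _≡_ τ → ∀ c → Injective _≡_ _≡_ (whiteEnd c)
  whiteEnd-injective τ-inj blue  = τ-inj
  whiteEnd-injective τ-inj green = id
  whiteEnd-injective τ-inj red   = id

  blackEnd-injective : Injective _≡_ _≡_ σ → ∀ c → Injective _≡_ _≡_ (blackEnd c)
  blackEnd-injective σ-inj blue  = id
  blackEnd-injective σ-inj green = id
  blackEnd-injective σ-inj red   = σ-inj

  Σ-edgeOf : (g : Fin (3 ℕ.* d) → ℚ) → Σ (allFin (3 ℕ.* d)) g ≡ Σ colours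
      (λ c → Σ (allFin d) λ i → g (edgeOf c i))
  Σ-edgeOf g = begin
    Σ (allFin (3 ℕ.* d)) g
      ≡⟨ (Σ-cong (allFin (3 ℕ.* d)) λ e → trans (sym (ℚ.*-identityˡ (g e)))
          (trans (cong (_* g e) (sym (one-edge e)))
           (trans (sym (Σ-*ʳ colours (g e) (λ c → Σ (allFin d) λ i → ⟦ edgeOf c i Fin.≟ e ⟧)))
             (Σ-cong colours λ c → sym (Σ-*ʳ (allFin d) (g e) (λ i → ⟦ edgeOf c i Fin.≟ e ⟧)))))) ⟩
    Σ (allFin (3 ℕ.* d)) (λ e → Σ colours λ c → Σ (allFin d) λ i → ⟦ edgeOf c i Fin.≟ e ⟧ * g e)
      ≡⟨ trans (Σ-swap (allFin (3 ℕ.* d)) colours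
          (λ e c → Σ (allFin d) λ i → ⟦ edgeOf c i Fin.≟ e ⟧ * g e))
           (Σ-cong colours λ c → Σ-swap (allFin (3 ℕ.* d)) (allFin d)
               (λ e i → ⟦ edgeOf c i Fin.≟ e ⟧ * g e)) ⟩
    Σ colours (λ c → Σ (allFin d) λ i → Σ (allFin (3 ℕ.* d)) λ e → ⟦ edgeOf c i Fin.≟ e ⟧ * g e)
      ≡⟨ (Σ-cong colours λ c → Σ-cong (allFin d) λ i →
           Σ-indicator (Unique.allFin⁺ (3 ℕ.* d)) (∈-allFin (edgeOf c i)) (edgeOf c i Fin.≟_) refl
               (λ _ → sym) g) ⟩
    Σ colours (λ c → Σ (allFin d) λ i → g (edgeOf c i)) ∎
    where
    open ≡-Reasoning
    colours-unique : Unique colours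
    colours-unique = ((λ ()) ∷ (λ ()) ∷ []) ∷ ((λ ()) ∷ []) ∷ [] ∷ []
    one-edge : ∀ e → Σ colours (λ c → Σ (allFin d) λ i → ⟦ edgeOf c i Fin.≟ e ⟧) ≡ 1ℚ
    one-edge e = trans (Σ-point colours-unique (∈-colours (colourOf {d} e))
        (λ {c} _ c≢ → Σ-null (allFin d) λ {i} _ →
        ⟦⟧-no (edgeOf c i Fin.≟ e) λ { refl → c≢ (sym (colourOf-edgeOf c i)) }))
      (Σ-one (Unique.allFin⁺ d) (∈-allFin (indexOf {d} e)) (λ i → edgeOf (colourOf {d} e) i Fin.≟ e)
          (edgeOf-colourOf {d} e)
        λ {i} _ q → trans (sym (indexOf-edgeOf (colourOf {d} e) i)) (cong (indexOf {d}) q))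

  -- The c–c′ cycles of the graph are the cycles of a permutation f of the white vertices.

  module Cycles (τ-inj : Injective _≡_ _≡_ τ) {c c′ : EdgeColour} (c≢c′ : c ≢ c′)
                {f : Fin d → Fin d} (f-inj : Injective _≡_ _≡_ f)
                (linked⇒same : ∀ {x y} → Linked graph (c ∷ c′ ∷ []) (inj₁ x) (inj₁ y) → Same f x y)
                (same⇒linked : ∀ {x y} → Same f x y → Linked graph (c ∷ c′ ∷ []) (inj₁ x) (inj₁ y))
                (toWhite : ∀ j → ∃ λ i → Linked graph (c ∷ c′ ∷ []) (inj₂ j) (inj₁ i)) where

    private
      cs : List EdgeColour
      cs = c ∷ c′ ∷ []

      V : List (Fin d)
      V = allFin d

      L : Vertex graph → Fin d → ℚ
      L r x = ⟦ linked? graph cs r (inj₁ x) ⟧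

      reps : List (Vertex graph)
      reps = cycles graph c c′

      whiteOf : ∀ r → ∃ λ x → Linked graph cs r (inj₁ x)
      whiteOf (inj₁ x) = x , ε
      whiteOf (inj₂ j) = toWhite j

      Σ-linked : ∀ r → Σ V (L r) ≡ fromℕ (suc (per f f-inj (proj₁ (whiteOf r))))
      Σ-linked r = let x , rx = whiteOf r in trans
        (Σ-cong V λ y → ⟦⟧-cong (linked? graph cs r (inj₁ y)) (same? f-inj x y)
          (λ ry → linked⇒same (linked-trans graph cs (linked-sym graph cs rx) ry))
          (λ xy → linked-trans graph cs rx (same⇒linked xy)))
        (Σ-same-one f-inj x)

      opaque
        -- An opaque copy of the cycle length, so that the comparisons with `2 ℕ.* suc i` below do
        -- not unfold the decision procedure for linkage.
        len : Vertex graph → ℕ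
        len = cycleLength graph c c′

        len≡ : ∀ r → len r ≡ cycleLength graph c c′ r
        len≡ r = refl

      Σ-colour : ∀ r k → Σ V (λ i → ⟦ _∈?_ graph (colourOf {d} (edgeOf k i)) cs ⟧ * L r
          (white graph (edgeOf k i))) ≡
                         ⟦ _∈?_ graph k cs ⟧ * Σ V (L r)
      Σ-colour r k = trans (Σ-cong V λ i → cong₂
          (λ k x → ⟦ _∈?_ graph k cs ⟧ * L r x) {colourOf {d} (edgeOf k i)} {k}
          {white graph (edgeOf k i)} {whiteEnd k i} (colourOf-edgeOf k i) (white-edgeOf k i))
        (trans (Σ-*ˡ V ⟦ _∈?_ graph k cs ⟧ (λ i → L r (whiteEnd k i)))
          (cong (⟦ _∈?_ graph k cs ⟧ *_) (sym (Σ-reindex (whiteEnd-injective τ-inj k) (L r)))))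

      two-colours : Σ colours (λ k → ⟦ _∈?_ graph k cs ⟧) ≡ fromℕ 2
      two-colours = go c c′ c≢c′
        where
        yes′ : ∀ {k k₁ k₂} → k ∈ k₁ ∷ k₂ ∷ [] → ⟦ _∈?_ graph k (k₁ ∷ k₂ ∷ []) ⟧ ≡ 1ℚ
        yes′ {k} {k₁} {k₂} = ⟦⟧-yes (_∈?_ graph k (k₁ ∷ k₂ ∷ []))
        no′ : ∀ {k k₁ k₂} → k ≢ k₁ → k ≢ k₂ → ⟦ _∈?_ graph k (k₁ ∷ k₂ ∷ []) ⟧ ≡ 0ℚ
        no′ {k} {k₁} {k₂} p q = ⟦⟧-no (_∈?_ graph k (k₁ ∷ k₂ ∷ []))
            λ { (here e) → p e ; (there (here e)) → q e }
        three : ∀ {a b c a′ b′ c′ : ℚ} → a ≡ a′ → b ≡ b′ → c ≡ c′ → a + (b + (c + 0ℚ)) ≡ a′ +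
            (b′ + (c′ + 0ℚ))
        three refl refl refl = refl
        1st : ∀ {k k₂ : EdgeColour} → k ∈ k ∷ k₂ ∷ []
        1st = here refl
        2nd : ∀ {k k₁ : EdgeColour} → k ∈ k₁ ∷ k ∷ []
        2nd = there (here refl)
        go : ∀ k₁ k₂ → k₁ ≢ k₂ → Σ colours (λ k → ⟦ _∈?_ graph k (k₁ ∷ k₂ ∷ []) ⟧) ≡ fromℕ 2
        go blue  blue  n = contradiction refl n
        go green green n = contradiction refl n
        go red   red   n = contradiction refl n
        go blue  green _ = three (yes′ 1st) (yes′ 2nd) (no′ (λ ()) (λ ()))
        go blue  red   _ = three (yes′ 1st) (no′ (λ ()) (λ ())) (yes′ 2nd)
        go green blue  _ = three (yes′ 2nd) (yes′ 1st) (no′ (λ ()) (λ ()))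
        go green red   _ = three (no′ (λ ()) (λ ())) (yes′ 1st) (yes′ 2nd)
        go red   blue  _ = three (yes′ 2nd) (no′ (λ ()) (λ ())) (yes′ 1st)
        go red   green _ = three (no′ (λ ()) (λ ())) (yes′ 2nd) (yes′ 1st)

      -- Every white vertex of the class carries one edge of each of the two colours, so the length
      -- of the graph cycle is twice the number of its white vertices, and these form a cycle of f.
      len-per : ∀ r → len r ≡ 2 ℕ.* suc (per f f-inj (proj₁ (whiteOf r)))
      len-per r = fromℕ-injective (begin
        fromℕ (len r)
          ≡⟨ cong fromℕ (len≡ r) ⟩
        fromℕ (cycleLength graph c c′ r)
          ≡⟨ fromℕ-cycleLength graph c c′ r ⟩
        Σ (allFin (3 ℕ.* d)) (λ e → ⟦ _∈?_ graph (colourOf {d} e) cs ⟧ * L r (white graph e))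
          ≡⟨ Σ-edgeOf (λ e → ⟦ _∈?_ graph (colourOf {d} e) cs ⟧ * L r (white graph e)) ⟩
        Σ colours (λ k → Σ V λ i → ⟦ _∈?_ graph (colourOf {d} (edgeOf k i)) cs ⟧ * L r
            (white graph (edgeOf k i)))
          ≡⟨ Σ-cong colours (Σ-colour r) ⟩
        Σ colours (λ k → ⟦ _∈?_ graph k cs ⟧ * Σ V (L r))
          ≡⟨ Σ-*ʳ colours (Σ V (L r)) (λ k → ⟦ _∈?_ graph k cs ⟧) ⟩
        Σ colours (λ k → ⟦ _∈?_ graph k cs ⟧) * Σ V (L r)
          ≡⟨ cong₂ _*_ two-colours (Σ-linked r) ⟩
        fromℕ 2 * fromℕ (suc (per f f-inj (proj₁ (whiteOf r))))
          ≡⟨ fromℕ-* 2 (suc (per f f-inj (proj₁ (whiteOf r)))) ⟨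
        fromℕ (2 ℕ.* suc (per f f-inj (proj₁ (whiteOf r)))) ∎)
        where open ≡-Reasoning

      double-injective : ∀ {a b} → 2 ℕ.* suc a ≡ 2 ℕ.* suc b → a ≡ b
      double-injective e = ℕ.suc-injective (ℕ.*-cancelˡ-≡ _ _ 2 e)

      len-white : ∀ {r x} → Linked graph cs r (inj₁ x) → len r ≡ 2 ℕ.* suc (per f f-inj x)
      len-white {r} {x} rx = trans (len-per r) (cong (λ p → 2 ℕ.* suc p) (per-same f-inj
        (linked⇒same (linked-trans graph cs (linked-sym graph cs (proj₂ (whiteOf r))) rx))))

    number : ℕ → ℕ
    number i = #cyclesOfLength graph c c′ (2 ℕ.* suc i)

    private
      fromℕ-number : ∀ i → fromℕ (number i) ≡ Σ reps (λ r → ⟦ len r ℕ.≟ 2 ℕ.* suc i ⟧)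
      fromℕ-number i = trans (fromℕ-#cyclesOfLength graph c c′ (2 ℕ.* suc i))
        (Σ-cong reps λ r → cong (λ l → ⟦ l ℕ.≟ 2 ℕ.* suc i ⟧) (sym (len≡ r)))

      count : ∀ i → fromℕ (suc i) * fromℕ (number i) ≡ Σ V (λ x → ⟦ per f f-inj x ℕ.≟ i ⟧)
      count i = sym (begin
        Σ V (λ x → ⟦ per f f-inj x ℕ.≟ i ⟧)
          ≡⟨ (Σ-cong V λ x → trans (sym (ℚ.*-identityˡ ⟦ per f f-inj x ℕ.≟ i ⟧))
              (trans (cong (_* ⟦ per f f-inj x ℕ.≟ i ⟧) (sym (cycles-one graph c c′ (inj₁ x))))
               (sym (Σ-*ʳ reps ⟦ per f f-inj x ℕ.≟ i ⟧ (λ r → L r x))))) ⟩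
        Σ V (λ x → Σ reps λ r → L r x * ⟦ per f f-inj x ℕ.≟ i ⟧)
          ≡⟨ Σ-swap V reps (λ x r → L r x * ⟦ per f f-inj x ℕ.≟ i ⟧) ⟩
        Σ reps (λ r → Σ V λ x → L r x * ⟦ per f f-inj x ℕ.≟ i ⟧)
          ≡⟨ (Σ-cong reps λ r → trans (Σ-cong V λ x → ⟦⟧*-cong (linked? graph cs r (inj₁ x)) λ rx →
               ⟦⟧-cong (per f f-inj x ℕ.≟ i) (len r ℕ.≟ 2 ℕ.* suc i)
                 (λ e → trans (len-white rx) (cong (λ p → 2 ℕ.* suc p) e))
                     (λ e → double-injective (trans (sym (len-white rx)) e)))
             (Σ-*ʳ V ⟦ len r ℕ.≟ 2 ℕ.* suc i ⟧ (L r))) ⟩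
        Σ reps (λ r → Σ V (L r) * ⟦ len r ℕ.≟ 2 ℕ.* suc i ⟧)
          ≡⟨ (Σ-cong reps λ r → trans (ℚ.*-comm (Σ V (L r)) _)
              (trans (⟦⟧*-cong (len r ℕ.≟ 2 ℕ.* suc i) λ e →
               trans (Σ-linked r) (cong (fromℕ ∘ suc)
                   (double-injective (trans (sym (len-per r)) e)))) (ℚ.*-comm _ (fromℕ (suc i))))) ⟩
        Σ reps (λ r → fromℕ (suc i) * ⟦ len r ℕ.≟ 2 ℕ.* suc i ⟧)
          ≡⟨ Σ-*ˡ reps (fromℕ (suc i)) (λ r → ⟦ len r ℕ.≟ 2 ℕ.* suc i ⟧) ⟩
        fromℕ (suc i) * Σ reps (λ r → ⟦ len r ℕ.≟ 2 ℕ.* suc i ⟧)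
          ≡⟨ cong (fromℕ (suc i) *_) (fromℕ-number i) ⟨
        fromℕ (suc i) * fromℕ (number i) ∎)
        where open ≡-Reasoning

    cycleType-number : cycleType f f-inj ≡ tabulate d number
    cycleType-number = cycleType-unique′ {f = f} {λ {x} {y} → f-inj {x} {y}} λ i → go i (i ℕ.<? d)
      where
      go : ∀ i → Dec (i ℕ.< d) → fromℕ (suc i) * fromℕ (at (tabulate d number) i) ≡ Σ V
          (λ x → ⟦ per f f-inj x ℕ.≟ i ⟧)
      go i (yes i<d) = trans (cong (λ n → fromℕ (suc i) * fromℕ n) (at-tabulate d number i<d))
          (count i)
      go i (no i≮d) = trans (cong (λ n → fromℕ (suc i) * fromℕ n)
          (at-tabulate-≥ d number (ℕ.≮⇒≥ i≮d)))
        (trans (ℚ.*-zeroʳ (fromℕ (suc i)))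
            (sym (Σ-null V λ {x} _ → ⟦⟧-no (per f f-inj x ℕ.≟ i)
            λ { refl → i≮d (per<d f f-inj x) })))

    #cycles-total : length (cycles graph c c′) ≡ total (cycleType f f-inj)
    #cycles-total = fromℕ-injective (sym (begin
      fromℕ (total (cycleType f f-inj))
        ≡⟨ cong (fromℕ ∘ total) cycleType-number ⟩
      fromℕ (total (tabulate d number))
        ≡⟨ fromℕ-total-tabulate d number ⟩
      Σ< d (fromℕ ∘ number)
        ≡⟨ Σ-cong (upTo d) fromℕ-number ⟩
      Σ< d (λ i → Σ reps λ r → ⟦ len r ℕ.≟ 2 ℕ.* suc i ⟧)
        ≡⟨ Σ-swap (upTo d) reps (λ i r → ⟦ len r ℕ.≟ 2 ℕ.* suc i ⟧) ⟩
      Σ reps (λ r → Σ< d λ i → ⟦ len r ℕ.≟ 2 ℕ.* suc i ⟧)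
        ≡⟨ (Σ-cong reps λ r → Σ-one (Unique.upTo⁺ d) (∈-upTo⁺ (per<d f f-inj (proj₁ (whiteOf r))))
            (λ i → len r ℕ.≟ 2 ℕ.* suc i)
             (len-per r) (λ _ e → double-injective (trans (sym e) (len-per r)))) ⟩
      Σ reps (λ _ → 1ℚ)
        ≡⟨ fromℕ-length reps ⟨
      fromℕ (length reps) ∎))
      where open ≡-Reasoning

module _ {d : ℕ} {σ τ : Fin d → Fin d}
         (σ-inj : Injective _≡_ _≡_ σ) (τ-inj : Injective _≡_ _≡_ τ) where

  private
    Γ : ColouredGraph
    Γ = graph σ τ

  viaGreen : Vertex Γ → Fin d
  viaGreen (inj₁ i) = i
  viaGreen (inj₂ j) = j

  private
    same-isEquivalence : ∀ {f : Fin d → Fin d} → Injective _≡_ _≡_ f → IsEquivalence (Same f)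
    same-isEquivalence {f} inj = record
        { refl = 0 , refl ; sym = same-sym inj ; trans = same-trans {f = f} }

    iterate-linked : ∀ {cs} {f : Fin d → Fin d} → (∀ x → Linked Γ cs (inj₁ x) (inj₁ (f x))) →
                     ∀ {x y} → Same f x y → Linked Γ cs (inj₁ x) (inj₁ y)
    iterate-linked         step (zero , refl)  = ε
    iterate-linked {f = f} step {x} (suc n , refl) = iterate-linked step (n , refl) ◅◅ step
        (iter f n x)

    -- On a red-blue cycle a black vertex j cannot be identified with a white one by its green edge;
    -- its blue edge leads to τ j. A red edge from i then becomes a step from i to τ (σ i).
    viaBlue : Vertex Γ → Fin d
    viaBlue (inj₁ i) = i
    viaBlue (inj₂ j) = τ j

    1st : ∀ {c c′ : EdgeColour} → c ∈ c ∷ c′ ∷ []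
    1st = here refl

    2nd : ∀ {c c′ : EdgeColour} → c′ ∈ c ∷ c′ ∷ []
    2nd = there (here refl)

    redGreen⇒same : ∀ {x y} → Linked Γ (red ∷ green ∷ []) (inj₁ x) (inj₁ y) → Same σ x y
    redGreen⇒same = linked-fold σ τ (same-isEquivalence σ-inj) viaGreen λ
      { red   i _ → 1 , refl
      ; green i _ → 0 , refl
      ; blue  i (here ())
      ; blue  i (there (here ())) }

    same⇒redGreen : ∀ {x y} → Same σ x y → Linked Γ (red ∷ green ∷ []) (inj₁ x) (inj₁ y)
    same⇒redGreen = iterate-linked {f = σ} λ x → fwd (adjacent σ τ red x 1st) ◅ bwd
        (adjacent σ τ green (σ x) 2nd) ◅ ε

    toWhite-redGreen : ∀ j → ∃ λ i → Linked Γ (red ∷ green ∷ []) (inj₂ j) (inj₁ i)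
    toWhite-redGreen j = j , bwd (adjacent σ τ green j 2nd) ◅ ε

    greenBlue⇒same : ∀ {x y} → Linked Γ (green ∷ blue ∷ []) (inj₁ x) (inj₁ y) → Same τ x y
    greenBlue⇒same = linked-fold σ τ (same-isEquivalence τ-inj) viaGreen λ
      { green i _ → 0 , refl
      ; blue  i _ → same-sym τ-inj (1 , refl)
      ; red   i (here ())
      ; red   i (there (here ())) }

    same⇒greenBlue : ∀ {x y} → Same τ x y → Linked Γ (green ∷ blue ∷ []) (inj₁ x) (inj₁ y)
    same⇒greenBlue = iterate-linked {f = τ} λ x → fwd (adjacent σ τ green x 1st) ◅ bwd
        (adjacent σ τ blue x 2nd) ◅ ε

    toWhite-greenBlue : ∀ j → ∃ λ i → Linked Γ (green ∷ blue ∷ []) (inj₂ j) (inj₁ i)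
    toWhite-greenBlue j = j , bwd (adjacent σ τ green j 1st) ◅ ε

    product-injective : Injective _≡_ _≡_ (τ ∘ σ)
    product-injective e = σ-inj (τ-inj e)

    redBlue⇒same : ∀ {x y} → Linked Γ (red ∷ blue ∷ []) (inj₁ x) (inj₁ y) → Same (τ ∘ σ) x y
    redBlue⇒same = linked-fold σ τ (same-isEquivalence {τ ∘ σ} product-injective) viaBlue λ
      { red   i _ → 1 , refl
      ; blue  i _ → 0 , refl
      ; green i (here ())
      ; green i (there (here ())) }

    same⇒redBlue : ∀ {x y} → Same (τ ∘ σ) x y → Linked Γ (red ∷ blue ∷ []) (inj₁ x) (inj₁ y)
    same⇒redBlue = iterate-linked {f = τ ∘ σ} λ x → fwd (adjacent σ τ red x 1st) ◅ bwd
        (adjacent σ τ blue (σ x) 2nd) ◅ ε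

    toWhite-redBlue : ∀ j → ∃ λ i → Linked Γ (red ∷ blue ∷ []) (inj₂ j) (inj₁ i)
    toWhite-redBlue j = τ j , bwd (adjacent σ τ blue j 2nd) ◅ ε

    red≢green : red ≢ green
    red≢green ()

    green≢blue : green ≢ blue
    green≢blue ()

    red≢blue : red ≢ blue
    red≢blue ()

    module RedGreen = Cycles σ τ τ-inj red≢green σ-inj
      redGreen⇒same same⇒redGreen toWhite-redGreen
    module GreenBlue = Cycles σ τ τ-inj green≢blue τ-inj
      greenBlue⇒same same⇒greenBlue toWhite-greenBlue
    module RedBlue = Cycles σ τ τ-inj red≢blue {τ ∘ σ} product-injective
      redBlue⇒same same⇒redBlue toWhite-redBlue

  white-regular : ∀ w c → ∃! _≡_ λ e → white Γ e ≡ w × colour Γ e ≡ c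
  white-regular w c = let i , e = injective⇒surjective (whiteEnd-injective σ τ τ-inj c) w in
      edgeOf c i , (trans (white-edgeOf σ τ c i) e , colourOf-edgeOf c i)
    , λ {e′} (p , q) → trans (cong₂ edgeOf (sym q) (whiteEnd-injective σ τ τ-inj c
          (trans e (trans (sym p) (cong (λ c → whiteEnd σ τ c (indexOf {d} e′)) q)))))
              (edgeOf-colourOf {d} e′)

  black-regular : ∀ b c → ∃! _≡_ λ e → black Γ e ≡ b × colour Γ e ≡ c
  black-regular b c = let i , e = injective⇒surjective (blackEnd-injective σ τ σ-inj c) b in
      edgeOf c i , (trans (black-edgeOf σ τ c i) e , colourOf-edgeOf c i)
    , λ {e′} (p , q) → trans (cong₂ edgeOf (sym q) (blackEnd-injective σ τ σ-inj c
          (trans e (trans (sym p) (cong (λ c → blackEnd σ τ c (indexOf {d} e′)) q)))))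
              (edgeOf-colourOf {d} e′)

  degree-graph : degree Γ ≡ d
  degree-graph = #green≡#vertex (white Γ) (colour Γ) white-regular

  type-graph : type Γ ≡ (total (cycleType σ σ-inj) , total (cycleType τ τ-inj) , cycleType (τ ∘ σ)
      (λ e → σ-inj (τ-inj e)))
  type-graph = cong₂ _,_ RedGreen.#cycles-total (cong₂ _,_ GreenBlue.#cycles-total
    (trans (cong (λ n → tabulate n RedBlue.number) degree-graph) (sym RedBlue.cycleType-number)))

  orbit⇒linked : ∀ {x y} → Orbit σ τ x y → Linked Γ colours (inj₁ x) (inj₁ y)
  orbit⇒linked = EqClosure.gfold (EqClosure.isEquivalence (Adjacent Γ colours)) inj₁ λ
    { (σ-step x) → fwd (adjacent σ τ red x (∈-colours red)) ◅ bwd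
        (adjacent σ τ green (σ x) (∈-colours green)) ◅ ε
    ; (τ-step x) → fwd (adjacent σ τ green x (∈-colours green)) ◅ bwd
        (adjacent σ τ blue x (∈-colours blue)) ◅ ε }

  linked⇒orbit : ∀ {x y} → Linked Γ colours x y → Orbit σ τ (viaGreen x) (viaGreen y)
  linked⇒orbit = linked-fold σ τ (EqClosure.isEquivalence (Step σ τ)) viaGreen λ
    { red   i _ → fwd (σ-step i) ◅ ε
    ; green i _ → ε
    ; blue  i _ → bwd (τ-step i) ◅ ε }

  linked-viaGreen : ∀ x → Linked Γ colours x (inj₁ (viaGreen x))
  linked-viaGreen (inj₁ i) = ε
  linked-viaGreen (inj₂ j) = bwd (adjacent σ τ green j (∈-colours green)) ◅ ε

connected⇒transitive : ∀ {d} {σ τ : Fin d → Fin d} → Injective _≡_ _≡_ σ → Injective _≡_ _≡_ τ →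
                       Connected (graph σ τ) → IsTransitive σ τ
connected⇒transitive {zero}  σ-inj τ-inj (inj₁ () , _)
connected⇒transitive {zero}  σ-inj τ-inj (inj₂ () , _)
connected⇒transitive {suc d} σ-inj τ-inj (_ , all) x = linked⇒orbit σ-inj τ-inj
  (all (inj₁ zero) (inj₁ x))

transitive⇒connected : ∀ {d} {σ τ : Fin d → Fin d} → Injective _≡_ _≡_ σ → Injective _≡_ _≡_ τ →
                       IsTransitive σ τ → Connected (graph σ τ)
transitive⇒connected {suc d} {σ} {τ} σ-inj τ-inj t = inj₁ zero , λ x y →
  linked-viaGreen σ-inj τ-inj x
  ◅◅ orbit⇒linked σ-inj τ-inj (EqClosure.symmetric (Step σ τ) (t (viaGreen σ-inj τ-inj x)) ◅◅ t
      (viaGreen σ-inj τ-inj y))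
  ◅◅ linked-sym (graph σ τ) colours (linked-viaGreen σ-inj τ-inj y)

graph-isBelyi : ∀ {d} {σ τ : Fin d → Fin d} → Injective _≡_ _≡_ σ → Injective _≡_ _≡_ τ →
                IsTransitive σ τ → IsBelyi (graph σ τ)
graph-isBelyi σ-inj τ-inj t =
  isBelyi (white-regular σ-inj τ-inj) (black-regular σ-inj τ-inj)
      (transitive⇒connected σ-inj τ-inj t)

-- Automorphisms and labellings

_≗?_ : ∀ {m n} (f g : Fin m → Fin n) → Dec (f ≗ g)
f ≗? g = Fin.all? (λ i → f i Fin.≟ g i)

-- Every function occurs exactly once in the enumeration up to pointwise equality. This takes the
-- place of uniqueness of the list when isomorphisms are counted.
Σ-functions : ∀ m {n} (f : Fin m → Fin n) → Σ (functions m (allFin n)) (λ g → ⟦ f ≗? g ⟧) ≡ 1ℚ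
Σ-functions zero    f = trans (ℚ.+-identityʳ ⟦ f ≗? Vector.[] ⟧) (⟦⟧-yes (f ≗? Vector.[]) λ ())
Σ-functions (suc m) {n} f = begin
  Σ (functions (suc m) (allFin n)) (λ g → ⟦ f ≗? g ⟧)
    ≡⟨ Σ-prodWith Vector._∷_ (allFin n) (functions m (allFin n)) (λ g → ⟦ f ≗? g ⟧) ⟩
  Σ (allFin n) (λ x → Σ (functions m (allFin n)) λ g → ⟦ f ≗? (x Vector.∷ g) ⟧)
    ≡⟨ (Σ-cong (allFin n) λ x → Σ-cong (functions m (allFin n)) λ g → trans
         (⟦⟧-cong (f ≗? (x Vector.∷ g)) ((f zero Fin.≟ x) ×-dec ((f ∘ suc) ≗? g))
             (λ e → e zero , e ∘ suc) cons)
         (⟦⟧-× (f zero Fin.≟ x) ((f ∘ suc) ≗? g))) ⟩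
  Σ (allFin n) (λ x → Σ (functions m (allFin n)) λ g → ⟦ f zero Fin.≟ x ⟧ * ⟦ (f ∘ suc) ≗? g ⟧)
    ≡⟨ Σ-*-Σ (allFin n) (functions m (allFin n)) (λ x → ⟦ f zero Fin.≟ x ⟧)
        (λ g → ⟦ (f ∘ suc) ≗? g ⟧) ⟩
  Σ (allFin n) (λ x → ⟦ f zero Fin.≟ x ⟧) * Σ (functions m (allFin n)) (λ g → ⟦ (f ∘ suc) ≗? g ⟧)
    ≡⟨ cong₂ _*_ (Σ-one (Unique.allFin⁺ n) (∈-allFin (f zero)) (f zero Fin.≟_) refl (λ _ → sym))
        (Σ-functions m (f ∘ suc)) ⟩
  1ℚ * 1ℚ
    ≡⟨ ℚ.*-identityˡ 1ℚ ⟩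
  1ℚ ∎
  where
  open ≡-Reasoning
  cons : ∀ {x g} → f zero ≡ x × f ∘ suc ≗ g → f ≗ x Vector.∷ g
  cons (p , q) zero    = p
  cons (p , q) (suc i) = q i

module _ {Γ Δ : ColouredGraph} where

  _≈ᵗ_ : Triple Γ Δ → Triple Γ Δ → Set
  (f , g , h) ≈ᵗ (f′ , g′ , h′) = f ≗ f′ × g ≗ g′ × h ≗ h′

  _≈ᵗ?_ : ∀ x y → Dec (x ≈ᵗ y)
  (f , g , h) ≈ᵗ? (f′ , g′ , h′) = (f ≗? f′) ×-dec (g ≗? g′) ×-dec (h ≗? h′)

  isIso-≈ᵗ : ∀ {x y} → x ≈ᵗ y → IsIso Γ Δ x → IsIso Γ Δ y
  isIso-≈ᵗ (p , q , r) = isIso-cong {Γ} {Δ} p q r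

  Σ-triples : ∀ x → Σ (triples Γ Δ) (λ y → ⟦ x ≈ᵗ? y ⟧) ≡ 1ℚ
  Σ-triples x@(f , g , h) = begin
    Σ (triples Γ Δ) (λ y → ⟦ x ≈ᵗ? y ⟧)
      ≡⟨ trans (Σ-prod Fs (cartesianProduct Gs Hs) (λ y → ⟦ x ≈ᵗ? y ⟧))
          (Σ-cong Fs λ f′ → Σ-prod Gs Hs (λ (g′ , h′) → ⟦ x ≈ᵗ? (f′ , g′ , h′) ⟧)) ⟩
    Σ Fs (λ f′ → Σ Gs λ g′ → Σ Hs λ h′ → ⟦ x ≈ᵗ? (f′ , g′ , h′) ⟧)
      ≡⟨ (Σ-cong Fs λ f′ → trans (Σ-cong Gs λ g′ → trans
          (Σ-cong Hs λ h′ → trans (⟦⟧-× (f ≗? f′) ((g ≗? g′) ×-dec (h ≗? h′)))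
             (cong (⟦ f ≗? f′ ⟧ *_) (⟦⟧-× (g ≗? g′) (h ≗? h′))))
           (Σ-*ˡ Hs ⟦ f ≗? f′ ⟧ (λ h′ → ⟦ g ≗? g′ ⟧ * ⟦ h ≗? h′ ⟧)))
         (Σ-*ˡ Gs ⟦ f ≗? f′ ⟧ (λ g′ → Σ Hs λ h′ → ⟦ g ≗? g′ ⟧ * ⟦ h ≗? h′ ⟧))) ⟩
    Σ Fs (λ f′ → ⟦ f ≗? f′ ⟧ * Σ Gs (λ g′ → Σ Hs λ h′ → ⟦ g ≗? g′ ⟧ * ⟦ h ≗? h′ ⟧))
      ≡⟨ Σ-*ʳ Fs (Σ Gs (λ g′ → Σ Hs λ h′ → ⟦ g ≗? g′ ⟧ * ⟦ h ≗? h′ ⟧)) (λ f′ → ⟦ f ≗? f′ ⟧) ⟩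
    Σ Fs (λ f′ → ⟦ f ≗? f′ ⟧) * Σ Gs (λ g′ → Σ Hs λ h′ → ⟦ g ≗? g′ ⟧ * ⟦ h ≗? h′ ⟧)
      ≡⟨ cong₂ _*_ (Σ-functions (#white Γ) f)
          (trans (Σ-*-Σ Gs Hs (λ g′ → ⟦ g ≗? g′ ⟧) (λ h′ → ⟦ h ≗? h′ ⟧))
           (cong₂ _*_ (Σ-functions (#black Γ) g) (Σ-functions (#edge Γ) h))) ⟩
    1ℚ * (1ℚ * 1ℚ)
      ≡⟨ trans (ℚ.*-identityˡ (1ℚ * 1ℚ)) (ℚ.*-identityˡ 1ℚ) ⟩
    1ℚ ∎
    where
    open ≡-Reasoning
    Fs = functions (#white Γ) (allFin (#white Δ))
    Gs = functions (#black Γ) (allFin (#black Δ))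
    Hs = functions (#edge Γ) (allFin (#edge Δ))

-- Composition with one isomorphism matches all isomorphisms Δ ≅ Γ with the automorphisms of Γ.

Σ-isos : ∀ Δ Γ → Σ (triples Δ Γ) (λ x → ⟦ isIso? Δ Γ x ⟧) ≡ ⟦ Δ ≅? Γ ⟧ * fromℕ (|Aut| Γ)
Σ-isos Δ Γ = go (Δ ≅? Γ)
  where
  go : Dec (Δ ≅ Γ) → Σ (triples Δ Γ) (λ x → ⟦ isIso? Δ Γ x ⟧) ≡ ⟦ Δ ≅? Γ ⟧ * fromℕ (|Aut| Γ)
  go (no ¬iso) = trans (Σ-null (triples Δ Γ) λ {x} _ → ⟦⟧-no (isIso? Δ Γ x) λ i → ¬iso
      (_ , _ , _ , i))
    (sym (trans (cong (_* fromℕ (|Aut| Γ)) (⟦⟧-no (Δ ≅? Γ) ¬iso)) (ℚ.*-zeroˡ (fromℕ (|Aut| Γ)))))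
  go (yes (f , g , h , iso)) = trans
    (Σ-match (triples Δ Γ) (triples Γ Γ) {λ x y → x ≈ᵗ∘ y} _≈ᵗ∘?_
      (λ {x} _ → trans (Σ-cong (triples Γ Γ) λ y → ⟦⟧-cong (x ≈ᵗ∘? y)
          (_≈ᵗ?_ {Γ} {Γ} (x ∘⁻¹) y) to from) (Σ-triples {Γ} {Γ} (x ∘⁻¹)))
      (λ {y} _ → trans (Σ-cong (triples Δ Γ) λ x → ⟦⟧-cong (x ≈ᵗ∘? y)
          (_≈ᵗ?_ {Δ} {Γ} (y ∘φ) x) swapped swapped) (Σ-triples {Δ} {Γ} (y ∘φ)))
      {λ x → ⟦ isIso? Δ Γ x ⟧} {λ y → ⟦ isIso? Γ Γ y ⟧}
      (λ {x} {y} _ _ e → ⟦⟧-cong (isIso? Δ Γ x) (isIso? Γ Γ y)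
        (λ i → isIso-≈ᵗ {Γ} {Γ} (to {x} {y} e) (isIso-∘ {Γ} {Δ} {Γ} i iso⁻¹))
        (λ i → isIso-≈ᵗ {Δ} {Γ} {y ∘φ} {x} (swapped {x} {y ∘φ} e) (isIso-∘ {Δ} {Γ} {Γ} i iso))))
    (sym (trans (cong₂ _*_ (⟦⟧-yes (Δ ≅? Γ) (f , g , h , iso))
        (fromℕ-count (isIso? Γ Γ) (triples Γ Γ)))
      (ℚ.*-identityˡ (Σ (triples Γ Γ) (λ y → ⟦ isIso? Γ Γ y ⟧)))))
    where
    open IsIsomorphism iso
    iso⁻¹ : IsIsomorphism Γ Δ (inverse white-bijective) (inverse black-bijective)
        (inverse edge-bijective)
    iso⁻¹ = proj₂ (proj₂ (proj₂ (≅-sym {Δ} {Γ} (f , g , h , iso))))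
    _∘φ : Triple Γ Γ → Triple Δ Γ
    (f′ , g′ , h′) ∘φ = f′ ∘ f , g′ ∘ g , h′ ∘ h
    _∘⁻¹ : Triple Δ Γ → Triple Γ Γ
    (f′ , g′ , h′) ∘⁻¹ = f′ ∘ inverse white-bijective , g′ ∘ inverse black-bijective , h′ ∘ inverse
        edge-bijective
    _≈ᵗ∘_ : Triple Δ Γ → Triple Γ Γ → Set
    x ≈ᵗ∘ y = _≈ᵗ_ {Δ} {Γ} x (y ∘φ)
    _≈ᵗ∘?_ : ∀ x y → Dec (x ≈ᵗ∘ y)
    x ≈ᵗ∘? y = _≈ᵗ?_ {Δ} {Γ} x (y ∘φ)
    swapped : ∀ {x y} → _≈ᵗ_ {Δ} {Γ} x y → _≈ᵗ_ {Δ} {Γ} y x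
    swapped (p , q , r) = (λ i → sym (p i)) , (λ i → sym (q i)) , (λ i → sym (r i))
    to : ∀ {x y} → x ≈ᵗ∘ y → _≈ᵗ_ {Γ} {Γ} (x ∘⁻¹) y
    to {y = f′ , g′ , h′} (p , q , r) =
        (λ i → trans (p (inverse white-bijective i)) (cong f′ (inverseʳ white-bijective i)))
      , (λ i → trans (q (inverse black-bijective i)) (cong g′ (inverseʳ black-bijective i)))
      , (λ i → trans (r (inverse edge-bijective i)) (cong h′ (inverseʳ edge-bijective i)))
    from : ∀ {x y} → _≈ᵗ_ {Γ} {Γ} (x ∘⁻¹) y → x ≈ᵗ∘ y
    from {f′ , g′ , h′} (p , q , r) =
        (λ i → trans (cong f′ (sym (inverseˡ white-bijective i))) (p (f i)))
      , (λ i → trans (cong g′ (sym (inverseˡ black-bijective i))) (q (g i)))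
      , (λ i → trans (cong h′ (sym (inverseˡ edge-bijective i))) (r (h i)))

_≟ᵖ_ : ∀ {d} → DecidableEquality (Perm d)
_≟ᵖ_ {zero}  tt      tt        = yes refl
_≟ᵖ_ {suc d} = Product.≡-dec Fin._≟_ _≟ᵖ_

Σ-perms : ∀ d → Σ (perms d) (λ _ → 1ℚ) ≡ fromℕ (d !)
Σ-perms zero    = refl
Σ-perms (suc d) = begin
  Σ (perms (suc d)) (λ _ → 1ℚ)
    ≡⟨ Σ-prod (allFin (suc d)) (perms d) (λ _ → 1ℚ) ⟩
  Σ (allFin (suc d)) (λ _ → Σ (perms d) (λ _ → 1ℚ))
    ≡⟨ (Σ-cong (allFin (suc d)) λ _ → Σ-perms d) ⟩
  Σ (allFin (suc d)) (λ _ → fromℕ (d !))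
    ≡⟨ (Σ-cong (allFin (suc d)) λ _ → ℚ.*-identityˡ (fromℕ (d !))) ⟨
  Σ (allFin (suc d)) (λ _ → 1ℚ * fromℕ (d !))
    ≡⟨ Σ-*ʳ (allFin (suc d)) (fromℕ (d !)) (λ _ → 1ℚ) ⟩
  Σ (allFin (suc d)) (λ _ → 1ℚ) * fromℕ (d !)
    ≡⟨ cong (_* fromℕ (d !)) (fromℕ-length (allFin (suc d))) ⟨
  fromℕ (length (allFin (suc d))) * fromℕ (d !)
    ≡⟨ cong (λ n → fromℕ n * fromℕ (d !)) (length-allFin (suc d)) ⟩
  fromℕ (suc d) * fromℕ (d !)
    ≡⟨ fromℕ-* (suc d) (d !) ⟨
  fromℕ (suc d !) ∎
  where
  open ≡-Reasoning
  length-allFin : ∀ n → length (allFin n) ≡ n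
  length-allFin n = List.length-tabulate id
    where import Data.List.Properties as List

graphOf : ∀ {d} → Perm d × Perm d → ColouredGraph
graphOf (σ , τ) = graph (decode σ) (decode τ)

-- A labelling φ of the white vertices of Γ by Fin d determines the black labels through the
-- green edges, and then σ and τ.

module Labelling {d} (col : Fin (3 ℕ.* d) → EdgeColour) (wh bl : Fin (3 ℕ.* d) → Fin d)
                 (β : IsBelyi (coloured d d (3 ℕ.* d) (col , wh , bl))) where

  Γ : ColouredGraph
  Γ = coloured d d (3 ℕ.* d) (col , wh , bl)

  private
    W Bl : Fin d → EdgeColour → Fin (3 ℕ.* d)
    W w c = proj₁ (IsBelyi.white-regular β w c)
    Bl b c = proj₁ (IsBelyi.black-regular β b c)

    wh-W : ∀ w c → wh (W w c) ≡ w
    wh-W w c = proj₁ (proj₁ (proj₂ (IsBelyi.white-regular β w c)))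

    col-W : ∀ w c → col (W w c) ≡ c
    col-W w c = proj₂ (proj₁ (proj₂ (IsBelyi.white-regular β w c)))

    W-unique : ∀ {w c e} → wh e ≡ w → col e ≡ c → W w c ≡ e
    W-unique {w} {c} p q = proj₂ (proj₂ (IsBelyi.white-regular β w c)) (p , q)

    bl-Bl : ∀ b c → bl (Bl b c) ≡ b
    bl-Bl b c = proj₁ (proj₁ (proj₂ (IsBelyi.black-regular β b c)))

    col-Bl : ∀ b c → col (Bl b c) ≡ c
    col-Bl b c = proj₂ (proj₁ (proj₂ (IsBelyi.black-regular β b c)))

    Bl-unique : ∀ {b c e} → bl e ≡ b → col e ≡ c → Bl b c ≡ e
    Bl-unique {b} {c} p q = proj₂ (proj₂ (IsBelyi.black-regular β b c)) (p , q)

    bl-W-injective : ∀ c {w w′} → bl (W w c) ≡ bl (W w′ c) → w ≡ w′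
    bl-W-injective c {w} {w′} e = trans (sym (wh-W w c))
        (trans (cong wh (trans (sym (Bl-unique e (col-W w c)))
      (Bl-unique refl (col-W w′ c)))) (wh-W w′ c))

    wh-Bl-injective : ∀ c {b b′} → wh (Bl b c) ≡ wh (Bl b′ c) → b ≡ b′
    wh-Bl-injective c {b} {b′} e = trans (sym (bl-Bl b c))
        (trans (cong bl (trans (sym (W-unique e (col-Bl b c)))
      (W-unique refl (col-Bl b′ c)))) (bl-Bl b′ c))

  module _ (φ : Fin d → Fin d) (φ-inj : Injective _≡_ _≡_ φ) where

    private
      φ-bij = injective⇒bijective φ-inj

      γ : Fin d → Fin d
      γ j = bl (W (φ j) green)

      γ-inj : Injective _≡_ _≡_ γ
      γ-inj = φ-inj ∘ bl-W-injective green

      γ-bij = injective⇒bijective γ-inj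

      σ⁰ τ⁰ : Fin d → Fin d
      σ⁰ i = inverse γ-bij (bl (W (φ i) red))
      τ⁰ j = inverse φ-bij (wh (Bl (γ j) blue))

      γ-σ⁰ : ∀ i → γ (σ⁰ i) ≡ bl (W (φ i) red)
      γ-σ⁰ i = inverseʳ γ-bij (bl (W (φ i) red))

      φ-τ⁰ : ∀ j → φ (τ⁰ j) ≡ wh (Bl (γ j) blue)
      φ-τ⁰ j = inverseʳ φ-bij (wh (Bl (γ j) blue))

      σ⁰-code = encode σ⁰ (λ {i} {j} e → φ-inj
          (bl-W-injective red (trans (sym (γ-σ⁰ i)) (trans (cong γ e) (γ-σ⁰ j)))))
      τ⁰-code = encode τ⁰ (λ {i} {j} e → γ-inj
          (wh-Bl-injective blue (trans (sym (φ-τ⁰ i)) (trans (cong φ e) (φ-τ⁰ j)))))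

    c⁰ : Perm d × Perm d
    c⁰ = proj₁ σ⁰-code , proj₁ τ⁰-code

    private
      -- The image of `edgeOf c i` is forced by regularity: green and red edges are found at their
      -- white end with label i, blue edges at their black end with label i.
      η : EdgeColour → Fin d → Fin (3 ℕ.* d)
      η blue  i = Bl (γ i) blue
      η green i = W (φ i) green
      η red   i = W (φ i) red

      col-η : ∀ c i → col (η c i) ≡ c
      col-η blue  i = col-Bl (γ i) blue
      col-η green i = col-W (φ i) green
      col-η red   i = col-W (φ i) red

      η-injective : ∀ c {i j} → η c i ≡ η c j → i ≡ j
      η-injective blue {i} {j} e = γ-inj
          (trans (sym (bl-Bl (γ i) blue)) (trans (cong bl e) (bl-Bl (γ j) blue)))
      η-injective green {i} {j} e = φ-inj
          (trans (sym (wh-W (φ i) green)) (trans (cong wh e) (wh-W (φ j) green)))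
      η-injective red {i} {j} e = φ-inj
          (trans (sym (wh-W (φ i) red)) (trans (cong wh e) (wh-W (φ j) red)))

      h⁰ : Fin (3 ℕ.* d) → Fin (3 ℕ.* d)
      h⁰ e = η (colourOf {d} e) (indexOf {d} e)

      h⁰-injective : Injective _≡_ _≡_ h⁰
      h⁰-injective {e} {e′} p = trans (sym (edgeOf-colourOf {d} e)) (trans (cong₂ edgeOf same-colour
          (η-injective (colourOf {d} e′) (trans
              (cong (λ c → η c (indexOf {d} e)) (sym same-colour)) p)))
          (edgeOf-colourOf {d} e′))
        where
        same-colour : colourOf {d} e ≡ colourOf {d} e′
        same-colour = trans (sym (col-η (colourOf {d} e) (indexOf {d} e)))
            (trans (cong col p) (col-η (colourOf {d} e′) (indexOf {d} e′)))

    t⁰ : Triple (graphOf c⁰) Γ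
    t⁰ = φ , γ , h⁰

    private
      Δ⁰ = graphOf c⁰

      iso⁰ : IsIso Δ⁰ Γ t⁰
      iso⁰ = isIso φ-bij γ-bij (injective⇒bijective h⁰-injective)
        (λ e → col-η (colourOf {d} e) (indexOf {d} e))
        (λ e → white⁰ (colourOf {d} e) (indexOf {d} e))
        (λ e → black⁰ (colourOf {d} e) (indexOf {d} e))
        where
        white⁰ : ∀ c i → wh (η c i) ≡ φ (whiteEnd (decode (proj₁ c⁰)) (decode (proj₂ c⁰)) c i)
        white⁰ blue  i = trans (sym (φ-τ⁰ i)) (cong φ (sym (proj₂ τ⁰-code i)))
        white⁰ green i = wh-W (φ i) green
        white⁰ red   i = wh-W (φ i) red
        black⁰ : ∀ c i → bl (η c i) ≡ γ (blackEnd (decode (proj₁ c⁰)) (decode (proj₂ c⁰)) c i)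
        black⁰ blue  i = bl-Bl (γ i) blue
        black⁰ green i = refl
        black⁰ red   i = trans (sym (γ-σ⁰ i)) (cong γ (sym (proj₂ σ⁰-code i)))

      -- The white part fixes the images of the green and red edges. The green edges fix the black
      -- part, and with it the images of the blue edges. Reading off the black ends of red edges and
      -- the white ends of blue edges then determines σ and τ.
      determined : ∀ c t → IsIso (graphOf c) Γ t → proj₁ t ≗ φ → c ≡ c⁰ × _≈ᵗ_ {graphOf c⁰} {Γ} t⁰ t
      determined c@(σ , τ) (f , g , h) iso f≗φ =
          cong₂ _,_ (decode-unique σ (proj₁ σ⁰-code) λ i → trans
              (γ-inj (trans (γ-σ i) (sym (γ-σ⁰ i)))) (sym (proj₂ σ⁰-code i)))
                    (decode-unique τ (proj₁ τ⁰-code) λ j → trans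
                        (φ-inj (trans (φ-τ j) (sym (φ-τ⁰ j)))) (sym (proj₂ τ⁰-code j)))
        , (λ i → sym (f≗φ i)) , (λ i → sym (g≗γ i)) , λ e → trans
            (η-h (colourOf {d} e) (indexOf {d} e)) (cong h (edgeOf-colourOf {d} e))
        where
        open IsIsomorphism iso
        s′ t′ : Fin d → Fin d
        s′ = decode σ
        t′ = decode τ
        col-h : ∀ c (i : Fin d) → col (h (edgeOf c i)) ≡ c
        col-h c i = trans (colour-preserved (edgeOf c i)) (colourOf-edgeOf {d} c i)
        wh-h : ∀ c (i : Fin d) → wh (h (edgeOf c i)) ≡ φ (whiteEnd s′ t′ c i)
        wh-h c i = trans (white-preserved (edgeOf c i))
            (trans (cong f (white-edgeOf s′ t′ c i)) (f≗φ (whiteEnd s′ t′ c i)))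
        bl-h : ∀ c (i : Fin d) → bl (h (edgeOf c i)) ≡ g (blackEnd s′ t′ c i)
        bl-h c i = trans (black-preserved (edgeOf c i)) (cong g (black-edgeOf s′ t′ c i))
        g≗γ : ∀ i → g i ≡ γ i
        g≗γ i = trans (sym (bl-h green i)) (cong bl (sym (W-unique (wh-h green i) (col-h green i))))
        γ-σ : ∀ i → γ (s′ i) ≡ bl (W (φ i) red)
        γ-σ i = trans (sym (g≗γ (s′ i))) (trans (sym (bl-h red i))
            (cong bl (sym (W-unique (wh-h red i) (col-h red i)))))
        φ-τ : ∀ j → φ (t′ j) ≡ wh (Bl (γ j) blue)
        φ-τ j = trans (sym (wh-h blue j))
            (cong wh (sym (Bl-unique (trans (bl-h blue j) (g≗γ j)) (col-h blue j))))
        η-h : ∀ c i → η c i ≡ h (edgeOf c i)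
        η-h blue  i = Bl-unique (trans (bl-h blue i) (g≗γ i)) (col-h blue i)
        η-h green i = W-unique (wh-h green i) (col-h green i)
        η-h red   i = W-unique (wh-h red i) (col-h red i)

    Σ-labelled : Σ (pairs d) (λ c → Σ (triples (graphOf c) Γ) λ t → ⟦ isIso?
        (graphOf c) Γ t ⟧ * ⟦ proj₁ t ≗? φ ⟧) ≡ 1ℚ
    Σ-labelled = begin
      Σ (pairs d) (λ c → Σ (triples (graphOf c) Γ) λ t → ⟦ isIso?
          (graphOf c) Γ t ⟧ * ⟦ proj₁ t ≗? φ ⟧)
        ≡⟨ (Σ-cong (pairs d) λ c → Σ-cong (triples (graphOf c) Γ) λ t → trans
            (sym (⟦⟧-× (isIso? (graphOf c) Γ t) (proj₁ t ≗? φ)))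
             (trans (⟦⟧-cong (isIso? (graphOf c) Γ t ×-dec (proj₁ t ≗? φ))
                 (c ≟ᶜᵖ c⁰ ×-dec _≈ᵗ?_ {Δ⁰} {Γ} t⁰ t)
               (λ (i , e) → determined c t i e)
               (λ { (refl , e) → isIso-≈ᵗ {Δ⁰} {Γ} e iso⁰ , λ i → sym (proj₁ e i) }))
               (⟦⟧-× (c ≟ᶜᵖ c⁰) (_≈ᵗ?_ {Δ⁰} {Γ} t⁰ t)))) ⟩
      -- The list `triples (graphOf c) Γ` depends only on the numbers of vertices and edges, so it
      -- is the same for all c and the double sum factors.
      Σ (pairs d) (λ c → Σ (triples Δ⁰ Γ) λ t → ⟦ c ≟ᶜᵖ c⁰ ⟧ * ⟦ _≈ᵗ?_ {Δ⁰} {Γ} t⁰ t ⟧)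
        ≡⟨ Σ-*-Σ (pairs d) (triples Δ⁰ Γ) (λ c → ⟦ c ≟ᶜᵖ c⁰ ⟧) (λ t → ⟦ _≈ᵗ?_ {Δ⁰} {Γ} t⁰ t ⟧) ⟩
      Σ (pairs d) (λ c → ⟦ c ≟ᶜᵖ c⁰ ⟧) * Σ (triples Δ⁰ Γ) (λ t → ⟦ _≈ᵗ?_ {Δ⁰} {Γ} t⁰ t ⟧)
        ≡⟨ cong₂ _*_ (Σ-one (pairs-unique d) (∈-pairs c⁰) (_≟ᶜᵖ c⁰) refl (λ _ → id))
            (Σ-triples {Δ⁰} {Γ} t⁰) ⟩
      1ℚ * 1ℚ
        ≡⟨ ℚ.*-identityˡ 1ℚ ⟩
      1ℚ ∎
      where
      open ≡-Reasoning
      _≟ᶜᵖ_ : DecidableEquality (Perm d × Perm d)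
      _≟ᶜᵖ_ = Product.≡-dec _≟ᵖ_ _≟ᵖ_

  -- Isomorphisms from the graphs of all pairs to Γ are counted in two ways: each graph isomorphic
  -- to Γ has |Aut Γ| of them, and each of the d! labellings of the white vertices belongs to
  -- exactly one.
  Σ-labellings : Σ (pairs d) (λ c → ⟦ graphOf c ≅? Γ ⟧) * fromℕ (|Aut| Γ) ≡ fromℕ (d !)
  Σ-labellings = begin
    Σ (pairs d) (λ c → ⟦ graphOf c ≅? Γ ⟧) * fromℕ (|Aut| Γ)
      ≡⟨ Σ-*ʳ (pairs d) (fromℕ (|Aut| Γ)) (λ c → ⟦ graphOf c ≅? Γ ⟧) ⟨
    Σ (pairs d) (λ c → ⟦ graphOf c ≅? Γ ⟧ * fromℕ (|Aut| Γ))
      ≡⟨ (Σ-cong (pairs d) λ c → Σ-isos (graphOf c) Γ) ⟨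
    Σ (pairs d) (λ c → Σ (triples (graphOf c) Γ) λ t → I c t)
      -- The white part of an isomorphism is a permutation, hence has exactly one code p; summing
      -- over p distributes the isomorphisms over the labellings.
      ≡⟨ (Σ-cong (pairs d) λ c → Σ-cong (triples (graphOf c) Γ) λ t → trans
          (sym (ℚ.*-identityʳ (I c t)))
           (trans (⟦⟧*-cong (isIso? (graphOf c) Γ t)
               (λ i → sym (one-code (proj₁ t) (proj₁ (IsIsomorphism.white-bijective i)))))
             (sym (Σ-*ˡ (perms d) (I c t) (λ p → ⟦ proj₁ t ≗? decode p ⟧))))) ⟩
    Σ (pairs d) (λ c → Σ (triples (graphOf c) Γ) λ t → Σ (perms d) λ p →
        I c t * ⟦ proj₁ t ≗? decode p ⟧)
      ≡⟨ (Σ-cong (pairs d) λ c → Σ-swap (triples (graphOf c) Γ) (perms d)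
          (λ t p → I c t * ⟦ proj₁ t ≗? decode p ⟧)) ⟩
    Σ (pairs d) (λ c → Σ (perms d) λ p → Σ (triples (graphOf c) Γ) λ t →
        I c t * ⟦ proj₁ t ≗? decode p ⟧)
      ≡⟨ Σ-swap (pairs d) (perms d) (λ c p → Σ (triples (graphOf c) Γ) λ t →
          I c t * ⟦ proj₁ t ≗? decode p ⟧) ⟩
    Σ (perms d) (λ p → Σ (pairs d) λ c → Σ (triples (graphOf c) Γ) λ t →
        I c t * ⟦ proj₁ t ≗? decode p ⟧)
      ≡⟨ (Σ-cong (perms d) λ p → Σ-labelled (decode p) (decode-injective p)) ⟩
    Σ (perms d) (λ _ → 1ℚ)
      ≡⟨ Σ-perms d ⟩
    fromℕ (d !) ∎
    where
    open ≡-Reasoning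
    I : ∀ c → Triple (graphOf c) Γ → ℚ
    I c t = ⟦ isIso? (graphOf c) Γ t ⟧
    one-code : (f : Fin d → Fin d) → Injective _≡_ _≡_ f → Σ (perms d) (λ p → ⟦ f ≗? decode p ⟧)
        ≡ 1ℚ
    one-code f inj = let p , e = encode f inj in
      Σ-one (perms-unique d) (∈-perms p) (λ p → f ≗? decode p) (λ i → sym (e i))
        λ {q} _ e′ → decode-unique q p λ i → trans (sym (e′ i)) (sym (e i))

  1/|Aut| : (ℤ.+ 1 / |Aut| Γ) {{|Aut|-nonZero Γ}} ≡ 1/ d ! * Σ (pairs d) (λ c → ⟦ graphOf c ≅? Γ ⟧)
  1/|Aut| = begin
    q
      ≡⟨ ℚ.*-identityˡ q ⟨
    1ℚ * q
      ≡⟨ cong (_* q) (1/!-fromℕ d) ⟨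
    1/ d ! * fromℕ (d !) * q
      ≡⟨ cong (λ x → 1/ d ! * x * q) Σ-labellings ⟨
    1/ d ! * (n * a) * q
      ≡⟨ ℚ.*-assoc (1/ d !) (n * a) q ⟩
    1/ d ! * ((n * a) * q)
      ≡⟨ cong (1/ d ! *_) (trans (ℚ.*-assoc n a q)
          (cong (n *_) (trans (ℚ.*-comm a q) (1/-fromℕ (|Aut| Γ) {{|Aut|-nonZero Γ}})))) ⟩
    1/ d ! * (n * 1ℚ)
      ≡⟨ cong (1/ d ! *_) (ℚ.*-identityʳ n) ⟩
    1/ d ! * n ∎
    where
    open ≡-Reasoning
    q n a : ℚ
    q = (ℤ.+ 1 / |Aut| Γ) {{|Aut|-nonZero Γ}}
    n = Σ (pairs d) (λ c → ⟦ graphOf c ≅? Γ ⟧)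
    a = fromℕ (|Aut| Γ)

-- F as the exponential generating function of transitive pairs

fromℕ-weight : ∀ m {N} → size m ℕ.≤ N → fromℕ (weight m) ≡ Σ< N
  (λ i → fromℕ (suc i) * fromℕ (at m i))
fromℕ-weight m {N} p = trans (go (size m) (λ i → suc i ℕ.* at m i))
  (trans (Σ-cong (upTo (size m)) λ i → fromℕ-* (suc i) (at m i))
    (sym (Σ<-extend (λ i → fromℕ (suc i) * fromℕ (at m i)) p λ i q →
      trans (cong (λ n → fromℕ (suc i) * fromℕ n) (at-size m q)) (ℚ.*-zeroʳ (fromℕ (suc i))))))
  where
  go : ∀ n (f : ℕ → ℕ) → fromℕ (foldr ℕ._+_ 0 (applyUpTo f n)) ≡ Σ< n (fromℕ ∘ f)
  go zero    f = refl
  go (suc n) f = trans (fromℕ-+ (f 0) _)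
      (trans (cong (fromℕ (f 0) +_) (go n (f ∘ suc))) (sym (Σ<-suc n (fromℕ ∘ f))))

weight-cycleType : ∀ {d} (f : Fin d → Fin d) (inj : Injective _≡_ _≡_ f) → weight (cycleType f inj)
  ≡ d
weight-cycleType {d} f inj = fromℕ-injective (begin
  fromℕ (weight m)
    ≡⟨ fromℕ-weight m (ℕ.m≤m⊔n (size m) d) ⟩
  Σ< N (λ i → fromℕ (suc i) * fromℕ (at m i))
    ≡⟨ (Σ-cong (upTo N) λ i → cong (fromℕ (suc i) *_) (ℚ.*-identityʳ (fromℕ (at m i)))) ⟨
  Σ< N (λ i → fromℕ (suc i) * (fromℕ (at m i) * 1ℚ))
    ≡⟨ Σ-per inj (λ _ → 1ℚ) (ℕ.m≤n⊔m (size m) d) ⟨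
  Σ (allFin d) (λ _ → 1ℚ)
    ≡⟨ fromℕ-length (allFin d) ⟨
  fromℕ (length (allFin d))
    ≡⟨ cong fromℕ (List.length-tabulate {n = d} id) ⟩
  fromℕ d ∎)
  where
  open ≡-Reasoning
  m = cycleType f inj
  N = size m ⊔ d

total≡0 : ∀ m → total m ≡ 0 → m ≡ nothing
total≡0 nothing  _ = refl
total≡0 (just m) e = contradiction e (positive m)
  where
  positive : ∀ m → total⁺ m ≢ 0
  positive [1+ _ ] ()
  positive (n ∷ m) e = positive m (ℕ.m+n≡0⇒n≡0 n e)

total-cycleType : ∀ {d} (f : Fin (suc d) → Fin (suc d)) (inj : Injective _≡_ _≡_ f) → total
  (cycleType f inj) ≢ 0
total-cycleType f inj e = ℕ.1+n≢0 (trans (sym (weight-cycleType f inj))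
  (cong weight (total≡0 (cycleType f inj) e)))

type-graphOf : ∀ {d} (c : Perm d × Perm d) → type (graphOf c) ≡
  (exp-u (monomial c) , exp-v (monomial c) , exp-t (monomial c))
type-graphOf (σ , τ) = type-graph (decode-injective σ) (decode-injective τ)

listed : ∀ {d} (c : Perm d × Perm d) → IsTransitive (decode (proj₁ c)) (decode (proj₂ c)) →
         ∃ λ Γ → Γ ∈ belyiGraphs d × graphOf c ≅ Γ × type Γ ≡
             (exp-u (monomial c) , exp-v (monomial c) , exp-t (monomial c))
listed {d} c@(σ , τ) t = let Γ , Γ∈ , iso = found in
    Γ , subst (λ n → Γ ∈ belyiGraphs n)
        (degree-graph (decode-injective σ) (decode-injective τ)) Γ∈ , iso
  , trans (sym (type-iso {graphOf c} {Γ} (proj₂ (proj₂ (proj₂ iso))))) (type-graphOf c)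
  where
  found : ∃ λ Γ → Γ ∈ belyiGraphs (degree (graphOf c)) × graphOf c ≅ Γ
  found = find {P = graphOf c ≅_} {xs = belyiGraphs (degree (graphOf c))}
    (belyiGraphs-complete (graphOf c) (graph-isBelyi (decode-injective σ) (decode-injective τ) t))

transitive-≅ : ∀ {d} (c : Perm d × Perm d) {Γ} → IsBelyi Γ → graphOf c ≅ Γ → IsTransitive
  (decode (proj₁ c)) (decode (proj₂ c))
transitive-≅ c@(σ , τ) {Γ} β iso = connected⇒transitive (decode-injective σ) (decode-injective τ)
  (connected-iso {graphOf c} {Γ} (proj₂ (proj₂ (proj₂ iso))) (IsBelyi.connected β))

monomial-type : ∀ {d} (c : Perm d × Perm d) {k l m} → type (graphOf c) ≡ (k , l , m) → monomial c
  ≡ mono 0 k l m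
monomial-type c e = cong (λ (k , l , m) → mono 0 k l m) (trans (sym (type-graphOf c)) e)

1/|Aut|-listed : ∀ {d Γ} → Γ ∈ belyiGraphs d → (ℤ.+ 1 / |Aut| Γ) {{|Aut|-nonZero Γ}} ≡ 1/ d ! * Σ
  (pairs d) (λ c → ⟦ graphOf c ≅? Γ ⟧)
1/|Aut|-listed {d} {Γ} i = go (proj₁ split-i) (proj₂ split-i)
  where
  split-i : Γ ∈ colouredGraphs d d (3 ℕ.* d) × IsBelyi Γ
  split-i = ∈-filter⁻ isBelyi? {v = Γ} {xs = colouredGraphs d d (3 ℕ.* d)} i
  -- A listed graph is replaced by its explicit form with d white vertices, d black vertices and 3d
  -- edges, to which `Labelling` applies.
  at-graph : ∀ x → IsBelyi (coloured d d (3 ℕ.* d) x) → Γ ≡ coloured d d (3 ℕ.* d) x →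
             (ℤ.+ 1 / |Aut| Γ) {{|Aut|-nonZero Γ}} ≡ 1/ d ! * Σ (pairs d) (λ c → ⟦ graphOf c ≅? Γ ⟧)
  at-graph (col , wh , bl) β refl = Labelling.1/|Aut| col wh bl β
  go : Γ ∈ colouredGraphs d d (3 ℕ.* d) → IsBelyi Γ →
       (ℤ.+ 1 / |Aut| Γ) {{|Aut|-nonZero Γ}} ≡ 1/ d ! * Σ (pairs d) (λ c → ⟦ graphOf c ≅? Γ ⟧)
  go j β = let x , _ , e = ∈-map⁻ (coloured d d (3 ℕ.* d)) j in at-graph x (subst IsBelyi e β) e

module _ (k l : ℕ) (m : Exponents) where

  private
    n : ℕ
    n = weight m

    HasType : Perm n × Perm n → Set
    HasType c = IsTransitive (decode (proj₁ c)) (decode (proj₂ c)) × monomial c ≡ mono 0 k l m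

    hasType? : ∀ c → Dec (HasType c)
    hasType? c = transitivePair? c ×-dec (monomial c ≟ᵐ mono 0 k l m)

    candidates : List ColouredGraph
    candidates = filter (λ Γ → type Γ ≟ᵗ (k , l , m)) (belyiGraphs n)

    ∈𝓑⇒∈belyiGraphs : ∀ {Γ} → Γ ∈ 𝓑 k l m → Γ ∈ belyiGraphs n × type Γ ≡ (k , l , m)
    ∈𝓑⇒∈belyiGraphs {Γ} i = ∈-filter⁻ (λ Γ → type Γ ≟ᵗ (k , l , m)) {v = Γ} {xs = belyiGraphs n}
        (∈-deduplicate⁻ _≅?_ candidates i)

    present : ∀ c → HasType c → Any (_≅ graphOf c) candidates
    present c (t , e) = let Γ , Γ∈ , iso , type≡ = listed c t in
      lose {P = _≅ graphOf c} {x = Γ} {xs = candidates}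
        (∈-filter⁺ (λ Γ → type Γ ≟ᵗ (k , l , m)) {x = Γ} {xs = belyiGraphs n} Γ∈
          (trans type≡ (cong (λ μ → exp-u μ , exp-v μ , exp-t μ) e)))
        (≅-sym {graphOf c} {Γ} iso)

    absent : ∀ c {Γ} → Γ ∈ 𝓑 k l m → graphOf c ≅ Γ → HasType c
    absent c {Γ} i iso = let Γ∈ , e = ∈𝓑⇒∈belyiGraphs {Γ} i in
        transitive-≅ c {Γ} (proj₂ (∈-filter⁻ isBelyi? {v = Γ} {xs = colouredGraphs n n (3 ℕ.* n)}
            Γ∈)) iso
      , monomial-type c (trans (type-iso {graphOf c} {Γ} (proj₂ (proj₂ (proj₂ iso)))) e)

    -- The graph of a transitive pair of the right type is isomorphic to a listed candidate, and
    -- hence to one representative. Conversely, an isomorphism to a representative transports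
    -- connectedness and type back to the pair.
    Σ-representatives : ∀ c → Σ (𝓑 k l m) (λ Γ → ⟦ graphOf c ≅? Γ ⟧) ≡ ⟦ hasType? c ⟧
    Σ-representatives c = go (hasType? c)
      where
      go : Dec (HasType c) → Σ (𝓑 k l m) (λ Γ → ⟦ graphOf c ≅? Γ ⟧) ≡ ⟦ hasType? c ⟧
      go (yes h) = trans (Σ-cong (𝓑 k l m) λ Γ → ⟦⟧-cong (graphOf c ≅? Γ) (Γ ≅? graphOf c)
          (≅-sym {graphOf c} {Γ}) (≅-sym {Γ} {graphOf c}))
        (trans (Σ-deduplicate _≅?_ (λ {Γ} {Δ} → ≅-sym {Γ} {Δ})
            (λ {Γ} {Δ} {Θ} → ≅-trans {Γ} {Δ} {Θ}) {candidates} {graphOf c} (present c h))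
            (sym (⟦⟧-yes (hasType? c) h)))
      go (no ¬h) = trans (Σ-null (𝓑 k l m) λ {Γ} i → ⟦⟧-no (graphOf c ≅? Γ) (¬h ∘ absent c i))
          (sym (⟦⟧-no (hasType? c) ¬h))

  𝓝-pairs : 𝓝 k l m ≡ 1/ n ! * Σ (pairs n) (λ c → ⟦ hasType? c ⟧)
  𝓝-pairs = begin
    Σ (𝓑 k l m) (λ Γ → (ℤ.+ 1 / |Aut| Γ) {{|Aut|-nonZero Γ}})
      ≡⟨ (Σ-cong∈ (𝓑 k l m) λ {Γ} i → 1/|Aut|-listed {n} {Γ} (proj₁ (∈𝓑⇒∈belyiGraphs {Γ} i))) ⟩
    Σ (𝓑 k l m) (λ Γ → 1/ n ! * Σ (pairs n) (λ c → ⟦ graphOf c ≅? Γ ⟧))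
      ≡⟨ Σ-*ˡ (𝓑 k l m) (1/ n !) (λ Γ → Σ (pairs n) (λ c → ⟦ graphOf c ≅? Γ ⟧)) ⟩
    1/ n ! * Σ (𝓑 k l m) (λ Γ → Σ (pairs n) (λ c → ⟦ graphOf c ≅? Γ ⟧))
      ≡⟨ cong (1/ n ! *_) (Σ-swap (𝓑 k l m) (pairs n) (λ Γ c → ⟦ graphOf c ≅? Γ ⟧)) ⟩
    1/ n ! * Σ (pairs n) (λ c → Σ (𝓑 k l m) (λ Γ → ⟦ graphOf c ≅? Γ ⟧))
      ≡⟨ cong (1/ n ! *_) (Σ-cong (pairs n) Σ-representatives) ⟩
    1/ n ! * Σ (pairs n) (λ c → ⟦ hasType? c ⟧) ∎
    where open ≡-Reasoning

  𝓝≡Êℂ : 𝓝 k l m ≡ Ê ℂ (mono n k l m)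
  𝓝≡Êℂ = trans 𝓝-pairs (cong (1/ n ! *_)
      (Σ-cong (pairs n) λ c → ⟦⟧-× (transitivePair? c) (monomial c ≟ᵐ mono 0 k l m)))

Êℂ-null : ∀ d k l m → (∀ (c : Perm d × Perm d) → IsTransitive (decode (proj₁ c))
  (decode (proj₂ c)) → monomial c ≢ mono 0 k l m) →
          Ê ℂ (mono d k l m) ≡ 0ℚ
Êℂ-null d k l m n = trans (cong (1/ d ! *_) (Σ-null (pairs d) λ {c} _ →
    trans (⟦⟧*-cong (transitivePair? c) (λ t → ⟦⟧-no (monomial c ≟ᵐ mono 0 k l m) (n c t)))
        (ℚ.*-zeroʳ ⟦ transitivePair? c ⟧)))
  (ℚ.*-zeroʳ (1/ d !))

-- Without this wrapper, the with in F-at would normalise 𝓝.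

record Value (k l : ℕ) (m : Exponents) (q : ℚ) : Set where
  constructor value
  field
    𝓝≡ : 𝓝 k l m ≡ q

F-at : ∀ d k l m {q} → weight m ≡ suc d → Value (suc k) (suc l) m q → F
  (mono (suc d) (suc k) (suc l) m) ≡ q
F-at d k l m e w with weight m ℕ.≟ suc d
... | yes _ = Value.𝓝≡ w
... | no ¬e = contradiction e ¬e

F-null : ∀ d k l m → weight m ≢ suc d → F (mono (suc d) (suc k) (suc l) m) ≡ 0ℚ
F-null d k l m n with weight m ℕ.≟ suc d
... | yes e = contradiction e n
... | no _  = refl

-- The coefficients that `F` sets to zero vanish on the right as well: no pair on the empty set is
-- transitive, a permutation of a nonempty set has at least one cycle, and the cycle lengths of τ ∘
-- σ add up to d.
F≈Êℂ : F ≈ Ê ℂ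
F≈Êℂ (mono zero k l m) = sym (Êℂ-null 0 k l m λ _ ())
F≈Êℂ (mono (suc d) zero l m) = sym (Êℂ-null (suc d) 0 l m λ (σ , τ) _ e →
  total-cycleType (decode σ) (decode-injective σ) (cong exp-u e))
F≈Êℂ (mono (suc d) (suc k) zero m) = sym (Êℂ-null (suc d) (suc k) 0 m λ (σ , τ) _ e →
  total-cycleType (decode τ) (decode-injective τ) (cong exp-v e))
F≈Êℂ (mono (suc d) (suc k) (suc l) m) = go (weight m ℕ.≟ suc d)
  where
  go : Dec (weight m ≡ suc d) → F (mono (suc d) (suc k) (suc l) m) ≡ Ê ℂ
      (mono (suc d) (suc k) (suc l) m)
  go (yes e) = F-at d k l m e (value (trans (𝓝≡Êℂ (suc k) (suc l) m)
      (cong (λ n → Ê ℂ (mono n (suc k) (suc l) m)) e)))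
  go (no n)  = trans (F-null d k l m n) (sym (Êℂ-null (suc d) (suc k) (suc l) m λ (σ , τ) _ e → n
    (trans (cong (weight ∘ exp-t) (sym e))
        (weight-cycleType (decode τ ∘ decode σ)
        (λ e → decode-injective σ (decode-injective τ e))))))

-- The differential equations for Z and F

Ê𝕎-at-s=0 : ∀ k l m → Ê 𝕎 (mono 0 k l m) ≡ 𝟏 (mono 0 k l m)
Ê𝕎-at-s=0 k l m = trans (ℚ.*-identityˡ (𝕎 0 (mono 0 k l m))) (𝕎-zero (mono 0 k l m))

⊗-agreeˡ : ∀ H {d G G′} → Agree d G G′ → Agree d (G ⊗ H) (G′ ⊗ H)
⊗-agreeˡ H σ = ⊗-agree σ (λ _ → slice λ k l m → sym (ℚ.*-identityˡ (H _)))

-- Both series have value 1 at s = 0 and solve the linear equation ∂Y/∂s = Y ∂F/∂s: the left one by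
-- the chain rule for `exp`, the right one by splitting off an orbit.
Z≈Ê𝕎 : Z ≈ Ê 𝕎
Z≈Ê𝕎 = ode-unique (_⊗ ∂ s F) (⊗-agreeˡ (∂ s F))
  (λ k l m → trans (exp-at-s=0 F F-zero k l m) (sym (Ê𝕎-at-s=0 k l m)))
  (∂-exp s F F-zero)
  (≈-trans ∂s-Ê𝕎 (⊗-cong (≈-refl {Ê 𝕎}) (∂-cong s (≈-sym F≈Êℂ))))

Z-ode : ∂ s Z ≈ Λ Z
Z-ode = ≈-trans (∂-cong s Z≈Ê𝕎) (≈-trans (Ê-ode 𝕎 𝕎-zero 𝕎-suc) (Λ-cong (≈-sym Z≈Ê𝕎)))

F-ode : ∂ s F ≈ Φ F
F-ode = ⊗-cancelˡ Z (exp-at-s=0 F F-zero)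
  (≈-trans (≈-sym (∂-exp s F F-zero)) (≈-trans Z-ode (Λ-exp F F-zero)))

theorem2 : ( ZeroAt-s=0 F
    × ∂ s F ≈ u · L₁ F ⊕ v · L₁ F ⊕ M₁ F ⊕ Q₁ F ⊕ u · v · t[1+ 0 ] · 𝟏 )
    × (∀ G → ZeroAt-s=0 G
    → ∂ s G ≈ u · L₁ G ⊕ v · L₁ G ⊕ M₁ G ⊕ Q₁ G ⊕ u · v · t[1+ 0 ] · 𝟏
    → G ≈ F)
    × Z ≈ exp-s· (λ G → u · L₁ G ⊕ v · L₁ G ⊕ M₁ G ⊕ u · v · t[1+ 0 ] · G) 𝟏
theorem2 = (F-zero , F-ode)
  , (λ G G₀ G-ode → ode-unique Φ Φ-agree
      (λ k l m → trans (G₀ k l m) (sym (F-zero k l m))) G-ode F-ode)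
  , ≈-trans Z≈Ê𝕎 (Ê≈exp-s· 𝕎 𝕎-zero 𝕎-suc)
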